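{- There exist positive constants $c_1, c_2, c_3$ such that the following hold. (a) Let $G = (V,E)$ be an $n$-vertex graph satisfying $\alpha(G)\delta(G) = O(n)$ and $\delta(G) > c_1 (\alpha(G) \log n)^2$. Then $G \cup \mathbb{G}(n,p)$ is a.a.s. pancyclic whenever $p := p(n) \geq \frac{c_2 \log n \,\log(\alpha(G) \log n)}{n \delta(G)}$. (b) For all integers $d := d(n) \geq 1$ and $k := k(n)$ with $k \to \infty$ as $n \to \infty$ and $k(d+1) \leq n$, there exists an $n$-vertex graph $H$ with $\alpha(H) = k$ and $\delta(H) = d$ such that a.a.s. $H \cup \mathbb{G}(n,p)$ is not Hamiltonian whenever $p := p(n) \leq \frac{c_3 \log k}{d n}$.
   Context: For an $n$-vertex graph $G$, $G \cup \mathbb{G}(n,p)$ denotes the union $G \cup R$ where $R$ is the binomial random graph on the vertex set $V(G)$ in which each pair of vertices is an edge independently with probability $p$. "A.a.s." means with probability tending to $1$ as $n \to \infty$. $\alpha(G)$ is the independence number and $\delta(G)$ the minimum degree. A graph on $n$ vertices is Hamiltonian if it has a cycle through all vertices, and pancyclic if it contains a cycle of length $\ell$ for every $3 \leq \ell \leq n$. Asymptotic notation is with respect to $n \to \infty$. -}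

module Defs where

open import Data.Bool.Base using (Bool; false; T; _∨_; if_then_else_)
open import Data.Bool.Properties using (T?)
open import Data.Empty using (⊥)
open import Data.Fin.Base as Fin using (Fin; zero; suc)
import Data.Fin.Properties as Fin
open import Data.Fin.Subset using (Subset; inside; outside; _∈_) renaming (∣_∣ to card)
open import Data.Fin.Subset.Properties using (_∈?_)
import Data.Integer.Base as ℤ
import Data.Integer.Properties as ℤ
open import Data.List.Base as List using (List; []; _∷_; _++_; filter; allFin; cartesianProduct; cartesianProductWith)
open import Data.List.Extrema.Nat using (max; min)
open import Data.Nat.Base as ℕ using (ℕ; zero; suc)
import Data.Nat.Properties as ℕ
open import Data.Product.Base using (∃; _×_; _,_; proj₁; proj₂)
import Data.Rational.Base as ℚ
import Data.Rational.Properties as ℚ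
open import Data.Rational.Base using (ℚ)
import Data.Rational.Unnormalised.Base as ℚᵘ
import Data.Rational.Unnormalised.Properties as ℚᵘ
open import Data.Rational.Solver using (module +-*-Solver)
open import Data.Sum.Base using (inj₁; inj₂)
open import Data.Vec.Base as Vec using (Vec; []; _∷_; _∷ʳ_; lookup; tabulate)
open import Data.Vec.Relation.Unary.AllPairs using (allPairs?)
open import Data.Vec.Relation.Unary.Linked using (Linked; linked?)
open import Data.Vec.Relation.Unary.Unique.Propositional using (Unique)
open import Function.Base using (_∘_)
open import Relation.Binary.PropositionalEquality using (_≡_; refl; sym; trans; cong; cong₂; subst; subst₂)
open import Relation.Nullary.Decidable using (Dec; no; map′; ¬?; _×-dec_; _→-dec_)
open import Relation.Nullary.Negation using (¬_)
open import Relation.Unary using (Decidable)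

Eventually : (ℕ → Set) → Set
Eventually P = ∃ λ N → ∀ n → N ℕ.≤ n → P n

infix 4 _=O_

_=O_ : (ℕ → ℕ) → (ℕ → ℕ) → Set
f =O g = ∃ λ C → Eventually λ n → f n ℕ.≤ C ℕ.* g n

_→∞ : (ℕ → ℕ) → Set
f →∞ = ∀ M → Eventually λ n → M ℕ.≤ f n

module ℚLemmas where
  open import Data.Rational.Base
  open +-*-Solver
  open ℚ.≤-Reasoning

  private
    nn : ∀ {q} → 0ℚ ≤ q → NonNegative q
    nn = nonNegative

  *-monoˡ : ∀ {a b} c → 0ℚ ≤ c → a ≤ b → c * a ≤ c * b
  *-monoˡ c 0≤c = ℚ.*-monoˡ-≤-nonNeg c {{nn 0≤c}}

  *-monoʳ : ∀ {a b} c → 0ℚ ≤ c → a ≤ b → a * c ≤ b * c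
  *-monoʳ c 0≤c = ℚ.*-monoʳ-≤-nonNeg c {{nn 0≤c}}

  *-mono : ∀ {a b c d} → 0ℚ ≤ c → a ≤ b → 0ℚ ≤ b → c ≤ d → a * c ≤ b * d
  *-mono {c = c} {d} 0≤c a≤b 0≤b c≤d = ℚ.≤-trans (*-monoʳ c 0≤c a≤b) (*-monoˡ _ 0≤b c≤d)

  *-nonneg : ∀ {a b} → 0ℚ ≤ a → 0ℚ ≤ b → 0ℚ ≤ a * b
  *-nonneg {a} 0≤a 0≤b = ℚ.≤-trans (ℚ.≤-reflexive (sym (ℚ.*-zeroʳ a))) (*-monoˡ a 0≤a 0≤b)

  *-pos : ∀ {a b} → 0ℚ < a → 0ℚ < b → 0ℚ < a * b
  *-pos {a} {b} 0<a 0<b =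
    ℚ.positive⁻¹ (a * b) {{ℚ.pos*pos⇒pos a {{positive 0<a}} b {{positive 0<b}}}}

  0≤1 : 0ℚ ≤ 1ℚ
  0≤1 = ℚ.nonNegative⁻¹ 1ℚ

  0<1 : 0ℚ < 1ℚ
  0<1 = ℚ.positive⁻¹ 1ℚ

  0<½ : 0ℚ < ½
  0<½ = ℚ.positive⁻¹ ½

  0≤½ : 0ℚ ≤ ½
  0≤½ = ℚ.<⇒≤ 0<½

  q≤∣q∣ : ∀ q → q ≤ ∣ q ∣
  q≤∣q∣ q with ℚ.≤-total 0ℚ q
  ... | inj₁ 0≤q = ℚ.≤-reflexive (sym (ℚ.0≤p⇒∣p∣≡p 0≤q))
  ... | inj₂ q≤0 = ℚ.≤-trans q≤0 (ℚ.0≤∣p∣ q)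

  ∣∣-comm : ∀ p q → ∣ p - q ∣ ≡ ∣ q - p ∣
  ∣∣-comm p q = trans (sym (ℚ.∣-p∣≡∣p∣ (p - q)))
    (cong ∣_∣ (solve 2 (λ x y → :- (x :- y) := y :- x) refl p q))

  ∣∣≤⇒≤+ : ∀ {p q ε} → ∣ p - q ∣ ≤ ε → p ≤ q + ε
  ∣∣≤⇒≤+ {p} {q} {ε} h = begin
    p           ≡⟨ solve 2 (λ x y → x := y :+ (x :- y)) refl p q ⟩
    q + (p - q) ≤⟨ ℚ.+-monoʳ-≤ q (ℚ.≤-trans (q≤∣q∣ (p - q)) h) ⟩
    q + ε       ∎

  ≤+⇒-≤ : ∀ {p q ε} → p ≤ q + ε → p - q ≤ ε
  ≤+⇒-≤ {p} {q} {ε} h = begin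
    p - q       ≤⟨ ℚ.+-monoˡ-≤ (- q) h ⟩
    q + ε - q   ≡⟨ solve 2 (λ y e → y :+ e :- y := e) refl q ε ⟩
    ε           ∎

  ≤+⇒∣∣≤ : ∀ {p q ε} → p ≤ q + ε → q ≤ p + ε → ∣ p - q ∣ ≤ ε
  ≤+⇒∣∣≤ {p} {q} {ε} h₁ h₂ with ℚ.∣p∣≡p∨∣p∣≡-p (p - q)
  ... | inj₁ e = ℚ.≤-trans (ℚ.≤-reflexive e) (≤+⇒-≤ h₁)
  ... | inj₂ e = ℚ.≤-trans
    (ℚ.≤-reflexive (trans e (solve 2 (λ x y → :- (x :- y) := y :- x) refl p q)))
    (≤+⇒-≤ h₂)

  halves : ∀ x → ½ * x + ½ * x ≡ x
  halves = solve 1 (λ x → con ½ :* x :+ con ½ :* x := x) refl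

  ⊔0-shift : ∀ {p q ε} → 0ℚ ≤ ε → p ≤ q + ε → p ⊔ 0ℚ ≤ q ⊔ 0ℚ + ε
  ⊔0-shift {p} {q} {ε} 0≤ε h = ℚ.⊔-lub
    (ℚ.≤-trans h (ℚ.+-monoˡ-≤ ε (ℚ.p≤p⊔q q 0ℚ)))
    (ℚ.≤-trans (ℚ.≤-reflexive (sym (ℚ.+-identityʳ 0ℚ))) (ℚ.+-mono-≤ (ℚ.p≤q⊔p q 0ℚ) 0≤ε))

  fromℕ-suc : ∀ n → ℤ.+ suc n / 1 ≡ 1ℚ + ℤ.+ n / 1
  fromℕ-suc n = ℚ.toℚᵘ-injective
    (ℚᵘ.≃-trans (ℚ.toℚᵘ-fromℚᵘ (ℚᵘ.mkℚᵘ (ℤ.+ suc n) 0))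
    (ℚᵘ.≃-trans step
    (ℚᵘ.≃-trans (ℚᵘ.+-congʳ ℚᵘ.1ℚᵘ (ℚᵘ.≃-sym (ℚ.toℚᵘ-fromℚᵘ (ℚᵘ.mkℚᵘ (ℤ.+ n) 0))))
      (ℚᵘ.≃-sym (ℚ.toℚᵘ-homo-+ 1ℚ (ℤ.+ n / 1))))))
    where
    step : ℚᵘ.mkℚᵘ (ℤ.+ suc n) 0 ℚᵘ.≃ ℚᵘ.1ℚᵘ ℚᵘ.+ ℚᵘ.mkℚᵘ (ℤ.+ n) 0
    step = ℚᵘ.*≡* (cong (ℤ._* ℤ.+ 1) (cong (ℤ._+_ (ℤ.+ 1)) (sym (ℤ.*-identityʳ (ℤ.+ n)))))

  0≤fromℕ : ∀ n → 0ℚ ≤ ℤ.+ n / 1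
  0≤fromℕ zero = ℚ.≤-refl
  0≤fromℕ (suc n) = ℚ.≤-trans (ℚ.+-mono-≤ 0≤1 (0≤fromℕ n)) (ℚ.≤-reflexive (sym (fromℕ-suc n)))

  fromℕ-mono : ∀ {m n} → m ℕ.≤ n → ℤ.+ m / 1 ≤ ℤ.+ n / 1
  fromℕ-mono {n = n} ℕ.z≤n = 0≤fromℕ n
  fromℕ-mono {suc m} {suc n} (ℕ.s≤s h) = subst₂ _≤_ (sym (fromℕ-suc m)) (sym (fromℕ-suc n))
    (ℚ.+-monoʳ-≤ 1ℚ (fromℕ-mono h))

  archimedean : ∀ q → ∃ λ K → q ≤ ℤ.+ K / 1
  archimedean q@(mkℚ n d _) = ℤ.∣ n ∣ , ℚ.toℚᵘ-cancel-≤
    (ℚᵘ.≤-trans (ℚᵘ.*≤* le) (ℚᵘ.≤-reflexive (ℚᵘ.≃-sym (ℚ.toℚᵘ-fromℚᵘ (ℚᵘ.mkℚᵘ (ℤ.+ ℤ.∣ n ∣) 0)))))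
    where
    n≤∣n∣ : ∀ i → i ℤ.≤ ℤ.+ ℤ.∣ i ∣
    n≤∣n∣ (ℤ.+ i) = ℤ.≤-refl
    n≤∣n∣ (ℤ.-[1+ i ]) = ℤ.-≤+
    le : n ℤ.* ℤ.+ 1 ℤ.≤ ℤ.+ ℤ.∣ n ∣ ℤ.* ℤ.+ suc d
    le = ℤ.≤-trans (ℤ.≤-reflexive (ℤ.*-identityʳ n)) (ℤ.≤-trans (n≤∣n∣ n)
      (ℤ.≤-trans (ℤ.+≤+ (ℕ.m≤m*n ℤ.∣ n ∣ (suc d))) (ℤ.≤-reflexive (ℤ.pos-* ℤ.∣ n ∣ (suc d)))))

  ½^ : ℕ → ℚ
  ½^ zero    = 1ℚ
  ½^ (suc n) = ½ * ½^ n

  ½^-nonneg : ∀ n → 0ℚ ≤ ½^ n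
  ½^-nonneg zero    = 0≤1
  ½^-nonneg (suc n) = *-nonneg 0≤½ (½^-nonneg n)

  ½^≤1 : ∀ n → ½^ n ≤ 1ℚ
  ½^≤1 zero    = ℚ.≤-refl
  ½^≤1 (suc n) = ℚ.≤-trans (*-monoˡ ½ 0≤½ (½^≤1 n)) (*≤* (ℤ.+≤+ (ℕ.s≤s ℕ.z≤n)))

  n*½^n≤1 : ∀ n → ℤ.+ n / 1 * ½^ n ≤ 1ℚ
  n*½^n≤1 zero    = 0≤1
  n*½^n≤1 (suc n) = begin
    ℤ.+ suc n / 1 * (½ * ½^ n)
      ≡⟨ cong (_* (½ * ½^ n)) (fromℕ-suc n) ⟩
    (1ℚ + ℤ.+ n / 1) * (½ * ½^ n)
      ≡⟨ solve 2 (λ k h → (con 1ℚ :+ k) :* (con ½ :* h) := con ½ :* h :+ con ½ :* (k :* h)) refl (ℤ.+ n / 1) (½^ n) ⟩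
    ½ * ½^ n + ½ * (ℤ.+ n / 1 * ½^ n)
      ≤⟨ ℚ.+-mono-≤ (*-monoˡ ½ 0≤½ (½^≤1 n)) (*-monoˡ ½ 0≤½ (n*½^n≤1 n)) ⟩
    ½ * 1ℚ + ½ * 1ℚ
      ≡⟨ halves 1ℚ ⟩
    1ℚ ∎

  ½^-decay : ∀ B ε → 0ℚ < ε → ∃ λ K → ∀ n → K ℕ.≤ n → ½^ n * B ≤ ε
  ½^-decay B ε 0<ε = K , λ n K≤n → begin
    ½^ n * B
      ≤⟨ *-monoˡ (½^ n) (½^-nonneg n) (begin
           B                 ≡⟨ sym (ℚ.*-identityʳ B) ⟩
           B * 1ℚ            ≡⟨ cong (B *_) (sym (ℚ.*-inverseˡ ε)) ⟩
           B * (1/ ε * ε)    ≡⟨ sym (ℚ.*-assoc B (1/ ε) ε) ⟩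
           B * 1/ ε * ε      ≤⟨ *-monoʳ ε (ℚ.<⇒≤ 0<ε) (ℚ.≤-trans (proj₂ arch) (fromℕ-mono K≤n)) ⟩
           ℤ.+ n / 1 * ε     ∎) ⟩
    ½^ n * (ℤ.+ n / 1 * ε)
      ≡⟨ solve 3 (λ h k e → h :* (k :* e) := (k :* h) :* e) refl (½^ n) (ℤ.+ n / 1) ε ⟩
    ℤ.+ n / 1 * ½^ n * ε
      ≤⟨ *-monoʳ ε (ℚ.<⇒≤ 0<ε) (n*½^n≤1 n) ⟩
    1ℚ * ε
      ≡⟨ ℚ.*-identityˡ ε ⟩
    ε ∎
    where
    instance
      ε≢0 : NonZero ε
      ε≢0 = >-nonZero 0<ε
    arch = archimedean (B * 1/ ε)
    K = proj₁ arch

IsCauchy : (ℕ → ℚ) → Set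
IsCauchy x = ∀ ε → ℚ.0ℚ ℚ.< ε →
  ∃ λ N → ∀ m n → N ℕ.≤ m → N ℕ.≤ n → ℚ.∣ x m ℚ.- x n ∣ ℚ.≤ ε

module Cauchy where
  open ℚLemmas
  open import Data.Rational.Base
  open +-*-Solver
  open ℚ.≤-Reasoning

  bound : ∀ x → IsCauchy x → ∃ λ B → 0ℚ < B × Eventually λ n → ∣ x n ∣ ≤ B
  bound x cx = ∣ x N ∣ + 1ℚ , ℚ.+-mono-≤-< (ℚ.0≤∣p∣ (x N)) 0<1 , N , λ n N≤n → begin
    ∣ x n ∣                   ≡⟨ cong ∣_∣ (solve 2 (λ a b → a := b :+ (a :- b)) refl (x n) (x N)) ⟩
    ∣ x N + (x n - x N) ∣     ≤⟨ ℚ.∣p+q∣≤∣p∣+∣q∣ (x N) (x n - x N) ⟩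
    ∣ x N ∣ + ∣ x n - x N ∣   ≤⟨ ℚ.+-monoʳ-≤ ∣ x N ∣ (proj₂ (cx 1ℚ 0<1) n N N≤n ℕ.≤-refl) ⟩
    ∣ x N ∣ + 1ℚ              ∎
    where
    N = proj₁ (cx 1ℚ 0<1)

  +-cauchy : ∀ x y → IsCauchy x → IsCauchy y → IsCauchy (λ n → x n + y n)
  +-cauchy x y cx cy ε 0<ε = N₁ ℕ.⊔ N₂ , λ m n N≤m N≤n → begin
    ∣ (x m + y m) - (x n + y n) ∣
      ≡⟨ cong ∣_∣ (solve 4 (λ a b c d → (a :+ b) :- (c :+ d) := (a :- c) :+ (b :- d)) refl (x m) (y m) (x n) (y n)) ⟩
    ∣ (x m - x n) + (y m - y n) ∣
      ≤⟨ ℚ.∣p+q∣≤∣p∣+∣q∣ (x m - x n) (y m - y n) ⟩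
    ∣ x m - x n ∣ + ∣ y m - y n ∣
      ≤⟨ ℚ.+-mono-≤
           (proj₂ (cx _ 0<ε/2) m n (ℕ.m⊔n≤o⇒m≤o N₁ N₂ N≤m) (ℕ.m⊔n≤o⇒m≤o N₁ N₂ N≤n))
           (proj₂ (cy _ 0<ε/2) m n (ℕ.m⊔n≤o⇒n≤o N₁ N₂ N≤m) (ℕ.m⊔n≤o⇒n≤o N₁ N₂ N≤n)) ⟩
    ½ * ε + ½ * ε
      ≡⟨ halves ε ⟩
    ε ∎
    where
    0<ε/2 = *-pos 0<½ 0<ε
    N₁ = proj₁ (cx _ 0<ε/2)
    N₂ = proj₁ (cy _ 0<ε/2)

  neg-cauchy : ∀ x → IsCauchy x → IsCauchy (λ n → - x n)
  neg-cauchy x cx ε 0<ε = proj₁ (cx ε 0<ε) , λ m n N≤m N≤n → begin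
    ∣ - x m - (- x n) ∣  ≡⟨ cong ∣_∣ (solve 2 (λ a b → :- a :- (:- b) := b :- a) refl (x m) (x n)) ⟩
    ∣ x n - x m ∣        ≤⟨ proj₂ (cx ε 0<ε) n m N≤n N≤m ⟩
    ε                    ∎

  *-diff : ∀ a b c d → a * b - c * d ≡ a * (b - d) + (a - c) * d
  *-diff = solve 4 (λ a b c d → a :* b :- c :* d := a :* (b :- d) :+ (a :- c) :* d) refl

  budget : ∀ a b η → a * η + η * b ≡ η * (a + b)
  budget = solve 3 (λ a b η → a :* η :+ η :* b := η :* (a :+ b)) refl

  *-close : ∀ {a b c d A D η} → ∣ a ∣ ≤ A → 0ℚ ≤ A → ∣ d ∣ ≤ D → 0ℚ ≤ η →
    ∣ b - d ∣ ≤ η → ∣ a - c ∣ ≤ η → ∣ a * b - c * d ∣ ≤ η * (A + D)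
  *-close {a} {b} {c} {d} {A} {D} {η} ha 0≤A hd 0≤η hbd hac = begin
    ∣ a * b - c * d ∣
      ≡⟨ cong ∣_∣ (*-diff a b c d) ⟩
    ∣ a * (b - d) + (a - c) * d ∣
      ≤⟨ ℚ.∣p+q∣≤∣p∣+∣q∣ (a * (b - d)) ((a - c) * d) ⟩
    ∣ a * (b - d) ∣ + ∣ (a - c) * d ∣
      ≡⟨ cong₂ _+_ (ℚ.∣p*q∣≡∣p∣*∣q∣ a (b - d)) (ℚ.∣p*q∣≡∣p∣*∣q∣ (a - c) d) ⟩
    ∣ a ∣ * ∣ b - d ∣ + ∣ a - c ∣ * ∣ d ∣
      ≤⟨ ℚ.+-mono-≤ (*-mono (ℚ.0≤∣p∣ _) ha 0≤A hbd) (*-mono (ℚ.0≤∣p∣ _) hac 0≤η hd) ⟩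
    A * η + η * D
      ≡⟨ budget A D η ⟩
    η * (A + D) ∎

  quotient : ∀ ε B → 0ℚ < ε → 0ℚ < B → ∃ λ η → 0ℚ < η × η * B ≡ ε
  quotient ε B 0<ε 0<B = ε * B⁻¹
    , *-pos 0<ε (ℚ.positive⁻¹ B⁻¹ {{ℚ.1/pos⇒pos B {{positive 0<B}}}})
    , trans (ℚ.*-assoc ε B⁻¹ B) (trans (cong (ε *_) (ℚ.*-inverseˡ B {{>-nonZero 0<B}})) (ℚ.*-identityʳ ε))
    where
    B⁻¹ : ℚ
    B⁻¹ = 1/_ B {{>-nonZero 0<B}}

  *-cauchy : ∀ x y → IsCauchy x → IsCauchy y → IsCauchy (λ n → x n * y n)
  *-cauchy x y cx cy ε 0<ε =
    let Bx , 0<Bx , M₁ , hx = bound x cx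
        By , 0<By , M₂ , hy = bound y cy
        η , 0<η , ηB≡ε = quotient ε (Bx + By) 0<ε (ℚ.+-mono-< 0<Bx 0<By)
        N₁ , hN₁ = cx η 0<η
        N₂ , hN₂ = cy η 0<η
        M≤ : ∀ {k} → (M₁ ℕ.⊔ M₂) ℕ.⊔ (N₁ ℕ.⊔ N₂) ℕ.≤ k → M₁ ℕ.⊔ M₂ ℕ.≤ k
        M≤ = ℕ.m⊔n≤o⇒m≤o (M₁ ℕ.⊔ M₂) (N₁ ℕ.⊔ N₂)
        N≤ : ∀ {k} → (M₁ ℕ.⊔ M₂) ℕ.⊔ (N₁ ℕ.⊔ N₂) ℕ.≤ k → N₁ ℕ.⊔ N₂ ℕ.≤ k
        N≤ = ℕ.m⊔n≤o⇒n≤o (M₁ ℕ.⊔ M₂) (N₁ ℕ.⊔ N₂)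
    in (M₁ ℕ.⊔ M₂) ℕ.⊔ (N₁ ℕ.⊔ N₂) , λ m n hm hn →
      subst (∣ x m * y m - x n * y n ∣ ≤_) ηB≡ε
        (*-close {x m} {y m} {x n} {y n}
          (hx m (ℕ.m⊔n≤o⇒m≤o M₁ M₂ (M≤ hm))) (ℚ.<⇒≤ 0<Bx)
          (hy n (ℕ.m⊔n≤o⇒n≤o M₁ M₂ (M≤ hn))) (ℚ.<⇒≤ 0<η)
          (hN₂ m n (ℕ.m⊔n≤o⇒n≤o N₁ N₂ (N≤ hm)) (ℕ.m⊔n≤o⇒n≤o N₁ N₂ (N≤ hn)))
          (hN₁ m n (ℕ.m⊔n≤o⇒m≤o N₁ N₂ (N≤ hm)) (ℕ.m⊔n≤o⇒m≤o N₁ N₂ (N≤ hn))))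

-- Natural logarithm.  For x ≥ 1, the substitution s = 1 + t (x - 1) gives
--   log x = ∫₁ˣ ds / s = ∫₀¹ a / (1 + t a) dt    where a = x - 1,
-- and the n-th rational approximation is the left Riemann sum over 2ⁿ equal
-- intervals.  For x < 1 the value of log x below is 0.

-- 1 / q for q ≥ 1.
recip₁ : ℚ → ℚ
recip₁ q = ℚ.1/_ (ℚ.1ℚ ℚ.⊔ q) {{ℚ.>-nonZero (ℚ.<-≤-trans (ℚ.positive⁻¹ ℚ.1ℚ) (ℚ.p≤p⊔q ℚ.1ℚ q))}}

logIntegrand : ℚ → ℚ → ℚ
logIntegrand a t = a ℚ.* recip₁ (ℚ.1ℚ ℚ.+ t ℚ.* a)

-- Left Riemann sum of g on [t , t + w] with 2ⁿ equal intervals.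
riemann : (ℚ → ℚ) → ℕ → ℚ → ℚ → ℚ
riemann g zero    t w = w ℚ.* g t
riemann g (suc n) t w = riemann g n t (ℚ.½ ℚ.* w) ℚ.+ riemann g n (t ℚ.+ ℚ.½ ℚ.* w) (ℚ.½ ℚ.* w)

logSeq : (ℕ → ℚ) → ℕ → ℚ
logSeq x n = riemann (logIntegrand ((x n ℚ.- ℚ.1ℚ) ℚ.⊔ ℚ.0ℚ)) n ℚ.0ℚ ℚ.1ℚ

module LogCauchy where
  open ℚLemmas
  open Cauchy
  open import Data.Rational.Base
  open +-*-Solver
  open ℚ.≤-Reasoning

  module _ (g : ℚ → ℚ) (anti : ∀ {s t} → s ≤ t → g t ≤ g s) where

    0≤½* : ∀ {w} → 0ℚ ≤ w → 0ℚ ≤ ½ * w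
    0≤½* = *-nonneg 0≤½

    t≤t+w : ∀ {t w} → 0ℚ ≤ w → t ≤ t + w
    t≤t+w {t} {w} 0≤w = ℚ.≤-trans (ℚ.≤-reflexive (sym (ℚ.+-identityʳ t))) (ℚ.+-monoʳ-≤ t 0≤w)

    end : ∀ t w → (t + ½ * w) + ½ * w ≡ t + w
    end = solve 2 (λ t w → (t :+ con ½ :* w) :+ con ½ :* w := t :+ w) refl

    split : ∀ w y → w * y ≡ (½ * w) * y + (½ * w) * y
    split = solve 2 (λ w y → w :* y := (con ½ :* w) :* y :+ (con ½ :* w) :* y) refl

    lower : ∀ n t w → 0ℚ ≤ w → w * g (t + w) ≤ riemann g n t w
    lower zero t w 0≤w = *-monoˡ w 0≤w (anti (t≤t+w 0≤w))
    lower (suc n) t w 0≤w = begin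
      w * g (t + w)
        ≡⟨ split w (g (t + w)) ⟩
      (½ * w) * g (t + w) + (½ * w) * g (t + w)
        ≤⟨ ℚ.+-mono-≤
             (*-monoˡ (½ * w) (0≤½* 0≤w) (anti (ℚ.≤-trans (t≤t+w (0≤½* 0≤w)) (ℚ.≤-reflexive (end t w)))))
             (ℚ.≤-reflexive (cong (λ z → (½ * w) * g z) (sym (end t w)))) ⟩
      (½ * w) * g (t + ½ * w) + (½ * w) * g ((t + ½ * w) + ½ * w)
        ≤⟨ ℚ.+-mono-≤ (lower n t (½ * w) (0≤½* 0≤w)) (lower n (t + ½ * w) (½ * w) (0≤½* 0≤w)) ⟩
      riemann g (suc n) t w ∎

    upper : ∀ n t w → 0ℚ ≤ w → riemann g n t w ≤ w * g t
    upper zero t w 0≤w = ℚ.≤-refl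
    upper (suc n) t w 0≤w = begin
      riemann g (suc n) t w
        ≤⟨ ℚ.+-mono-≤ (upper n t (½ * w) (0≤½* 0≤w)) (upper n (t + ½ * w) (½ * w) (0≤½* 0≤w)) ⟩
      (½ * w) * g t + (½ * w) * g (t + ½ * w)
        ≤⟨ ℚ.+-monoʳ-≤ ((½ * w) * g t) (*-monoˡ (½ * w) (0≤½* 0≤w) (anti (t≤t+w (0≤½* 0≤w)))) ⟩
      (½ * w) * g t + (½ * w) * g t
        ≡⟨ sym (split w (g t)) ⟩
      w * g t ∎

    refine-≤ : ∀ n k t w → 0ℚ ≤ w → riemann g (n ℕ.+ k) t w ≤ riemann g n t w
    refine-≤ zero k t w 0≤w = upper k t w 0≤w
    refine-≤ (suc n) k t w 0≤w = ℚ.+-mono-≤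
      (refine-≤ n k t (½ * w) (0≤½* 0≤w)) (refine-≤ n k (t + ½ * w) (½ * w) (0≤½* 0≤w))

    refine-≥ : ∀ n k t w → 0ℚ ≤ w →
      riemann g n t w ≤ riemann g (n ℕ.+ k) t w + ½^ n * (w * (g t - g (t + w)))
    refine-≥ zero k t w 0≤w = begin
      w * g t
        ≡⟨ solve 3 (λ w x y → w :* x := w :* y :+ con 1ℚ :* (w :* (x :- y))) refl w (g t) (g (t + w)) ⟩
      w * g (t + w) + 1ℚ * (w * (g t - g (t + w)))
        ≤⟨ ℚ.+-monoˡ-≤ _ (lower k t w 0≤w) ⟩
      riemann g k t w + 1ℚ * (w * (g t - g (t + w))) ∎
    refine-≥ (suc n) k t w 0≤w = begin
      riemann g (suc n) t w
        ≤⟨ ℚ.+-mono-≤ (refine-≥ n k t w/2 (0≤½* 0≤w)) (refine-≥ n k (t + w/2) w/2 (0≤½* 0≤w)) ⟩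
      (r₁ + ½^ n * (w/2 * (g t - g (t + w/2)))) + (r₂ + ½^ n * (w/2 * (g (t + w/2) - g ((t + w/2) + w/2))))
        ≡⟨ solve 7 (λ r₁ r₂ h w x y z →
             (r₁ :+ h :* (con ½ :* w :* (x :- y))) :+ (r₂ :+ h :* (con ½ :* w :* (y :- z)))
             := (r₁ :+ r₂) :+ con ½ :* h :* (w :* (x :- z)))
             refl r₁ r₂ (½^ n) w (g t) (g (t + w/2)) (g ((t + w/2) + w/2)) ⟩
      (r₁ + r₂) + ½ * ½^ n * (w * (g t - g ((t + w/2) + w/2)))
        ≡⟨ cong (λ z → (r₁ + r₂) + ½ * ½^ n * (w * (g t - g z))) (end t w) ⟩
      (r₁ + r₂) + ½ * ½^ n * (w * (g t - g (t + w))) ∎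
      where
      w/2 = ½ * w
      r₁ = riemann g (n ℕ.+ k) t w/2
      r₂ = riemann g (n ℕ.+ k) (t + w/2) w/2

  riemann-shift : ∀ g g′ c → (∀ t → 0ℚ ≤ t → g t ≤ g′ t + c) →
    ∀ n t w → 0ℚ ≤ t → 0ℚ ≤ w → riemann g n t w ≤ riemann g′ n t w + w * c
  riemann-shift g g′ c h zero t w 0≤t 0≤w = begin
    w * g t          ≤⟨ *-monoˡ w 0≤w (h t 0≤t) ⟩
    w * (g′ t + c)   ≡⟨ ℚ.*-distribˡ-+ w (g′ t) c ⟩
    w * g′ t + w * c ∎
  riemann-shift g g′ c h (suc n) t w 0≤t 0≤w = begin
    riemann g (suc n) t w
      ≤⟨ ℚ.+-mono-≤
           (riemann-shift g g′ c h n t (½ * w) 0≤t (*-nonneg 0≤½ 0≤w))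
           (riemann-shift g g′ c h n (t + ½ * w) (½ * w) (ℚ.+-mono-≤ 0≤t (*-nonneg 0≤½ 0≤w)) (*-nonneg 0≤½ 0≤w)) ⟩
    (r₁ + (½ * w) * c) + (r₂ + (½ * w) * c)
      ≡⟨ solve 4 (λ a b w c → (a :+ con ½ :* w :* c) :+ (b :+ con ½ :* w :* c) := (a :+ b) :+ w :* c) refl r₁ r₂ w c ⟩
    riemann g′ (suc n) t w + w * c ∎
    where
    r₁ = riemann g′ n t (½ * w)
    r₂ = riemann g′ n (t + ½ * w) (½ * w)

  module _ (q : ℚ) where
    u : ℚ
    u = 1ℚ ⊔ q

    0<u : 0ℚ < u
    0<u = ℚ.<-≤-trans 0<1 (ℚ.p≤p⊔q 1ℚ q)

    recip₁-nonneg : 0ℚ ≤ recip₁ q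
    recip₁-nonneg = ℚ.<⇒≤ (ℚ.positive⁻¹ (recip₁ q) {{ℚ.1/pos⇒pos u {{positive 0<u}}}})

    recip₁-inv : recip₁ q * u ≡ 1ℚ
    recip₁-inv = ℚ.*-inverseˡ u {{>-nonZero 0<u}}

    recip₁≤1 : recip₁ q ≤ 1ℚ
    recip₁≤1 = begin
      recip₁ q       ≡⟨ sym (ℚ.*-identityʳ (recip₁ q)) ⟩
      recip₁ q * 1ℚ  ≤⟨ *-monoˡ (recip₁ q) recip₁-nonneg (ℚ.p≤p⊔q 1ℚ q) ⟩
      recip₁ q * u   ≡⟨ recip₁-inv ⟩
      1ℚ             ∎

    recip₁-inv′ : 1ℚ ≤ q → recip₁ q * q ≡ 1ℚ
    recip₁-inv′ h = trans (cong (recip₁ q *_) (sym (ℚ.p≤q⇒p⊔q≡q h))) recip₁-inv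

  recip₁-anti : ∀ {q r} → q ≤ r → recip₁ r ≤ recip₁ q
  recip₁-anti {q} {r} q≤r = begin
    recip₁ r                     ≡⟨ sym (ℚ.*-identityʳ (recip₁ r)) ⟩
    recip₁ r * 1ℚ                ≡⟨ cong (recip₁ r *_) (sym (recip₁-inv q)) ⟩
    recip₁ r * (recip₁ q * u q)  ≤⟨ *-monoˡ (recip₁ r) (recip₁-nonneg r)
                                      (*-monoˡ (recip₁ q) (recip₁-nonneg q) (ℚ.⊔-monoʳ-≤ 1ℚ q≤r)) ⟩
    recip₁ r * (recip₁ q * u r)  ≡⟨ solve 3 (λ a b c → a :* (b :* c) := b :* (a :* c)) refl (recip₁ r) (recip₁ q) (u r) ⟩
    recip₁ q * (recip₁ r * u r)  ≡⟨ cong (recip₁ q *_) (recip₁-inv r) ⟩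
    recip₁ q * 1ℚ                ≡⟨ ℚ.*-identityʳ (recip₁ q) ⟩
    recip₁ q                     ∎

  integrand-anti : ∀ a → 0ℚ ≤ a → ∀ {s t} → s ≤ t → logIntegrand a t ≤ logIntegrand a s
  integrand-anti a 0≤a s≤t = *-monoˡ a 0≤a (recip₁-anti (ℚ.+-monoʳ-≤ 1ℚ (*-monoʳ a 0≤a s≤t)))

  integrand-nonneg : ∀ a → 0ℚ ≤ a → ∀ t → 0ℚ ≤ logIntegrand a t
  integrand-nonneg a 0≤a t = *-nonneg 0≤a (recip₁-nonneg (1ℚ + t * a))

  integrand≤ : ∀ a → 0ℚ ≤ a → ∀ t → logIntegrand a t ≤ a
  integrand≤ a 0≤a t = ℚ.≤-trans (*-monoˡ a 0≤a (recip₁≤1 (1ℚ + t * a))) (ℚ.≤-reflexive (ℚ.*-identityʳ a))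

  1≤1+ta : ∀ {t a} → 0ℚ ≤ t → 0ℚ ≤ a → 1ℚ ≤ 1ℚ + t * a
  1≤1+ta 0≤t 0≤a = ℚ.≤-trans (ℚ.≤-reflexive (sym (ℚ.+-identityʳ 1ℚ))) (ℚ.+-monoʳ-≤ 1ℚ (*-nonneg 0≤t 0≤a))

  integrand-lip : ∀ a b → 0ℚ ≤ a → 0ℚ ≤ b → ∀ t → 0ℚ ≤ t →
    logIntegrand a t ≤ logIntegrand b t + ∣ a - b ∣
  integrand-lip a b 0≤a 0≤b t 0≤t = begin
    a * i
      ≡⟨ solve 2 (λ a i → a :* i := a :* i :* con 1ℚ) refl a i ⟩
    a * i * 1ℚ
      ≡⟨ cong (a * i *_) (sym (recip₁-inv′ (1ℚ + t * b) (1≤1+ta 0≤t 0≤b))) ⟩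
    a * i * (j * (1ℚ + t * b))
      ≡⟨ solve 5 (λ a b t i j → a :* i :* (j :* (con 1ℚ :+ t :* b))
           := b :* j :* (i :* (con 1ℚ :+ t :* a)) :+ (a :- b) :* (i :* j)) refl a b t i j ⟩
    b * j * (i * (1ℚ + t * a)) + (a - b) * (i * j)
      ≡⟨ cong (λ z → b * j * z + (a - b) * (i * j)) (recip₁-inv′ (1ℚ + t * a) (1≤1+ta 0≤t 0≤a)) ⟩
    b * j * 1ℚ + (a - b) * (i * j)
      ≤⟨ ℚ.+-mono-≤ (ℚ.≤-reflexive (ℚ.*-identityʳ (b * j)))
           (*-mono (*-nonneg (recip₁-nonneg (1ℚ + t * a)) (recip₁-nonneg (1ℚ + t * b))) (q≤∣q∣ (a - b)) (ℚ.0≤∣p∣ (a - b))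
             (*-mono (recip₁-nonneg (1ℚ + t * b)) (recip₁≤1 (1ℚ + t * a)) 0≤1 (recip₁≤1 (1ℚ + t * b)))) ⟩
    b * j + ∣ a - b ∣ * 1ℚ
      ≡⟨ cong (b * j +_) (ℚ.*-identityʳ ∣ a - b ∣) ⟩
    b * j + ∣ a - b ∣ ∎
    where
    i = recip₁ (1ℚ + t * a)
    j = recip₁ (1ℚ + t * b)

  L : ℚ → ℕ → ℚ
  L a n = riemann (logIntegrand a) n 0ℚ 1ℚ

  L-lip : ∀ a b → 0ℚ ≤ a → 0ℚ ≤ b → ∀ n → L a n ≤ L b n + ∣ a - b ∣
  L-lip a b 0≤a 0≤b n = ℚ.≤-trans
    (riemann-shift _ _ _ (integrand-lip a b 0≤a 0≤b) n 0ℚ 1ℚ ℚ.≤-refl 0≤1)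
    (ℚ.≤-reflexive (cong (L b n +_) (ℚ.*-identityˡ ∣ a - b ∣)))

  L-≤ : ∀ a → 0ℚ ≤ a → ∀ {N n} → N ℕ.≤ n → L a n ≤ L a N
  L-≤ a 0≤a {N} {n} N≤n = subst (λ k → L a k ≤ L a N) (ℕ.m+[n∸m]≡n N≤n)
    (refine-≤ _ (integrand-anti a 0≤a) N (n ℕ.∸ N) 0ℚ 1ℚ 0≤1)

  L-≥ : ∀ a → 0ℚ ≤ a → ∀ {N n} → N ℕ.≤ n → L a N ≤ L a n + ½^ N * a
  L-≥ a 0≤a {N} {n} N≤n = subst (λ k → L a N ≤ L a k + ½^ N * a) (ℕ.m+[n∸m]≡n N≤n) (begin
    L a N
      ≤⟨ refine-≥ _ (integrand-anti a 0≤a) N (n ℕ.∸ N) 0ℚ 1ℚ 0≤1 ⟩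
    L a (N ℕ.+ (n ℕ.∸ N)) + ½^ N * (1ℚ * (g 0ℚ - g (0ℚ + 1ℚ)))
      ≤⟨ ℚ.+-monoʳ-≤ (L a (N ℕ.+ (n ℕ.∸ N))) (*-monoˡ (½^ N) (½^-nonneg N) gap) ⟩
    L a (N ℕ.+ (n ℕ.∸ N)) + ½^ N * a ∎)
    where
    g = logIntegrand a
    gap : 1ℚ * (g 0ℚ - g (0ℚ + 1ℚ)) ≤ a
    gap = begin
      1ℚ * (g 0ℚ - g (0ℚ + 1ℚ)) ≡⟨ ℚ.*-identityˡ _ ⟩
      g 0ℚ - g (0ℚ + 1ℚ)        ≤⟨ ℚ.+-mono-≤ (integrand≤ a 0≤a 0ℚ) (ℚ.neg-antimono-≤ (integrand-nonneg a 0≤a (0ℚ + 1ℚ))) ⟩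
      a - 0ℚ                    ≡⟨ ℚ.+-identityʳ a ⟩
      a                         ∎

  trunc : ℚ → ℚ
  trunc x = (x - 1ℚ) ⊔ 0ℚ

  trunc-shift : ∀ {x y ε} → 0ℚ ≤ ε → x ≤ y + ε → trunc x ≤ trunc y + ε
  trunc-shift {x} {y} {ε} 0≤ε h = ⊔0-shift {x - 1ℚ} {y - 1ℚ} 0≤ε (ℚ.≤-trans (ℚ.+-monoˡ-≤ (- 1ℚ) h)
    (ℚ.≤-reflexive (solve 2 (λ y e → y :+ e :- con 1ℚ := y :- con 1ℚ :+ e) refl y ε)))

  trunc-cauchy : ∀ x → IsCauchy x → IsCauchy (trunc ∘ x)
  trunc-cauchy x cx ε 0<ε = proj₁ (cx ε 0<ε) , λ m n N≤m N≤n → ≤+⇒∣∣≤ {trunc (x m)} {trunc (x n)}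
    (trunc-shift {x m} {x n} (ℚ.<⇒≤ 0<ε) (∣∣≤⇒≤+ (proj₂ (cx ε 0<ε) m n N≤m N≤n)))
    (trunc-shift {x n} {x m} (ℚ.<⇒≤ 0<ε) (∣∣≤⇒≤+ (proj₂ (cx ε 0<ε) n m N≤n N≤m)))

  L-close : ∀ {a b B ε N m n} → 0ℚ ≤ a → 0ℚ ≤ b → b ≤ B → ½^ N * B ≤ ½ * ε → ∣ a - b ∣ ≤ ½ * ε →
    N ℕ.≤ m → N ℕ.≤ n → L a m ≤ L b n + ε
  L-close {a} {b} {B} {ε} {N} {m} {n} 0≤a 0≤b b≤B hB hab N≤m N≤n = begin
    L a m
      ≤⟨ L-≤ a 0≤a N≤m ⟩
    L a N
      ≤⟨ L-lip a b 0≤a 0≤b N ⟩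
    L b N + ∣ a - b ∣
      ≤⟨ ℚ.+-mono-≤ (L-≥ b 0≤b N≤n) hab ⟩
    L b n + ½^ N * b + ½ * ε
      ≤⟨ ℚ.+-monoˡ-≤ (½ * ε) (ℚ.+-monoʳ-≤ (L b n) (ℚ.≤-trans (*-monoˡ (½^ N) (½^-nonneg N) b≤B) hB)) ⟩
    L b n + ½ * ε + ½ * ε
      ≡⟨ trans (ℚ.+-assoc (L b n) (½ * ε) (½ * ε)) (cong (L b n +_) (halves ε)) ⟩
    L b n + ε ∎

  logSeq-cauchy : ∀ x → IsCauchy x → IsCauchy (logSeq x)
  logSeq-cauchy x cx ε 0<ε =
    let B , _ , M , hB = bound (trunc ∘ x) (trunc-cauchy x cx)
        K , hK = ½^-decay B (½ * ε) (*-pos 0<½ 0<ε)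
        N₁ , hN = trunc-cauchy x cx (½ * ε) (*-pos 0<½ 0<ε)
        N = M ℕ.⊔ (K ℕ.⊔ N₁)
        KN≤ : ∀ {k} → N ℕ.≤ k → K ℕ.⊔ N₁ ℕ.≤ k
        KN≤ = ℕ.m⊔n≤o⇒n≤o M (K ℕ.⊔ N₁)
        step : ∀ m n → N ℕ.≤ m → N ℕ.≤ n → L (trunc (x m)) m ≤ L (trunc (x n)) n + ε
        step m n N≤m N≤n = L-close {trunc (x m)} {trunc (x n)} {B} {ε} {N} {m} {n}
          (ℚ.p≤q⊔p (x m - 1ℚ) 0ℚ) (ℚ.p≤q⊔p (x n - 1ℚ) 0ℚ)
          (ℚ.≤-trans (q≤∣q∣ (trunc (x n))) (hB n (ℕ.m⊔n≤o⇒m≤o M (K ℕ.⊔ N₁) N≤n)))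
          (hK N (ℕ.m⊔n≤o⇒m≤o K N₁ (KN≤ ℕ.≤-refl)))
          (hN m n (ℕ.m⊔n≤o⇒n≤o K N₁ (KN≤ N≤m)) (ℕ.m⊔n≤o⇒n≤o K N₁ (KN≤ N≤n)))
          N≤m N≤n
    in N , λ m n N≤m N≤n →
      ≤+⇒∣∣≤ {logSeq x m} {logSeq x n} (step m n N≤m N≤n) (step n m N≤n N≤m)

record ℝ : Set where
  constructor mkℝ
  field
    seq    : ℕ → ℚ
    cauchy : IsCauchy seq
open ℝ public

infix 4 _<_ _≤_

_<_ : ℝ → ℝ → Set
x < y = ∃ λ ε → ℚ.0ℚ ℚ.< ε × Eventually λ n → seq x n ℚ.+ ε ℚ.≤ seq y n

_≤_ : ℝ → ℝ → Set
x ≤ y = ∀ ε → ℚ.0ℚ ℚ.< ε → Eventually λ n → seq x n ℚ.≤ seq y n ℚ.+ ε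

fromℚ : ℚ → ℝ
fromℚ q = mkℝ (λ _ → q) λ ε 0<ε → 0 , λ _ _ _ _ →
  ℚ.≤-trans (ℚ.≤-reflexive (cong ℚ.∣_∣ (ℚ.+-inverseʳ q))) (ℚ.<⇒≤ 0<ε)

fromℕ : ℕ → ℝ
fromℕ n = fromℚ (ℤ.+ n ℚ./ 1)

0ℝ 1ℝ : ℝ
0ℝ = fromℕ 0
1ℝ = fromℕ 1

infix  8 -_
infixr 8 _^_
infixl 7 _*_ _/_
infixl 6 _+_ _-_

_+_ : ℝ → ℝ → ℝ
x + y = mkℝ (λ n → seq x n ℚ.+ seq y n) (Cauchy.+-cauchy (seq x) (seq y) (cauchy x) (cauchy y))

-_ : ℝ → ℝ
- x = mkℝ (λ n → ℚ.- seq x n) (Cauchy.neg-cauchy (seq x) (cauchy x))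

_-_ : ℝ → ℝ → ℝ
x - y = x + (- y)

_*_ : ℝ → ℝ → ℝ
x * y = mkℝ (λ n → seq x n ℚ.* seq y n) (Cauchy.*-cauchy (seq x) (seq y) (cauchy x) (cauchy y))

_^_ : ℝ → ℕ → ℝ
x ^ zero  = 1ℝ
x ^ suc n = x * x ^ n

-- Division by zero gives 0.
_/_ : ℝ → ℕ → ℝ
x / zero  = 0ℝ
x / suc m = x * fromℚ (ℤ.+ 1 ℚ./ suc m)

∑ ∏ : List ℝ → ℝ
∑ = List.foldr _+_ 0ℝ
∏ = List.foldr _*_ 1ℝ

infix 4 _⟶_

_⟶_ : (ℕ → ℝ) → ℝ → Set
x ⟶ l = ∀ ε → 0ℝ < ε → Eventually λ n → (l - ε ≤ x n) × (x n ≤ l + ε)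

log : ℝ → ℝ
log x = mkℝ (logSeq (seq x)) (LogCauchy.logSeq-cauchy (seq x) (cauchy x))

record Graph (n : ℕ) : Set where
  field
    adj     : Fin n → Fin n → Bool
    adj-sym : ∀ u v → adj u v ≡ adj v u
    adj-irr : ∀ v → adj v v ≡ false
open Graph public

private
  variable
    n : ℕ

Adj : Graph n → Fin n → Fin n → Set
Adj G u v = T (adj G u v)

infixl 6 _∪_

_∪_ : Graph n → Graph n → Graph n
adj     (G ∪ H) u v = adj G u v ∨ adj H u v
adj-sym (G ∪ H) u v = cong₂ _∨_ (adj-sym G u v) (adj-sym H u v)
adj-irr (G ∪ H) v   = cong₂ _∨_ (adj-irr G v) (adj-irr H v)

subsets : ∀ n → List (Subset n)
subsets zero    = [] ∷ []
subsets (suc n) = List.map (outside ∷_) (subsets n) ++ List.map (inside ∷_) (subsets n)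

Independent : Graph n → Subset n → Set
Independent G S = ∀ u v → u ∈ S → v ∈ S → ¬ Adj G u v

independent? : (G : Graph n) → Decidable (Independent G)
independent? G S = Fin.all? λ u → Fin.all? λ v → (u ∈? S) →-dec ((v ∈? S) →-dec ¬? (T? (adj G u v)))

α : Graph n → ℕ
α {n} G = max 0 (List.map card (filter (independent? G) (subsets n)))

degree : Graph n → Fin n → ℕ
degree G v = card (tabulate (adj G v))

-- The default value n of min exceeds every degree, so it only matters for n = 0.
δ : Graph n → ℕ
δ {n} G = min n (List.map (degree G) (allFin n))

IsCycle : ∀ {ℓ} → Graph n → Vec (Fin n) ℓ → Set
IsCycle G []       = ⊥
IsCycle G (v ∷ vs) = Unique (v ∷ vs) × Linked (Adj G) (v ∷ (vs ∷ʳ v))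

HasCycle : Graph n → ℕ → Set
HasCycle {n} G ℓ = 3 ℕ.≤ ℓ × ∃ λ (vs : Vec (Fin n) ℓ) → IsCycle G vs

Hamiltonian : Graph n → Set
Hamiltonian {n} G = HasCycle G n

Pancyclic : Graph n → Set
Pancyclic {n} G = ∀ ℓ → 3 ℕ.≤ ℓ → ℓ ℕ.≤ n → HasCycle G ℓ

isCycle? : ∀ {ℓ} (G : Graph n) → Decidable (IsCycle {ℓ = ℓ} G)
isCycle? G []       = no λ ()
isCycle? G (v ∷ vs) =
  allPairs? (λ x y → ¬? (x Fin.≟ y)) (v ∷ vs) ×-dec linked? (λ x y → T? (adj G x y)) (v ∷ (vs ∷ʳ v))

anyVec? : ∀ ℓ {P : Vec (Fin n) ℓ → Set} → Decidable P → Dec (∃ P)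
anyVec? zero    P? = map′ (λ p → [] , p) (λ { ([] , p) → p }) (P? [])
anyVec? (suc ℓ) P? = map′ (λ { (v , vs , p) → v ∷ vs , p }) (λ { (v ∷ vs , p) → v , vs , p })
  (Fin.any? λ v → anyVec? ℓ λ vs → P? (v ∷ vs))

hasCycle? : (G : Graph n) → Decidable (HasCycle G)
hasCycle? G ℓ = (3 ℕ.≤? ℓ) ×-dec anyVec? ℓ (isCycle? G)

hamiltonian? : Decidable (Hamiltonian {n})
hamiltonian? {n} G = hasCycle? G n

pancyclic? : Decidable (Pancyclic {n})
pancyclic? {n} G = map′
  (λ f ℓ 3≤ℓ ℓ≤n → f {ℓ} (ℕ.s≤s ℓ≤n) 3≤ℓ)
  (λ f {ℓ} ℓ<1+n 3≤ℓ → f ℓ 3≤ℓ (ℕ.≤-pred ℓ<1+n))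
  (ℕ.allUpTo? {P = λ ℓ → 3 ℕ.≤ ℓ → HasCycle G ℓ} (λ ℓ → (3 ℕ.≤? ℓ) →-dec hasCycle? G ℓ) (suc n))

addVertex : Subset n → Graph n → Graph (suc n)
adj (addVertex S G) zero    zero    = false
adj (addVertex S G) zero    (suc v) = lookup S v
adj (addVertex S G) (suc u) zero    = lookup S u
adj (addVertex S G) (suc u) (suc v) = adj G u v
adj-sym (addVertex S G) zero    zero    = refl
adj-sym (addVertex S G) zero    (suc v) = refl
adj-sym (addVertex S G) (suc u) zero    = refl
adj-sym (addVertex S G) (suc u) (suc v) = adj-sym G u v
adj-irr (addVertex S G) zero    = refl
adj-irr (addVertex S G) (suc v) = adj-irr G v

emptyGraph : Graph 0
adj     emptyGraph ()
adj-sym emptyGraph ()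
adj-irr emptyGraph ()

-- Each graph on Fin n occurs exactly once, up to pointwise equality of adj.
graphs : ∀ n → List (Graph n)
graphs zero    = emptyGraph ∷ []
graphs (suc n) = cartesianProductWith addVertex (subsets n) (graphs n)

pairs : ∀ n → List (Fin n × Fin n)
pairs n = filter (λ (u , v) → u Fin.<? v) (cartesianProduct (allFin n) (allFin n))

-- ℙ[ 𝔾(n,p) = R ]
weight : ℝ → Graph n → ℝ
weight {n} p R = ∏ (List.map (λ (u , v) → if adj R u v then p else 1ℝ - p) (pairs n))

-- ℙ[ 𝔾(n,p) ∈ A ]
ℙ : ℝ → {A : Graph n → Set} → Decidable A → ℝ
ℙ {n} p A? = ∑ (List.map (weight p) (filter A? (graphs n)))

IsProbability : ℝ → Set
IsProbability p = (0ℝ ≤ p) × (p ≤ 1ℝ)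

-- 𝔾(n,p(n)) a.a.s. has property A(n).
Aas : (ℕ → ℝ) → {A : ∀ n → Graph n → Set} → (∀ n → Decidable (A n)) → Set
Aas p A? = (λ n → ℙ (p n) (A? n)) ⟶ 1ℝ

{-# OPTIONS --safe #-}
module Submission where

-- (a) Cutting along small separators splits G, up to few vertices, into at most α(G) pieces that stay connected after
-- the removal of any small set.  Exposing 𝔾(n,p) between disjoint quarters of the pieces gives, with high probability,
-- two vertex-disjoint spanning trees of random edges on the set of pieces: the first links the pieces, and a T-join in
-- the second corrects parities, so that the random edges and short tight walks inside the pieces (a tight walk has an
-- independent set of half its size, so it is short) combine to a path that meets each piece often.  Since among any
-- α(G)+1 vertices two are adjacent, this path can be extended until it covers everything but a reserved fan; chords
-- shorten it in steps of at most 2α(G), and the fan fills the gaps between the lengths obtained.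
-- (b) H is a disjoint union of k cliques, all but one on d+1 vertices.  Among k^{1/3} of the small cliques there are
-- a.a.s. no random edges, and as the edges leaving different cliques are independent, a.a.s. one of them has no random edge to
-- the rest of the graph either.  Such a clique is a component of H ∪ 𝔾(n,p).

-- The obstacle is that many path ends must be linked disjointly inside one piece, with only
-- connectivity and no expansion at hand. The way out is economy: among m terminals of a piece some
-- two are joined by a path with O(α/m + 1) inner vertices, so linking all of them one after another
-- costs O(α log n) by a harmonic sum. Connectivity of this order is demanded of the pieces; at most
-- α separators of this size delete O(α² log n) vertices, and the lower bound on δ(G) pays for them.
-- Parity enters because a link uses up two path ends, so every piece but a root must be met by an
-- even number of them; the root also carries the two ends of the path to be built. The tree edges
-- must be vertex-disjoint, so each vertex may use only its first random edge into the target part.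
-- This also turns the event that no such edge leaves a set of pieces into a product over vertices.
-- Finally, rational approximations of a real p may leave [0,1], so all estimates are made for
-- rational q in [0,1] and transferred by Lipschitz continuity.

-- Lists: disjointness, related pairs and pigeonhole arguments.

module Lists where

 open import Data.Empty using (⊥-elim)
 open import Data.List.Base hiding (find; lookup)
 open import Data.List.Properties
 open import Data.List.Membership.Propositional using (_∈_; _∉_; find)
 open import Data.List.Membership.Propositional.Properties
 open import Data.List.Relation.Unary.All as All using (All; []; _∷_)
 import Data.List.Relation.Unary.All.Properties as All
 open import Data.List.Relation.Unary.Any as Any using (Any; here; there)
 open import Data.List.Relation.Unary.AllPairs as AllPairs using (AllPairs; []; _∷_)
 import Data.List.Relation.Unary.AllPairs.Properties as AllPairs
 open import Data.List.Relation.Unary.Unique.Propositional using (Unique)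
 import Data.List.Relation.Unary.Unique.Propositional.Properties as Unique
 open import Data.List.Relation.Binary.Permutation.Propositional
 open import Data.List.Relation.Binary.Permutation.Propositional.Properties as Perm using (shift)
 import Data.List.Relation.Binary.Permutation.Setoid.Properties as PermS
 open import Data.Nat.Base
 open import Data.Nat.Properties
 open import Data.Product.Base using (∃; _×_; _,_; proj₁; proj₂)
 open import Data.Sum.Base using (_⊎_; inj₁; inj₂)
 open import Function.Base using (_∘_; id)
 open import Relation.Binary.Definitions using (DecidableEquality)
 open import Relation.Binary.PropositionalEquality as ≡ using (_≡_; _≢_; cong; subst; setoid)
 open import Relation.Nullary
 open import Relation.Unary using (Decidable)

 infix 4 _≟ℕ_
 _≟ℕ_ : DecidableEquality ℕ
 _≟ℕ_ = Data.Nat.Properties._≟_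

 module _ {A : Set} where

   infix 4 _⊆_
   _⊆_ : List A → List A → Set
   xs ⊆ ys = ∀ {x} → x ∈ xs → x ∈ ys

   Unique-↭ : ∀ {xs ys : List A} → xs ↭ ys → Unique xs → Unique ys
   Unique-↭ p = PermS.Unique-resp-↭ (setoid A) (Perm.↭⇒↭ₛ p)
     where import Data.List.Relation.Binary.Permutation.Propositional as Perm

   ∈-remove : ∀ as {bs} {x y : A} → y ≢ x → y ∈ as ++ x ∷ bs → y ∈ as ++ bs
   ∈-remove as y≢x y∈ with ∈-++⁻ as y∈
   ... | inj₁ p = ∈-++⁺ˡ p
   ... | inj₂ (here e) = ⊥-elim (y≢x e)
   ... | inj₂ (there p) = ∈-++⁺ʳ as p

   length-⊆ : ∀ {xs ys : List A} → Unique xs → xs ⊆ ys → length xs ≤ length ys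
   length-⊆ [] _ = z≤n
   length-⊆ {x ∷ xs} {ys} (px ∷ u) sub with as , bs , ≡.refl ← ∈-∃++ (sub (here ≡.refl)) =
     ≤-trans (s≤s (length-⊆ u λ y∈ → ∈-remove as (λ e → All.lookup px y∈ (≡.sym e)) (sub (there y∈))))
       (≤-reflexive (≡.sym (Perm.↭-length (shift x as bs))))

   Unique-∷ : ∀ {x} {xs : List A} → x ∉ xs → Unique xs → Unique (x ∷ xs)
   Unique-∷ x∉ u = All.tabulate (λ y∈ e → x∉ (subst (_∈ _) (≡.sym e) y∈)) ∷ u

   Unique-∉ : ∀ {x} {xs : List A} → Unique (x ∷ xs) → x ∉ xs
   Unique-∉ (p ∷ _) x∈ = All.lookup p x∈ ≡.refl

   Unique-++⁻ : ∀ xs {ys : List A} → Unique (xs ++ ys) → Unique xs × Unique ys × (∀ {x} → x ∈ xs → x ∉ ys)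
   Unique-++⁻ [] u = [] , u , λ ()
   Unique-++⁻ (x ∷ xs) (p ∷ u) with u₁ , u₂ , d ← Unique-++⁻ xs u =
     (All.++⁻ˡ xs p ∷ u₁) , u₂ , λ { (here ≡.refl) y → All.lookup (All.++⁻ʳ xs p) y ≡.refl ; (there q) → d q }

   Unique-++ : ∀ {xs ys : List A} → Unique xs → Unique ys → (∀ {x} → x ∈ xs → x ∉ ys) → Unique (xs ++ ys)
   Unique-++ u v d = Unique.++⁺ u v (λ (p , q) → d p q)

   ++-compare : ∀ as as′ {r r′ : List A} → as ++ r ≡ as′ ++ r′ →
     (∃ λ m → as′ ≡ as ++ m × r ≡ m ++ r′) ⊎ (∃ λ m → as ≡ as′ ++ m × r′ ≡ m ++ r)
   ++-compare [] as′ e = inj₁ (as′ , ≡.refl , e)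
   ++-compare (a ∷ as) [] e = inj₂ (a ∷ as , ≡.refl , ≡.sym e)
   ++-compare (a ∷ as) (a′ ∷ as′) e with ∷-injective e
   ... | ≡.refl , e′ with ++-compare as as′ e′
   ...   | inj₁ (m , p , q) = inj₁ (m , cong (a ∷_) p , q)
   ...   | inj₂ (m , p , q) = inj₂ (m , cong (a ∷_) p , q)

   module _ {R : A → A → Set} (R? : ∀ x y → Dec (R x y)) where

     -- Keeping the sublists around the pair lets one search serve for repeated vertices, chords and
     -- touching blocks, all of which cut the list at the two places.
     Related : List A → Set
     Related xs = ∃ λ as → ∃ λ x → ∃ λ bs → ∃ λ y → ∃ λ cs → xs ≡ as ++ x ∷ bs ++ y ∷ cs × R x y

     search : ∀ xs → AllPairs (λ x y → ¬ R x y) xs ⊎ Related xs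
     search [] = inj₁ []
     search (x ∷ xs) with Any.any? (R? x) xs
     ... | yes p with y , y∈ , r ← find p = let bs , cs , e = ∈-∃++ y∈ in
             inj₂ ([] , x , bs , y , cs , cong (x ∷_) e , r)
     ... | no ¬p with search xs
     ...   | inj₁ ap = inj₁ (All.¬Any⇒All¬ xs ¬p ∷ ap)
     ...   | inj₂ (as , y , bs , z , cs , e , r) = inj₂ (x ∷ as , y , bs , z , cs , cong (x ∷_) e , r)

   pick : ∀ {B : Set} (f : A → B) {t} ps → t ∈ map f ps → ∃ λ p → ∃ λ r → ps ↭ p ∷ r × f p ≡ t
   pick f ps t∈ with p , p∈ , e ← ∈-map⁻ f t∈ with as , bs , ≡.refl ← ∈-∃++ p∈ =
     p , as ++ bs , shift p as bs , ≡.sym e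

   split-first : ∀ {P : A → Set} → Decidable P → ∀ {xs} → Any P xs →
     ∃ λ as → ∃ λ x → ∃ λ bs → xs ≡ as ++ x ∷ bs × P x × All (¬_ ∘ P) as
   split-first P? {x ∷ xs} p with P? x
   ... | yes px = [] , x , xs , ≡.refl , px , []
   ... | no ¬px with p
   ...   | here px = ⊥-elim (¬px px)
   ...   | there q with as , y , bs , e , py , al ← split-first P? q = x ∷ as , y , bs , cong (x ∷_) e , py , ¬px ∷ al

   concatMap-↭ : ∀ {B : Set} (f : A → List B) {ps qs} → ps ↭ qs → concatMap f ps ↭ concatMap f qs
   concatMap-↭ f refl = refl
   concatMap-↭ f (prep x p) = Perm.++⁺ˡ (f x) (concatMap-↭ f p)
   concatMap-↭ f (swap {xs} {ys} x y p) = trans (Perm.shifts (f x) (f y)) (Perm.++⁺ˡ (f y) (Perm.++⁺ˡ (f x) (concatMap-↭ f p)))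
   concatMap-↭ f (trans p q) = trans (concatMap-↭ f p) (concatMap-↭ f q)

   ++-length-≤ˡ : ∀ (xs : List A) {ys} → length xs ≤ length (xs ++ ys)
   ++-length-≤ˡ xs = ≤-trans (m≤m+n _ _) (≤-reflexive (≡.sym (length-++ xs)))

   module _ (_≟_ : DecidableEquality A) where
     open import Data.List.Membership.DecPropositional _≟_ using (_∈?_; _∉?_)

     ∃∉ : ∀ {xs ys : List A} → Unique xs → length ys < length xs → ∃ λ x → x ∈ xs × x ∉ ys
     ∃∉ {xs} {ys} u lt with Any.any? (_∉? ys) xs
     ... | yes p = find p
     ... | no ¬p = ⊥-elim (<⇒≱ lt (length-⊆ u λ x∈ → decidable-stable (_ ∈? ys) (All.lookup (All.¬Any⇒All¬ xs ¬p) x∈)))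

     fresh : ∀ {bs : List A} ys j → Unique bs → j + length ys ≤ length bs →
       ∃ λ cs → Unique cs × length cs ≡ j × cs ⊆ bs × (∀ {x} → x ∈ cs → x ∉ ys)
     fresh {bs} ys j u le = take j fs , Unique.take⁺ j (Unique.filter⁺ (_∉? ys) u)
       , ≡.trans (length-take j fs) (m≤n⇒m⊓n≡m j≤)
       , (λ x∈ → proj₁ (∈-filter⁻ (_∉? ys) (take-⊆ x∈))) , λ x∈ → proj₂ (∈-filter⁻ (_∉? ys) {xs = bs} (take-⊆ x∈))
       where
       fs = filter (_∉? ys) bs
       take-⊆ : take j fs ⊆ fs
       take-⊆ x∈ = subst (_ ∈_) (take++drop≡id j fs) (∈-++⁺ˡ x∈)
       sub : bs ⊆ fs ++ ys
       sub {x} x∈ with x ∈? ys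
       ... | yes p = ∈-++⁺ʳ fs p
       ... | no ¬p = ∈-++⁺ˡ (∈-filter⁺ (_∉? ys) x∈ ¬p)
       j≤ : j ≤ length fs
       j≤ = +-cancelʳ-≤ (length ys) j (length fs) (≤-trans le (≤-trans (length-⊆ u sub) (≤-reflexive (length-++ fs))))

-- Tight walks and short links between terminals.

module WalkJoining where

 open import Data.Empty using (⊥-elim)
 open import Data.List.Base hiding (find; lookup)
 open import Data.List.Properties
 open import Data.List.Membership.Propositional using (_∈_; _∉_; find)
 open import Data.List.Membership.Propositional.Properties
 open import Data.List.Relation.Unary.All as All using (All; []; _∷_)
 import Data.List.Relation.Unary.All.Properties as All
 open import Data.List.Relation.Unary.Any as Any using (Any; here; there)
 open import Data.List.Relation.Unary.AllPairs as AllPairs using (AllPairs; []; _∷_)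
 import Data.List.Relation.Unary.AllPairs.Properties as AllPairs
 open import Data.List.Relation.Unary.Unique.Propositional using (Unique)
 import Data.List.Relation.Unary.Unique.Propositional.Properties as Unique
 open import Data.List.Relation.Binary.Permutation.Propositional
 open import Data.List.Relation.Binary.Permutation.Propositional.Properties as Perm using (∈-resp-↭)
 import Data.List.Relation.Binary.Permutation.Setoid.Properties as PermS
 open import Data.Nat.Base
 open import Data.Nat.Properties
 open import Data.Product.Base using (Σ; ∃; _×_; _,_; proj₁; proj₂)
 open import Data.Sum.Base using (_⊎_; inj₁; inj₂)
 open import Function.Base using (_∘_; id)
 open import Relation.Binary.Definitions using (DecidableEquality)
 open import Relation.Binary.PropositionalEquality as ≡ using (_≡_; _≢_; cong; subst)
 open import Relation.Nullary
 open import Relation.Unary using (Decidable)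

 open Lists
 open import Data.Nat.DivMod using (_/_; _%_; m≡m%n+[m/n]*n; m%n<n)
 open import Relation.Nullary.Decidable using (_⊎-dec_)

 AllPairs-at : ∀ {A : Set} {R : A → A → Set} as {x bs y cs} → AllPairs R (as ++ x ∷ bs ++ y ∷ cs) → R x y
 AllPairs-at [] {bs = bs} (p ∷ _) = All.lookup p (∈-++⁺ʳ bs (here ≡.refl))
 AllPairs-at (a ∷ as) (_ ∷ ap) = AllPairs-at as ap

 Unique-drop-mid : ∀ {A : Set} (as m : List A) {cs} → Unique (as ++ m ++ cs) → Unique (as ++ cs)
 Unique-drop-mid as m u with u₁ , u₂ , d ← Unique-++⁻ as u with _ , u₃ , _ ← Unique-++⁻ m u₂ =
   Unique-++ u₁ u₃ λ p q → d p (∈-++⁺ʳ m q)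

 -- Consecutive vertices of a walk are always adjacent, but two different places of `evens xs` are
 -- never consecutive in `xs`, so an edge between them is a genuine shortcut.
 evens : ∀ {A : Set} → List A → List A
 evens [] = []
 evens (x ∷ []) = x ∷ []
 evens (x ∷ y ∷ zs) = x ∷ evens zs

 module _ {A : Set} where

   evens-⊆ : ∀ (xs : List A) → evens xs ⊆ xs
   evens-⊆ (x ∷ []) p = p
   evens-⊆ (x ∷ y ∷ zs) (here e) = here e
   evens-⊆ (x ∷ y ∷ zs) (there p) = there (there (evens-⊆ zs p))

   evens-take : ∀ s (xs : List A) → s + s ≤ length xs → length (evens (take (s + s) xs)) ≡ s
   evens-take zero xs le = ≡.refl
   evens-take (suc s) (x ∷ []) (s≤s le) rewrite +-suc s s with () ← le
   evens-take (suc s) (x ∷ y ∷ zs) (s≤s le) rewrite +-suc s s = cong suc (evens-take s zs (≤-pred le))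

   evens-take-⊑ : ∀ s (xs : List A) → ∃ λ r → evens xs ≡ evens (take (s + s) xs) ++ r
   evens-take-⊑ zero xs = evens xs , ≡.refl
   evens-take-⊑ (suc s) [] = [] , ≡.refl
   evens-take-⊑ (suc s) (x ∷ []) rewrite +-suc s s = [] , ≡.refl
   evens-take-⊑ (suc s) (x ∷ y ∷ zs) rewrite +-suc s s with r , e ← evens-take-⊑ s zs = r , cong (x ∷_) e

   -- The vertex `z` is the point: bypassing it makes the walk strictly shorter.
   evens-split : ∀ xs {as x bs y cs} → evens xs ≡ as ++ x ∷ bs ++ y ∷ cs →
     ∃ λ as′ → ∃ λ z → ∃ λ bs′ → ∃ λ cs′ → xs ≡ as′ ++ x ∷ z ∷ bs′ ++ y ∷ cs′
   evens-split [] {[]} ()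
   evens-split [] {_ ∷ _} ()
   evens-split (x ∷ []) {[]} {bs = []} ()
   evens-split (x ∷ []) {[]} {bs = _ ∷ _} ()
   evens-split (x ∷ []) {a ∷ []} ()
   evens-split (x ∷ []) {a ∷ _ ∷ _} ()
   evens-split (x ∷ z ∷ zs) {[]} {bs = bs} e with ≡.refl , e′ ← ∷-injective e =
     let bs′ , cs′ , eq = ∈-∃++ (evens-⊆ zs (subst (_ ∈_) (≡.sym e′) (∈-++⁺ʳ bs (here ≡.refl))))
     in [] , z , bs′ , cs′ , cong (λ l → x ∷ z ∷ l) eq
   evens-split (x ∷ z ∷ zs) {a ∷ as} e with ≡.refl , e′ ← ∷-injective e =
     let as′ , w , bs′ , cs′ , eq = evens-split zs e′ in x ∷ z ∷ as′ , w , bs′ , cs′ , cong (λ l → x ∷ z ∷ l) eq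

 -- With s = a / m + 1, m separated blocks of s independent vertices would exceed the independence
 -- number a. A link runs through two touching blocks, each entered by a walk on at most 2s
 -- vertices.
 cost : ℕ → ℕ → ℕ
 cost a zero = 0
 cost a (suc m) = 4 * suc (a / suc m)

 module Walks {V : Set} (_≟_ : DecidableEquality V) (E : V → V → Set) (E? : ∀ x y → Dec (E x y))
              (E-sym : ∀ {x y} → E x y → E y x) where

   -- W u xs w: the list xs is a walk that starts at u and ends at w.
   data W : V → List V → V → Set where
     stop : ∀ u → W u (u ∷ []) u
     step : ∀ {u v xs w} → E u v → W v xs w → W u (u ∷ xs) w

   Cl : V → V → Set
   Cl x y = x ≡ y ⊎ E x y

   Cl? : ∀ x y → Dec (Cl x y)
   Cl? x y = (x ≟ y) ⊎-dec E? x y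

   Indep : List V → Set
   Indep = AllPairs (λ x y → ¬ Cl x y)

   W-++ : ∀ {u xs w w′ ys v} → W u xs w → E w w′ → W w′ ys v → W u (xs ++ ys) v
   W-++ (stop _) e q = step e q
   W-++ (step d p) e q = step d (W-++ p e q)

   W-glue : ∀ {u l x bs w} → W u l x → W x (x ∷ bs) w → W u (l ++ bs) w
   W-glue (stop _) q = q
   W-glue (step e p) q = step e (W-glue p q)

   W-rev : ∀ {u xs w} → W u xs w → W w (reverse xs) u
   W-rev (stop u) = stop u
   W-rev (step {u} {v} {xs} e p) = subst (λ l → W _ l u) (≡.sym (unfold-reverse u xs)) (W-++ (W-rev p) (E-sym e) (stop u))

   W-head : ∀ {u xs w} → W u xs w → ∃ λ ys → xs ≡ u ∷ ys
   W-head (stop u) = [] , ≡.refl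
   W-head (step e p) = _ , ≡.refl

   W-head∈ : ∀ {u xs w} → W u xs w → u ∈ xs
   W-head∈ (stop u) = here ≡.refl
   W-head∈ (step e p) = here ≡.refl

   W-last∈ : ∀ {u xs w} → W u xs w → w ∈ xs
   W-last∈ (stop u) = here ≡.refl
   W-last∈ (step e p) = there (W-last∈ p)

   private
     []≢++∷ : ∀ (as : List V) {x bs} → [] ≢ as ++ x ∷ bs
     []≢++∷ [] ()
     []≢++∷ (_ ∷ _) ()

   W-split : ∀ as {u l w x bs} → W u l w → l ≡ as ++ x ∷ bs → W u (as ++ x ∷ []) x × W x (x ∷ bs) w
   W-split [] (stop u) ≡.refl = stop u , stop u
   W-split [] (step e p) ≡.refl = stop _ , step e p
   W-split (a ∷ as) (stop u) eq = ⊥-elim ([]≢++∷ as (∷-injectiveʳ eq))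
   W-split (a ∷ as) (step e p) eq with ≡.refl , e′ ← ∷-injective eq = let p₁ , p₂ = W-split as p e′ in step e p₁ , p₂

   W-cut : ∀ as {u l w x s r} → W u l w → l ≡ as ++ x ∷ s ∷ r → W u (as ++ x ∷ []) x × E x s × W s (s ∷ r) w
   W-cut as p eq with W-split as p eq
   ... | p₁ , step e p₂ with W-head p₂
   ...   | _ , ≡.refl = p₁ , e , p₂

   W-take : ∀ j {p z Y} → W p (p ∷ Y) z → ∃ λ z′ → W p (p ∷ take j Y) z′ × z′ ∈ p ∷ Y
   W-take zero p = _ , stop _ , here ≡.refl
   W-take (suc j) (stop _) = _ , stop _ , here ≡.refl
   W-take (suc j) (step e p) with W-head p
   ... | _ , ≡.refl = let z′ , q , m = W-take j p in z′ , step e q , there m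

   shorten≡ : ∀ as {u xs w x bs cs} → W u xs w → xs ≡ as ++ x ∷ bs ++ x ∷ cs →
     ∃ λ ys → W u ys w × ys ⊆ xs × length ys < length xs
   shorten≡ as {x = x} {bs} {cs} p ≡.refl =
     (as ++ x ∷ []) ++ cs , W-glue (proj₁ (W-split as p ≡.refl)) (proj₂ (W-split (as ++ x ∷ bs) p (≡.sym (++-assoc as (x ∷ bs) (x ∷ cs)))))
     , sub , lt
     where
     sub : (as ++ x ∷ []) ++ cs ⊆ as ++ x ∷ bs ++ x ∷ cs
     sub q with ∈-++⁻ (as ++ x ∷ []) q
     ... | inj₂ r = ∈-++⁺ʳ as (there (∈-++⁺ʳ bs (there r)))
     ... | inj₁ r with ∈-++⁻ as r
     ...   | inj₁ r′ = ∈-++⁺ˡ r′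
     ...   | inj₂ (here e) = ∈-++⁺ʳ as (here e)
     lt : length ((as ++ x ∷ []) ++ cs) < length (as ++ x ∷ bs ++ x ∷ cs)
     lt rewrite ++-assoc as (x ∷ []) cs | length-++ as {x ∷ cs} | length-++ as {x ∷ bs ++ x ∷ cs} | length-++ bs {x ∷ cs} =
       +-monoʳ-< (length as) (s≤s (m≤n+m _ (length bs)))

   shortenE : ∀ as {u xs w x m y cs} → W u xs w → xs ≡ as ++ x ∷ m ++ y ∷ cs → E x y → W u (as ++ x ∷ y ∷ cs) w
   shortenE as {x = x} {m} {y} {cs} p ≡.refl e = subst (λ l → W _ l _) (++-assoc as (x ∷ []) (y ∷ cs))
     (W-++ (proj₁ (W-split as p ≡.refl)) e (proj₂ (W-split (as ++ x ∷ m) p (≡.sym (++-assoc as (x ∷ m) (y ∷ cs))))))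

   mid-⊆ : ∀ (as : List V) {x} m {cs} → as ++ x ∷ cs ⊆ as ++ x ∷ m ++ cs
   mid-⊆ as m q with ∈-++⁻ as q
   ... | inj₁ r = ∈-++⁺ˡ r
   ... | inj₂ (here e) = ∈-++⁺ʳ as (here e)
   ... | inj₂ (there r) = ∈-++⁺ʳ as (there (∈-++⁺ʳ m r))

   mid-length : ∀ (as : List V) {x} m {cs} → length (as ++ x ∷ m ++ cs) ≡ length m + length (as ++ x ∷ cs)
   mid-length [] m = ≡.trans (cong suc (length-++ m)) (≡.sym (+-suc (length m) _))
   mid-length (a ∷ as) m = ≡.trans (cong suc (mid-length as m)) (≡.sym (+-suc (length m) _))

   -- Every repetition and every chord between even places strictly shortens the walk, with `k` as
   -- fuel. What remains is a path half of whose vertices are independent.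
   tighten : ∀ k {u xs w} → length xs ≤ k → W u xs w →
     ∃ λ ys → W u ys w × ys ⊆ xs × length ys ≤ length xs × Unique ys × Indep (evens ys)
   tighten zero le p with _ , ≡.refl ← W-head p with () ← le
   tighten (suc k) {xs = xs} le p with search _≟_ xs
   ... | inj₂ (as , x , bs , .x , cs , eq , ≡.refl) =
         let ys , q , s , lt = shorten≡ as p eq
             zs , q′ , s′ , le′ , r = tighten k (≤-pred (≤-trans lt le)) q
         in zs , q′ , s ∘ s′ , ≤-trans le′ (<⇒≤ lt) , r
   ... | inj₁ uniq with search Cl? (evens xs)
   ...   | inj₁ ind = xs , p , id , ≤-refl , uniq , ind
   ...   | inj₂ (as , x , bs , y , cs , eq , inj₁ ≡.refl) =
           let as′ , z , bs′ , cs′ , eq′ = evens-split xs {as} eq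
               ys , q , s , lt = shorten≡ as′ {bs = z ∷ bs′} p eq′
               zs , q′ , s′ , le′ , r = tighten k (≤-pred (≤-trans lt le)) q
           in zs , q′ , s ∘ s′ , ≤-trans le′ (<⇒≤ lt) , r
   ...   | inj₂ (as , x , bs , y , cs , eq , inj₂ e) =
           let as′ , z , bs′ , cs′ , eq′ = evens-split xs {as} eq
               q = shortenE as′ {m = z ∷ bs′} p eq′ e
               lt : length (as′ ++ x ∷ y ∷ cs′) < length xs
               lt = subst (length (as′ ++ x ∷ y ∷ cs′) <_) (cong length (≡.sym eq′))
                      (≤-trans (s≤s (m≤n+m _ (length bs′))) (≤-reflexive (≡.sym (mid-length as′ (z ∷ bs′)))))
               zs , q′ , s′ , le′ , r = tighten k (≤-pred (≤-trans lt le)) q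
           in zs , q′ , subst (_ ∈_) (≡.sym eq′) ∘ mid-⊆ as′ (z ∷ bs′) ∘ s′ , ≤-trans le′ (<⇒≤ lt) , r

   module _ (a : ℕ) (ind : ∀ zs → Indep zs → length zs ≤ a) where

     clash : ∀ zs → a < length zs → Related Cl? zs
     clash zs lt with search Cl? zs
     ... | inj₁ i = ⊥-elim (<⇒≱ lt (ind zs i))
     ... | inj₂ r = r

     module Join (Rg : V → Set) (rc : ∀ u w → Rg u → Rg w → ∃ λ xs → W u xs w × (∀ {x} → x ∈ xs → Rg x)) where

       open import Data.List.Membership.DecPropositional _≟_ using (_∈?_)

       -- Only an initial stretch of the walk is used, as a substitute for a ball around `t`.
       record Tight (ts : List V) (t : V) : Set where
         field
           t∈    : t ∈ ts
           {t′}  : V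
           t′∈   : t′ ∈ ts
           t≢t′  : t ≢ t′
           {π}   : List V
           walk  : W t π t′
           inRg  : ∀ {x} → x ∈ π → Rg x
           indep : Indep (evens π)
       open Tight

       record Link (ts : List V) (b : ℕ) : Set where
         field
           {t t′} : V
           t∈    : t ∈ ts
           t′∈   : t′ ∈ ts
           t≢t′  : t ≢ t′
           {zs}  : List V
           walk  : W t (t ∷ zs ++ t′ ∷ []) t′
           uniq  : Unique zs
           inRg  : ∀ {x} → x ∈ zs → Rg x
           off   : ∀ {x} → x ∈ zs → x ∉ ts
           short : length zs ≤ b

       -- Stopping the tightened walk at the first terminal after `t` keeps its inner vertices off
       -- `ts`; the terminal reached may differ from `t′`.
       link : ∀ {ts t t′ xs} b → t ∈ ts → t′ ∈ ts → t ≢ t′ → W t xs t′ → (∀ {x} → x ∈ xs → Rg x) → length xs ≤ b → Link ts b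
       link {ts} {t} {t′} {xs} b t∈ t′∈ t≢t′ p rg le with tighten (length xs) ≤-refl p
       ... | ys , q , s , le′ , u , _ with W-head q
       ...   | ys′ , ≡.refl with split-first (_∈? ts) (Any.map (λ { ≡.refl → t′∈ }) (tail∈ (W-last∈ q)))
         where
         tail∈ : t′ ∈ t ∷ ys′ → t′ ∈ ys′
         tail∈ (here e) = ⊥-elim (t≢t′ (≡.sym e))
         tail∈ (there r) = r
       ...     | zs , t″ , r , ≡.refl , t″∈ , al = record
         { t∈ = t∈ ; t′∈ = t″∈ ; t≢t′ = λ e → Unique-∉ u (∈-++⁺ʳ zs (here e))
         ; walk = proj₁ (W-split (t ∷ zs) q ≡.refl)
         ; uniq = proj₁ (Unique-++⁻ zs (AllPairs.tail u))
         ; inRg = λ x∈ → rg (s (there (∈-++⁺ˡ x∈)))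
         ; off = λ x∈ → All.lookup al x∈
         ; short = ≤-trans (++-length-≤ˡ zs) (≤-trans (n≤1+n _) (≤-trans le′ le)) }

       zipAll : ∀ {P : V → Set} {ts} → All P ts → List (Σ V P)
       zipAll [] = []
       zipAll (p ∷ ps) = (_ , p) ∷ zipAll ps

       map-zipAll : ∀ {P : V → Set} {ts} (ps : All P ts) → map proj₁ (zipAll ps) ≡ ts
       map-zipAll [] = ≡.refl
       map-zipAll (p ∷ ps) = cong (_ ∷_) (map-zipAll ps)

       module _ (s : ℕ) where

         -- An independent set of s vertices near the terminal, as soon as the tight walk has 2s
         -- vertices.
         block : ∀ {ts} → Σ V (Tight ts) → List V
         block (_ , w) = evens (take (s + s) (π w))

         block-walk : ∀ {ts} ((t , w) : Σ V (Tight ts)) {u} → u ∈ block (t , w) →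
           ∃ λ l → W t l u × (∀ {x} → x ∈ l → Rg x) × length l ≤ s + s
         block-walk (t , w) {u} u∈ =
           let as , bs , eq = ∈-∃++ (evens-⊆ (take (s + s) (π w)) u∈)
               πeq : π w ≡ as ++ u ∷ (bs ++ drop (s + s) (π w))
               πeq = ≡.trans (≡.sym (take++drop≡id (s + s) (π w)))
                       (≡.trans (cong (_++ drop (s + s) (π w)) eq) (++-assoc as (u ∷ bs) _))
               eq′ : (as ++ u ∷ []) ++ bs ≡ take (s + s) (π w)
               eq′ = ≡.trans (++-assoc as (u ∷ []) bs) (≡.sym eq)
           in as ++ u ∷ [] , proj₁ (W-split as (walk w) πeq)
              , (λ x∈ → inRg w (subst (_ ∈_) (take++drop≡id (s + s) (π w)) (∈-++⁺ˡ (subst (_ ∈_) eq′ (∈-++⁺ˡ x∈)))))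
              , ≤-trans (++-length-≤ˡ (as ++ u ∷ [])) (≤-trans (≤-reflexive (cong length eq′))
                  (≤-trans (≤-reflexive (length-take (s + s) (π w))) (m⊓n≤m (s + s) _)))

         Meet : ∀ {ts} → Σ V (Tight ts) → Σ V (Tight ts) → Set
         Meet b b′ = Any (λ u → Any (Cl u) (block b′)) (block b)

         Meet? : ∀ {ts} (b b′ : Σ V (Tight ts)) → Dec (Meet b b′)
         Meet? b b′ = Any.any? (λ u → Any.any? (Cl? u) (block b′)) (block b)

         block-length : ∀ {ts} (bs : List (Σ V (Tight ts))) → All (λ (_ , w) → s + s ≤ length (π w)) bs →
           length (concatMap block bs) ≡ length bs * s
         block-length [] [] = ≡.refl
         block-length ((t , w) ∷ bs) (p ∷ ps) = ≡.trans (length-++ (block (t , w)))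
           (≡.cong₂ _+_ (evens-take s (π w) p) (block-length bs ps))

         -- If all tight walks were long and no two blocks touched, the union of the blocks would be
         -- independent and larger than a. So some tight walk is short, or two blocks touch and the
         -- walks from their terminals to the point of contact join up.
         linkShort : ∀ {ts} (tws : All (Tight ts) ts) → Unique ts → a < length ts * s → Link ts ((s + s) + (s + s))
         linkShort {ts} tws u lt with Any.any? (λ (_ , w) → length (π w) ≤? (s + s)) (zipAll tws)
         ... | yes p = let (t , w) , _ , le = find p in
               link _ (t∈ w) (t′∈ w) (t≢t′ w) (walk w) (inRg w) (≤-trans le (m≤m+n _ _))
         ... | no ¬p with search Meet? (zipAll tws)
         ...   | inj₁ ap = ⊥-elim (<⇒≱ lt (≤-trans (≤-reflexive (≡.sym len)) (ind (concat (map block (zipAll tws))) indp)))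
           where
           len : length (concatMap block (zipAll tws)) ≡ length ts * s
           len = ≡.trans (block-length (zipAll tws) (All.map (λ q → <⇒≤ (≰⇒> q)) (All.¬Any⇒All¬ _ ¬p)))
             (cong (_* s) (≡.trans (≡.sym (length-map proj₁ (zipAll tws))) (cong length (map-zipAll tws))))
           indp : Indep (concat (map block (zipAll tws)))
           indp = AllPairs.concat⁺
             (All.map⁺ (All.tabulate λ {(_ , w)} _ → let r , e = evens-take-⊑ s (π w) in
                ++⁻ (block (_ , w)) (subst Indep e (indep w))))
             (AllPairs.map⁺ (AllPairs.map (λ q → All.map (All.¬Any⇒All¬ _) (All.¬Any⇒All¬ _ q)) ap))
             where
             ++⁻ : ∀ xs {ys} → Indep (xs ++ ys) → Indep xs
             ++⁻ [] _ = []
             ++⁻ (x ∷ xs) (p ∷ q) = All.++⁻ˡ xs p ∷ ++⁻ xs q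
         ...   | inj₂ (as , (t , w) , bs , (t′ , w′) , cs , eq , m) =
           let v , v∈ , m′ = find m
               v′ , v′∈ , c = find m′
               l , p , rg , le = block-walk (t , w) v∈
               l′ , p′ , rg′ , le′ = block-walk (t′ , w′) v′∈
               t≢ : t ≢ t′
               t≢ = AllPairs-at as (subst (AllPairs (λ b b′ → proj₁ b ≢ proj₁ b′)) eq
                      (AllPairs.map⁻ (subst Unique (≡.sym (map-zipAll tws)) u)))
               rev-rg : ∀ {x} → x ∈ reverse l′ → Rg x
               rev-rg x∈ = rg′ (∈-resp-↭ (Perm.↭-reverse l′) x∈)
               rle : length (reverse l′) ≤ s + s
               rle = ≤-trans (≤-reflexive (length-reverse l′)) le′
           in go t≢ (t∈ w) (t∈ w′) p (W-rev p′) rg rev-rg le rle c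
           where
           go : ∀ {t t′ v v′ l r} → t ≢ t′ → t ∈ ts → t′ ∈ ts → W t l v → W v′ r t′ → (∀ {x} → x ∈ l → Rg x) →
                (∀ {x} → x ∈ r → Rg x) → length l ≤ s + s → length r ≤ s + s → Cl v v′ → Link ts ((s + s) + (s + s))
           go {l = l} {r} t≢ t∈ t′∈ p q rg rg′ le le′ (inj₂ e) = link _ t∈ t′∈ t≢ (W-++ p e q)
             (λ x∈ → Data.Sum.Base.[ rg , rg′ ]′ (∈-++⁻ l x∈))
             (≤-trans (≤-reflexive (length-++ l)) (+-mono-≤ le le′))
             where import Data.Sum.Base
           go {l = l} t≢ t∈ t′∈ p q rg rg′ le le′ (inj₁ ≡.refl) with W-head q
           ... | r′ , ≡.refl = link _ t∈ t′∈ t≢ (W-glue p q)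
             (λ x∈ → Data.Sum.Base.[ rg , rg′ ∘ there ]′ (∈-++⁻ l x∈))
             (≤-trans (≤-reflexive (length-++ l)) (+-mono-≤ le (≤-trans (n≤1+n _) le′)))
             where import Data.Sum.Base

       tights : ∀ {t₁ t₂ ts} → Unique (t₁ ∷ t₂ ∷ ts) → (∀ {t} → t ∈ t₁ ∷ t₂ ∷ ts → Rg t) →
         All (Tight (t₁ ∷ t₂ ∷ ts)) (t₁ ∷ t₂ ∷ ts)
       tights {t₁} {t₂} {ts} u rg = All.tabulate λ {t} t∈ → mk t∈
         where
         mk′ : ∀ {t o} → t ∈ t₁ ∷ t₂ ∷ ts → o ∈ t₁ ∷ t₂ ∷ ts → t ≢ o → Tight (t₁ ∷ t₂ ∷ ts) t
         mk′ t∈ o∈ t≢o =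
           let xs , p , r = rc _ _ (rg t∈) (rg o∈)
               ys , q , s , _ , _ , i = tighten (length xs) ≤-refl p
           in record { t∈ = t∈ ; t′∈ = o∈ ; t≢t′ = t≢o ; walk = q ; inRg = r ∘ s ; indep = i }
         mk : ∀ {t} → t ∈ t₁ ∷ t₂ ∷ ts → Tight (t₁ ∷ t₂ ∷ ts) t
         mk {t} t∈ with t ≟ t₁
         ... | no t≢ = mk′ t∈ (here ≡.refl) t≢
         ... | yes ≡.refl = mk′ t∈ (there (here ≡.refl)) λ e → Unique-∉ u (here e)

       join : ∀ ts → Unique ts → (∀ {t} → t ∈ ts → Rg t) → 2 ≤ length ts → Link ts (cost a (length ts))
       join (t₁ ∷ []) _ _ (s≤s ())
       join (t₁ ∷ t₂ ∷ ts) u rg _ = subst (Link _) eq (linkShort s (tights u rg) u lt)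
         where
         m = length (t₁ ∷ t₂ ∷ ts)
         s = suc (a / m)
         eq : (s + s) + (s + s) ≡ 4 * s
         eq = ≡.trans (+-assoc s s (s + s)) (cong (λ z → s + (s + (s + z))) (≡.sym (+-identityʳ s)))
         lt : a < m * s
         lt = ≤-trans (s≤s (≤-reflexive (m≡m%n+[m/n]*n a m))) (≤-trans (+-monoˡ-≤ (a / m * m) (m%n<n a m))
           (≤-reflexive (≡.trans (cong (m +_) (*-comm (a / m) m)) (≡.sym (*-suc m (a / m))))))

-- Extending and shortening a path when the independence number is at most a.

module Extension where

 open import Data.Empty using (⊥-elim)
 open import Data.List.Base hiding (find; lookup)
 open import Data.List.Properties
 open import Data.List.Membership.Propositional using (_∈_; _∉_; find)
 open import Data.List.Membership.Propositional.Properties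
 open import Data.List.Relation.Unary.All as All using (All; []; _∷_)
 import Data.List.Relation.Unary.All.Properties as All
 open import Data.List.Relation.Unary.Any as Any using (Any; here; there)
 open import Data.List.Relation.Unary.AllPairs as AllPairs using (AllPairs; []; _∷_)
 import Data.List.Relation.Unary.AllPairs.Properties as AllPairs
 open import Data.List.Relation.Unary.Unique.Propositional using (Unique)
 import Data.List.Relation.Unary.Unique.Propositional.Properties as Unique
 open import Data.List.Relation.Binary.Permutation.Propositional
 open import Data.List.Relation.Binary.Permutation.Propositional.Properties as Perm using (shift; ∈-resp-↭)
 import Data.List.Relation.Binary.Permutation.Setoid.Properties as PermS
 open import Data.Nat.Base
 open import Data.Nat.Properties
 open import Data.Product.Base using (Σ; ∃; ∃₂; _×_; _,_; proj₁; proj₂)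
 open import Data.Sum.Base using (_⊎_; inj₁; inj₂)
 open import Function.Base using (_∘_; id)
 open import Relation.Binary.Definitions using (DecidableEquality)
 open import Relation.Binary.PropositionalEquality as ≡ using (_≡_; _≢_; cong; subst)
 open import Relation.Nullary
 open import Relation.Unary using (Decidable)

 open Lists
 open WalkJoining
 open import Relation.Nullary.Decidable using (_×-dec_)

 module Extend {V : Set} (_≟_ : DecidableEquality V) (E : V → V → Set) (E? : ∀ x y → Dec (E x y))
               (E-sym : ∀ {x y} → E x y → E y x)
               (a : ℕ) (ind : ∀ zs → Walks.Indep _≟_ E E? E-sym zs → length zs ≤ a) where
   open Walks _≟_ E E? E-sym
   open import Data.List.Membership.DecPropositional _≟_ using (_∈?_; _∉?_)

   module _ (Ok : V → Set) where

     -- The walks to different vertices may overlap; when two of them are combined into a detour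
     -- through `w`, tightening makes it a path.
     Reach : List V → V → V → Set
     Reach q w x = ∃₂ λ ys y → W w ys y × E y x × (∀ {z} → z ∈ ys → z ∉ q × Ok z)

     -- At most one of the a + 2 vertices is the end of the path. The other a + 1 have successors,
     -- and two of these are adjacent.
     Marks : List V → V → Set
     Marks q w = ∃ λ xs → Unique xs × suc (suc a) ≤ length xs × (∀ {x} → x ∈ xs → x ∈ q × Reach q w x)

     Longer : V → List V → V → Set
     Longer v q p = ∃₂ λ h hs → ∃ λ q′ → W v q′ p × q′ ↭ (h ∷ hs) ++ q × Unique (h ∷ hs) × (∀ {z} → z ∈ h ∷ hs → z ∉ q × Ok z)

     record Cut (q : List V) (x : V) : Set where
       constructor cut
       field
         {l r} : List V
         {s} : V
         eq : q ≡ (l ++ x ∷ []) ++ s ∷ r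

     module _ {v p : V} {q : List V} (path : W v q p) (uq : Unique q) {w : V} where

       -- Successors s, s′ of two marked vertices x, x′ are adjacent:
       -- reverse the part between them and go from x to x′ outside the path.
       reroute : ∀ {x x′ l s r s′ r′} → q ≡ (l ++ x ∷ []) ++ s ∷ r → ∀ m′ → s ∷ r ≡ (m′ ++ x′ ∷ []) ++ s′ ∷ r′ → E s s′ →
         Reach q w x → Reach q w x′ → Longer v q p
       reroute {x} {x′} {l} {s} {r} {s′} {r′} eq m′ eq′ ss′ (ys , y , wy , yx , out) (ys′ , y′ , wy′ , y′x′ , out′)
         with W-head wy′
       ... | zs , ≡.refl with tighten _ ≤-refl (W-glue (W-rev wy) wy′)
       ...   | hs , hw , sub , _ , uh , _ with W-head hw
       ...     | hs′ , ≡.refl =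
         let c₁ , xs , c₂ = W-cut l path (≡.trans eq (++-assoc l (x ∷ []) (s ∷ r)))
             c₃ , _ , c₄ = W-cut m′ c₂ (≡.trans eq′ (++-assoc m′ (x′ ∷ []) (s′ ∷ r′)))
             M = m′ ++ x′ ∷ []
             L = l ++ x ∷ []
             new = W-++ c₁ (E-sym yx) (W-++ hw y′x′ (W-++ (W-rev c₃) ss′ c₄))
             perm : L ++ hs ++ reverse M ++ s′ ∷ r′ ↭ hs ++ q
             perm = trans (Perm.shifts L hs) (Perm.++⁺ˡ hs (trans (Perm.++⁺ˡ L (Perm.++⁺ʳ (s′ ∷ r′) (Perm.↭-reverse M)))
                      (↭-reflexive (≡.trans (cong (L ++_) (≡.sym eq′)) (≡.sym eq)))))
         in y , hs′ , _ , new , perm , uh , outs ∘ sub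
         where
         outs : ∀ {z} → z ∈ reverse ys ++ zs → z ∉ q × Ok z
         outs z∈ with ∈-++⁻ (reverse ys) z∈
         ... | inj₁ r = out (∈-resp-↭ (Perm.↭-reverse ys) r)
         ... | inj₂ r = out′ (there r)

       -- Here `m` is the stretch from the first cut to the second. If it were empty, x and x′ would
       -- coincide, and equal successors would contradict that `q` has no repetition.
       reroute′ : ∀ {x x′ l s r l′ s′ r′} → x ≢ x′ → q ≡ (l ++ x ∷ []) ++ s ∷ r → ∀ m →
         l′ ++ x′ ∷ [] ≡ (l ++ x ∷ []) ++ m → s ∷ r ≡ m ++ s′ ∷ r′ → Cl s s′ → Reach q w x → Reach q w x′ → Longer v q p
       reroute′ {x} {x′} {l} {l′ = l′} x≢x′ eq m e₁ e₂ c rx rx′ with initLast m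
       ... | [] = ⊥-elim (x≢x′ (≡.sym (∷ʳ-injectiveʳ l′ l (≡.trans e₁ (++-identityʳ _)))))
       ... | m′ ∷ʳ′ z with ∷ʳ-injectiveʳ l′ ((l ++ x ∷ []) ++ m′) (≡.trans e₁ (≡.sym (++-assoc (l ++ x ∷ []) m′ (z ∷ []))))
       ...   | ≡.refl with c
       ...     | inj₂ ss′ = reroute eq m′ e₂ ss′ rx rx′
       ...     | inj₁ ≡.refl = ⊥-elim (proj₂ (proj₂ (Unique-++⁻ (m′ ++ z ∷ []) (subst Unique e₂ (proj₁ (proj₂ (Unique-++⁻ (l ++ x ∷ []) (subst Unique eq uq)))))))
                  (s∈ m′ e₂) (here ≡.refl))
         where
         s∈ : ∀ {s r t} m′ → s ∷ r ≡ (m′ ++ z ∷ []) ++ t → s ∈ m′ ++ z ∷ []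
         s∈ [] e = here (∷-injectiveˡ e)
         s∈ (_ ∷ _) e = here (∷-injectiveˡ e)

       Cl-sym : ∀ {x y} → Cl x y → Cl y x
       Cl-sym (inj₁ e) = inj₁ (≡.sym e)
       Cl-sym (inj₂ e) = inj₂ (E-sym e)

       cutOf : ∀ {x} → x ∈ q → x ≢ p → Cut q x
       cutOf x∈ x≢p with ∈-∃++ x∈
       ... | l , [] , eq with stop _ ← proj₂ (W-split l path eq) = ⊥-elim (x≢p ≡.refl)
       ... | l , s ∷ r , eq = cut (≡.trans eq (≡.sym (++-assoc l (_ ∷ []) (s ∷ r))))

       extend : Marks q w → Longer v q p
       extend (xs , ux , le , mk) with fresh _≟_ (p ∷ []) (suc a) ux (≤-trans (≤-reflexive (+-comm (suc a) 1)) le)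
       ... | cs , uc , lc , sub , np = conclude
         where
         C : V → Set
         C x = Cut q x × Reach q w x
         cuts : ∀ cs → (∀ {x} → x ∈ cs → x ∈ xs × x ≢ p) → All C cs
         cuts [] h = []
         cuts (c ∷ cs) h = let c∈ , c≢ = h (here ≡.refl) in (cutOf (proj₁ (mk c∈)) c≢ , proj₂ (mk c∈)) ∷ cuts cs (h ∘ there)
         allC : All C cs
         allC = cuts cs λ x∈ → sub x∈ , λ { ≡.refl → np x∈ (here ≡.refl) }
         zipC : ∀ {cs} → All C cs → List (Σ V C)
         zipC [] = []
         zipC (p ∷ ps) = (_ , p) ∷ zipC ps
         map-zipC : ∀ {cs} (ps : All C cs) → map proj₁ (zipC ps) ≡ cs
         map-zipC [] = ≡.refl
         map-zipC (p ∷ ps) = cong (_ ∷_) (map-zipC ps)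
         succ : Σ V C → V
         succ (_ , c , _) = Cut.s c
         conclude : Longer v q p
         conclude with search (λ c c′ → Cl? (succ c) (succ c′)) (zipC allC)
         ... | inj₁ ap = ⊥-elim (<⇒≱ (≤-reflexive (≡.sym lc)) (≤-trans (≤-reflexive (≡.sym len)) (ind _ (AllPairs.map⁺ {f = succ} ap))))
           where
           len : length (map succ (zipC allC)) ≡ length cs
           len = ≡.trans (length-map succ (zipC allC)) (≡.trans (≡.sym (length-map proj₁ (zipC allC))) (cong length (map-zipC allC)))
         ... | inj₂ (as , (x , cut {l} {r} {s} e , rx) , bs , (x′ , cut {l′} {r′} {s′} e′ , rx′) , ds , eq , c)
           with x≢ ← AllPairs-at as (subst (AllPairs (λ b b′ → proj₁ b ≢ proj₁ b′)) eq
                      (AllPairs.map⁻ (subst Unique (≡.sym (map-zipC allC)) uc)))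
           with ++-compare (l ++ x ∷ []) (l′ ++ x′ ∷ []) (≡.trans (≡.sym e) e′)
         ...   | inj₁ (m , e₁ , e₂) = reroute′ {l = l} {l′ = l′} x≢ e m e₁ e₂ c rx rx′
         ...   | inj₂ (m , e₁ , e₂) = reroute′ {l = l′} {l′ = l} (x≢ ∘ ≡.sym) e′ m e₁ e₂ (Cl-sym c) rx′ rx

       module _ (A : V → Set) (A⇒Ok : ∀ {x} → A x → Ok x)
                (conn : ∀ Z → length Z ≤ suc a → ∀ u w → A u → A w → u ∉ Z → w ∉ Z →
                        ∃ λ xs → W u xs w × (∀ {x} → x ∈ xs → A x × x ∉ Z)) where

         -- The marks are found one at a time: those already found are deleted, and a walk to
         -- another vertex of `qA` is stopped where it first meets the path. Only the marks have to
         -- be distinct, so connectivity after deleting at most a + 1 vertices takes the place of a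
         -- fan of disjoint paths.
         marks : ∀ {qA} → Unique qA → suc (suc a) ≤ length qA → (∀ {x} → x ∈ qA → x ∈ q × A x) →
                 w ∉ q → A w → Marks q w
         marks {qA} uA le inA w∉ Aw = let xs , u , e , m = go (suc (suc a)) ≤-refl in xs , u , ≤-reflexive (≡.sym e) , m
           where
           go : ∀ j → j ≤ suc (suc a) → ∃ λ xs → Unique xs × length xs ≡ j × (∀ {x} → x ∈ xs → x ∈ q × Reach q w x)
           go zero _ = [] , [] , ≡.refl , λ ()
           go (suc j) (s≤s j≤) with go j (m≤n⇒m≤1+n j≤)
           ... | xs , u , ≡.refl , m with ∃∉ _≟_ uA (≤-trans (s≤s j≤) le)
           ...   | y , y∈ , y∉ with conn xs j≤ w y Aw (proj₂ (inA y∈)) (λ w∈ → w∉ (proj₁ (m w∈))) y∉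
           ...     | zs , p , out with split-first (_∈? q) (Any.map (λ { ≡.refl → proj₁ (inA y∈) }) (W-last∈ p))
           ...       | ys , x , _ , ≡.refl , x∈q , al with initLast ys
           ...         | [] = ⊥-elim (w∉ (subst (_∈ q) (∷-injectiveˡ (proj₂ (W-head p))) x∈q))
           ...         | ys′ ∷ʳ′ z = x ∷ xs , Unique-∷ (proj₂ (out (∈-++⁺ʳ ys (here ≡.refl)))) u , ≡.refl ,
                           λ { (here ≡.refl) → x∈q , ys , z , proj₁ c , proj₁ (proj₂ c) ,
                                 λ z∈ → All.lookup al z∈ , A⇒Ok (proj₁ (out (∈-++⁺ˡ z∈)))
                             ; (there x∈) → m x∈ }
             where
             ys″ = ys′ ++ z ∷ []
             c = W-cut ys′ p (++-assoc ys′ (z ∷ []) (x ∷ _))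

     -- The vertex that `prog` marks from may differ from the missing one it is told about. This
     -- allows piece vertices to be absorbed before all others. The inclusion of `q` is kept because
     -- the initial path is what meets every piece often.
     saturate : Decidable Ok → ∀ vs → (∀ x → x ∈ vs) → ∀ {v p q} → W v q p → Unique q → (∀ {x} → x ∈ q → Ok x) →
       (∀ q′ → W v q′ p → Unique q′ → q ⊆ q′ → (∃ λ w → w ∉ q′ × Ok w) → ∃ λ w → w ∉ q′ × Marks q′ w) →
       ∃ λ q′ → W v q′ p × Unique q′ × (∀ {x} → x ∈ q′ → Ok x) × (∀ {x} → Ok x → x ∈ q′)
     saturate Ok? vs all {v} {p} {q} path uq ok prog = go (suc (length vs)) q path uq ok id (m≤n+m _ _)
       where
       go : ∀ k q′ → W v q′ p → Unique q′ → (∀ {x} → x ∈ q′ → Ok x) → q ⊆ q′ → suc (length vs) ≤ length q′ + k →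
         ∃ λ q″ → W v q″ p × Unique q″ × (∀ {x} → x ∈ q″ → Ok x) × (∀ {x} → Ok x → x ∈ q″)
       go zero q′ _ u _ _ le = ⊥-elim (<⇒≱ (≤-trans le (≤-reflexive (+-identityʳ _))) (length-⊆ u (λ _ → all _)))
       go (suc k) q′ pa u ok′ sub le with Any.any? (λ w → (w ∉? q′) ×-dec Ok? w) vs
       ... | no none = q′ , pa , u , ok′ , λ {x} okx → decidable-stable (x ∈? q′) λ x∉ →
               All.lookup (All.¬Any⇒All¬ vs none) (all x) (x∉ , okx)
       ... | yes some with w , _ , w∉ , okw ← find some with w′ , w′∉ , mk ← prog q′ pa u sub (w , w∉ , okw)
         with h , hs , q″ , pa″ , perm , uh , out ← extend pa u mk =
           go k q″ pa″ (Unique-↭ (↭-sym perm) (Unique-++ uh u (λ z∈ → proj₁ (out z∈))))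
             (λ x∈ → ok″ (∈-++⁻ (h ∷ hs) (∈-resp-↭ perm x∈)))
             (λ x∈ → ∈-resp-↭ (↭-sym perm) (∈-++⁺ʳ (h ∷ hs) (sub x∈)))
             (≤-trans le (≤-trans (≤-reflexive (+-suc (length q′) k)) (+-monoˡ-≤ k len)))
         where
         ok″ : ∀ {x} → x ∈ h ∷ hs ⊎ x ∈ q′ → Ok x
         ok″ (inj₁ x∈) = proj₂ (out x∈)
         ok″ (inj₂ x∈) = ok′ x∈
         len : suc (length q′) ≤ length q″
         len = ≤-trans (s≤s (≤-trans (m≤n+m _ (length hs)) (≤-reflexive (≡.sym (length-++ hs))))) (≤-reflexive (≡.sym (Perm.↭-length perm)))

   -- The a + 1 vertices at even places among the first 2a + 2 contain an adjacent pair, and this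
   -- chord skips at least one and at most 2a vertices.
   chord : ∀ {v q p} → W v q p → Unique q → suc a + suc a ≤ length q →
     ∃ λ q′ → W v q′ p × Unique q′ × q′ ⊆ q × length q′ < length q × length q ≤ length q′ + (a + a)
   chord {v} {q} {p} path u le with clash a ind (evens (take (suc a + suc a) q)) (≤-reflexive (≡.sym (evens-take (suc a) q le)))
   ... | as , x , bs , y , cs , eq , c with evens-split (take (suc a + suc a) q) {as} eq
   ...   | as′ , z , bs′ , cs′ , eq′ with c
   ...     | inj₁ ≡.refl = ⊥-elim (AllPairs-at as′ {bs = z ∷ bs′} (subst Unique eq′ (Unique.take⁺ (suc a + suc a) u)) ≡.refl)
   ...     | inj₂ e = as′ ++ x ∷ y ∷ D , shortenE as′ {m = z ∷ bs′} path qeq e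
                    , subst Unique (++-assoc as′ (x ∷ []) (y ∷ D)) (Unique-drop-mid (as′ ++ x ∷ []) (z ∷ bs′) (subst Unique (≡.trans qeq (≡.sym (++-assoc as′ (x ∷ []) _))) u))
                    , (λ x∈ → subst (_ ∈_) (≡.sym qeq) (mid-⊆ as′ (z ∷ bs′) x∈))
                    , ≤-trans (s≤s (m≤n+m _ (length bs′))) (≤-reflexive (≡.sym len))
                    , ≤-trans (≤-reflexive (≡.trans len (+-comm (length (z ∷ bs′)) _))) (+-monoʳ-≤ _ short)
     where
     D = cs′ ++ drop (suc a + suc a) q
     qeq : q ≡ as′ ++ x ∷ (z ∷ bs′) ++ y ∷ D
     qeq = ≡.trans (≡.sym (take++drop≡id (suc a + suc a) q)) (≡.trans (cong (_++ drop (suc a + suc a) q) eq′)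
       (≡.trans (++-assoc as′ _ _) (cong (λ l → as′ ++ x ∷ z ∷ l) (++-assoc bs′ (y ∷ cs′) _))))
     len : length q ≡ length (z ∷ bs′) + length (as′ ++ x ∷ y ∷ D)
     len = ≡.trans (cong length qeq) (mid-length as′ (z ∷ bs′))
     short : suc (length bs′) ≤ a + a
     short = ≤-pred (≤-pred (begin
       3 + length bs′ ≤⟨ s≤s (s≤s (s≤s (≤-trans (m≤m+n _ (length cs′)) (≤-reflexive (≡.sym (length-++ bs′)))))) ⟩
       3 + length (bs′ ++ cs′) ≡⟨ cong (2 +_) (≡.sym (Perm.↭-length (shift y bs′ cs′))) ⟩
       2 + length (bs′ ++ y ∷ cs′) ≤⟨ m≤n+m _ (length as′) ⟩
       length as′ + length (x ∷ z ∷ bs′ ++ y ∷ cs′) ≡⟨ ≡.sym (length-++ as′) ⟩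
       length (as′ ++ x ∷ z ∷ bs′ ++ y ∷ cs′) ≡⟨ cong length (≡.sym eq′) ⟩
       length (take (suc a + suc a) q) ≤⟨ ≤-trans (≤-reflexive (length-take (suc a + suc a) q)) (m⊓n≤m (suc a + suc a) (length q)) ⟩
       suc a + suc a ≡⟨ cong suc (+-suc a a) ⟩
       2 + (a + a) ∎))
       where open ≤-Reasoning

   Cycle : ℕ → Set
   Cycle ℓ = ∃ λ u → ∃ λ xs → ∃ λ w → W u xs w × E w u × Unique xs × length xs ≡ ℓ

   -- The fan: every vertex of the path p ∷ Y is adjacent to v, so a v–p path avoiding Y
   -- closes to a cycle through any initial segment of Y.
   module Fan {v p z : V} {Y : List V} (fan : W p (p ∷ Y) z) (spokes : ∀ {x} → x ∈ p ∷ Y → E x v) (uY : Unique Y) where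

     closeUp : ∀ {q} → W v q p → Unique q → (∀ {x} → x ∈ q → x ∉ Y) → ∀ j → j ≤ length Y → Cycle (length q + j)
     closeUp {q} path u off j j≤ = let z′ , f , m = W-take j fan in
       v , q ++ take j Y , z′ , W-glue path f , spokes m
       , Unique-++ u (Unique.take⁺ j uY) (λ x∈ y∈ → off x∈ (subst (_ ∈_) (take++drop≡id j Y) (∈-++⁺ˡ y∈)))
       , ≡.trans (length-++ q) (cong (length q +_) (≡.trans (length-take j Y) (m≤n⇒m⊓n≡m j≤)))

     -- One path yields all lengths from |q| to |q| + |Y|. A chord shortens q by at most 2a, hence
     -- by at most |Y|, so the intervals of successive paths leave no gap.
     allLengths : a + a ≤ length Y → v ≢ p → v ∉ Y → p ∉ Y → ∀ k {q} → length q ≤ k → W v q p → Unique q → (∀ {x} → x ∈ q → x ∉ Y) →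
       ∀ ℓ → 2 ≤ ℓ → ℓ ≤ length q + length Y → Cycle ℓ
     allLengths big v≢p v∉ p∉ k {q} q≤ path u off ℓ 2≤ ℓ≤ with length q ≤? ℓ
     ... | yes le = subst Cycle (m+[n∸m]≡n le) (closeUp path u off (ℓ ∸ length q) (≤-trans (∸-monoˡ-≤ (length q) ℓ≤) (≤-reflexive (m+n∸m≡n (length q) _))))
     ... | no gt with suc a + suc a ≤? length q
     -- Here q has at most 2a + 1 vertices and ℓ < |q|, so ℓ ≤ 2a. The edge from v to p, closed
     -- through ℓ - 2 fan vertices, already gives the cycle.
     ...   | no small = subst Cycle (m+[n∸m]≡n 2≤) (closeUp (step (E-sym (spokes (here ≡.refl))) (stop p))
               (((v≢p ∷ [])) ∷ [] ∷ []) (λ { (here ≡.refl) → v∉ ; (there (here ≡.refl)) → p∉ }) (ℓ ∸ 2)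
               (≤-trans (m∸n≤m ℓ 2) (≤-trans (≤-pred (≤-pred (≤-trans (s≤s (≰⇒> gt)) (≤-trans (≰⇒> small) (≤-reflexive (cong suc (+-suc a a))))))) big)))
     ...   | yes long with chord path u long
     allLengths big v≢p v∉ p∉ zero {[]} q≤ () u off ℓ 2≤ ℓ≤ | no gt | yes long | _
     allLengths big v≢p v∉ p∉ (suc k) {q} q≤ path u off ℓ 2≤ ℓ≤ | no gt | yes long | q′ , pa , u′ , sub , lt , le =
       allLengths big v≢p v∉ p∉ k (≤-pred (≤-trans lt q≤)) pa u′ (off ∘ sub) ℓ 2≤
         (≤-trans (<⇒≤ (≰⇒> gt)) (≤-trans le (+-monoʳ-≤ (length q′) big)))

-- Systems of disjoint paths and their mergers inside a piece.

module PathSystems where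

 open import Data.Empty using (⊥-elim)
 open import Data.List.Base hiding (find; lookup)
 open import Data.List.Properties
 open import Data.List.Membership.Propositional using (_∈_; _∉_; find)
 open import Data.List.Membership.Propositional.Properties
 open import Data.List.Relation.Unary.All as All using (All; []; _∷_)
 import Data.List.Relation.Unary.All.Properties as All
 open import Data.List.Relation.Unary.Any as Any using (here; there)
 open import Data.List.Relation.Unary.AllPairs as AllPairs using (AllPairs; []; _∷_)
 import Data.List.Relation.Unary.AllPairs.Properties as AllPairs
 open import Data.List.Relation.Unary.Unique.Propositional using (Unique)
 import Data.List.Relation.Unary.Unique.Propositional.Properties as Unique
 open import Data.List.Relation.Binary.Permutation.Propositional
 open import Data.List.Relation.Binary.Permutation.Propositional.Properties as Perm using (shift; ∈-resp-↭)
 import Data.List.Relation.Binary.Permutation.Setoid.Properties as PermS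
 open import Data.Nat.Base
 open import Data.Nat.Properties
 open import Data.Product.Base using (∃; _×_; _,_; proj₁; proj₂)
 open import Data.Sum.Base using (_⊎_; inj₁; inj₂)
 open import Function.Base using (_∘_; id)
 open import Relation.Binary.Definitions using (DecidableEquality)
 open import Relation.Binary.PropositionalEquality as ≡ using (_≡_; _≢_; cong; subst)
 open import Relation.Nullary
 open import Relation.Unary using (Decidable)

 open Lists
 open WalkJoining
 open import Data.Bool.Base using (Bool; true; false; not)

 odd : ℕ → Bool
 odd zero = false
 odd (suc n) = not (odd n)

 not-not : ∀ b → not (not b) ≡ b
 not-not true = ≡.refl
 not-not false = ≡.refl

 odd-+2 : ∀ j n → odd (j + j + n) ≡ odd n
 odd-+2 zero n = ≡.refl
 odd-+2 (suc j) n rewrite +-suc j j = ≡.trans (not-not _) (odd-+2 j n)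

 -- The price of linking m paths one after another; since a link among i paths costs about 4 (a / i
 -- + 1), this is O(m + a log m).
 costs : ℕ → ℕ → ℕ
 costs a zero = 0
 costs a (suc m) = cost a (suc m) + costs a m

 costs-mono : ∀ a {m n} → m ≤ n → costs a m ≤ costs a n
 costs-mono a {n = zero} z≤n = z≤n
 costs-mono a {m} {suc n} le with m≤n⇒m<n∨m≡n le
 ... | inj₂ ≡.refl = ≤-refl
 ... | inj₁ (s≤s le′) = ≤-trans (costs-mono a le′) (m≤n+m _ (cost a (suc n)))

 module System {V : Set} (_≟_ : DecidableEquality V) (E : V → V → Set) (E? : ∀ x y → Dec (E x y))
               (E-sym : ∀ {x y} → E x y → E y x)
               (a : ℕ) (ind : ∀ zs → Walks.Indep _≟_ E E? E-sym zs → length zs ≤ a) (col : V → ℕ) where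
   open Walks _≟_ E E? E-sym
   open import Data.List.Membership.DecPropositional _≟_ using (_∉?_)

   record Path : Set where
     constructor path
     field
       {h l} : V
       {vs} : List V
       walk : W h vs l
   open Path public

   verts : List Path → List V
   verts = concatMap vs

   -- A one-vertex path contributes its vertex twice, so that every path with both ends in a colour
   -- counts two there.
   ends : List Path → List V
   ends = concatMap (λ P → h P ∷ l P ∷ [])

   flip : Path → Path
   flip P = path (W-rev (walk P))

   cnt : ℕ → List V → ℕ
   cnt c xs = length (filter (λ x → col x ≟ℕ c) xs)

   module _ (c : ℕ) where
     cnt-++ : ∀ xs {ys} → cnt c (xs ++ ys) ≡ cnt c xs + cnt c ys
     cnt-++ xs {ys} = ≡.trans (cong length (filter-++ (λ x → col x ≟ℕ c) xs ys)) (length-++ (filter (λ x → col x ≟ℕ c) xs))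

     cnt-↭ : ∀ {xs ys} → xs ↭ ys → cnt c xs ≡ cnt c ys
     cnt-↭ p = Perm.↭-length (Perm.filter-↭ (λ x → col x ≟ℕ c) p)

     cnt-yes : ∀ {x} xs → col x ≡ c → cnt c (x ∷ xs) ≡ suc (cnt c xs)
     cnt-yes xs e = cong length (filter-accept (λ x → col x ≟ℕ c) e)

     cnt-no : ∀ {x} xs → col x ≢ c → cnt c (x ∷ xs) ≡ cnt c xs
     cnt-no xs e = cong length (filter-reject (λ x → col x ≟ℕ c) e)

     cnt-≤ : ∀ xs → cnt c xs ≤ length xs
     cnt-≤ xs = length-filter (λ x → col x ≟ℕ c) xs

     cnt-all : ∀ xs → (∀ {x} → x ∈ xs → col x ≡ c) → cnt c xs ≡ length xs
     cnt-all [] _ = ≡.refl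
     cnt-all (x ∷ xs) f = ≡.trans (cnt-yes xs (f (here ≡.refl))) (cong suc (cnt-all xs (f ∘ there)))

     cnt-none : ∀ xs → (∀ {x} → x ∈ xs → col x ≢ c) → cnt c xs ≡ 0
     cnt-none [] _ = ≡.refl
     cnt-none (x ∷ xs) f = ≡.trans (cnt-no xs (f (here ≡.refl))) (cnt-none xs (f ∘ there))

   Fresh : List V → List V → Set
   Fresh zs xs = Unique zs × (∀ {z} → z ∈ zs → z ∉ xs)

   Unique-fresh : ∀ {xs ys zs : List V} → ys ↭ zs ++ xs → Fresh zs xs → Unique xs → Unique ys
   Unique-fresh p (uz , d) u = Unique-↭ (↭-sym p) (Unique-++ uz u d)

   heads-⊆ : ∀ ps {t} → t ∈ map h ps → t ∈ verts ps
   heads-⊆ (P ∷ ps) (here ≡.refl) = ∈-++⁺ˡ (W-head∈ (walk P))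
   heads-⊆ (P ∷ ps) (there t∈) = ∈-++⁺ʳ (vs P) (heads-⊆ ps t∈)

   heads-unique : ∀ ps → Unique (verts ps) → Unique (map h ps)
   heads-unique [] _ = []
   heads-unique (P ∷ ps) u = let _ , u₂ , d = Unique-++⁻ (vs P) u in
     Unique-∷ (λ h∈ → d (W-head∈ (walk P)) (heads-⊆ ps h∈)) (heads-unique ps u₂)

   verts-++ : ∀ ps {qs} → verts (ps ++ qs) ≡ verts ps ++ verts qs
   verts-++ ps {qs} = concatMap-++ vs ps qs

   ends-++ : ∀ ps {qs} → ends (ps ++ qs) ≡ ends ps ++ ends qs
   ends-++ ps {qs} = concatMap-++ (λ P → h P ∷ l P ∷ []) ps qs

   tail∈ : ∀ {x y : V} {ys} → x ≢ y → x ∈ y ∷ ys → x ∈ ys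
   tail∈ ne (here e) = ⊥-elim (ne e)
   tail∈ ne (there p) = p

   -- Links are always made at heads: the two heads become inner vertices, and the two last vertices
   -- are the ends of the new path.
   splice : ∀ P P′ {zs} → W (h P) (h P ∷ zs ++ h P′ ∷ []) (h P′) →
     ∃ λ Q → h Q ≡ l P × l Q ≡ l P′ × vs Q ↭ zs ++ vs P ++ vs P′
   splice P P′ {zs} w with W-head (walk P′)
   ... | r , e = path {vs = (reverse (vs P) ++ zs ++ h P′ ∷ []) ++ r} (W-glue (W-glue (W-rev (walk P)) w) (subst (λ q → W _ q _) e (walk P′)))
     , ≡.refl , ≡.refl , perm
     where
     perm : (reverse (vs P) ++ zs ++ h P′ ∷ []) ++ r ↭ zs ++ vs P ++ vs P′
     perm = trans (↭-reflexive (≡.trans (++-assoc (reverse (vs P)) _ r) (cong (reverse (vs P) ++_) (≡.trans (++-assoc zs _ r) (cong (zs ++_) (≡.sym e))))))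
       (trans (Perm.shifts (reverse (vs P)) zs) (Perm.++⁺ˡ zs (Perm.++⁺ʳ (vs P′) (Perm.↭-reverse (vs P)))))

   module Piece (c t : ℕ)
       (conn : ∀ Z → length Z < t → ∀ u w → col u ≡ c → col w ≡ c → u ∉ Z → w ∉ Z →
               ∃ λ xs → W u xs w × (∀ {x} → x ∈ xs → col x ≡ c × x ∉ Z)) where

     record Bridge (ps : List Path) (ctx : List V) : Set where
       field
         {t₁ t₂} : V
         t₁∈ : t₁ ∈ map h ps
         t₂∈ : t₂ ∈ map h ps
         t₁≢t₂ : t₁ ≢ t₂
         {zs} : List V
         walk₁₂ : W t₁ (t₁ ∷ zs ++ t₂ ∷ []) t₂
         zsFresh : Fresh zs (verts ps ++ ctx)
         zsCol : ∀ {z} → z ∈ zs → col z ≡ c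
         zsShort : length zs ≤ cost a (length ps)

     -- All vertices of colour c in use are deleted, except the heads to be linked. These are fewer
     -- than t, so the rest of the piece is connected and `join` applies.
     bridge : ∀ ps ctx → Unique (verts ps ++ ctx) → (∀ {P} → P ∈ ps → col (h P) ≡ c) → 2 ≤ length ps →
       cnt c (verts ps ++ ctx) < t → Bridge ps ctx
     bridge ps ctx u hc 2≤ lt = record
       { t₁∈ = J.Link.t∈ lk ; t₂∈ = J.Link.t′∈ lk ; t₁≢t₂ = J.Link.t≢t′ lk ; walk₁₂ = J.Link.walk lk
       ; zsFresh = J.Link.uniq lk , λ z∈ z∈all → proj₂ (J.Link.inRg lk z∈)
           (∈-filter⁺ (_∉? ts) (∈-filter⁺ (λ x → col x ≟ℕ c) z∈all (proj₁ (J.Link.inRg lk z∈))) (J.Link.off lk z∈))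
       ; zsCol = λ z∈ → proj₁ (J.Link.inRg lk z∈)
       ; zsShort = subst (λ m → length (J.Link.zs lk) ≤ cost a m) (length-map h ps) (J.Link.short lk) }
       where
       ts = map h ps
       Z = filter (_∉? ts) (filter (λ x → col x ≟ℕ c) (verts ps ++ ctx))
       Rg : V → Set
       Rg z = col z ≡ c × z ∉ Z
       rc : ∀ u w → Rg u → Rg w → ∃ λ xs → W u xs w × (∀ {x} → x ∈ xs → Rg x)
       rc u w (cu , u∉) (cw , w∉) = conn Z (≤-<-trans (length-filter (_∉? ts) (filter (λ x → col x ≟ℕ c) (verts ps ++ ctx))) lt) u w cu cw u∉ w∉
       module J = Join a ind Rg rc
       tRg : ∀ {t} → t ∈ ts → Rg t
       tRg t∈ = (let P , P∈ , e = ∈-map⁻ h t∈ in ≡.trans (cong col e) (hc P∈)) , λ t∈Z → proj₂ (∈-filter⁻ (_∉? ts) {xs = filter (λ x → col x ≟ℕ c) (verts ps ++ ctx)} t∈Z) t∈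
       lk = J.join ts (heads-unique ps (proj₁ (Unique-++⁻ (verts ps) u))) tRg (subst (2 ≤_) (≡.sym (length-map h ps)) 2≤)

     flipBridge : ∀ {t₁ t₂ zs} → W t₁ (t₁ ∷ zs ++ t₂ ∷ []) t₂ → W t₂ (t₂ ∷ reverse zs ++ t₁ ∷ []) t₁
     flipBridge {t₁} {t₂} {zs} w = subst (λ q → W _ q _) (≡.trans (unfold-reverse t₁ (zs ++ t₂ ∷ [])) (cong (_++ t₁ ∷ []) (reverse-++ zs (t₂ ∷ [])))) (W-rev w)

     heads-≤ : ∀ ps ctx → Unique (verts ps ++ ctx) → (∀ {P} → P ∈ ps → col (h P) ≡ c) → length ps ≤ cnt c (verts ps ++ ctx)
     heads-≤ ps ctx u hc = ≤-trans (≤-reflexive (≡.sym (length-map h ps)))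
       (length-⊆ (heads-unique ps (proj₁ (Unique-++⁻ (verts ps) u)))
         λ t∈ → ∈-filter⁺ (λ x → col x ≟ℕ c) (∈-++⁺ˡ (heads-⊆ ps t∈)) (let P , P∈ , e = ∈-map⁻ h t∈ in ≡.trans (cong col e) (hc P∈)))

     fresh-↭ : ∀ {zs xs ys} → xs ↭ ys → Fresh zs xs → Fresh zs ys
     fresh-↭ p (u , d) = u , λ z∈ y∈ → d z∈ (∈-resp-↭ (↭-sym p) y∈)

     -- State change of a merge: the vertex list grows by the fresh vertices zs of colour c.
     module _ {vs vs′ zs ctx : List V} (p : vs′ ↭ zs ++ vs) (f : Fresh zs (vs ++ ctx)) (cz : ∀ {z} → z ∈ zs → col z ≡ c) where

       grown : vs′ ++ ctx ↭ zs ++ vs ++ ctx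
       grown = trans (Perm.++⁺ʳ ctx p) (↭-reflexive (++-assoc zs vs ctx))

       grown-unique : Unique (vs ++ ctx) → Unique (vs′ ++ ctx)
       grown-unique = Unique-fresh grown f

       grown-cnt : cnt c (vs′ ++ ctx) ≡ length zs + cnt c (vs ++ ctx)
       grown-cnt = ≡.trans (cnt-↭ c grown) (≡.trans (cnt-++ c zs) (cong (_+ cnt c (vs ++ ctx)) (cnt-all c zs cz)))

     Loop : Path → Set
     Loop P = col (h P) ≡ c × col (l P) ≡ c

     record Absorbed (X : Path) (vs₀ ctx : List V) (b : ℕ) : Set where
       field
         X′ : Path
         hX′ : col (h X′) ≡ c
         lX′ : l X′ ≡ l X
         new : List V
         perm : vs X′ ↭ new ++ vs₀
         newFresh : Fresh new (vs₀ ++ ctx)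
         newCol : ∀ {z} → z ∈ new → col z ≡ c
         newShort : length new ≤ b

     private
       fresh-++ : ∀ {zs ws xs ctx : List V} {vs′} → vs′ ↭ zs ++ xs → Fresh zs (xs ++ ctx) → Fresh ws (vs′ ++ ctx) → Fresh (ws ++ zs) (xs ++ ctx)
       fresh-++ {zs} {ws} {xs} {ctx} p (u , d) (u′ , d′) =
         Unique-++ u′ u (λ w∈ z∈ → d′ w∈ (∈-++⁺ˡ (∈-resp-↭ (↭-sym p) (∈-++⁺ˡ z∈)))) ,
         λ x∈ x∈′ → dis (∈-++⁻ ws x∈) x∈′
         where
         dis : ∀ {x} → x ∈ ws ⊎ x ∈ zs → x ∉ xs ++ ctx
         dis (inj₂ x∈) q = d x∈ q
         dis (inj₁ x∈) q with ∈-++⁻ xs q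
         ... | inj₁ r = d′ x∈ (∈-++⁺ˡ (∈-resp-↭ (↭-sym p) (∈-++⁺ʳ zs r)))
         ... | inj₂ r = d′ x∈ (∈-++⁺ʳ _ r)

       col-++ : ∀ ws {zs : List V} → (∀ {z} → z ∈ ws → col z ≡ c) → (∀ {z} → z ∈ zs → col z ≡ c) → ∀ {z} → z ∈ ws ++ zs → col z ≡ c
       col-++ ws f g z∈ with ∈-++⁻ ws z∈
       ... | inj₁ p = f p
       ... | inj₂ p = g p

       budget : ∀ {z b k b₁ t} → z ≤ k → b + (k + b₁) < t → (z + b) + b₁ < t
       budget {z} {b} {k} {b₁} z≤ lt = ≤-<-trans (≤-trans (≤-reflexive (≡.trans (cong (_+ b₁) (+-comm z b)) (+-assoc b z b₁))) (+-monoʳ-≤ b (+-monoˡ-≤ b₁ z≤))) lt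

     -- A bridge joins X to a loop or two loops to a new loop. In both cases one loop less is left,
     -- while X still starts in the piece and keeps its last vertex.
     absorb : ∀ k loops → length loops ≡ k → ∀ X ctx → col (h X) ≡ c → (∀ {P} → P ∈ loops → Loop P) →
       Unique (verts (X ∷ loops) ++ ctx) → cnt c (verts (X ∷ loops) ++ ctx) + costs a (suc k) < t →
       Absorbed X (verts (X ∷ loops)) ctx (costs a (suc k))
     absorb zero [] _ X ctx hX lp u lt = record { X′ = X ; hX′ = hX ; lX′ = ≡.refl ; new = [] ; perm = ↭-reflexive (≡.sym (++-identityʳ (vs X)))
       ; newFresh = [] , λ () ; newCol = λ () ; newShort = z≤n }
     absorb (suc k) loops@(_ ∷ _) len X ctx hX lp u lt = go (Bridge.t₁≢t₂ B) (Bridge.t₁∈ B) (Bridge.t₂∈ B) (Bridge.walk₁₂ B) (Bridge.zsFresh B) (Bridge.zsCol B) (Bridge.zsShort B)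
       where
       hcol : ∀ {P} → P ∈ X ∷ loops → col (h P) ≡ c
       hcol (here ≡.refl) = hX
       hcol (there P∈) = proj₁ (lp P∈)
       B = bridge (X ∷ loops) ctx u hcol (s≤s (s≤s z≤n)) (≤-<-trans (m≤m+n _ _) lt)
       cost≡ : length (X ∷ loops) ≡ suc (suc k)
       cost≡ = cong suc len
       Goal = Absorbed X (verts (X ∷ loops)) ctx (costs a (suc (suc k)))
       recurse : ∀ X₁ loops₁ zs → length loops₁ ≡ k → l X₁ ≡ l X → col (h X₁) ≡ c → (∀ {P} → P ∈ loops₁ → Loop P) →
         verts (X₁ ∷ loops₁) ↭ zs ++ verts (X ∷ loops) → Fresh zs (verts (X ∷ loops) ++ ctx) → (∀ {z} → z ∈ zs → col z ≡ c) →
         length zs ≤ cost a (length (X ∷ loops)) → Goal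
       recurse X₁ loops₁ zs len₁ lX₁ hX₁ lp₁ p f cz sh = record
         { X′ = A.X′ ; hX′ = A.hX′ ; lX′ = ≡.trans A.lX′ lX₁ ; new = A.new ++ zs
         ; perm = trans A.perm (trans (Perm.++⁺ˡ A.new p) (↭-reflexive (≡.sym (++-assoc A.new zs _))))
         ; newFresh = fresh-++ p f A.newFresh
         ; newCol = col-++ A.new A.newCol cz
         ; newShort = ≤-trans (≤-reflexive (≡.trans (length-++ A.new) (+-comm (length A.new) _))) (+-mono-≤ sh′ A.newShort) }
         where
         sh′ : length zs ≤ cost a (suc (suc k))
         sh′ = subst (λ m → length zs ≤ cost a m) cost≡ sh
         module A = Absorbed (absorb k loops₁ len₁ X₁ ctx hX₁ lp₁ (grown-unique p f cz u)
           (subst (λ m → m + costs a (suc k) < t) (≡.sym (grown-cnt p f cz)) (budget {length zs} sh′ lt)))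
       withX : ∀ {L r zs} → loops ↭ L ∷ r → W (h L) (h L ∷ zs ++ h X ∷ []) (h X) → Fresh zs (verts (X ∷ loops) ++ ctx) →
         (∀ {z} → z ∈ zs → col z ≡ c) → length zs ≤ cost a (length (X ∷ loops)) → Goal
       withX {L} {r} {zs} pl w f cz sh with splice L X w
       ... | X₁ , hX₁ , lX₁ , pv = recurse X₁ r zs (suc-injective (≡.trans (≡.sym (Perm.↭-length pl)) len)) lX₁
             (≡.trans (cong col hX₁) (proj₂ (lp (∈-resp-↭ (↭-sym pl) (here ≡.refl))))) (λ P∈ → lp (∈-resp-↭ (↭-sym pl) (there P∈)))
             (trans (Perm.++⁺ʳ (verts r) pv) (trans (↭-reflexive (++-assoc zs (vs L ++ vs X) (verts r)))
               (Perm.++⁺ˡ zs (trans (Perm.++⁺ʳ (verts r) (Perm.++-comm (vs L) (vs X))) (trans (↭-reflexive (++-assoc (vs X) (vs L) (verts r)))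
                 (Perm.++⁺ˡ (vs X) (concatMap-↭ vs (↭-sym pl))))))))
             f cz sh
       go : ∀ {t₁ t₂ zs} → t₁ ≢ t₂ → t₁ ∈ h X ∷ map h loops → t₂ ∈ h X ∷ map h loops → W t₁ (t₁ ∷ zs ++ t₂ ∷ []) t₂ →
         Fresh zs (verts (X ∷ loops) ++ ctx) → (∀ {z} → z ∈ zs → col z ≡ c) → length zs ≤ cost a (length (X ∷ loops)) → Goal
       go ne (here ≡.refl) (here ≡.refl) _ _ _ _ = ⊥-elim (ne ≡.refl)
       -- The bridge was found from X towards the loop. It is reversed, so that the loop comes first
       -- and the last vertex of X survives.
       go {zs = zs} ne (here ≡.refl) (there t₂∈) w (uz , d) cz sh with L , r , pl , ≡.refl ← pick h loops t₂∈ =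
         withX pl (flipBridge w) (Unique-↭ (↭-sym (Perm.↭-reverse _)) uz , λ z∈ → d (∈-resp-↭ (Perm.↭-reverse _) z∈))
           (λ z∈ → cz (∈-resp-↭ (Perm.↭-reverse _) z∈)) (≤-trans (≤-reflexive (length-reverse zs)) sh)
       go ne (there t₁∈) (here ≡.refl) w f cz sh with L , r , pl , ≡.refl ← pick h loops t₁∈ = withX pl w f cz sh
       go {zs = zs} ne (there t₁∈) (there t₂∈) w f cz sh with L , r , pl , ≡.refl ← pick h loops t₁∈
         with L′ , r′ , pr , ≡.refl ← pick h r (tail∈ (λ e → ne (≡.sym e)) (∈-resp-↭ (Perm.map⁺ h pl) t₂∈))
         with Q , hQ , lQ , pv ← splice L L′ w =
           recurse X (Q ∷ r′) zs (suc-injective (≡.trans (≡.sym (Perm.↭-length (trans pl (prep L pr)))) len)) ≡.refl hX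
             (λ { (here ≡.refl) → ≡.trans (cong col hQ) (proj₂ (lp (∈-resp-↭ (↭-sym pl) (here ≡.refl))))
                                , ≡.trans (cong col lQ) (proj₂ (lp (∈-resp-↭ (↭-sym pl) (there (∈-resp-↭ (↭-sym pr) (here ≡.refl))))))
                ; (there P∈) → lp (∈-resp-↭ (↭-sym pl) (there (∈-resp-↭ (↭-sym pr) (there P∈)))) })
             (trans (Perm.++⁺ˡ (vs X) (trans (Perm.++⁺ʳ (verts r′) pv) (trans (↭-reflexive (≡.trans (++-assoc zs _ (verts r′)) (cong (zs ++_) (++-assoc (vs L) (vs L′) (verts r′)))))
               (Perm.++⁺ˡ zs (concatMap-↭ vs (↭-sym (trans pl (prep L pr))))))))
               (Perm.shifts (vs X) zs))
             f cz sh

-- Clearing one piece of path ends.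

module PieceTour where

 open import Data.List.Base hiding (find; lookup)
 open import Data.List.Properties
 open import Data.List.Membership.Propositional using (_∈_; _∉_; find)
 open import Data.List.Membership.Propositional.Properties
 open import Data.List.Relation.Unary.All as All using (All; []; _∷_)
 import Data.List.Relation.Unary.All.Properties as All
 open import Data.List.Relation.Unary.Any as Any using (here; there)
 open import Data.List.Relation.Unary.AllPairs as AllPairs using (AllPairs; []; _∷_)
 import Data.List.Relation.Unary.AllPairs.Properties as AllPairs
 open import Data.List.Relation.Unary.Unique.Propositional using (Unique)
 import Data.List.Relation.Unary.Unique.Propositional.Properties as Unique
 open import Data.List.Relation.Binary.Permutation.Propositional
 open import Data.List.Relation.Binary.Permutation.Propositional.Properties as Perm using (shift; ∈-resp-↭)
 import Data.List.Relation.Binary.Permutation.Setoid.Properties as PermS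
 open import Data.Nat.Base
 open import Data.Nat.Properties
 open import Data.Product.Base using (∃; _×_; _,_; proj₁; proj₂)
 open import Data.Sum.Base using (_⊎_; inj₁; inj₂)
 open import Function.Base using (_∘_; id)
 open import Relation.Binary.Definitions using (DecidableEquality)
 open import Relation.Binary.PropositionalEquality as ≡ using (_≡_; _≢_; cong; subst)
 open import Relation.Nullary
 open import Relation.Unary using (Decidable)

 open Lists
 open WalkJoining
 open PathSystems
 open import Data.Bool.Base using (false; not)

 module _ {V : Set} where
   open import Algebra.Solver.CommutativeMonoid (Perm.++-commutativeMonoid {A = V}) using (solve; _⊜_; _⊕_)

   gather₁ : ∀ (p n x l h w : List V) → (p ++ (n ++ x ++ l) ++ h) ++ w ↭ (p ++ n) ++ x ++ l ++ h ++ w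
   gather₁ = solve 6 (λ p n x l h w → ((p ⊕ ((n ⊕ (x ⊕ l)) ⊕ h)) ⊕ w) ⊜ ((p ⊕ n) ⊕ (x ⊕ (l ⊕ (h ⊕ w))))) ↭-refl

   gather₂ : ∀ (x l h w k : List V) → (x ++ l) ++ h ++ w ++ k ↭ (x ++ l ++ h ++ w) ++ k
   gather₂ = solve 5 (λ x l h w k → ((x ⊕ l) ⊕ (h ⊕ (w ⊕ k))) ⊜ ((x ⊕ (l ⊕ (h ⊕ w))) ⊕ k)) ↭-refl

   gather₃ : ∀ (x l h w k : List V) → (x ++ h) ++ l ++ w ++ k ↭ (x ++ l ++ h ++ w) ++ k
   gather₃ = solve 5 (λ x l h w k → ((x ⊕ h) ⊕ (l ⊕ (w ⊕ k))) ⊜ ((x ⊕ (l ⊕ (h ⊕ w))) ⊕ k)) ↭-refl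

 module Tour {V : Set} (_≟_ : DecidableEquality V) (E : V → V → Set) (E? : ∀ x y → Dec (E x y))
             (E-sym : ∀ {x y} → E x y → E y x)
             (a : ℕ) (ind : ∀ zs → Walks.Indep _≟_ E E? E-sym zs → length zs ≤ a) (col : V → ℕ) where
   open Walks _≟_ E E? E-sym
   open System _≟_ E E? E-sym a ind col


   Half : ℕ → Path → Set
   Half c P = col (h P) ≡ c × col (l P) ≢ c

   Away : ℕ → Path → Set
   Away c P = col (h P) ≢ c × col (l P) ≢ c

   module Step (c t : ℕ)
       (conn : ∀ Z → length Z < t → ∀ u w → col u ≡ c → col w ≡ c → u ∉ Z → w ∉ Z →
               ∃ λ xs → W u xs w × (∀ {x} → x ∈ xs → col x ≡ c × x ∉ Z)) where
     open Piece c t conn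

     record Paired (hs : List Path) (ctx : List V) (b : ℕ) : Set where
       field
         ps : List Path
         pEnds : ends ps ↭ map l hs
         new : List V
         perm : verts ps ↭ new ++ verts hs
         newFresh : Fresh new (verts hs ++ ctx)
         newCol : ∀ {z} → z ∈ new → col z ≡ c
         newShort : length new ≤ b

     -- Two half paths linked at their heads form a path with both ends outside the piece, so an
     -- even number of them leaves no end of colour c behind.
     pairUp : ∀ k hs → length hs ≤ k → odd (length hs) ≡ false → ∀ ctx → (∀ {P} → P ∈ hs → col (h P) ≡ c) →
       Unique (verts hs ++ ctx) → cnt c (verts hs ++ ctx) + costs a (length hs) < t → Paired hs ctx (costs a (length hs))
     pairUp k [] _ _ ctx _ _ _ = record { ps = [] ; pEnds = refl ; new = [] ; perm = refl ; newFresh = [] , λ () ; newCol = λ () ; newShort = z≤n }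
     pairUp k (_ ∷ []) _ ()
     pairUp (suc k) hs@(_ ∷ _ ∷ _) (s≤s len) ev ctx hc u lt
       with bridge hs ctx u hc (s≤s (s≤s z≤n)) (≤-<-trans (m≤m+n _ _) lt)
     ... | record { t₁∈ = t₁∈ ; t₂∈ = t₂∈ ; t₁≢t₂ = ne ; zs = zs ; walk₁₂ = w ; zsFresh = f ; zsCol = cz ; zsShort = sh }
       with P , r , pP , ≡.refl ← pick h hs t₁∈
       with P′ , r′ , pr , ≡.refl ← pick h r (tail∈ (λ e → ne (≡.sym e)) (∈-resp-↭ (Perm.map⁺ h pP) t₂∈))
       with Q , hQ , lQ , pv ← splice P P′ w = record
         { ps = Q ∷ R.ps
         ; pEnds = trans (↭-reflexive (≡.cong₂ (λ x y → x ∷ y ∷ ends R.ps) hQ lQ))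
                     (trans (prep _ (prep _ R.pEnds)) (Perm.map⁺ l (↭-sym ph)))
         ; new = R.new ++ zs
         ; perm = trans (Perm.++⁺ pv R.perm) (trans rearr (↭-sym (trans (↭-reflexive (++-assoc R.new zs _)) (Perm.++⁺ˡ R.new (Perm.++⁺ˡ zs vp)))))
         ; newFresh = Unique-++ (proj₁ R.newFresh) (proj₁ f) (λ x∈ z∈ → proj₂ R.newFresh x∈ (∈-++⁺ʳ (verts r′) (∈-++⁺ˡ z∈)))
                    , λ x∈ x∈′ → dis (∈-++⁻ R.new x∈) x∈′
         ; newCol = λ z∈ → cols (∈-++⁻ R.new z∈)
         ; newShort = ≤-trans (≤-reflexive (≡.trans (length-++ R.new) (+-comm (length R.new) _))) (≤-trans (+-mono-≤ sh R.newShort) cle) }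
       where
       ph : hs ↭ P ∷ P′ ∷ r′
       ph = trans pP (prep P pr)
       vp : verts hs ↭ vs P ++ vs P′ ++ verts r′
       vp = concatMap-↭ vs ph
       lenr : length hs ≡ suc (suc (length r′))
       lenr = Perm.↭-length ph
       ctx′ = zs ++ (vs P ++ vs P′) ++ ctx
       p′ : verts r′ ++ ctx′ ↭ zs ++ verts hs ++ ctx
       p′ = trans (Perm.shifts (verts r′) zs) (Perm.++⁺ˡ zs (trans (↭-reflexive (≡.sym (++-assoc (verts r′) _ ctx)))
              (Perm.++⁺ʳ ctx (trans (Perm.++-comm (verts r′) _) (trans (↭-reflexive (++-assoc (vs P) (vs P′) _)) (↭-sym vp))))))
       cle : cost a (length hs) + costs a (length r′) ≤ costs a (length hs)
       cle = subst (λ m → cost a m + costs a (length r′) ≤ costs a m) (≡.sym lenr) (+-monoʳ-≤ (cost a (2 + length r′)) (m≤n+m _ _))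
       lt′ : cnt c (verts r′ ++ ctx′) + costs a (length r′) < t
       lt′ = ≤-<-trans (≤-trans (≤-reflexive (cong (_+ costs a (length r′)) (≡.trans (cnt-↭ c p′) (≡.trans (cnt-++ c zs) (+-comm (cnt c zs) _)))))
               (≤-trans (≤-reflexive (+-assoc (cnt c (verts hs ++ ctx)) (cnt c zs) _)) (+-monoʳ-≤ _ (≤-trans (+-monoˡ-≤ _ (≤-trans (cnt-≤ c zs) sh)) cle)))) lt
       module R = Paired (pairUp k r′ (≤-trans (n≤1+n _) (≤-trans (≤-reflexive (≡.sym (suc-injective lenr))) len))
         (≡.trans (≡.sym (≡.trans (cong odd lenr) (not-not _))) ev)
         ctx′ (λ P∈ → hc (∈-resp-↭ (↭-sym ph) (there (there P∈)))) (Unique-fresh p′ f u) lt′)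
       rearr : (zs ++ vs P ++ vs P′) ++ R.new ++ verts r′ ↭ R.new ++ zs ++ vs P ++ vs P′ ++ verts r′
       rearr = trans (Perm.shifts (zs ++ vs P ++ vs P′) R.new) (Perm.++⁺ˡ R.new (↭-reflexive (≡.trans (++-assoc zs _ _) (cong (zs ++_) (++-assoc (vs P) _ _)))))
       dis : ∀ {x} → x ∈ R.new ⊎ x ∈ zs → x ∉ verts hs ++ ctx
       dis (inj₂ x∈) = proj₂ f x∈
       dis (inj₁ x∈) q = proj₂ R.newFresh x∈ (∈-resp-↭ (↭-sym p′) (∈-++⁺ʳ zs q))
       cols : ∀ {x} → x ∈ R.new ⊎ x ∈ zs → col x ≡ c
       cols (inj₁ x∈) = R.newCol x∈
       cols (inj₂ x∈) = cz x∈

     record Sorted (ps : List Path) : Set where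
       field
         loops halves aways : List Path
         isLoop : ∀ {P} → P ∈ loops → Loop P
         isHalf : ∀ {P} → P ∈ halves → Half c P
         isAway : ∀ {P} → P ∈ aways → Away c P
         vPerm : verts ps ↭ verts loops ++ verts halves ++ verts aways
         ePerm : ends ps ↭ ends loops ++ ends halves ++ ends aways

     sortPaths : ∀ ps → Sorted ps
     sortPaths [] = record { loops = [] ; halves = [] ; aways = [] ; isLoop = λ () ; isHalf = λ () ; isAway = λ () ; vPerm = refl ; ePerm = refl }
     sortPaths (P ∷ ps) with sortPaths ps | col (h P) ≟ℕ c | col (l P) ≟ℕ c
     ... | record { loops = ls ; halves = hs ; aways = as ; isLoop = L ; isHalf = H ; isAway = A ; vPerm = vp ; ePerm = ep } | yes p | yes q =
       record { loops = P ∷ ls ; halves = hs ; aways = as ; isLoop = λ { (here ≡.refl) → p , q ; (there x) → L x } ; isHalf = H ; isAway = A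
              ; vPerm = trans (Perm.++⁺ˡ (vs P) vp) (↭-reflexive (≡.sym (++-assoc (vs P) _ _))) ; ePerm = prep _ (prep _ ep) }
     ... | record { loops = ls ; halves = hs ; aways = as ; isLoop = L ; isHalf = H ; isAway = A ; vPerm = vp ; ePerm = ep } | yes p | no q =
       record { loops = ls ; halves = P ∷ hs ; aways = as ; isLoop = L ; isHalf = λ { (here ≡.refl) → p , q ; (there x) → H x } ; isAway = A
              ; vPerm = trans (Perm.++⁺ˡ (vs P) vp) (trans (Perm.shifts (vs P) (verts ls)) (Perm.++⁺ˡ (verts ls) (↭-reflexive (≡.sym (++-assoc (vs P) _ _)))))
              ; ePerm = trans (prep _ (prep _ ep)) (Perm.shifts (h P ∷ l P ∷ []) (ends ls)) }
     ... | record { loops = ls ; halves = hs ; aways = as ; isLoop = L ; isHalf = H ; isAway = A ; vPerm = vp ; ePerm = ep } | no p | yes q =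
       record { loops = ls ; halves = flip P ∷ hs ; aways = as ; isLoop = L ; isHalf = λ { (here ≡.refl) → q , p ; (there x) → H x } ; isAway = A
              ; vPerm = trans (Perm.++⁺ (↭-sym (Perm.↭-reverse (vs P))) vp) (trans (Perm.shifts (reverse (vs P)) (verts ls)) (Perm.++⁺ˡ (verts ls) (↭-reflexive (≡.sym (++-assoc (reverse (vs P)) _ _)))))
              ; ePerm = trans (swap _ _ ep) (Perm.shifts (l P ∷ h P ∷ []) (ends ls)) }
     ... | record { loops = ls ; halves = hs ; aways = as ; isLoop = L ; isHalf = H ; isAway = A ; vPerm = vp ; ePerm = ep } | no p | no q =
       record { loops = ls ; halves = hs ; aways = P ∷ as ; isLoop = L ; isHalf = H ; isAway = λ { (here ≡.refl) → p , q ; (there x) → A x }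
              ; vPerm = trans (Perm.++⁺ˡ (vs P) vp) (trans (Perm.shifts (vs P) (verts ls)) (Perm.++⁺ˡ (verts ls) (Perm.shifts (vs P) (verts hs))))
              ; ePerm = trans (prep _ (prep _ ep)) (trans (Perm.shifts (h P ∷ l P ∷ []) (ends ls)) (Perm.++⁺ˡ (ends ls) (Perm.shifts (h P ∷ l P ∷ []) (ends hs)))) }

     cnt-loops : ∀ ls → (∀ {P} → P ∈ ls → Loop P) → cnt c (ends ls) ≡ length ls + length ls
     cnt-loops [] _ = ≡.refl
     cnt-loops (P ∷ ls) f = ≡.trans (cnt-yes c _ (proj₁ (f (here ≡.refl)))) (cong suc (≡.trans (cnt-yes c _ (proj₂ (f (here ≡.refl))))
       (≡.trans (cong suc (cnt-loops ls (f ∘ there))) (≡.sym (+-suc _ _)))))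

     cnt-halves : ∀ hs → (∀ {P} → P ∈ hs → Half c P) → cnt c (ends hs) ≡ length hs
     cnt-halves [] _ = ≡.refl
     cnt-halves (P ∷ hs) f = ≡.trans (cnt-yes c _ (proj₁ (f (here ≡.refl)))) (cong suc (≡.trans (cnt-no c _ (proj₂ (f (here ≡.refl)))) (cnt-halves hs (f ∘ there))))

     cnt-aways : ∀ hs → (∀ {P} → P ∈ hs → Away c P) → cnt c (ends hs) ≡ 0
     cnt-aways [] _ = ≡.refl
     cnt-aways (P ∷ hs) f = ≡.trans (cnt-no c _ (proj₁ (f (here ≡.refl)))) (≡.trans (cnt-no c _ (proj₂ (f (here ≡.refl)))) (cnt-aways hs (f ∘ there)))

     cnt′-loops : ∀ c′ → c ≢ c′ → ∀ ls → (∀ {P} → P ∈ ls → Loop P) → cnt c′ (ends ls) ≡ 0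
     cnt′-loops c′ ne [] _ = ≡.refl
     cnt′-loops c′ ne (P ∷ ls) f = let p , q = f (here ≡.refl) in
       ≡.trans (cnt-no c′ _ (λ e → ne (≡.trans (≡.sym p) e))) (≡.trans (cnt-no c′ _ (λ e → ne (≡.trans (≡.sym q) e))) (cnt′-loops c′ ne ls (f ∘ there)))

     cnt′-halves : ∀ c′ → c ≢ c′ → ∀ hs → (∀ {P} → P ∈ hs → col (h P) ≡ c) → cnt c′ (ends hs) ≡ cnt c′ (map l hs)
     cnt′-halves c′ ne [] _ = ≡.refl
     cnt′-halves c′ ne (P ∷ hs) f = ≡.trans (cnt-no c′ _ (λ e → ne (≡.trans (≡.sym (f (here ≡.refl))) e)))
       (≡.trans (cnt-++ c′ (l P ∷ [])) (≡.trans (cong (cnt c′ (l P ∷ []) +_) (cnt′-halves c′ ne hs (f ∘ there))) (≡.sym (cnt-++ c′ (l P ∷ [])))))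

     single : V → Path
     single z = path (stop z)

     verts-singles : ∀ zs → verts (map single zs) ≡ zs
     verts-singles [] = ≡.refl
     verts-singles (z ∷ zs) = cong (z ∷_) (verts-singles zs)

     -- These vertices serve as one-vertex loops. Absorbing them forces the final path to meet the
     -- piece at least a + 2 times, as needed for marking later.
     addSingles : ∀ U bs → Unique bs → (∀ {x} → x ∈ bs → col x ≡ c) → suc (suc a) + U ≤ length bs → ∀ all → cnt c all ≤ U →
       ∃ λ zs → length zs ≡ suc (suc a) × Fresh zs all × (∀ {z} → z ∈ zs → col z ≡ c)
     addSingles U bs ub cb big all le with fresh _≟_ (filter (λ x → col x ≟ℕ c) all) (suc (suc a)) ub (≤-trans (+-monoʳ-≤ (suc (suc a)) le) big)
     ... | zs , uz , len , sub , off = zs , len , (uz , λ z∈ z∈′ → off z∈ (∈-filter⁺ (λ x → col x ≟ℕ c) z∈′ (cb (sub z∈)))) , cb ∘ sub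

     -- Clearing colour c leaves the number of ends in every other colour as it was, so the parity
     -- condition survives for the colours still to come.
     record Processed (X : Path) (rest : List Path) (ctx : List V) : Set where
       field
         rest′ : List Path
         new : List V
         perm : verts rest′ ↭ new ++ verts (X ∷ rest)
         newFresh : Fresh new (verts (X ∷ rest) ++ ctx)
         newCol : ∀ {z} → z ∈ new → col z ≡ c
         many : suc (suc a) ≤ length new
         endsOff : ∀ {e} → e ∈ ends rest′ → col e ≢ c × e ∈ ends (X ∷ rest)
         endsCnt : ∀ c′ → c ≢ c′ → cnt c′ (ends rest′) ≡ cnt c′ (ends (X ∷ rest))

     -- `U` bounds the vertices of colour c in use, a + 2 are added as loops, and the two terms
     -- `costs` pay for absorbing loops and for pairing half paths.
     module _ (U : ℕ) (bound : (U + suc (suc a)) + costs a (U + suc (suc a)) + costs a (U + suc (suc a)) < t)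
              (bs : List V) (ub : Unique bs) (cb : ∀ {x} → x ∈ bs → col x ≡ c) (big : suc (suc a) + U ≤ length bs) where

       private
         U′ = U + suc (suc a)

       record Absorbed′ (X : Path) (loops : List Path) (ctx : List V) : Set where
         field
           X′ : Path
           hX′ : col (h X′) ≡ c
           lX′ : l X′ ≡ l X
           new : List V
           perm : vs X′ ↭ new ++ verts (X ∷ loops)
           newFresh : Fresh new (verts (X ∷ loops) ++ ctx)
           newCol : ∀ {z} → z ∈ new → col z ≡ c
           many : suc (suc a) ≤ length new
           few : cnt c (vs X′ ++ ctx) ≤ U′ + costs a U′

       absorb′ : ∀ X loops ctx → col (h X) ≡ c → (∀ {P} → P ∈ loops → Loop P) →
         Unique (verts (X ∷ loops) ++ ctx) → cnt c (verts (X ∷ loops) ++ ctx) ≤ U → Absorbed′ X loops ctx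
       absorb′ X loops ctx hX lp u le with addSingles U bs ub cb big (verts (X ∷ loops) ++ ctx) le
       ... | zs , len , f , cz = record
         { X′ = A.X′ ; hX′ = A.hX′ ; lX′ = A.lX′ ; new = A.new ++ zs
         ; perm = trans A.perm (trans (Perm.++⁺ˡ A.new p₀) (↭-reflexive (≡.sym (++-assoc A.new zs _))))
         ; newFresh = Unique-++ (proj₁ A.newFresh) (proj₁ f) (λ x∈ z∈ → proj₂ A.newFresh x∈ (∈-resp-↭ (↭-sym p₁) (∈-++⁺ˡ z∈)))
                    , λ x∈ → dis (∈-++⁻ A.new x∈)
         ; newCol = λ x∈ → cols (∈-++⁻ A.new x∈)
         ; many = ≤-trans (≤-reflexive (≡.sym len)) (≤-trans (m≤n+m _ (length A.new)) (≤-reflexive (≡.sym (length-++ A.new))))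
         ; few = ≤-trans (≤-reflexive (grown-cnt {vs = verts (X ∷ loops′)} {ctx = ctx} A.perm A.newFresh A.newCol))
             (≤-trans (≤-reflexive (+-comm (length A.new) _)) (+-mono-≤ cnt₁ (≤-trans A.newShort (costs-mono a tok)))) }
         where
         loops′ = map single zs ++ loops
         lp′ : ∀ {P} → P ∈ loops′ → Loop P
         lp′ P∈ with ∈-++⁻ (map single zs) P∈
         ... | inj₂ q = lp q
         ... | inj₁ q with ∈-map⁻ single q
         ...   | z , z∈ , ≡.refl = cz z∈ , cz z∈
         p₀ : verts (X ∷ loops′) ↭ zs ++ verts (X ∷ loops)
         p₀ = trans (↭-reflexive (cong (vs X ++_) (≡.trans (verts-++ (map single zs)) (cong (_++ verts loops) (verts-singles zs))))) (Perm.shifts (vs X) zs)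
         p₁ : verts (X ∷ loops′) ++ ctx ↭ zs ++ verts (X ∷ loops) ++ ctx
         p₁ = grown {vs = verts (X ∷ loops)} {ctx = ctx} p₀ f cz
         u₁ : Unique (verts (X ∷ loops′) ++ ctx)
         u₁ = Unique-fresh p₁ f u
         cnt₁ : cnt c (verts (X ∷ loops′) ++ ctx) ≤ U′
         cnt₁ = ≤-trans (≤-reflexive (≡.trans (grown-cnt {vs = verts (X ∷ loops)} {ctx = ctx} p₀ f cz) (≡.trans (cong (_+ _) len) (+-comm (suc (suc a)) _)))) (+-monoˡ-≤ (suc (suc a)) le)
         hcs : ∀ {P} → P ∈ X ∷ loops′ → col (h P) ≡ c
         hcs (here ≡.refl) = hX
         hcs (there P∈) = proj₁ (lp′ P∈)
         tok : suc (length loops′) ≤ U′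
         tok = ≤-trans (heads-≤ (X ∷ loops′) ctx u₁ hcs) cnt₁
         module A = Absorbed (absorb (length loops′) loops′ ≡.refl X ctx hX lp′ u₁
           (≤-<-trans (+-mono-≤ cnt₁ (costs-mono a tok)) (≤-<-trans (m≤m+n _ _) bound)))
         dis : ∀ {x} → x ∈ A.new ⊎ x ∈ zs → x ∉ verts (X ∷ loops) ++ ctx
         dis (inj₂ x∈) = proj₂ f x∈
         dis (inj₁ x∈) q = proj₂ A.newFresh x∈ (∈-resp-↭ (↭-sym p₁) (∈-++⁺ʳ zs q))
         cols : ∀ {x} → x ∈ A.new ⊎ x ∈ zs → col x ≡ c
         cols (inj₁ x∈) = A.newCol x∈
         cols (inj₂ x∈) = cz x∈

       module Assemble (X : Path) (rest : List Path) (ctx : List V) (HX : Half c X) (ev : odd (cnt c (ends (X ∷ rest))) ≡ false)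
                (u : Unique (verts (X ∷ rest) ++ ctx)) (le : cnt c (verts (X ∷ rest) ++ ctx) ≤ U) (SR : Sorted rest) where
        module _ where
         hX = proj₁ HX
         lX = proj₂ HX
         module S = Sorted {rest} SR
         ctxA = verts S.halves ++ verts S.aways ++ ctx
         ctxB = verts S.aways ++ ctx
         p₁ : verts (X ∷ S.loops) ++ ctxA ↭ verts (X ∷ rest) ++ ctx
         p₁ = trans (gather₂ (vs X) (verts S.loops) (verts S.halves) (verts S.aways) ctx)
                (Perm.++⁺ʳ ctx (Perm.++⁺ˡ (vs X) (↭-sym S.vPerm)))
        module _ (AR : Absorbed′ X S.loops ctxA) where
         module _ where
          module A = Absorbed′ {X} {S.loops} {ctxA} AR
          hs : List Path
          hs = A.X′ ∷ S.halves
          p₂ : verts hs ++ ctxB ↭ A.new ++ verts (X ∷ rest) ++ ctx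
          p₂ = trans (↭-reflexive (++-assoc (vs A.X′) (verts S.halves) ctxB)) (trans (grown {vs = verts (X ∷ S.loops)} {ctx = ctxA} A.perm A.newFresh A.newCol) (Perm.++⁺ˡ A.new p₁))
          fA : Fresh A.new (verts (X ∷ rest) ++ ctx)
          fA = fresh-↭ p₁ A.newFresh
          hc : ∀ {P} → P ∈ hs → col (h P) ≡ c
          hc (here ≡.refl) = A.hX′
          hc (there P∈) = proj₁ (S.isHalf P∈)
          -- Each loop contributes two ends of colour c, each half path one, and X one. So the even
          -- end count makes the number of half paths, X included, even.
          ev′ : odd (length hs) ≡ false
          ev′ = ≡.trans (≡.sym (≡.trans (cong odd ends≡) (cong not (odd-+2 (length S.loops) (length S.halves))))) ev
            where
            rest≡ : cnt c (ends rest) ≡ length S.loops + length S.loops + length S.halves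
            rest≡ = ≡.trans (cnt-↭ c S.ePerm) (≡.trans (cnt-++ c (ends S.loops)) (≡.cong₂ _+_ (cnt-loops S.loops S.isLoop)
              (≡.trans (cnt-++ c (ends S.halves)) (≡.trans (≡.cong₂ _+_ (cnt-halves S.halves S.isHalf) (cnt-aways S.aways S.isAway)) (+-identityʳ _)))))
            ends≡ : cnt c (ends (X ∷ rest)) ≡ suc (length S.loops + length S.loops + length S.halves)
            ends≡ = ≡.trans (cnt-yes c _ hX) (cong suc (≡.trans (cnt-no c _ lX) rest≡))
          hs≤ : length hs ≤ U′
          hs≤ = ≤-trans (heads-≤ (X ∷ S.halves) (verts S.loops ++ verts S.aways ++ ctx) (Unique-↭ (↭-sym p₃) u)
                  (λ { (here ≡.refl) → hX ; (there P∈) → proj₁ (S.isHalf P∈) }))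
                (≤-trans (≤-reflexive (cnt-↭ c p₃)) (≤-trans le (m≤m+n U _)))
            where
            p₃ : verts (X ∷ S.halves) ++ verts S.loops ++ verts S.aways ++ ctx ↭ verts (X ∷ rest) ++ ctx
            p₃ = trans (gather₃ (vs X) (verts S.loops) (verts S.halves) (verts S.aways) ctx)
                 (Perm.++⁺ʳ ctx (Perm.++⁺ˡ (vs X) (↭-sym S.vPerm)))
          cnt₂ : cnt c (verts hs ++ ctxB) ≤ U′ + costs a U′
          cnt₂ = ≤-trans (≤-reflexive (cong (cnt c) (++-assoc (vs A.X′) (verts S.halves) ctxB))) A.few
         module _ (PR : Paired hs ctxB (costs a (length hs))) where
          module _ where
           module P = Paired {hs} {ctxB} {costs a (length hs)} PR
           dis : ∀ {x} → x ∈ P.new ⊎ x ∈ A.new → x ∉ verts (X ∷ rest) ++ ctx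
           dis (inj₂ x∈) = proj₂ fA x∈
           dis (inj₁ x∈) q = proj₂ P.newFresh x∈ (∈-resp-↭ (↭-sym p₂) (∈-++⁺ʳ A.new q))
           cols : ∀ {x} → x ∈ P.new ⊎ x ∈ A.new → col x ≡ c
           cols (inj₁ x∈) = P.newCol x∈
           cols (inj₂ x∈) = A.newCol x∈
           cntl : ∀ c′ → cnt c′ (map l hs) ≡ cnt c′ (l X ∷ []) + cnt c′ (map l S.halves)
           cntl c′ = ≡.trans (cnt-++ c′ (l A.X′ ∷ [])) (cong (λ z → cnt c′ (z ∷ []) + cnt c′ (map l S.halves)) A.lX′)
           l∈ends : ∀ {e} ps → e ∈ map l ps → e ∈ ends ps
           l∈ends (P ∷ ps) (here p) = there (here p)
           l∈ends (P ∷ ps) (there p) = there (there (l∈ends ps p))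
           inRest : ∀ {e} → e ∈ ends S.loops ++ ends S.halves ++ ends S.aways → e ∈ ends (X ∷ rest)
           inRest e∈ = there (there (∈-resp-↭ (↭-sym S.ePerm) e∈))
           off : ∀ {e} → e ∈ ends P.ps ⊎ e ∈ ends S.aways → col e ≢ c × e ∈ ends (X ∷ rest)
           off (inj₂ e∈) = aw S.aways S.isAway e∈ , inRest (∈-++⁺ʳ (ends S.loops) (∈-++⁺ʳ (ends S.halves) e∈))
             where
             aw : ∀ as → (∀ {P} → P ∈ as → Away c P) → ∀ {e} → e ∈ ends as → col e ≢ c
             aw (P ∷ as) f (here ≡.refl) = proj₁ (f (here ≡.refl))
             aw (P ∷ as) f (there (here ≡.refl)) = proj₂ (f (here ≡.refl))
             aw (P ∷ as) f (there (there q)) = aw as (f ∘ there) q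
           off (inj₁ e∈) with ∈-resp-↭ P.pEnds e∈
           ... | here ≡.refl rewrite A.lX′ = lX , there (here ≡.refl)
           ... | there q = (let P , P∈ , e = ∈-map⁻ l q in λ ce → proj₂ (S.isHalf P∈) (≡.trans (cong col (≡.sym e)) ce))
                 , inRest (∈-++⁺ʳ (ends S.loops) (∈-++⁺ˡ (l∈ends S.halves q)))
          assemble : Processed X rest ctx
          assemble = record
            { rest′ = P.ps ++ S.aways
            ; new = P.new ++ A.new
            ; perm = trans (↭-reflexive (verts-++ P.ps)) (trans (Perm.++⁺ʳ (verts S.aways) (trans P.perm (Perm.++⁺ˡ P.new (Perm.++⁺ʳ (verts S.halves) A.perm))))
                (trans (gather₁ P.new A.new (vs X) (verts S.loops) (verts S.halves) (verts S.aways))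
                  (Perm.++⁺ˡ (P.new ++ A.new) (Perm.++⁺ˡ (vs X) (↭-sym S.vPerm)))))
            ; newFresh = Unique-++ (proj₁ P.newFresh) (proj₁ A.newFresh) (λ x∈ z∈ → proj₂ P.newFresh x∈ (∈-resp-↭ (↭-sym p₂) (∈-++⁺ˡ z∈)))
                       , λ x∈ → dis (∈-++⁻ P.new x∈)
            ; newCol = λ x∈ → cols (∈-++⁻ P.new x∈)
            ; many = ≤-trans A.many (≤-trans (m≤n+m _ (length P.new)) (≤-reflexive (≡.sym (length-++ P.new))))
            ; endsOff = λ e∈ → off (∈-++⁻ (ends P.ps) (subst (_ ∈_) (ends-++ P.ps) e∈))
            ; endsCnt = λ c′ ne → ≡.trans (cong (cnt c′) (ends-++ P.ps)) (≡.trans (cnt-++ c′ (ends P.ps)) (≡.trans (cong (_+ cnt c′ (ends S.aways)) (≡.trans (cnt-↭ c′ P.pEnds) (cntl c′)))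
                (≡.sym (≡.trans (cnt-no c′ _ (λ e → ne (≡.trans (≡.sym hX) e))) (≡.trans (cnt-++ c′ (l X ∷ [])) (≡.trans (cong (cnt c′ (l X ∷ []) +_)
                  (≡.trans (cnt-↭ c′ S.ePerm) (≡.trans (cnt-++ c′ (ends S.loops)) (≡.trans (cong (_+ cnt c′ (ends S.halves ++ ends S.aways)) (cnt′-loops c′ ne S.loops S.isLoop))
                    (≡.trans (cnt-++ c′ (ends S.halves)) (cong (_+ cnt c′ (ends S.aways)) (cnt′-halves c′ ne S.halves (λ P∈ → proj₁ (S.isHalf P∈)))))))))
                  (≡.sym (+-assoc (cnt c′ (l X ∷ [])) _ _))))))))
            }

       -- The half path X ties the piece to the others: the loops, old and new, are absorbed into
       -- it, and then it is paired up along with the other half paths.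
       process : ∀ X rest ctx → Half c X → odd (cnt c (ends (X ∷ rest))) ≡ false →
         Unique (verts (X ∷ rest) ++ ctx) → cnt c (verts (X ∷ rest) ++ ctx) ≤ U → Processed X rest ctx
       process X rest ctx HX ev u le = Assemble.assemble X rest ctx HX ev u le SR AR
         (pairUp _ (Assemble.hs X rest ctx HX ev u le SR AR) ≤-refl (Assemble.ev′ X rest ctx HX ev u le SR AR) _ (Assemble.hc X rest ctx HX ev u le SR AR)
           (Unique-fresh (Assemble.p₂ X rest ctx HX ev u le SR AR) (Assemble.fA X rest ctx HX ev u le SR AR) u)
           (≤-<-trans (+-mono-≤ (Assemble.cnt₂ X rest ctx HX ev u le SR AR) (costs-mono a (Assemble.hs≤ X rest ctx HX ev u le SR AR))) bound))
         where
         SR = sortPaths rest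
         AR = absorb′ X (Sorted.loops SR) _ (proj₁ HX) (Sorted.isLoop SR) (Unique-↭ (↭-sym (Assemble.p₁ X rest ctx HX ev u le SR)) u)
                (≤-trans (≤-reflexive (cnt-↭ c (Assemble.p₁ X rest ctx HX ev u le SR))) le)

-- Trees of pieces, parity correction, and routing through all pieces.

module TreeRouting where

 open import Data.Empty using (⊥-elim)
 open import Data.List.Base hiding (find; lookup)
 open import Data.List.Properties
 open import Data.List.Membership.Propositional using (_∈_; _∉_; find)
 open import Data.List.Membership.Propositional.Properties
 open import Data.List.Relation.Unary.All as All using (All; []; _∷_)
 import Data.List.Relation.Unary.All.Properties as All
 open import Data.List.Relation.Unary.Any as Any using (here; there)
 open import Data.List.Relation.Unary.AllPairs as AllPairs using (AllPairs; []; _∷_)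
 import Data.List.Relation.Unary.AllPairs.Properties as AllPairs
 open import Data.List.Relation.Unary.Unique.Propositional using (Unique)
 import Data.List.Relation.Unary.Unique.Propositional.Properties as Unique
 open import Data.List.Relation.Binary.Permutation.Propositional
 open import Data.List.Relation.Binary.Permutation.Propositional.Properties as Perm using (shift; ∈-resp-↭)
 import Data.List.Relation.Binary.Permutation.Setoid.Properties as PermS
 open import Data.Nat.Base
 open import Data.Nat.Properties
 open import Data.Product.Base using (∃; _×_; _,_; proj₁; proj₂)
 open import Data.Sum.Base using (inj₁; inj₂)
 open import Function.Base using (_∘_; id; case_of_)
 open import Relation.Binary.Definitions using (DecidableEquality)
 open import Relation.Binary.PropositionalEquality as ≡ using (_≡_; _≢_; cong; subst)
 open import Relation.Nullary
 open import Relation.Unary using (Decidable)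

 open Lists
 open WalkJoining
 open PathSystems
 open PieceTour
 open import Data.Bool.Base using (true; false; not)

 module _ {V : Set} where
   open import Algebra.Solver.CommutativeMonoid (Perm.++-commutativeMonoid {A = V}) using (solve; _⊜_; _⊕_)

   gather₄ : ∀ (p e r v w : List V) → (p ++ r) ++ e ++ v ++ w ↭ (p ++ e) ++ r ++ v ++ w
   gather₄ = solve 5 (λ p e r v w → ((p ⊕ r) ⊕ (e ⊕ (v ⊕ w))) ⊜ ((p ⊕ e) ⊕ (r ⊕ (v ⊕ w)))) ↭-refl

   gather₅ : ∀ (e r v w : List V) → e ++ r ++ v ++ w ↭ r ++ e ++ v ++ w
   gather₅ = solve 4 (λ e r v w → (e ⊕ (r ⊕ (v ⊕ w))) ⊜ (r ⊕ (e ⊕ (v ⊕ w)))) ↭-refl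

   gather₇ : ∀ (x r w : List V) → (x ++ r) ++ w ↭ r ++ x ++ w
   gather₇ = solve 3 (λ x r w → ((x ⊕ r) ⊕ w) ⊜ (r ⊕ (x ⊕ w))) ↭-refl

 module Route {V : Set} (_≟_ : DecidableEquality V) (E : V → V → Set) (E? : ∀ x y → Dec (E x y))
              (E-sym : ∀ {x y} → E x y → E y x)
              (a : ℕ) (ind : ∀ zs → Walks.Indep _≟_ E E? E-sym zs → length zs ≤ a) (col : V → ℕ) (ρ : ℕ) where
   open Walks _≟_ E E? E-sym
   open System _≟_ E E? E-sym a ind col
   open Tour _≟_ E E? E-sym a ind col

   -- A tree on the colours cs with root ρ; each path P in es attaches the new colour col (h P).
   data Tree : List ℕ → List Path → Set where
     root : Tree (ρ ∷ []) []
     grow : ∀ {cs es} → Tree cs es → ∀ P → col (l P) ∈ cs → col (h P) ∉ cs → Tree (col (h P) ∷ cs) (P ∷ es)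

   ρ∈ : ∀ {cs es} → Tree cs es → ρ ∈ cs
   ρ∈ root = here ≡.refl
   ρ∈ (grow T _ _ _) = there (ρ∈ T)

   tree-ends : ∀ {cs es} → Tree cs es → ∀ {e} → e ∈ ends es → col e ∈ cs
   tree-ends (grow T P _ _) (here ≡.refl) = here ≡.refl
   tree-ends (grow T P l∈ _) (there (here ≡.refl)) = there l∈
   tree-ends (grow T P _ _) (there (there e∈)) = there (tree-ends T e∈)

   cnt-ends-∷ : ∀ c P ps → cnt c (ends (P ∷ ps)) ≡ cnt c (h P ∷ l P ∷ []) + cnt c (ends ps)
   cnt-ends-∷ c P ps = cnt-++ c (h P ∷ l P ∷ [])

   cnt-tree : ∀ {cs es} → Tree cs es → ∀ {c} → c ∉ cs → cnt c (ends es) ≡ 0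
   cnt-tree {es = es} T c∉ = cnt-none _ (ends es) λ e∈ e → c∉ (subst (_∈ _) e (tree-ends T e∈))

   -- `js` is a sublist of `es`, recorded through its consequences; `jUnique` has a context `Z` so
   -- that disjointness holds in the presence of other paths. The root is exempt from `even` because
   -- in the end only loops at the root are left.
   record Parity (cs : List ℕ) (es qs : List Path) : Set where
     field
       js : List Path
       jUnique : ∀ Z → Unique (verts es ++ Z) → Unique (verts js ++ Z)
       jShort : length (verts js) ≤ length (verts es)
       jSub : ∀ {x} → x ∈ verts js → x ∈ verts es
       jEnds : ∀ {e} → e ∈ ends js → e ∈ ends es
       jNone : ∀ {c} → c ∉ cs → cnt c (ends js) ≡ 0
       even : ∀ {c} → c ∈ cs → c ≢ ρ → odd (cnt c (ends js) + cnt c (ends qs)) ≡ false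

   -- T-join: going from the leaves to the root, take an edge of the tree iff its lower colour is still odd.
   tJoin : ∀ {cs es} → Tree cs es → ∀ qs → Parity cs es qs
   tJoin root qs = record { js = [] ; jUnique = λ _ u → u ; jShort = z≤n ; jSub = λ () ; jEnds = λ () ; jNone = λ _ → ≡.refl
     ; even = λ { (here e) ne → ⊥-elim (ne e) } }
   tJoin (grow {cs} {es} T P l∈ h∉) qs with odd (cnt (col (h P)) (ends qs)) in eq
   ... | false = record { js = I.js ; jUnique = λ Z u → I.jUnique Z (proj₁ (proj₂ (Unique-++⁻ (vs P) (subst Unique (++-assoc (vs P) (verts es) Z) u))))
       ; jShort = ≤-trans I.jShort (≤-trans (m≤n+m _ (length (vs P))) (≤-reflexive (≡.sym (length-++ (vs P)))))
       ; jSub = λ x∈ → ∈-++⁺ʳ (vs P) (I.jSub x∈) ; jEnds = λ e∈ → there (there (I.jEnds e∈)) ; jNone = λ c∉ → I.jNone (c∉ ∘ there)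
       ; even = λ { (here ≡.refl) _ → ≡.trans (cong (λ m → odd (m + cnt (col (h P)) (ends qs))) (I.jNone h∉)) eq ; (there c∈) ne → I.even c∈ ne } }
     where module I = Parity (tJoin T qs)
   ... | true = record { js = P ∷ I.js
       ; jUnique = λ Z u → subst Unique (≡.sym (++-assoc (vs P) (verts I.js) Z))
           (Unique-↭ (Perm.shifts (verts I.js) (vs P)) (I.jUnique (vs P ++ Z) (Unique-↭ (Perm.shifts (vs P) (verts es)) (subst Unique (++-assoc (vs P) (verts es) Z) u))))
       ; jShort = ≤-trans (≤-reflexive (length-++ (vs P))) (≤-trans (+-monoʳ-≤ (length (vs P)) I.jShort) (≤-reflexive (≡.sym (length-++ (vs P)))))
       ; jSub = λ x∈ → case ∈-++⁻ (vs P) x∈ of λ { (inj₁ r) → ∈-++⁺ˡ r ; (inj₂ r) → ∈-++⁺ʳ (vs P) (I.jSub r) }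
       ; jEnds = λ { (here e) → here e ; (there (here e)) → there (here e) ; (there (there e∈)) → there (there (I.jEnds e∈)) }
       ; jNone = λ c∉ → ≡.trans (cnt-no _ _ (λ e → c∉ (here (≡.sym e)))) (≡.trans (cnt-no _ _ (λ e → c∉ (there (subst (_∈ cs) e l∈)))) (I.jNone (c∉ ∘ there)))
       ; even = λ { (here ≡.refl) _ → ≡.trans (cong (λ m → odd (m + cnt (col (h P)) (ends qs)))
                      (≡.trans (cnt-yes _ _ ≡.refl) (cong suc (≡.trans (cnt-no _ _ (λ e → h∉ (subst (_∈ cs) e l∈))) (I.jNone h∉))))) (cong not eq)
                  ; {c} (there c∈) ne → ≡.trans (cong odd (sw c)) (I.even c∈ ne) } }
     where
     -- A chosen edge joins `qs` in the recursive call, so that its upper colour takes it into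
     -- account.
     module I = Parity (tJoin T (P ∷ qs))
     sw : ∀ c → cnt c (ends (P ∷ I.js)) + cnt c (ends qs) ≡ cnt c (ends I.js) + cnt c (ends (P ∷ qs))
     sw c = ≡.trans (cong (_+ cnt c (ends qs)) (≡.trans (cnt-ends-∷ c P I.js) (+-comm (cnt c (h P ∷ l P ∷ [])) _)))
       (≡.trans (+-assoc (cnt c (ends I.js)) _ _) (cong (cnt c (ends I.js) +_) (≡.sym (cnt-ends-∷ c P qs))))

   module _ (t U : ℕ) (bound : (U + suc (suc a)) + costs a (U + suc (suc a)) + costs a (U + suc (suc a)) < t) (Pc : ℕ → Set)
       (conn : ∀ c → Pc c → ∀ Z → length Z < t → ∀ u w → col u ≡ c → col w ≡ c → u ∉ Z → w ∉ Z →
               ∃ λ xs → W u xs w × (∀ {x} → x ∈ xs → col x ≡ c × x ∉ Z))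
       (big : ∀ c → Pc c → ∃ λ bs → Unique bs × (∀ {x} → x ∈ bs → col x ≡ c) × suc (suc a) + U ≤ length bs)
       (Xv Xp : Path) (hv : col (h Xv) ≡ ρ) (hp : col (h Xp) ≡ ρ) where

     base : List V
     base = vs Xv ++ vs Xp

     record Routed (cs : List ℕ) (all : List V) : Set where
       field
         q new : List V
         walkq : W (l Xv) q (l Xp)
         perm : q ↭ new ++ all
         newFresh : Fresh new all
         newPc : ∀ {z} → z ∈ new → Pc (col z)
         rich : ∀ {c} → c ∈ cs → suc (suc a) ≤ cnt c q

     fresh-trans : ∀ {ws zs all all′ : List V} → all′ ↭ zs ++ all → Fresh zs all → Fresh ws all′ → Fresh (ws ++ zs) all
     fresh-trans {ws} {zs} {all} p (u , d) (u′ , d′) = Unique-++ u′ u (λ w∈ z∈ → d′ w∈ (∈-resp-↭ (↭-sym p) (∈-++⁺ˡ z∈)))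
       , λ x∈ q → case ∈-++⁻ ws x∈ of λ { (inj₁ r) → d′ r (∈-resp-↭ (↭-sym p) (∈-++⁺ʳ zs q)) ; (inj₂ r) → d r q }

     cnt-new : ∀ {c zs all all′} → all′ ↭ zs ++ all → (∀ {z} → z ∈ zs → col z ≡ c) → length zs ≤ cnt c all′
     cnt-new {c} {zs} p cz = ≤-trans (≤-reflexive (≡.sym (cnt-all c zs cz))) (≤-trans (m≤m+n _ _) (≤-reflexive (≡.sym (≡.trans (cnt-↭ c p) (cnt-++ c zs)))))

     cnt-same : ∀ {c c′ zs all all′} → c ≢ c′ → all′ ↭ zs ++ all → (∀ {z} → z ∈ zs → col z ≡ c) → cnt c′ all′ ≡ cnt c′ all
     cnt-same {c} {c′} {zs} ne p cz = ≡.trans (cnt-↭ c′ p) (≡.trans (cnt-++ c′ zs) (cong (_+ _) (cnt-none c′ zs (λ z∈ e → ne (≡.trans (≡.sym (cz z∈)) e)))))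

     -- In the root piece all remaining paths are loops, in whatever number. They are absorbed into
     -- `Xv`, and one bridge to `Xp` completes the path.
     module AtRoot (Pρ : Pc ρ) (rest : List Path) (u : Unique (verts rest ++ base)) where
       open Step ρ t (conn ρ Pρ)
       open Piece ρ t (conn ρ Pρ)

       module _ (AR : Absorbed′ U bound (proj₁ (big ρ Pρ)) (proj₁ (proj₂ (big ρ Pρ))) (proj₁ (proj₂ (proj₂ (big ρ Pρ)))) (proj₂ (proj₂ (proj₂ (big ρ Pρ)))) Xv rest (vs Xp)) where
         module A = Absorbed′ AR

         p₁ : vs A.X′ ++ vs Xp ↭ A.new ++ verts rest ++ base
         p₁ = trans (grown {vs = verts (Xv ∷ rest)} {ctx = vs Xp} A.perm A.newFresh A.newCol) (Perm.++⁺ˡ A.new (gather₇ (vs Xv) (verts rest) (vs Xp)))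

         fA : Fresh A.new (verts rest ++ base)
         fA = fresh-↭ (gather₇ (vs Xv) (verts rest) (vs Xp)) A.newFresh

         two : List Path
         two = A.X′ ∷ Xp ∷ []

         two≡ : verts two ++ [] ≡ vs A.X′ ++ vs Xp
         two≡ = ≡.trans (++-identityʳ _) (cong (vs A.X′ ++_) (++-identityʳ _))

         finish : ∀ {zs} → (∃ λ Q → h Q ≡ l A.X′ × l Q ≡ l Xp × vs Q ↭ zs ++ vs A.X′ ++ vs Xp) → Fresh zs (vs A.X′ ++ vs Xp) →
           (∀ {z} → z ∈ zs → col z ≡ ρ) → Routed (ρ ∷ []) (verts rest ++ base)
         finish {zs} (Q , hQ , lQ , pv) f cz = record
           { q = vs Q ; new = zs ++ A.new ; walkq = ≡.subst₂ (λ x y → W x (vs Q) y) (≡.trans hQ A.lX′) lQ (walk Q)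
           ; perm = pq ; newFresh = fresh-trans p₁ fA f ; newPc = λ z∈ → subst Pc (≡.sym (cnew z∈)) Pρ
           ; rich = λ { (here ≡.refl) → ≤-trans A.many (≤-trans (m≤n+m _ (length zs)) (≤-trans (≤-reflexive (≡.sym (length-++ zs))) (cnt-new pq cnew))) } }
           where
           pq : vs Q ↭ (zs ++ A.new) ++ verts rest ++ base
           pq = trans pv (trans (Perm.++⁺ˡ zs p₁) (↭-reflexive (≡.sym (++-assoc zs A.new _))))
           cnew : ∀ {z} → z ∈ zs ++ A.new → col z ≡ ρ
           cnew z∈ with ∈-++⁻ zs z∈
           ... | inj₁ p = cz p
           ... | inj₂ p = A.newCol p

         close : Routed (ρ ∷ []) (verts rest ++ base)
         close with bridge two [] (subst Unique (≡.sym two≡) (Unique-fresh p₁ fA u))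
                      (λ { (here ≡.refl) → A.hX′ ; (there (here ≡.refl)) → hp }) ≤-refl
                      (≤-<-trans (≤-trans (≤-reflexive (cong (cnt ρ) two≡)) A.few) (≤-<-trans (m≤m+n _ _) bound))
         ... | record { t₁∈ = t₁∈ ; t₂∈ = t₂∈ ; t₁≢t₂ = ne ; zs = zs ; walk₁₂ = w ; zsFresh = (uz , d) ; zsCol = cz } = go t₁∈ t₂∈ ne w
           where
           f : Fresh zs (vs A.X′ ++ vs Xp)
           f = uz , λ z∈ q → d z∈ (subst (_ ∈_) (≡.sym two≡) q)
           go : ∀ {t₁ t₂} → t₁ ∈ h A.X′ ∷ h Xp ∷ [] → t₂ ∈ h A.X′ ∷ h Xp ∷ [] → t₁ ≢ t₂ → W t₁ (t₁ ∷ zs ++ t₂ ∷ []) t₂ → Routed (ρ ∷ []) (verts rest ++ base)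
           go (here ≡.refl) (here ≡.refl) ne _ = ⊥-elim (ne ≡.refl)
           go (there (here ≡.refl)) (there (here ≡.refl)) ne _ = ⊥-elim (ne ≡.refl)
           go (here ≡.refl) (there (here ≡.refl)) _ w = finish (splice A.X′ Xp w) f cz
           go (there (here ≡.refl)) (here ≡.refl) _ w = finish (splice A.X′ Xp (flipBridge w))
             (Unique-↭ (↭-sym (Perm.↭-reverse zs)) uz , λ z∈ → proj₂ f (∈-resp-↭ (Perm.↭-reverse zs) z∈)) (λ z∈ → cz (∈-resp-↭ (Perm.↭-reverse zs) z∈))

     -- The leaf added last is cleared first, with its tree edge as the half path of `process`. No
     -- end of that colour remains and all new vertices have that colour, so the vertex counts and
     -- parities of the other colours do not change.
     run : ∀ {cs es} → Tree cs es → (∀ {c} → c ∈ cs → Pc c) → ∀ rest → Unique (verts es ++ verts rest ++ base) →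
       (∀ {c} → c ∈ cs → cnt c (verts es ++ verts rest ++ base) ≤ U) → (∀ {e} → e ∈ ends rest → col e ∈ cs) →
       (∀ {c} → c ∈ cs → c ≢ ρ → odd (cnt c (ends es) + cnt c (ends rest)) ≡ false) →
       Routed cs (verts es ++ verts rest ++ base)
     run root pc rest u le ec ev = AtRoot.close Pρ rest u (Step.absorb′ ρ t (conn ρ Pρ) U bound _ _ _ _ Xv rest (vs Xp) hv (λ P∈ → loop rest P∈ ec)
         (Unique-↭ (↭-sym (gather₇ (vs Xv) (verts rest) (vs Xp))) u) (≤-trans (≤-reflexive (cnt-↭ ρ (gather₇ (vs Xv) (verts rest) (vs Xp)))) (le (here ≡.refl))))
       where
       Pρ = pc (here ≡.refl)
       loop : ∀ {P} ps → P ∈ ps → (∀ {e} → e ∈ ends ps → col e ∈ ρ ∷ []) → Piece.Loop ρ t (conn ρ Pρ) P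
       loop (P ∷ ps) (here ≡.refl) f with f (here ≡.refl) | f (there (here ≡.refl))
       ... | here p | here q = p , q
       loop (P ∷ ps) (there P∈) f = loop ps P∈ (λ e∈ → f (there (there e∈)))
     run (grow {cs} {es} T P l∈ h∉) pc rest u le ec ev = step′ (Step.process c t (conn c Pcc) U bound _ (proj₁ (proj₂ bg)) (proj₁ (proj₂ (proj₂ bg))) (proj₂ (proj₂ (proj₂ bg))) P rest ctx (≡.refl , l≢) ev₀
           (Unique-↭ (↭-sym p₀) u) (≤-trans (≤-reflexive (cnt-↭ c p₀)) (le (here ≡.refl))))
       where
       c = col (h P)
       Pcc = pc (here ≡.refl)
       bg = big c Pcc
       ctx = verts es ++ base
       p₀ : verts (P ∷ rest) ++ ctx ↭ verts (P ∷ es) ++ verts rest ++ base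
       p₀ = gather₄ (vs P) (verts es) (verts rest) (vs Xv) (vs Xp)
       l≢ : col (l P) ≢ c
       l≢ e = h∉ (subst (_∈ cs) e l∈)
       c≢ρ : c ≢ ρ
       c≢ρ e = h∉ (subst (_∈ cs) (≡.sym e) (ρ∈ T))
       ev₀ : odd (cnt c (ends (P ∷ rest))) ≡ false
       ev₀ = ≡.trans (cong odd (≡.trans (cnt-ends-∷ c P rest) (cong (_+ cnt c (ends rest))
               (≡.trans (≡.sym (+-identityʳ _)) (≡.trans (cong (cnt c (h P ∷ l P ∷ []) +_) (≡.sym (cnt-tree T h∉))) (≡.sym (cnt-ends-∷ c P es))))))) (ev (here ≡.refl) c≢ρ)
       step′ : Step.Processed c t (conn c Pcc) P rest ctx → Routed (c ∷ cs) (verts (P ∷ es) ++ verts rest ++ base)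
       step′ PR = record
         { q = I.q ; new = I.new ++ R.new ; walkq = I.walkq
         ; perm = trans I.perm (trans (Perm.++⁺ˡ I.new p₁) (↭-reflexive (≡.sym (++-assoc I.new R.new _))))
         ; newFresh = fresh-trans p₁ fR I.newFresh
         ; newPc = λ z∈ → case ∈-++⁻ I.new z∈ of λ { (inj₁ r) → I.newPc r ; (inj₂ r) → subst Pc (≡.sym (R.newCol r)) Pcc }
         ; rich = λ { (here ≡.refl) → ≤-trans R.many (≤-trans (cnt-new p₁ R.newCol) (≤-trans (m≤n+m _ (cnt c I.new)) (≤-reflexive (≡.sym (≡.trans (cnt-↭ c I.perm) (cnt-++ c I.new))))))
                    ; (there c∈) → I.rich c∈ } }
         where
         module R = Step.Processed PR
         p₁ : verts es ++ verts R.rest′ ++ base ↭ R.new ++ verts (P ∷ es) ++ verts rest ++ base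
         p₁ = trans (gather₅ (verts es) (verts R.rest′) (vs Xv) (vs Xp)) (trans (Perm.++⁺ʳ ctx R.perm) (trans (↭-reflexive (++-assoc R.new _ ctx)) (Perm.++⁺ˡ R.new p₀)))
         fR : Fresh R.new (verts (P ∷ es) ++ verts rest ++ base)
         fR = proj₁ R.newFresh , λ z∈ q → proj₂ R.newFresh z∈ (∈-resp-↭ (↭-sym p₀) q)
         ne : ∀ {c′} → c′ ∈ cs → c ≢ c′
         ne c∈ e = h∉ (subst (_∈ cs) (≡.sym e) c∈)
         ecol : ∀ {e} → e ∈ ends R.rest′ → col e ∈ cs
         ecol e∈ with R.endsOff e∈
         ... | ce , here ≡.refl = ⊥-elim (ce ≡.refl)
         ... | ce , there (here ≡.refl) = l∈
         ... | ce , there (there e∈′) with ec e∈′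
         ...   | here e = ⊥-elim (ce e)
         ...   | there r = r
         ev₁ : ∀ {c′} → c′ ∈ cs → c′ ≢ ρ → odd (cnt c′ (ends es) + cnt c′ (ends R.rest′)) ≡ false
         ev₁ {c′} c∈ nr = ≡.trans (cong odd (≡.trans (cong (cnt c′ (ends es) +_) (≡.trans (R.endsCnt c′ (ne c∈)) (cnt-ends-∷ c′ P rest)))
           (≡.trans (≡.sym (+-assoc (cnt c′ (ends es)) _ _)) (cong (_+ cnt c′ (ends rest)) (≡.trans (+-comm (cnt c′ (ends es)) _) (≡.sym (cnt-ends-∷ c′ P es)))))))
           (ev (there c∈) nr)
         module I = Routed (run T (pc ∘ there) R.rest′ (Unique-fresh p₁ fR u)
           (λ c∈ → ≤-trans (≤-reflexive (cnt-same (ne c∈) p₁ R.newCol)) (le (there c∈))) ecol ev₁)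

-- Decomposition into connected pieces, long paths in neighbourhoods, spanning trees of pieces.

module Pieces where

 open import Data.Empty using (⊥-elim)
 open import Data.List.Base hiding (find; lookup)
 open import Data.List.Properties
 open import Data.List.Membership.Propositional using (_∈_; _∉_; find)
 open import Data.List.Membership.Propositional.Properties
 open import Data.List.Relation.Unary.All as All using (All; []; _∷_)
 import Data.List.Relation.Unary.All.Properties as All
 open import Data.List.Relation.Unary.Any as Any using (Any; here; there)
 open import Data.List.Relation.Unary.AllPairs as AllPairs using (AllPairs; []; _∷_)
 import Data.List.Relation.Unary.AllPairs.Properties as AllPairs
 open import Data.List.Relation.Unary.Unique.Propositional using (Unique)
 import Data.List.Relation.Unary.Unique.Propositional.Properties as Unique
 open import Data.List.Relation.Binary.Permutation.Propositional
 open import Data.List.Relation.Binary.Permutation.Propositional.Properties as Perm using (shift; ∈-resp-↭)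
 import Data.List.Relation.Binary.Permutation.Setoid.Properties as PermS
 open import Data.Nat.Base
 open import Data.Nat.Properties
 open import Data.Product.Base using (Σ; ∃; ∃₂; _×_; _,_; proj₁; proj₂)
 open import Data.Sum.Base using (_⊎_; inj₁; inj₂)
 open import Function.Base using (_∘_; id)
 open import Relation.Binary.Definitions using (DecidableEquality)
 open import Relation.Binary.PropositionalEquality as ≡ using (_≡_; _≢_; cong; subst)
 open import Relation.Nullary
 open import Relation.Unary using (Decidable)

 open Lists
 open WalkJoining
 open PathSystems
 open TreeRouting
 open import Data.Bool.Base using (Bool; T)
 open import Data.Bool.Properties using (T?)
 open import Data.Fin.Base as Fin using (Fin)
 import Data.Fin.Properties as Fin
 open import Data.Fin.Subset using (Subset)
 open import Data.Fin.Subset.Properties using (anySubset?)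
 open import Data.Vec.Base as Vec using (Vec)
 import Data.Vec.Properties as Vec
 open import Data.Maybe.Base using (Maybe; just)
 open import Data.Maybe.Properties using (just-injective)
 open import Defs using (anyVec?)
 open import Relation.Nullary.Decidable using (_×-dec_; _→-dec_; ¬?; isYes; toWitness; fromWitness)

 pieces : ℕ → List ℕ
 pieces k = applyUpTo suc k

 ∈-pieces : ∀ {k c} → 1 ≤ c → c ≤ k → c ∈ pieces k
 ∈-pieces (s≤s z≤n) c≤k = ∈-applyUpTo⁺ suc c≤k

 ∈-pieces⁻ : ∀ {k c} → c ∈ pieces k → 1 ≤ c × c ≤ k
 ∈-pieces⁻ c∈ with i , i<k , ≡.refl ← ∈-applyUpTo⁻ suc c∈ = s≤s z≤n , i<k

 module Decompose {n : ℕ} (E : Fin n → Fin n → Set) (E? : ∀ x y → Dec (E x y)) (E-sym : ∀ {x y} → E x y → E y x)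
                  (a : ℕ) (ind : ∀ zs → Walks.Indep Fin._≟_ E E? E-sym zs → length zs ≤ a) (t : ℕ) where
   open Walks Fin._≟_ E E? E-sym
   open import Data.List.Membership.DecPropositional (Fin._≟_ {n}) using (_∈?_; _∉?_)


   -- Colour 0 stands for deleted vertices, colours 1 to k for the pieces. A refinement deletes a
   -- separator of fewer than t vertices and creates one piece, whence the bound `t * k`.
   record Colouring (k : ℕ) : Set where
     field
       col : Fin n → ℕ
       apart : ∀ {u v} → E u v → col u ≡ 0 ⊎ col v ≡ 0 ⊎ col u ≡ col v
       rep : ∀ {c} → 1 ≤ c → c ≤ k → ∃ λ v → col v ≡ c
       colMax : ∀ v → col v ≤ k
       removed : length (filter (λ v → col v ≟ℕ 0) (allFin n)) ≤ t * k
   open Colouring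

   module _ (col : Fin n → ℕ) (c : ℕ) where

     In : List (Fin n) → Fin n → Set
     In Z v = col v ≡ c × v ∉ Z

     In? : ∀ Z → Decidable (In Z)
     In? Z v = (col v ≟ℕ c) ×-dec (v ∉? Z)

     Split : List (Fin n) → Subset n → Set
     Split Z B = (∃ λ u → In Z u × T (Vec.lookup B u)) × (∃ λ w → In Z w × ¬ T (Vec.lookup B w)) ×
       (∀ u w → In Z u × T (Vec.lookup B u) → In Z w × ¬ T (Vec.lookup B w) → ¬ E u w)

     -- Vectors for the separator and subsets for a side make this decidable by exhaustive search,
     -- so that the decomposition can branch on it.
     Sep : Set
     Sep = ∃ λ j → j < t × ∃ λ (Z : Vec (Fin n) j) → ∃ λ B → Split (Vec.toList Z) B

     sep? : Dec Sep
     sep? = anyUpTo? (λ j → anyVec? j λ Z → anySubset? λ B →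
       Fin.any? (λ u → In? (Vec.toList Z) u ×-dec T? (Vec.lookup B u)) ×-dec
       Fin.any? (λ w → In? (Vec.toList Z) w ×-dec ¬? (T? (Vec.lookup B w))) ×-dec
       Fin.all? λ u → Fin.all? λ w → (In? (Vec.toList Z) u ×-dec T? (Vec.lookup B u)) →-dec
         ((In? (Vec.toList Z) w ×-dec ¬? (T? (Vec.lookup B w))) →-dec ¬? (E? u w))) t

     -- The set of vertices reached from u grows as long as an edge leaves it within the piece minus
     -- Z. If it stops without w, it is the side B of a separation.
     connected : ¬ Sep → ∀ Z → length Z < t → ∀ u w → col u ≡ c → col w ≡ c → u ∉ Z → w ∉ Z →
       ∃ λ xs → W u xs w × (∀ {x} → x ∈ xs → col x ≡ c × x ∉ Z)
     connected ¬sep Z lt u w cu cw u∉ w∉ = go (suc n) (u ∷ []) ([] ∷ []) (here ≡.refl)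
       (λ { (here ≡.refl) → u ∷ [] , stop u , λ { (here ≡.refl) → cu , u∉ } }) (m≤n+m (suc n) 1)
       where
       Walk : Fin n → Set
       Walk x = ∃ λ xs → W u xs x × (∀ {y} → y ∈ xs → In Z y)
       go : ∀ k bs → Unique bs → u ∈ bs → (∀ {x} → x ∈ bs → Walk x) → suc n ≤ length bs + k → Walk w
       go zero bs ub _ _ le = ⊥-elim (<⇒≱ (≤-trans le (≤-reflexive (+-identityʳ _)))
         (≤-trans (length-⊆ ub (λ _ → ∈-allFin _)) (≤-reflexive (length-tabulate {n = n} id))))
       go (suc k) bs ub u∈ ws le with w ∈? bs
       ... | yes w∈ = ws w∈
       ... | no w∉bs with Fin.any? (λ x → Fin.any? λ y → (x ∈? bs) ×-dec (y ∉? bs) ×-dec In? Z y ×-dec E? x y)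
       ...   | yes (x , y , x∈ , y∉ , iy , e) = go k (y ∷ bs) (Unique-∷ y∉ ub) (there u∈)
               (λ { (here ≡.refl) → let xs , p , i = ws x∈ in xs ++ y ∷ [] , W-++ p e (stop y) , λ z∈ → ins xs i iy (∈-++⁻ xs z∈)
                  ; (there z∈) → ws z∈ })
               (≤-trans le (≤-reflexive (+-suc (length bs) k)))
         where
         ins : ∀ xs {y} → (∀ {z} → z ∈ xs → In Z z) → In Z y → ∀ {z} → z ∈ xs ⊎ z ∈ y ∷ [] → In Z z
         ins xs i iy (inj₁ z∈) = i z∈
         ins xs i iy (inj₂ (here ≡.refl)) = iy
       ...   | no none = ⊥-elim (¬sep (length Z , lt , Vec.fromList Z , B , subst (λ Z → Split Z B) (≡.sym (Vec.toList∘fromList Z))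
                 ((u , (cu , u∉) , mem⁺ u∈) , (w , (cw , w∉) , λ m → w∉bs (mem⁻ m))
                 , λ { x y (_ , mx) (iy , my) e → none (x , y , mem⁻ mx , (λ y∈ → my (mem⁺ y∈)) , iy , e) })))
         where
         B : Subset n
         B = Vec.tabulate (λ v → isYes (v ∈? bs))
         mem⁺ : ∀ {v} → v ∈ bs → T (Vec.lookup B v)
         mem⁺ {v} v∈ = subst T (≡.sym (Vec.lookup∘tabulate (λ v → isYes (v ∈? bs)) v)) (fromWitness v∈)
         mem⁻ : ∀ {v} → T (Vec.lookup B v) → v ∈ bs
         mem⁻ {v} m = toWitness (subst T (Vec.lookup∘tabulate (λ v → isYes (v ∈? bs)) v) m)

   reps : ∀ {k} (C : Colouring k) → ∃ λ vs → map (col C) vs ≡ pieces k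
   reps {k} C = go (pieces k) ∈-pieces⁻
     where
     go : ∀ cs → (∀ {c} → c ∈ cs → 1 ≤ c × c ≤ k) → ∃ λ vs → map (col C) vs ≡ cs
     go [] _ = [] , ≡.refl
     go (c ∷ cs) f = let v , e = rep C (proj₁ (f (here ≡.refl))) (proj₂ (f (here ≡.refl)))
                         vs , es = go cs (f ∘ there)
                     in v ∷ vs , ≡.cong₂ _∷_ e es

   -- One vertex from each piece gives an independent set.
   k≤a : ∀ {k} → Colouring k → k ≤ a
   k≤a {k} C with reps C
   ... | vs , e = ≤-trans (≤-reflexive (≡.trans (≡.sym (length-applyUpTo suc k)) (≡.trans (cong length (≡.sym e)) (length-map (col C) vs))))
     (ind vs (AllPairs.map noCl (AllPairs.zip (AllPairs.map⁻ (subst Unique (≡.sym e) (Unique.applyUpTo⁺₁ suc k (λ i<j _ q → <⇒≢ i<j (suc-injective q)))) , pos))))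
     where
     positive : All (λ v → col C v ≢ 0) vs
     positive = All.tabulate λ v∈ q → <⇒≢ (proj₁ (∈-pieces⁻ (subst (_ ∈_) e (∈-map⁺ (col C) v∈)))) (≡.sym q)
     pos : AllPairs (λ u v → col C u ≢ 0 × col C v ≢ 0) vs
     pos = mk vs positive
       where
       mk : ∀ vs → All (λ v → col C v ≢ 0) vs → AllPairs (λ u v → col C u ≢ 0 × col C v ≢ 0) vs
       mk [] [] = []
       mk (v ∷ vs) (p ∷ ps) = All.map (p ,_) ps ∷ mk vs ps
     noCl : ∀ {u v} → (col C u ≢ col C v × (col C u ≢ 0 × col C v ≢ 0)) → ¬ Cl u v
     noCl (ne , _ , _) (inj₁ ≡.refl) = ne ≡.refl
     noCl (ne , nu , nv) (inj₂ q) with apart C q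
     ... | inj₁ z = nu z
     ... | inj₂ (inj₁ z) = nv z
     ... | inj₂ (inj₂ z) = ne z

   -- Split the piece c along Z: the side B keeps colour c, the rest gets the new colour, Z is removed.
   module Refine {k : ℕ} (C : Colouring k) {c : ℕ} (1≤c : 1 ≤ c) (c≤k : c ≤ k) {j : ℕ} (j<t : j < t) (Zv : Vec (Fin n) j) (B : Subset n)
                 (sp : Split (col C) c (Vec.toList Zv) B) where
     Z = Vec.toList Zv
     inB = λ v → T (Vec.lookup B v)

     -- The new colour is described together with the reason for it, so that an edge is treated by
     -- cases on the reasons at its ends; `unview` shows that the colour is determined.
     data View (v : Fin n) : ℕ → Set where
       other : col C v ≢ c → View v (col C v)
       cut   : col C v ≡ c → v ∈ Z → View v 0
       left  : In (col C) c Z v → inB v → View v c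
       right : In (col C) c Z v → ¬ inB v → View v (suc k)

     view : ∀ v → ∃ (View v)
     view v with col C v ≟ℕ c | v ∈? Z | T? (Vec.lookup B v)
     ... | no p | _ | _ = _ , other p
     ... | yes p | yes q | _ = _ , cut p q
     ... | yes p | no q | yes r = _ , left (p , q) r
     ... | yes p | no q | no r = _ , right (p , q) r

     unview : ∀ {v x y} → View v x → View v y → x ≡ y
     unview (other _) (other _) = ≡.refl
     unview (other p) (cut q _) = ⊥-elim (p q)
     unview (other p) (left (q , _) _) = ⊥-elim (p q)
     unview (other p) (right (q , _) _) = ⊥-elim (p q)
     unview (cut q _) (other p) = ⊥-elim (p q)
     unview (left (q , _) _) (other p) = ⊥-elim (p q)
     unview (right (q , _) _) (other p) = ⊥-elim (p q)
     unview (cut _ _) (cut _ _) = ≡.refl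
     unview (cut _ z) (left (_ , z′) _) = ⊥-elim (z′ z)
     unview (cut _ z) (right (_ , z′) _) = ⊥-elim (z′ z)
     unview (left (_ , z′) _) (cut _ z) = ⊥-elim (z′ z)
     unview (right (_ , z′) _) (cut _ z) = ⊥-elim (z′ z)
     unview (left _ _) (left _ _) = ≡.refl
     unview (left _ b) (right _ b′) = ⊥-elim (b′ b)
     unview (right _ b′) (left _ b) = ⊥-elim (b′ b)
     unview (right _ _) (right _ _) = ≡.refl

     apart-c : ∀ {u v} → E u v → col C u ≢ c → col C v ≡ c → col C u ≡ 0
     apart-c e ne cv with apart C e
     ... | inj₁ z = z
     ... | inj₂ (inj₁ z) = ⊥-elim (<⇒≢ 1≤c (≡.trans (≡.sym z) cv))
     ... | inj₂ (inj₂ z) = ⊥-elim (ne (≡.trans z cv))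

     apart′ : ∀ {u v x y} → E u v → View u x → View v y → x ≡ 0 ⊎ y ≡ 0 ⊎ x ≡ y
     apart′ e (other _) (other _) = apart C e
     apart′ e (cut _ _) _ = inj₁ ≡.refl
     apart′ e _ (cut _ _) = inj₂ (inj₁ ≡.refl)
     apart′ e (other p) (left (q , _) _) = inj₁ (apart-c e p q)
     apart′ e (other p) (right (q , _) _) = inj₁ (apart-c e p q)
     apart′ e (left (q , _) _) (other p) = inj₂ (inj₁ (apart-c (E-sym e) p q))
     apart′ e (right (q , _) _) (other p) = inj₂ (inj₁ (apart-c (E-sym e) p q))
     apart′ e (left _ _) (left _ _) = inj₂ (inj₂ ≡.refl)
     apart′ e (right _ _) (right _ _) = inj₂ (inj₂ ≡.refl)
     apart′ e (left i b) (right i′ b′) = ⊥-elim (proj₂ (proj₂ sp) _ _ (i , b) (i′ , b′) e)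
     apart′ e (right i′ b′) (left i b) = ⊥-elim (proj₂ (proj₂ sp) _ _ (i , b) (i′ , b′) (E-sym e))

     max′ : ∀ {v x} → View v x → x ≤ suc k
     max′ (other _) = m≤n⇒m≤1+n (colMax C _)
     max′ (cut _ _) = z≤n
     max′ (left _ _) = m≤n⇒m≤1+n c≤k
     max′ (right _ _) = ≤-refl

     col′ : Fin n → ℕ
     col′ v = proj₁ (view v)

     refined : Colouring (suc k)
     refined = record
       { col = col′
       ; apart = λ {u} {v} e → apart′ e (proj₂ (view u)) (proj₂ (view v))
       ; rep = rep′
       ; colMax = λ v → max′ (proj₂ (view v))
       ; removed = ≤-trans (length-⊆ (Unique.filter⁺ (λ v → col′ v ≟ℕ 0) (Unique.allFin⁺ n)) sub)
           (≤-trans (≤-reflexive (length-++ (filter (λ v → col C v ≟ℕ 0) (allFin n))))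
           (≤-trans (+-mono-≤ (removed C) (≤-trans (≤-reflexive (Vec.length-toList Zv)) (<⇒≤ j<t)))
           (≤-reflexive (≡.trans (+-comm (t * k) t) (≡.sym (*-suc t k)))))) }
       where
       rep′ : ∀ {c′} → 1 ≤ c′ → c′ ≤ suc k → ∃ λ v → col′ v ≡ c′
       rep′ {c′} p q with c′ ≟ℕ suc k
       ... | yes ≡.refl = let w , i , b = proj₁ (proj₂ sp) in w , unview (proj₂ (view w)) (right i b)
       ... | no ne with c′ ≟ℕ c
       ...   | yes ≡.refl = let u , i , b = proj₁ sp in u , unview (proj₂ (view u)) (left i b)
       ...   | no ne′ = let v , e = rep C p (≤-pred (≤∧≢⇒< q ne)) in v , ≡.trans (unview (proj₂ (view v)) (other (λ z → ne′ (≡.trans (≡.sym e) z)))) e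
       zero-⊆ : ∀ {v x} → x ≡ 0 → View v x → v ∈ filter (λ v → col C v ≟ℕ 0) (allFin n) ⊎ v ∈ Z
       zero-⊆ e (other _) = inj₁ (∈-filter⁺ (λ v → col C v ≟ℕ 0) (∈-allFin _) e)
       zero-⊆ e (cut _ z) = inj₂ z
       zero-⊆ e (left _ _) = ⊥-elim (<⇒≢ 1≤c (≡.sym e))
       zero-⊆ () (right _ _)
       sub : filter (λ v → col′ v ≟ℕ 0) (allFin n) ⊆ filter (λ v → col C v ≟ℕ 0) (allFin n) ++ Z
       sub {v} v∈ with zero-⊆ (proj₂ (∈-filter⁻ (λ v → col′ v ≟ℕ 0) {xs = allFin n} v∈)) (proj₂ (view v))
       ... | inj₁ p = ∈-++⁺ˡ p
       ... | inj₂ p = ∈-++⁺ʳ _ p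

   -- Every refinement adds a piece and there are never more than a pieces, so the refinements come
   -- to an end.
   decompose : Fin n → ∃ λ k → 1 ≤ k × Σ (Colouring k) λ C → ∀ {c} → 1 ≤ c → c ≤ k → ¬ Sep (col C) c
   decompose v₀ = go a 1 (s≤s z≤n) ≤-refl record
     { col = λ _ → 1 ; apart = λ _ → inj₂ (inj₂ ≡.refl) ; rep = λ p q → v₀ , ≤-antisym p q ; colMax = λ _ → ≤-refl
     ; removed = ≤-trans (≤-reflexive (cong length (filter-none (λ _ → 1 ≟ℕ 0) {xs = allFin n} (All.tabulate λ _ ())))) z≤n }
     where
     go : ∀ f k → 1 ≤ k → suc a ≤ k + f → Colouring k → ∃ λ k → 1 ≤ k × Σ (Colouring k) λ C → ∀ {c} → 1 ≤ c → c ≤ k → ¬ Sep (col C) c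
     go zero k _ le C = ⊥-elim (<⇒≱ (≤-trans le (≤-reflexive (+-identityʳ k))) (k≤a C))
     go (suc f) k 1≤k le C with Any.any? (sep? (col C)) (pieces k)
     ... | no none = k , 1≤k , C , λ p q s → All.lookup (All.¬Any⇒All¬ _ none) (∈-pieces p q) s
     ... | yes some with c , c∈ , j , j<t , Z , B , sp ← find some =
           let p , q = ∈-pieces⁻ c∈ in go f (suc k) (s≤s z≤n) (≤-trans le (≤-reflexive (+-suc k f))) (Refine.refined C p q j<t Z B sp)

 module FanPath {V : Set} (_≟_ : DecidableEquality V) (E : V → V → Set) (E? : ∀ x y → Dec (E x y)) (E-sym : ∀ {x y} → E x y → E y x)
                (a : ℕ) (ind : ∀ zs → Walks.Indep _≟_ E E? E-sym zs → length zs ≤ a) where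
   open Walks _≟_ E E? E-sym
   open System _≟_ E E? E-sym a ind (λ _ → 0)

   -- Gallai–Milgram for undirected graphs: the vertices can be covered by at most a paths.
   cover : ∀ f ps → length ps ≤ f → Unique (verts ps) → ∃ λ qs → verts qs ↭ verts ps × length qs ≤ a
   cover f ps le u with length ps ≤? a
   ... | yes p = ps , refl , p
   cover zero [] _ u | no ¬p = ⊥-elim (¬p z≤n)
   cover (suc f) ps le u | no ¬p with search (λ P P′ → Cl? (h P) (h P′)) ps
   ... | inj₁ ap = ⊥-elim (¬p (≤-trans (≤-reflexive (≡.sym (length-map h ps))) (ind (map h ps) (AllPairs.map⁺ ap))))
   ... | inj₂ (as , P , bs , P′ , cs , ≡.refl , inj₁ e) = ⊥-elim (AllPairs-at as (AllPairs.map⁻ (heads-unique ps u)) e)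
   ... | inj₂ (as , P , bs , P′ , cs , ≡.refl , inj₂ e) =
         let qs , p , l = cover f (Q ∷ r) (≤-pred (≤-trans (≤-reflexive (≡.sym (Perm.↭-length perm))) le)) (Unique-↭ vp u) in qs , trans p (↭-sym vp) , l
     where
     Q = path (W-++ (W-rev (walk P)) e (walk P′))
     r = as ++ bs ++ cs
     perm : ps ↭ P ∷ P′ ∷ r
     perm = trans (shift P as (bs ++ P′ ∷ cs)) (prep P (trans (Perm.++⁺ˡ as (shift P′ bs cs)) (shift P′ as (bs ++ cs))))
     vp : verts ps ↭ verts (Q ∷ r)
     vp = trans (concatMap-↭ vs perm) (trans (↭-reflexive (≡.sym (++-assoc (vs P) (vs P′) (verts r))))
       (Perm.++⁺ʳ (verts r) (Perm.++⁺ʳ (vs P′) (↭-sym (Perm.↭-reverse (vs P))))))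

   -- Pigeonhole on a cover of N by at most a paths.
   longPath : ∀ N m → Unique N → a * m < length N → ∃ λ P → vs P ⊆ N × Unique (vs P) × m < length (vs P)
   longPath N m u lt with cover (length (map sg N)) (map sg N) ≤-refl (subst Unique (≡.sym (sgs N)) u)
     where
     sg : V → Path
     sg z = path (stop z)
     sgs : ∀ N → verts (map sg N) ≡ N
     sgs [] = ≡.refl
     sgs (z ∷ N) = cong (z ∷_) (sgs N)
   ... | qs , p , le with Any.any? (λ P → suc m ≤? length (vs P)) qs
   ...   | yes some = let P , P∈ , lm = find some in P , (λ x∈ → ∈-resp-↭ p′ (∈-concatMap⁺ vs (Any.map (λ { ≡.refl → x∈ }) P∈))) , uniq qs P∈ (Unique-↭ (↭-sym p′) u) , lm
     where
     sgs : ∀ N → verts (map (λ z → path (stop z)) N) ≡ N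
     sgs [] = ≡.refl
     sgs (z ∷ N) = cong (z ∷_) (sgs N)
     p′ : verts qs ↭ N
     p′ = trans p (↭-reflexive (sgs N))
     uniq : ∀ qs {P} → P ∈ qs → Unique (verts qs) → Unique (vs P)
     uniq (Q ∷ qs) (here ≡.refl) u = proj₁ (Unique-++⁻ (vs Q) u)
     uniq (Q ∷ qs) (there P∈) u = uniq qs P∈ (proj₁ (proj₂ (Unique-++⁻ (vs Q) u)))
   ...   | no none = ⊥-elim (<⇒≱ lt (≤-trans (≤-reflexive (≡.sym (Perm.↭-length (trans p (↭-reflexive (sgs N))))))
           (≤-trans (short qs (All.map (λ q → ≤-pred (≰⇒> q)) (All.¬Any⇒All¬ _ none))) (*-monoˡ-≤ m le))))
     where
     sgs : ∀ N → verts (map (λ z → path (stop z)) N) ≡ N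
     sgs [] = ≡.refl
     sgs (z ∷ N) = cong (z ∷_) (sgs N)
     short : ∀ qs → All (λ P → length (vs P) ≤ m) qs → length (verts qs) ≤ length qs * m
     short [] [] = z≤n
     short (Q ∷ qs) (p ∷ ps) = ≤-trans (≤-reflexive (length-++ (vs Q))) (+-mono-≤ p (short qs ps))

 module TreeBuild {V : Set} (_≟_ : DecidableEquality V) (E : V → V → Set) (E? : ∀ x y → Dec (E x y)) (E-sym : ∀ {x y} → E x y → E y x)
                  (a : ℕ) (ind : ∀ zs → Walks.Indep _≟_ E E? E-sym zs → length zs ≤ a) (col : V → ℕ) (k : ℕ)
                  (Ps Cs : List V) (disj : ∀ {x} → x ∈ Ps → x ∉ Cs) (F : V → Maybe V) where
   open Walks _≟_ E E? E-sym
   open System _≟_ E E? E-sym a ind col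
   open Route _≟_ E E? E-sym a ind col 1
   open import Data.List.Membership.DecPropositional Data.Nat.Properties._≟_ using (_∈?_; _∉?_)

   -- A vertex y of `Ps` may be used only for the edge to `F y`. This restriction makes the tree
   -- edges disjoint, although several of them may leave the same piece.
   Crossing : List ℕ → Set
   Crossing S = ∃₂ λ y x → y ∈ Ps × x ∈ Cs × F y ≡ just x × E y x × col y ∈ S × col x ∈ pieces k × col x ∉ S

   record Good (P : Path) : Set where
     field
       l∈ : l P ∈ Ps
       h∈ : h P ∈ Cs
       F≡ : F (l P) ≡ just (h P)
       vs≡ : vs P ≡ h P ∷ l P ∷ []
   open Good

   spanning : 1 ≤ k → (∀ S → 1 ∈ S → (∀ {c} → c ∈ S → c ∈ pieces k) → (∃ λ c → c ∈ pieces k × c ∉ S) → Crossing S) →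
     ∃₂ λ cs es → Tree cs es × Unique cs × (∀ {c} → c ∈ cs → c ∈ pieces k) × (∀ {c} → c ∈ pieces k → c ∈ cs) × (∀ {P} → P ∈ es → Good P)
   spanning 1≤k cross = go k root ([] ∷ []) (λ { (here ≡.refl) → ∈-pieces ≤-refl 1≤k }) (λ ()) ≤-refl
     where
     go : ∀ f {cs es} → Tree cs es → Unique cs → (∀ {c} → c ∈ cs → c ∈ pieces k) → (∀ {P} → P ∈ es → Good P) → suc k ≤ length cs + f →
       ∃₂ λ cs es → Tree cs es × Unique cs × (∀ {c} → c ∈ cs → c ∈ pieces k) × (∀ {c} → c ∈ pieces k → c ∈ cs) × (∀ {P} → P ∈ es → Good P)
     go zero T u sub _ le = ⊥-elim (<⇒≱ (≤-trans le (≤-reflexive (+-identityʳ _))) (≤-trans (length-⊆ u sub) (≤-reflexive (length-applyUpTo suc k))))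
     go (suc f) {cs} {es} T u sub gd le with Any.any? (_∉? cs) (pieces k)
     ... | no none = cs , es , T , u , sub , (λ c∈ → decidable-stable (_ ∈? cs) (All.lookup (All.¬Any⇒All¬ _ none) c∈)) , gd
     ... | yes some with cross cs (ρ∈ T) sub (find some)
     ...   | y , x , y∈ , x∈ , Fy , e , cy , cx , cx∉ = go f (grow T (path (step (E-sym e) (stop y))) cy cx∉) (Unique-∷ cx∉ u)
               (λ { (here ≡.refl) → cx ; (there c∈) → sub c∈ })
               (λ { (here ≡.refl) → record { l∈ = y∈ ; h∈ = x∈ ; F≡ = Fy ; vs≡ = ≡.refl } ; (there P∈) → gd P∈ })
               (≤-trans le (≤-reflexive (+-suc (length cs) f)))

   good-verts : ∀ es → (∀ {P} → P ∈ es → Good P) → ∀ {z} → z ∈ verts es → ∃ λ P → P ∈ es × (z ≡ h P ⊎ z ≡ l P)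
   good-verts (P ∷ es) gd z∈ with ∈-++⁻ (vs P) z∈
   ... | inj₂ q = let P , P∈ , r = good-verts es (gd ∘ there) q in P , there P∈ , r
   ... | inj₁ q with subst (_ ∈_) (vs≡ (gd (here ≡.refl))) q
   ...   | here e = P , here ≡.refl , inj₁ e
   ...   | there (here e) = P , here ≡.refl , inj₂ e

   end∈ : ∀ {es P} → P ∈ es → h P ∈ ends es × l P ∈ ends es
   end∈ (here ≡.refl) = here ≡.refl , there (here ≡.refl)
   end∈ (there P∈) = let p , q = end∈ P∈ in there (there p) , there (there q)

   -- The vertices in `Cs` have different colours, since each attaches a new one. The vertices in
   -- `Ps` differ because equal ones would have equal images under `F`.
   tree-unique : ∀ {cs es} → Tree cs es → (∀ {P} → P ∈ es → Good P) → Unique (verts es)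
   tree-unique root _ = []
   tree-unique (grow {cs} {es} T P l∈cs h∉cs) gd rewrite vs≡ (gd (here ≡.refl)) =
     Unique-∷ (λ { (here e) → disj (l∈ gP) (subst (_∈ Cs) e (h∈ gP)) ; (there z∈) → hNew (good-verts es gd′ z∈) })
       (Unique-∷ (λ z∈ → lNew (good-verts es gd′ z∈)) (tree-unique T gd′))
     where
     gP = gd (here ≡.refl)
     gd′ = λ {Q} (Q∈ : Q ∈ es) → gd (there Q∈)
     hNew : ¬ (∃ λ Q → Q ∈ es × (h P ≡ h Q ⊎ h P ≡ l Q))
     hNew (Q , Q∈ , inj₁ e) = h∉cs (subst (λ z → col z ∈ cs) (≡.sym e) (tree-ends T (proj₁ (end∈ Q∈))))
     hNew (Q , Q∈ , inj₂ e) = disj (l∈ (gd′ Q∈)) (subst (_∈ Cs) e (h∈ gP))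
     lNew : ¬ (∃ λ Q → Q ∈ es × (l P ≡ h Q ⊎ l P ≡ l Q))
     lNew (Q , Q∈ , inj₁ e) = disj (l∈ gP) (subst (_∈ Cs) (≡.sym e) (h∈ (gd′ Q∈)))
     lNew (Q , Q∈ , inj₂ e) = h∉cs (subst (λ z → col z ∈ cs) (just-injective (≡.trans (≡.sym (F≡ (gd′ Q∈))) (≡.trans (cong F (≡.sym e)) (F≡ gP)))) (tree-ends T (proj₁ (end∈ Q∈))))

-- The fan and the pieces of a graph with large minimum degree.

module GraphSetup where

 open import Data.Empty using (⊥-elim)
 open import Data.List.Base hiding (find; lookup)
 open import Data.List.Properties
 open import Data.List.Membership.Propositional using (_∈_; _∉_; find)
 open import Data.List.Membership.Propositional.Properties
 open import Data.List.Relation.Unary.All as All using (All; []; _∷_)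
 import Data.List.Relation.Unary.All.Properties as All
 open import Data.List.Relation.Unary.Any as Any using (here; there)
 open import Data.List.Relation.Unary.AllPairs as AllPairs using (AllPairs; []; _∷_)
 import Data.List.Relation.Unary.AllPairs.Properties as AllPairs
 open import Data.List.Relation.Unary.Unique.Propositional using (Unique)
 import Data.List.Relation.Unary.Unique.Propositional.Properties as Unique
 open import Data.List.Relation.Binary.Permutation.Propositional
 open import Data.List.Relation.Binary.Permutation.Propositional.Properties as Perm using ()
 import Data.List.Relation.Binary.Permutation.Setoid.Properties as PermS
 open import Data.Nat.Base
 open import Data.Nat.Properties
 open import Data.Product.Base using (∃; _×_; _,_; proj₁; proj₂)
 open import Data.Sum.Base using (inj₁; inj₂)
 open import Function.Base using (_∘_; id; case_of_)
 open import Relation.Binary.PropositionalEquality as ≡ using (_≡_; _≢_; cong; subst)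
 open import Relation.Nullary
 open import Relation.Unary using (Decidable)

 open Lists
 open WalkJoining
 open Extension
 open PathSystems
 open TreeRouting
 open Pieces
 open import Data.Bool.Base using (Bool; T)
 open import Data.Bool.Properties using (T?)
 open import Data.Fin.Base as Fin using (Fin)
 import Data.Fin.Properties as Fin
 open import Defs using (Graph; Adj; adj; adj-sym)
 open import Relation.Nullary.Decidable using (¬?)


 module GraphWalks {n : ℕ} (G : Graph n) where
   E? : ∀ x y → Dec (Adj G x y)
   E? x y = T? (adj G x y)

   E-sym : ∀ {x y} → Adj G x y → Adj G y x
   E-sym {x} {y} = subst T (adj-sym G x y)

   open Walks (Fin._≟_ {n}) (Adj G) E? E-sym public

 map-W : ∀ {n} {G H : Graph n} → (∀ {x y} → Adj G x y → Adj H x y) → ∀ {u xs w} → GraphWalks.W G u xs w → GraphWalks.W H u xs w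
 map-W f (Walks.stop u) = Walks.stop u
 map-W {G = G} {H} f (Walks.step e p) = Walks.step (f e) (map-W {G = G} {H} f p)

 module _ {n : ℕ} (G : Graph n) (a us : ℕ) where
   open GraphWalks G

   -- The extra 2a + 2 vertices are v, p and Y, which are taken out of the pieces after the
   -- decomposition.
   connectivity : ℕ
   connectivity = us + suc (suc (a + a))

   -- A bound on the number of vertices outside the pieces.
   waste : ℕ
   waste = connectivity * a + suc (suc (a + a))

   -- The path to be built runs from v through v′ into piece 1 and returns through p′ to p. All of
   -- `p ∷ Y` is adjacent to v, so the cycle can be closed after any initial segment of Y.
   record Setup (δ : ℕ) : Set where
     field
       k : ℕ
       1≤k : 1 ≤ k
       k≤a : k ≤ a
       col : Fin n → ℕ
       colMax : ∀ x → col x ≤ k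
       v p v′ p′ z : Fin n
       Y : List (Fin n)
       fan : W p (p ∷ Y) z
       spokes : ∀ {x} → x ∈ p ∷ Y → Adj G x v
       uniqueD : Unique (v ∷ p ∷ Y)
       lengthY : length Y ≡ a + a
       colD : ∀ {x} → x ∈ v ∷ p ∷ Y → col x ≡ 0
       colv′ : col v′ ≡ 1
       colp′ : col p′ ≡ 1
       v′v : Adj G v′ v
       p′p : Adj G p′ p
       v′≢p′ : v′ ≢ p′
       conn : ∀ c → 1 ≤ c → c ≤ k → ∀ Z → length Z < us → ∀ u w → col u ≡ c → col w ≡ c → u ∉ Z → w ∉ Z →
               ∃ λ xs → W u xs w × (∀ {x} → x ∈ xs → col x ≡ c × x ∉ Z)
       big : ∀ c → 1 ≤ c → c ≤ k → ∃ λ bs → Unique bs × (∀ {x} → x ∈ bs → col x ≡ c) × δ ≤ length bs + waste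
       nbrs : ∀ w → ∃ λ xs → Unique xs × (∀ {x} → x ∈ xs → Adj G w x × col x ≢ 0) × δ ≤ length xs + waste
       zeros : length (filter (λ x → col x ≟ℕ 0) (allFin n)) ≤ waste

   module _ (ind : ∀ zs → Indep zs → length zs ≤ a) (δ : ℕ)
            (deg : ∀ v → ∃ λ nb → Unique nb × (∀ {x} → x ∈ nb → Adj G v x) × δ ≤ length nb)
            (large : a * (a + a) + a + 4 + waste ≤ δ) (v₀ : Fin n) where
     open Decompose (Adj G) E? E-sym a ind (connectivity)
     open import Data.List.Membership.DecPropositional (Fin._≟_ {n}) using (_∈?_; _∉?_)

     module Stage₁ {k : ℕ} (1≤k : 1 ≤ k) (C : Colouring k) (nosep : ∀ {c} → 1 ≤ c → c ≤ k → ¬ Sep (Colouring.col C) c) where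
       col₀ = Colouring.col C
       zs₀ = filter (λ x → col₀ x ≟ℕ 0) (allFin n)
       zs≤ : length zs₀ ≤ connectivity * a
       zs≤ = ≤-trans (Colouring.removed C) (*-monoʳ-≤ (connectivity) (k≤a C))
       inPiece : ∀ w {c} → 1 ≤ c → col₀ w ≡ c → ∃ λ xs → Unique xs × (∀ {x} → x ∈ xs → Adj G w x × col₀ x ≡ c) × δ ≤ length xs + connectivity * a
       inPiece w {c} 1≤c cw with deg w
       ... | nb , unb , ad , le = filter (λ x → col₀ x ≟ℕ c) nb , Unique.filter⁺ _ unb
         , (λ x∈ → let x∈nb , cx = ∈-filter⁻ (λ x → col₀ x ≟ℕ c) x∈ in ad x∈nb , cx)
         , ≤-trans le (≤-trans (length-⊆ unb sub) (≤-trans (≤-reflexive (length-++ (filter (λ x → col₀ x ≟ℕ c) nb))) (+-monoʳ-≤ _ zs≤)))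
         where
         sub : nb ⊆ filter (λ x → col₀ x ≟ℕ c) nb ++ zs₀
         sub {x} x∈ with Colouring.apart C (ad x∈)
         ... | inj₁ e = ⊥-elim (<⇒≢ 1≤c (≡.trans (≡.sym e) cw))
         ... | inj₂ (inj₁ e) = ∈-++⁺ʳ (filter (λ x → col₀ x ≟ℕ c) nb) (∈-filter⁺ (λ x → col₀ x ≟ℕ 0) (∈-allFin x) e)
         ... | inj₂ (inj₂ e) = ∈-++⁺ˡ (∈-filter⁺ (λ x → col₀ x ≟ℕ c) x∈ (≡.trans (≡.sym e) cw))
       slack : ∀ {m x y} → δ ≤ length m + x → y + x ≤ δ → y ≤ length {A = Fin n} m
       slack {m} {x} {y} p q = +-cancelʳ-≤ x y (length m) (≤-trans q p)
       -- Discounting the deleted vertices, a piece still contains more than 2a² neighbours, enough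
       -- for `longPath`, and more than 2a + 3, enough to choose v′ and p′ outside the fan.
       room : ∀ xs → δ ≤ length {A = Fin n} xs + connectivity * a → (a * (a + a) + a + 4) + suc (suc (a + a)) ≤ length xs
       room xs le = slack {xs} le (≤-trans (≤-reflexive (≡.trans (+-assoc (a * (a + a) + a + 4) _ _) (cong (a * (a + a) + a + 4 +_) (+-comm _ (connectivity * a))))) large)
       module Stage₂ {v : Fin n} (cv : col₀ v ≡ 1) {N : List (Fin n)} (uN : Unique N) (adjN : ∀ {x} → x ∈ N → Adj G v x × col₀ x ≡ 1)
                     {p z : Fin n} {Yr : List (Fin n)} (walkP : W p (p ∷ Yr) z) (P⊆N : p ∷ Yr ⊆ N) (uP : Unique (p ∷ Yr)) (lenP : a + a < length (p ∷ Yr)) where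
         Y = take (a + a) Yr
         D : List (Fin n)
         D = v ∷ p ∷ Y
         pY⊆ : ∀ {x} → x ∈ p ∷ Y → x ∈ N
         pY⊆ (here e) = P⊆N (here e)
         pY⊆ (there x∈) = P⊆N (there (subst (_ ∈_) (take++drop≡id (a + a) Yr) (∈-++⁺ˡ x∈)))
         lenY : length Y ≡ a + a
         lenY = ≡.trans (length-take (a + a) Yr) (m≤n⇒m⊓n≡m (≤-pred lenP))
         lenD : length D ≡ suc (suc (a + a))
         lenD = cong (λ m → suc (suc m)) lenY
         irr : ∀ {x} → ¬ Adj G x x
         irr {x} e rewrite Graph.adj-irr G x = e
         uD : Unique D
         uD = Unique-∷ (λ v∈ → irr (proj₁ (adjN (pY⊆ v∈)))) (Unique.take⁺ (suc (a + a)) uP)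
         col : Fin n → ℕ
         col x with x ∈? D
         ... | yes _ = 0
         ... | no _ = col₀ x
         col-D : ∀ {x} → x ∈ D → col x ≡ 0
         col-D {x} x∈ with x ∈? D
         ... | yes _ = ≡.refl
         ... | no x∉ = ⊥-elim (x∉ x∈)
         col-off : ∀ {x} → x ∉ D → col x ≡ col₀ x
         col-off {x} x∉ with x ∈? D
         ... | yes x∈ = ⊥-elim (x∉ x∈)
         ... | no _ = ≡.refl
         col-pos : ∀ {x c} → 1 ≤ c → col x ≡ c → x ∉ D × col₀ x ≡ c
         col-pos {x} 1≤c e with x ∈? D
         ... | yes _ = ⊥-elim (<⇒≢ 1≤c e)
         ... | no x∉ = x∉ , e
         avoid : ∀ xs → δ ≤ length xs + connectivity * a → suc (suc (suc (a + a))) < length xs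
         avoid xs le = ≤-trans (+-monoˡ-≤ (suc (suc (a + a))) (≤-trans (s≤s (s≤s (z≤n {2}))) (m≤n+m 4 (a * (a + a) + a)))) (room xs le)
         zeros′ : length (filter (λ x → col x ≟ℕ 0) (allFin n)) ≤ waste
         zeros′ = ≤-trans (length-⊆ (Unique.filter⁺ (λ x → col x ≟ℕ 0) (Unique.allFin⁺ n)) sub)
             (≤-trans (≤-reflexive (length-++ zs₀)) (+-mono-≤ zs≤ (≤-reflexive lenD)))
           where
           sub : filter (λ x → col x ≟ℕ 0) (allFin n) ⊆ zs₀ ++ D
           sub {x} x∈ with x ∈? D
           ... | yes q = ∈-++⁺ʳ zs₀ q
           ... | no q = ∈-++⁺ˡ (∈-filter⁺ (λ x → col₀ x ≟ℕ 0) (∈-allFin x) (≡.trans (≡.sym (col-off q)) (proj₂ (∈-filter⁻ (λ x → col x ≟ℕ 0) {xs = allFin n} x∈))))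
         big′ : ∀ c → 1 ≤ c → c ≤ k → ∃ λ bs → Unique bs × (∀ {x} → x ∈ bs → col x ≡ c) × δ ≤ length bs + waste
         big′ c 1≤c c≤k with Colouring.rep C 1≤c c≤k
         ... | w , cw with inPiece w 1≤c cw
         ...   | xs , ux , f , le = filter (_∉? D) xs , Unique.filter⁺ (_∉? D) ux
             , (λ x∈ → let x∈xs , x∉ = ∈-filter⁻ (_∉? D) {xs = xs} x∈ in ≡.trans (col-off x∉) (proj₂ (f x∈xs)))
             , ≤-trans le (≤-trans (+-monoˡ-≤ (connectivity * a) (≤-trans (length-⊆ ux sub) (≤-reflexive (≡.trans (length-++ (filter (_∉? D) xs)) (cong (length (filter (_∉? D) xs) +_) lenD)))))
                (≤-reflexive (≡.trans (+-assoc (length (filter (_∉? D) xs)) _ _) (cong (length (filter (_∉? D) xs) +_) (+-comm _ (connectivity * a))))))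
           where
           sub : xs ⊆ filter (_∉? D) xs ++ D
           sub {x} x∈ with x ∈? D
           ... | yes q = ∈-++⁺ʳ (filter (_∉? D) xs) q
           ... | no q = ∈-++⁺ˡ (∈-filter⁺ (_∉? D) x∈ q)
         nbrs′ : ∀ w → ∃ λ xs → Unique xs × (∀ {x} → x ∈ xs → Adj G w x × col x ≢ 0) × δ ≤ length xs + waste
         nbrs′ w with deg w
         ... | nb , unb , ad , le = filter nz? nb , Unique.filter⁺ nz? unb
             , (λ x∈ → let x∈nb , cx = ∈-filter⁻ nz? {xs = nb} x∈ in ad x∈nb , cx)
             , ≤-trans le (≤-trans (length-⊆ unb sub) (≤-trans (≤-reflexive (length-++ (filter nz? nb))) (+-monoʳ-≤ _ zeros′)))
           where
           nz? : ∀ x → Dec (col x ≢ 0)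
           nz? x = ¬? (col x ≟ℕ 0)
           sub : nb ⊆ filter nz? nb ++ filter (λ x → col x ≟ℕ 0) (allFin n)
           sub {x} x∈ with nz? x
           ... | yes q = ∈-++⁺ˡ (∈-filter⁺ nz? x∈ q)
           ... | no q = ∈-++⁺ʳ (filter nz? nb) (∈-filter⁺ (λ x → col x ≟ℕ 0) (∈-allFin x) (decidable-stable (col x ≟ℕ 0) q))
         conn′ : ∀ c → 1 ≤ c → c ≤ k → ∀ Z → length Z < us → ∀ u w → col u ≡ c → col w ≡ c → u ∉ Z → w ∉ Z →
                 ∃ λ xs → W u xs w × (∀ {x} → x ∈ xs → col x ≡ c × x ∉ Z)
         conn′ c 1≤c c≤k Z lt u w cu cw u∉ w∉ with col-pos 1≤c cu | col-pos 1≤c cw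
         ... | u∉D , cu₀ | w∉D , cw₀ with connected col₀ c (nosep 1≤c c≤k) (Z ++ D) (≤-<-trans (≤-reflexive (≡.trans (length-++ Z) (cong (length Z +_) lenD))) (+-monoˡ-< (suc (suc (a + a))) lt))
                                          u w cu₀ cw₀ (λ q → case ∈-++⁻ Z q of λ { (inj₁ r) → u∉ r ; (inj₂ r) → u∉D r }) (λ q → case ∈-++⁻ Z q of λ { (inj₁ r) → w∉ r ; (inj₂ r) → w∉D r })
         ...   | xs , wk , ins = xs , wk , λ x∈ → let cx , x∉ = ins x∈ in ≡.trans (col-off (x∉ ∘ ∈-++⁺ʳ Z)) cx , x∉ ∘ ∈-++⁺ˡ
         ft = W-take (a + a) walkP
         result : ∀ {v′ p′} → v′ ∈ N → v′ ∉ D → Adj G p p′ → col₀ p′ ≡ 1 → p′ ∉ v′ ∷ D → Setup δ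
         result {v′} {p′} v′∈ v′∉ pp′ cp′ p′∉ = record
           { k = k ; 1≤k = 1≤k ; k≤a = k≤a C ; col = col ; colMax = colMax′ ; v = v ; p = p ; v′ = v′ ; p′ = p′ ; z = proj₁ ft ; Y = Y
           ; fan = proj₁ (proj₂ ft) ; spokes = λ x∈ → E-sym (proj₁ (adjN (pY⊆ x∈))) ; uniqueD = uD ; lengthY = lenY ; colD = col-D
           ; colv′ = ≡.trans (col-off v′∉) (proj₂ (adjN v′∈))
           ; colp′ = ≡.trans (col-off (λ q → p′∉ (there q))) cp′
           ; v′v = E-sym (proj₁ (adjN v′∈)) ; p′p = E-sym pp′
           ; v′≢p′ = λ e → p′∉ (here (≡.sym e))
           ; conn = conn′ ; big = big′ ; nbrs = nbrs′ ; zeros = zeros′ }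
           where
           colMax′ : ∀ x → col x ≤ k
           colMax′ x with x ∈? D
           ... | yes _ = z≤n
           ... | no _ = Colouring.colMax C x

     -- The fan is built in piece 1: the neighbours of v in it contain a path on more than 2a
     -- vertices, and `p ∷ Y` is its initial segment on 2a + 1 vertices.
     setup : Setup δ
     setup with decompose v₀
     ... | k , 1≤k , C , nosep with Colouring.rep C (s≤s z≤n) 1≤k
     ...   | v , cv with Stage₁.inPiece 1≤k C nosep v (s≤s z≤n) cv
     ...     | N , uN , adjN , leN with FanPath.longPath (Fin._≟_ {n}) (Adj G) E? E-sym a ind N (a + a) uN
                 (≤-trans (≤-trans (≤-reflexive (+-comm 1 (a * (a + a)))) (≤-trans (+-mono-≤ (m≤m+n (a * (a + a)) a) (s≤s (z≤n {3}))) (m≤m+n _ _))) (Stage₁.room 1≤k C nosep N leN))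
     ...       | System.path walkP , P⊆N , uP , lenP with W-head walkP
     ...         | Yr , ≡.refl with ∃∉ Fin._≟_ {xs = N} {ys = S.D} uN (≤-trans (s≤s (≤-reflexive S.lenD)) (<⇒≤ (S.avoid N leN)))
       where module S = Stage₁.Stage₂ 1≤k C nosep cv uN adjN walkP P⊆N uP lenP
     ...           | v′ , v′∈ , v′∉ with Stage₁.inPiece 1≤k C nosep _ (s≤s z≤n) (proj₂ (adjN (P⊆N (here ≡.refl))))
     ...             | Np , uNp , adjp , leNp with ∃∉ Fin._≟_ {xs = Np} {ys = v′ ∷ S.D} uNp (≤-trans (s≤s (s≤s (≤-reflexive S.lenD))) (S.avoid Np leNp))
       where module S = Stage₁.Stage₂ 1≤k C nosep cv uN adjN walkP P⊆N uP lenP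
     ...               | p′ , p′∈ , p′∉ = Stage₁.Stage₂.result 1≤k C nosep cv uN adjN walkP P⊆N uP lenP v′∈ v′∉ (proj₁ (adjp p′∈)) (proj₂ (adjp p′∈)) p′∉

-- Cycles of all lengths from two disjoint spanning trees of the pieces.

module CycleLengths where

 open import Data.List.Base hiding (find; lookup)
 open import Data.List.Properties
 open import Data.List.Membership.Propositional using (_∈_; _∉_; find)
 open import Data.List.Membership.Propositional.Properties
 open import Data.List.Relation.Unary.All as All using (All; []; _∷_)
 import Data.List.Relation.Unary.All.Properties as All
 open import Data.List.Relation.Unary.Any as Any using (here; there)
 open import Data.List.Relation.Unary.AllPairs as AllPairs using (AllPairs; []; _∷_)
 import Data.List.Relation.Unary.AllPairs.Properties as AllPairs
 open import Data.List.Relation.Unary.Unique.Propositional using (Unique)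
 import Data.List.Relation.Unary.Unique.Propositional.Properties as Unique
 open import Data.List.Relation.Binary.Permutation.Propositional
 open import Data.List.Relation.Binary.Permutation.Propositional.Properties as Perm using (∈-resp-↭)
 import Data.List.Relation.Binary.Permutation.Setoid.Properties as PermS
 open import Data.Nat.Base
 open import Data.Nat.Properties
 open import Data.Product.Base using (∃; _×_; _,_; proj₁; proj₂)
 open import Data.Sum.Base using (_⊎_; inj₁; inj₂)
 open import Function.Base using (_∘_; id)
 open import Relation.Binary.PropositionalEquality as ≡ using (_≡_; _≢_; cong; subst)
 open import Relation.Nullary
 open import Relation.Unary using (Decidable)

 open Lists
 open WalkJoining
 open Extension
 open PathSystems
 open TreeRouting
 open Pieces
 open GraphSetup
 open import Data.Bool.Base using (Bool; T)
 open import Data.Bool.Properties using (T-∨)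
 open import Data.Fin.Base as Fin using (Fin)
 import Data.Fin.Properties as Fin
 open import Data.Maybe.Base using (Maybe)
 open import Defs using (Graph; Adj; adj; _∪_)
 open import Function.Bundles using (Equivalence)
 open import Relation.Nullary.Decidable using (_×-dec_)

 module _ {V : Set} where
   open import Algebra.Solver.CommutativeMonoid (Perm.++-commutativeMonoid {A = V}) using (solve; _⊜_; _⊕_)

   gather₈ : ∀ (f e b : List V) → f ++ e ++ b ↭ e ++ f ++ b
   gather₈ = solve 3 (λ f e b → (f ⊕ (e ⊕ b)) ⊜ (e ⊕ (f ⊕ b))) ↭-refl

 adj-∪ˡ : ∀ {n} {G R : Graph n} {x y} → Adj G x y → Adj (G ∪ R) x y
 adj-∪ˡ = Equivalence.from T-∨ ∘ inj₁

 adj-∪ʳ : ∀ {n} {G R : Graph n} {x y} → Adj R x y → Adj (G ∪ R) x y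
 adj-∪ʳ {G = G} {R} {x} {y} e = Equivalence.from (T-∨ {x = adj G x y}) (inj₂ e)

 module _ {n : ℕ} (G R : Graph n) (a us δ : ℕ) (S : Setup G a us δ)
     (indG : ∀ zs → GraphWalks.Indep G zs → length zs ≤ a) where
   open Setup S
   open GraphWalks (G ∪ R)

   ind∪ : ∀ zs → Indep zs → length zs ≤ a
   ind∪ zs i = indG zs (AllPairs.map (λ nc → λ { (inj₁ e) → nc (inj₁ e) ; (inj₂ e) → nc (inj₂ (adj-∪ˡ {G = G} {R} e)) }) i)

   open System (Fin._≟_ {n}) (Adj (G ∪ R)) E? E-sym a ind∪ col
   open Route (Fin._≟_ {n}) (Adj (G ∪ R)) E? E-sym a ind∪ col 1
   open Extend (Fin._≟_ {n}) (Adj (G ∪ R)) E? E-sym a ind∪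
   open import Data.List.Membership.DecPropositional (Fin._≟_ {n}) using (_∈?_; _∉?_)

   module TB (Ps Cs : List (Fin n)) (disj : ∀ {x} → x ∈ Ps → x ∉ Cs) (F : Fin n → Maybe (Fin n)) =
     TreeBuild (Fin._≟_ {n}) (Adj (G ∪ R)) E? E-sym a ind∪ col k Ps Cs disj F

   IsPiece : Fin n → Set
   IsPiece x = 1 ≤ col x

   D : List (Fin n)
   D = v ∷ p ∷ Y

   piece∉D : ∀ {x} → IsPiece x → x ∉ D
   piece∉D 1≤ x∈ = <⇒≢ 1≤ (≡.sym (colD x∈))

   conn∪ : ∀ c → 1 ≤ c × c ≤ k → ∀ Z → length Z < us → ∀ u w → col u ≡ c → col w ≡ c → u ∉ Z → w ∉ Z →
           ∃ λ xs → W u xs w × (∀ {x} → x ∈ xs → col x ≡ c × x ∉ Z)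
   conn∪ c (p , q) Z lt u w cu cw u∉ w∉ = let xs , wk , f = conn c p q Z lt u w cu cw u∉ w∉ in
     xs , map-W {G = G} {G ∪ R} (adj-∪ˡ {G = G} {R}) wk , f

   Xv Xp : Path
   Xv = path (Walks.step (adj-∪ˡ {G = G} {R} v′v) (Walks.stop v))
   Xp = path (Walks.step (adj-∪ˡ {G = G} {R} p′p) (Walks.stop p))

   -- The number 4a + 4 counts at most 2a vertices on the edges of each tree and four on `Xv` and
   -- `Xp`; the further a + 2 are the loops of `addSingles`.
   module _ (U≥ : (4 * a + 4 + suc (suc a)) + costs a (4 * a + 4 + suc (suc a)) + costs a (4 * a + 4 + suc (suc a)) < us)
            (δ≥ : suc (suc a) + (4 * a + 4) + waste G a us ≤ δ)
            {cs₁ cs₂ : List ℕ} {es₁ es₂ : List Path} (T₁ : Tree cs₁ es₁) (T₂ : Tree cs₂ es₂)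
            (u₁ : Unique cs₁) (u₂ : Unique cs₂)
            (sub₁ : ∀ {c} → c ∈ cs₁ → c ∈ pieces k) (sup₁ : ∀ {c} → c ∈ pieces k → c ∈ cs₁)
            (sub₂ : ∀ {c} → c ∈ cs₂ → c ∈ pieces k) (sup₂ : ∀ {c} → c ∈ pieces k → c ∈ cs₂)
            (two₁ : ∀ {P} → P ∈ es₁ → length (vs P) ≡ 2) (two₂ : ∀ {P} → P ∈ es₂ → length (vs P) ≡ 2)
            (uEdges : Unique (verts es₂ ++ verts es₁))
            (pieceEdges : ∀ {x} → x ∈ verts es₂ ++ verts es₁ → IsPiece x × x ≢ v′ × x ≢ p′) where

     -- The join lies in the second tree and corrects the degrees of the first, so that together
     -- they have even degree at every piece but the root.
     J : Parity cs₂ es₂ es₁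
     J = tJoin T₂ es₁

     B₀ : List (Fin n)
     B₀ = v′ ∷ v ∷ p′ ∷ p ∷ []

     pc0 : ∀ {x} → x ≡ v′ ⊎ x ≡ p′ → IsPiece x
     pc0 (inj₁ ≡.refl) = ≤-reflexive (≡.sym colv′)
     pc0 (inj₂ ≡.refl) = ≤-reflexive (≡.sym colp′)

     uB₀ : Unique B₀
     uB₀ = Unique-∷ (λ { (here e) → piece∉D (pc0 (inj₁ ≡.refl)) (here e) ; (there (here e)) → v′≢p′ e ; (there (there (here e))) → piece∉D (pc0 (inj₁ ≡.refl)) (there (here e)) })
          (Unique-∷ (λ { (here e) → piece∉D (pc0 (inj₂ ≡.refl)) (here (≡.sym e)) ; (there (here e)) → Unique-∉ uniqueD (here e) })
          (Unique-∷ (λ { (here e) → piece∉D (pc0 (inj₂ ≡.refl)) (there (here e)) }) ([] ∷ [])))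

     uAll₂ : Unique (verts es₂ ++ verts es₁ ++ B₀)
     uAll₂ = subst Unique (++-assoc (verts es₂) (verts es₁) B₀) (Unique-++ uEdges uB₀ λ x∈ →
       λ { (here e) → proj₁ (proj₂ (pieceEdges x∈)) e
         ; (there (here e)) → piece∉D (proj₁ (pieceEdges x∈)) (here e)
         ; (there (there (here e))) → proj₂ (proj₂ (pieceEdges x∈)) e
         ; (there (there (there (here e)))) → piece∉D (proj₁ (pieceEdges x∈)) (there (here e)) })

     tree-length : ∀ {cs es} → Tree cs es → length cs ≡ suc (length es)
     tree-length root = ≡.refl
     tree-length (grow T _ _ _) = cong suc (tree-length T)

     verts-length : ∀ es → (∀ {P} → P ∈ es → length (vs P) ≡ 2) → length (verts es) ≡ length es + length es
     verts-length [] _ = ≡.refl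
     verts-length (P ∷ es) f = ≡.trans (length-++ (vs P)) (≡.trans (≡.cong₂ _+_ (f (here ≡.refl)) (verts-length es (f ∘ there))) (cong suc (≡.sym (+-suc (length es) (length es)))))

     edges≤ : ∀ {cs es} → Tree cs es → Unique cs → (∀ {c} → c ∈ cs → c ∈ pieces k) → (∀ {P} → P ∈ es → length (vs P) ≡ 2) → length (verts es) ≤ a + a
     edges≤ {cs} {es} T u sub two = ≤-trans (≤-reflexive (verts-length es two)) (+-mono-≤ e≤ e≤)
       where
       e≤ : length es ≤ a
       e≤ = ≤-trans (n≤1+n _) (≤-trans (≤-reflexive (≡.sym (tree-length T))) (≤-trans (length-⊆ u sub) (≤-trans (≤-reflexive (length-applyUpTo suc k)) k≤a)))

     js : List Path
     js = Parity.js J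

     count≤ : length (verts es₁ ++ verts js ++ B₀) ≤ 4 * a + 4
     count≤ = ≤-trans (≤-reflexive (≡.trans (length-++ (verts es₁)) (cong (length (verts es₁) +_) (length-++ (verts js)))))
       (≤-trans (+-mono-≤ (edges≤ T₁ u₁ sub₁ two₁) (+-monoˡ-≤ 4 (≤-trans (Parity.jShort J) (edges≤ T₂ u₂ sub₂ two₂))))
       (≤-reflexive (solve 1 (λ a → (a :+ a) :+ ((a :+ a) :+ con 4) := con 4 :* a :+ con 4) ≡.refl a)))
       where
       open import Data.Nat.Solver using (module +-*-Solver)
       open +-*-Solver

     bigBs : ∀ c → 1 ≤ c × c ≤ k → ∃ λ bs → Unique bs × (∀ {x} → x ∈ bs → col x ≡ c) × suc (suc a) + (4 * a + 4) ≤ length bs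
     bigBs c (p , q) = let bs , u , f , le = big c p q in bs , u , f , +-cancelʳ-≤ (waste G a us) _ _ (≤-trans δ≥ le)

     routed : Routed us (4 * a + 4) U≥ (λ c → 1 ≤ c × c ≤ k) conn∪ bigBs Xv Xp colv′ colp′ cs₁ (verts es₁ ++ verts js ++ B₀)
     routed = run us (4 * a + 4) U≥ (λ c → 1 ≤ c × c ≤ k) conn∪ bigBs Xv Xp colv′ colp′ T₁ (λ c∈ → ∈-pieces⁻ (sub₁ c∈)) js
       (Unique-↭ (gather₈ (verts js) (verts es₁) B₀) (Parity.jUnique J (verts es₁ ++ B₀) uAll₂))
       (λ {c} _ → ≤-trans (cnt-≤ c (verts es₁ ++ verts js ++ B₀)) count≤)
       (λ e∈ → sup₁ (sub₂ (tree-ends T₂ (Parity.jEnds J e∈))))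
       (λ {c} c∈ ne → ≡.trans (cong odd (+-comm (cnt c (ends es₁)) (cnt c (ends js)))) (Parity.even J (sup₂ (sub₁ c∈)) ne))

     -- Y stays reserved for closing the path; everything else is to be covered.
     Ok : Fin n → Set
     Ok x = x ∉ Y

     module Finish (RT : Routed us (4 * a + 4) U≥ (λ c → 1 ≤ c × c ≤ k) conn∪ bigBs Xv Xp colv′ colp′ cs₁ (verts es₁ ++ verts js ++ B₀)) where
       module Q = Routed RT

       uq : Unique Q.q
       uq = Unique-fresh Q.perm Q.newFresh (Unique-↭ (gather₈ (verts js) (verts es₁) B₀) (Parity.jUnique J (verts es₁ ++ B₀) uAll₂))

       js⊆ : ∀ {x} → x ∈ verts js → IsPiece x
       js⊆ x∈ = proj₁ (pieceEdges (∈-++⁺ˡ (Parity.jSub J x∈)))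

       piece-ok : ∀ {x} → IsPiece x → Ok x
       piece-ok i x∈ = piece∉D i (there (there x∈))

       okq : ∀ {x} → x ∈ Q.q → Ok x
       okq x∈ with ∈-++⁻ Q.new (∈-resp-↭ Q.perm x∈)
       ... | inj₁ r = piece-ok (proj₁ (Q.newPc r))
       ... | inj₂ r with ∈-++⁻ (verts es₁) r
       ...   | inj₁ r′ = piece-ok (proj₁ (pieceEdges (∈-++⁺ʳ (verts es₂) r′)))
       ...   | inj₂ r′ with ∈-++⁻ (verts js) r′
       ...     | inj₁ r″ = piece-ok (js⊆ r″)
       ...     | inj₂ (here ≡.refl) = piece-ok (pc0 (inj₁ ≡.refl))
       ...     | inj₂ (there (here ≡.refl)) = λ y∈ → Unique-∉ uniqueD (there y∈)
       ...     | inj₂ (there (there (here ≡.refl))) = piece-ok (pc0 (inj₂ ≡.refl))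
       ...     | inj₂ (there (there (there (here ≡.refl)))) = Unique-∉ (AllPairs.tail uniqueD)

       -- A missing vertex of a piece is marked through the connectivity of the piece, which the
       -- path meets at least a + 2 times. If every piece is covered, a missing vertex has at least
       -- a + 2 neighbours in the pieces, and they all lie on the path.
       progress : ∀ q′ → W v q′ p → Unique q′ → Q.q ⊆ q′ → (∃ λ w → w ∉ q′ × Ok w) → ∃ λ w → w ∉ q′ × Marks Ok q′ w
       progress q′ pa u sub (w₀ , w₀∉ , okw₀) with Fin.any? (λ w → (w ∉? q′) ×-dec (1 ≤? col w))
       ... | yes (w , w∉ , 1≤) = w , w∉ , marks Ok pa u (λ x → col x ≡ col w) (λ {x} e → piece-ok (≤-trans 1≤ (≤-reflexive (≡.sym e))))
               (λ Z le → conn∪ (col w) (1≤ , colMax w) Z (≤-trans (s≤s le) (≤-trans (≤-trans (m≤n+m (suc (suc a)) (4 * a + 4)) (≤-trans (m≤m+n _ _) (m≤m+n _ _))) (<⇒≤ U≥))))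
               (Unique.filter⁺ (λ x → col x ≟ℕ col w) uq) (Q.rich (sup₁ (∈-pieces 1≤ (colMax w))))
               (λ x∈ → let x∈q , e = ∈-filter⁻ (λ x → col x ≟ℕ col w) {xs = Q.q} x∈ in sub x∈q , e) w∉ ≡.refl
       ... | no none = w₀ , w₀∉ , xs , ux , +-cancelʳ-≤ (waste G a us) _ _ (≤-trans (≤-trans (+-monoˡ-≤ (waste G a us) (m≤m+n (suc (suc a)) (4 * a + 4))) δ≥) le)
               , λ {x} x∈ → decidable-stable (x ∈? q′) (λ x∉ → none (x , x∉ , n≢0⇒n>0 (proj₂ (ad x∈))))
                 , w₀ ∷ [] , w₀ , Walks.stop w₀ , adj-∪ˡ {G = G} {R} (proj₁ (ad x∈)) , λ { (here ≡.refl) → w₀∉ , okw₀ }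
         where
         N = nbrs w₀
         xs = proj₁ N
         ux = proj₁ (proj₂ N)
         ad = proj₁ (proj₂ (proj₂ N))
         le = proj₂ (proj₂ (proj₂ N))

       cycles : ∀ ℓ → 2 ≤ ℓ → ℓ ≤ n → Cycle ℓ
       cycles ℓ 2≤ ℓ≤ with saturate Ok (_∉? Y) (allFin n) ∈-allFin Q.walkq uq okq progress
       ... | q , pa , u , ok , full = Fan.allLengths {Y = Y} (map-W {G = G} {G ∪ R} (adj-∪ˡ {G = G} {R}) fan) (λ x∈ → adj-∪ˡ {G = G} {R} (spokes x∈)) (AllPairs.tail (AllPairs.tail uniqueD))
           (≤-reflexive (≡.sym lengthY)) (λ e → Unique-∉ uniqueD (here e)) (λ y∈ → Unique-∉ uniqueD (there y∈)) (Unique-∉ (AllPairs.tail uniqueD))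
           (length q) ≤-refl pa u ok ℓ 2≤ (≤-trans ℓ≤ (≤-trans (≤-reflexive (≡.sym (length-tabulate {n = n} id))) (≤-trans (length-⊆ (Unique.allFin⁺ n) cov) (≤-reflexive (length-++ q)))))
         where
         cov : allFin n ⊆ q ++ Y
         cov {x} _ with x ∈? Y
         ... | yes y∈ = ∈-++⁺ʳ q y∈
         ... | no y∉ = ∈-++⁺ˡ (full y∉)

     allCycles : ∀ ℓ → 2 ≤ ℓ → ℓ ≤ n → Cycle ℓ
     allCycles = Finish.cycles routed

-- Independence number, minimum degree and cycles in terms of lists.

module GraphParameters where

 open import Data.List.Base hiding (find; lookup)
 open import Data.List.Properties
 open import Data.List.Membership.Propositional using (_∈_; find)
 open import Data.List.Membership.Propositional.Properties
 open import Data.List.Relation.Unary.All as All using (All; []; _∷_)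
 import Data.List.Relation.Unary.All.Properties as All
 open import Data.List.Relation.Unary.Any as Any using (here; there)
 open import Data.List.Relation.Unary.AllPairs as AllPairs using (AllPairs; []; _∷_)
 import Data.List.Relation.Unary.AllPairs.Properties as AllPairs
 open import Data.List.Relation.Unary.Unique.Propositional using (Unique)
 import Data.List.Relation.Unary.Unique.Propositional.Properties as Unique
 open import Data.List.Relation.Binary.Permutation.Propositional
 open import Data.List.Relation.Binary.Permutation.Propositional.Properties as Perm using ()
 import Data.List.Relation.Binary.Permutation.Setoid.Properties as PermS
 open import Data.Nat.Base
 open import Data.Nat.Properties
 open import Data.Product.Base using (∃; _×_; _,_; proj₂)
 open import Data.Sum.Base using (inj₁; inj₂)
 open import Function.Base using (_∘_; id)
 open import Relation.Binary.PropositionalEquality as ≡ using (_≡_; cong; subst)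
 open import Relation.Nullary
 open import Relation.Unary using (Decidable)

 open Lists
 open WalkJoining
 open Extension
 open GraphSetup
 open import Data.Bool.Base using (Bool; true; false; T)
 open import Data.Bool.Properties using (T?; T-≡)
 open import Data.Fin.Base as Fin using (Fin)
 import Data.Fin.Properties as Fin
 open import Data.Fin.Subset using (Subset; inside; outside) renaming (∣_∣ to card)
 open import Data.List.Extrema.Nat using (max; min; xs≤max; min≤xs; max≤v⁺; v≤min⁺)
 open import Data.Vec.Base as Vec using (Vec)
 import Data.Vec.Properties as Vec
 import Data.Vec.Relation.Unary.All as VAll
 import Data.Vec.Relation.Unary.AllPairs as VPairs
 import Data.Vec.Relation.Unary.Linked as VLinked
 open import Defs using (Graph; Adj; adj; α; δ; degree; subsets; Independent; independent?; HasCycle)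
 open import Function.Bundles using (Equivalence)
 open import Relation.Nullary.Decidable using (isYes; toWitness; fromWitness)

 private
   variable
     n : ℕ

 elems : Subset n → List (Fin n)
 elems S = filter (λ v → T? (Vec.lookup S v)) (allFin _)

 filter-map : ∀ {A B : Set} (f : A → B) (P : B → Bool) xs → length (filter (λ x → T? (P x)) (map f xs)) ≡ length (filter (λ x → T? (P (f x))) xs)
 filter-map f P [] = ≡.refl
 filter-map f P (x ∷ xs) with P (f x)
 ... | true = cong suc (filter-map f P xs)
 ... | false = filter-map f P xs

 card-elems : (S : Subset n) → card S ≡ length (elems S)
 card-elems Vec.[] = ≡.refl
 card-elems {suc n} (b Vec.∷ S) = ≡.trans (aux b) (cong (λ l → length (filter (λ v → T? (Vec.lookup (b Vec.∷ S) v)) (Fin.zero ∷ l))) (map-tabulate id Fin.suc))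
   where
   aux : ∀ b → card (b Vec.∷ S) ≡ length (filter (λ v → T? (Vec.lookup (b Vec.∷ S) v)) (Fin.zero ∷ map Fin.suc (allFin n)))
   aux true = cong suc (≡.trans (card-elems S) (≡.sym (filter-map Fin.suc (Vec.lookup (true Vec.∷ S)) (allFin n))))
   aux false = ≡.trans (card-elems S) (≡.sym (filter-map Fin.suc (Vec.lookup (false Vec.∷ S)) (allFin n)))

 ∈-subsets : (S : Subset n) → S ∈ subsets n
 ∈-subsets Vec.[] = here ≡.refl
 ∈-subsets (false Vec.∷ S) = ∈-++⁺ˡ (∈-map⁺ (outside Vec.∷_) (∈-subsets S))
 ∈-subsets {suc n} (true Vec.∷ S) = ∈-++⁺ʳ (map (outside Vec.∷_) (subsets n)) (∈-map⁺ (inside Vec.∷_) (∈-subsets S))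

 module _ {n : ℕ} where
   open import Data.List.Membership.DecPropositional (Fin._≟_ {n}) using (_∈?_)

   fromElems : List (Fin n) → Subset n
   fromElems zs = Vec.tabulate (λ v → isYes (v ∈? zs))

   ∈-fromElems⁺ : ∀ {zs v} → v ∈ zs → T (Vec.lookup (fromElems zs) v)
   ∈-fromElems⁺ {zs} {v} v∈ = subst T (≡.sym (Vec.lookup∘tabulate (λ v → isYes (v ∈? zs)) v)) (fromWitness v∈)

   ∈-fromElems⁻ : ∀ {zs v} → T (Vec.lookup (fromElems zs) v) → v ∈ zs
   ∈-fromElems⁻ {zs} {v} m = toWitness (subst T (Vec.lookup∘tabulate (λ v → isYes (v ∈? zs)) v) m)

   lookup-T : ∀ {S : Subset n} {v} → S Vec.[ v ]= inside → T (Vec.lookup S v)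
   lookup-T v∈ = Equivalence.from T-≡ (Vec.[]=⇒lookup v∈)

   T-lookup : ∀ {S : Subset n} {v} → T (Vec.lookup S v) → S Vec.[ v ]= inside
   T-lookup {S} {v} m = Vec.lookup⇒[]= v S (Equivalence.to T-≡ m)

   length≤card : ∀ {zs} → Unique zs → length zs ≤ card (fromElems zs)
   length≤card {zs} u = ≤-trans (length-⊆ u λ z∈ → ∈-filter⁺ (λ v → T? (Vec.lookup (fromElems zs) v)) (∈-allFin _) (∈-fromElems⁺ z∈))
     (≤-reflexive (≡.sym (card-elems (fromElems zs))))

   module _ (G : Graph n) where
     open GraphWalks G

     indep-≤α : ∀ zs → Indep zs → length zs ≤ α G
     indep-≤α zs i = ≤-trans (length≤card (AllPairs.map (λ nc e → nc (inj₁ e)) i))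
       (All.lookup (xs≤max 0 _) (∈-map⁺ card (∈-filter⁺ (independent? G) (∈-subsets (fromElems zs)) ind)))
       where
       no-edge : ∀ {zs} → Indep zs → ∀ {u v} → u ∈ zs → v ∈ zs → ¬ Adj G u v
       no-edge (p ∷ i) (here ≡.refl) (here ≡.refl) e = subst T (Graph.adj-irr G _) e
       no-edge (p ∷ i) (here ≡.refl) (there v∈) e = All.lookup p v∈ (inj₂ e)
       no-edge (p ∷ i) (there u∈) (here ≡.refl) e = All.lookup p u∈ (inj₂ (E-sym e))
       no-edge (p ∷ i) (there u∈) (there v∈) e = no-edge i u∈ v∈ e
       ind : Independent G (fromElems zs)
       ind u v u∈ v∈ = no-edge i (∈-fromElems⁻ (lookup-T u∈)) (∈-fromElems⁻ (lookup-T v∈))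

     α-≤ : ∀ m → (∀ zs → Indep zs → length zs ≤ m) → α G ≤ m
     α-≤ m h = max≤v⁺ z≤n (All.map⁺ (All.tabulate λ {S} S∈ → ≤-trans (≤-reflexive (card-elems S))
       (h (elems S) (ind S (proj₂ (∈-filter⁻ (independent? G) {xs = subsets n} S∈))))))
       where
       strengthen : ∀ {zs} → Unique zs → (∀ {u v} → u ∈ zs → v ∈ zs → ¬ Adj G u v) → Indep zs
       strengthen [] _ = []
       strengthen (p ∷ u) f = All.tabulate (λ v∈ → λ { (inj₁ e) → All.lookup p v∈ e ; (inj₂ e) → f (here ≡.refl) (there v∈) e })
         ∷ strengthen u (λ x∈ y∈ → f (there x∈) (there y∈))
       ind : ∀ S → Independent G S → Indep (elems S)
       ind S iS = strengthen (Unique.filter⁺ _ (Unique.allFin⁺ n)) λ u∈ v∈ →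
         iS _ _ (T-lookup (proj₂ (∈-filter⁻ (λ v → T? (Vec.lookup S v)) {xs = allFin n} u∈))) (T-lookup (proj₂ (∈-filter⁻ (λ v → T? (Vec.lookup S v)) {xs = allFin n} v∈)))

     nbrList : Fin n → List (Fin n)
     nbrList v = elems (Vec.tabulate (adj G v))

     ∈-nbrList⁺ : ∀ {v x} → Adj G v x → x ∈ nbrList v
     ∈-nbrList⁺ {v} {x} e = ∈-filter⁺ (λ y → T? (Vec.lookup (Vec.tabulate (adj G v)) y)) (∈-allFin x) (subst T (≡.sym (Vec.lookup∘tabulate (adj G v) x)) e)

     ∈-nbrList⁻ : ∀ {v x} → x ∈ nbrList v → Adj G v x
     ∈-nbrList⁻ {v} {x} x∈ = subst T (Vec.lookup∘tabulate (adj G v) x) (proj₂ (∈-filter⁻ (λ y → T? (Vec.lookup (Vec.tabulate (adj G v)) y)) {xs = allFin n} x∈))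

     degree≡ : ∀ v → degree G v ≡ length (nbrList v)
     degree≡ v = card-elems (Vec.tabulate (adj G v))

     unique-nbrList : ∀ v → Unique (nbrList v)
     unique-nbrList v = Unique.filter⁺ _ (Unique.allFin⁺ n)

     neighbours : ∀ v → ∃ λ nb → Unique nb × (∀ {x} → x ∈ nb → Adj G v x) × δ G ≤ length nb
     neighbours v = nbrList v , unique-nbrList v , ∈-nbrList⁻ ,
       ≤-trans (All.lookup (min≤xs n _) (∈-map⁺ (degree G) (∈-allFin v))) (≤-reflexive (degree≡ v))

     δ-≥ : ∀ d → d ≤ n → (∀ v → d ≤ degree G v) → d ≤ δ G
     δ-≥ d d≤n h = v≤min⁺ {xs = map (degree G) (allFin n)} d≤n (All.map⁺ {xs = allFin n} (All.tabulate λ {v} _ → h v))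

     δ-≤ : ∀ v → δ G ≤ degree G v
     δ-≤ v = All.lookup (min≤xs n _) (∈-map⁺ (degree G) (∈-allFin v))

     toVec-All : ∀ {P : Fin n → Set} {xs} → All P xs → VAll.All P (Vec.fromList xs)
     toVec-All [] = VAll.[]
     toVec-All (p ∷ ps) = p VAll.∷ toVec-All ps

     toVec-Pairs : ∀ {R : Fin n → Fin n → Set} {xs} → AllPairs R xs → VPairs.AllPairs R (Vec.fromList xs)
     toVec-Pairs [] = VPairs.[]
     toVec-Pairs (p ∷ ps) = toVec-All p VPairs.∷ toVec-Pairs ps

     toVec-Linked : ∀ {u xs w z} → W u xs w → Adj G w z → VLinked.Linked (Adj G) (Vec.fromList xs Vec.∷ʳ z)
     toVec-Linked (Walks.stop u) e = e VLinked.∷ VLinked.[-]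
     toVec-Linked (Walks.step d p) e with W-head p | toVec-Linked p e
     ... | _ , ≡.refl | q = d VLinked.∷ q

     hasCycle : ∀ {ℓ} u xs w → W u xs w → Adj G w u → Unique xs → length xs ≡ ℓ → 3 ≤ ℓ → HasCycle G ℓ
     hasCycle u xs w p e uq ≡.refl 3≤ with W-head p | toVec-Linked p e
     ... | xs′ , ≡.refl | q = 3≤ , Vec.fromList xs , toVec-Pairs uq , q

-- A sufficient condition on the random edges for pancyclicity.

module PancyclicCriterion where

 open import Data.Empty using (⊥-elim)
 open import Data.List.Base hiding (find; lookup)
 open import Data.List.Properties
 open import Data.List.Membership.Propositional using (_∈_; _∉_; find)
 open import Data.List.Membership.Propositional.Properties
 open import Data.List.Relation.Unary.All as All using (All; []; _∷_)
 import Data.List.Relation.Unary.All.Properties as All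
 open import Data.List.Relation.Unary.Any as Any using (Any; here; there)
 open import Data.List.Relation.Unary.AllPairs as AllPairs using (AllPairs; []; _∷_)
 import Data.List.Relation.Unary.AllPairs.Properties as AllPairs
 open import Data.List.Relation.Unary.Unique.Propositional using (Unique)
 import Data.List.Relation.Unary.Unique.Propositional.Properties as Unique
 open import Data.List.Relation.Binary.Permutation.Propositional
 open import Data.List.Relation.Binary.Permutation.Propositional.Properties as Perm using ()
 import Data.List.Relation.Binary.Permutation.Setoid.Properties as PermS
 open import Data.Nat.Base
 open import Data.Nat.Properties
 open import Data.Product.Base using (∃; ∃₂; _×_; _,_; proj₁; proj₂)
 open import Data.Sum.Base using (_⊎_; inj₁; inj₂)
 open import Function.Base using (id; case_of_)
 open import Relation.Binary.PropositionalEquality as ≡ using (_≡_; _≢_; cong; subst)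
 open import Relation.Nullary
 open import Relation.Unary using (Decidable)

 open Lists
 open WalkJoining
 open Extension
 open PathSystems
 open TreeRouting
 open Pieces
 open GraphSetup
 open CycleLengths
 open GraphParameters
 open import Data.Bool.Base using (Bool; true; false; T; if_then_else_)
 open import Data.Bool.Properties using (T?)
 open import Data.Fin.Base as Fin using (Fin)
 import Data.Fin.Properties as Fin
 open import Data.Maybe.Base using (Maybe; just; nothing)
 open import Data.Nat.DivMod using (_/_)
 import Data.Sum.Base
 open import Defs using (Graph; Adj; adj; HasCycle; Pancyclic; _∪_)
 open import Relation.Nullary.Decidable using (isYes; fromWitness; _×-dec_; ¬?)
 open import Data.List.Membership.DecPropositional _≟ℕ_ using () renaming (_∈?_ to _∈ℕ?_; _∉?_ to _∉ℕ?_) public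

 subs : List ℕ → List (List ℕ)
 subs [] = [] ∷ []
 subs (c ∷ cs) = map (c ∷_) (subs cs) ++ subs cs

 filter∈subs : ∀ {P : ℕ → Set} (P? : Decidable P) cs → filter P? cs ∈ subs cs
 filter∈subs P? [] = here ≡.refl
 filter∈subs P? (c ∷ cs) with P? c
 ... | yes _ = ∈-++⁺ˡ (∈-map⁺ (c ∷_) (filter∈subs P? cs))
 ... | no _ = ∈-++⁺ʳ (map (c ∷_) (subs cs)) (filter∈subs P? cs)

 module _ {n : ℕ} (R : Graph n) where

   first : Fin n → List (Fin n) → Maybe (Fin n)
   first y [] = nothing
   first y (x ∷ xs) = if adj R y x then just x else first y xs

   first-just : ∀ y xs {x} → first y xs ≡ just x → x ∈ xs × Adj R y x
   first-just y (x ∷ xs) e with adj R y x in eq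
   first-just y (x ∷ xs) ≡.refl | true = here ≡.refl , subst T (≡.sym eq) _
   ... | false = let p , q = first-just y xs e in there p , q

   -- The first neighbour of y in xs, if there is one, has a colour in S.
   inside : (Fin n → ℕ) → List ℕ → Fin n → List (Fin n) → Bool
   inside col S y [] = true
   inside col S y (x ∷ xs) = if adj R y x then isYes (col x ∈ℕ? S) else inside col S y xs

   ¬inside : ∀ col S y xs → ¬ T (inside col S y xs) → ∃ λ x → first y xs ≡ just x × col x ∉ S
   ¬inside col S y [] h = ⊥-elim (h _)
   ¬inside col S y (x ∷ xs) h with adj R y x
   ... | true = x , ≡.refl , λ c∈ → h (fromWitness c∈)
   ... | false = ¬inside col S y xs h

   -- Vertices without a neighbour in `Cs` count as inside. If the set is not stuck, some first edge
   -- leads out of S, and a tree on the colours S can grow along it.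
   Stuck : (Fin n → ℕ) → List (Fin n) → List (Fin n) → List ℕ → Set
   Stuck col Ps Cs S = All (λ y → T (inside col S y Cs)) (filter (λ y → col y ∈ℕ? S) Ps)

   stuck? : ∀ col Ps Cs S → Dec (Stuck col Ps Cs S)
   stuck? col Ps Cs S = All.all? (λ y → T? (inside col S y Cs)) (filter (λ y → col y ∈ℕ? S) Ps)

 -- Parts 0 and 1 of the pieces serve the first tree, parts 2 and 3 the second, which keeps the
 -- trees disjoint. Within a tree, edges go from one part to another, so that different vertices
 -- look at different pairs.
 quarter : ∀ {A : Set} → List A → ℕ
 quarter xs = length xs / 4

 module _ {A : Set} where
   part : ℕ → ℕ → List A → List A
   part q zero xs = take q xs
   part q (suc i) xs = part q i (drop q xs)

   part-⊆ : ∀ q i xs → part q i xs ⊆ xs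
   part-⊆ q zero xs x∈ = subst (_ ∈_) (take++drop≡id q xs) (∈-++⁺ˡ x∈)
   part-⊆ q (suc i) xs x∈ = subst (_ ∈_) (take++drop≡id q xs) (∈-++⁺ʳ (take q xs) (part-⊆ q i (drop q xs) x∈))

   part-disjoint : ∀ q {i j} xs → Unique xs → i < j → ∀ {x} → x ∈ part q i xs → x ∉ part q j xs
   part-disjoint q {zero} {suc j} xs u _ x∈ x∈′ = proj₂ (proj₂ (Unique-++⁻ (take q xs) (subst Unique (≡.sym (take++drop≡id q xs)) u))) x∈ (part-⊆ q j (drop q xs) x∈′)
   part-disjoint q {suc i} {suc j} xs u (s≤s lt) = part-disjoint q {i} {j} (drop q xs) (Unique.drop⁺ q u) lt

   part-length : ∀ q i xs → suc i * q ≤ length xs → length (part q i xs) ≡ q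
   part-length q zero xs le = ≡.trans (length-take q xs) (m≤n⇒m⊓n≡m (≤-trans (≤-reflexive (≡.sym (+-identityʳ q))) le))
   part-length q (suc i) xs le = part-length q i (drop q xs) (≤-trans (≤-reflexive (≡.sym (m+n∸m≡n q (suc i * q)))) (≤-trans (∸-monoˡ-≤ q le) (≤-reflexive (≡.sym (length-drop q xs)))))

 module Parts {n : ℕ} (G : Graph n) (a us δ₀ : ℕ) (S : Setup G a us δ₀) where
   open Setup S

   free? : ∀ c x → Dec (col x ≡ c × x ≢ v′ × x ≢ p′)
   free? c x = (col x ≟ℕ c) ×-dec ¬? (x Fin.≟ v′) ×-dec ¬? (x Fin.≟ p′)

   avail : ℕ → List (Fin n)
   avail c = filter (free? c) (allFin n)

   Pt : ℕ → ℕ → List (Fin n)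
   Pt i c = part (quarter (avail c)) i (avail c)

   Part : ℕ → List (Fin n)
   Part i = concatMap (Pt i) (pieces k)

   Pt-free : ∀ i c {x} → x ∈ Pt i c → col x ≡ c × x ≢ v′ × x ≢ p′
   Pt-free i c x∈ = proj₂ (∈-filter⁻ (free? c) {xs = allFin n} (part-⊆ (quarter (avail c)) i (avail c) x∈))

   Part⁻ : ∀ i {x} → x ∈ Part i → ∃ λ c → c ∈ pieces k × x ∈ Pt i c
   Part⁻ i x∈ with find (∈-concatMap⁻ (Pt i) {xs = pieces k} x∈)
   ... | c , c∈ , q = c , c∈ , q

   Part-piece : ∀ i {x} → x ∈ Part i → col x ∈ pieces k × x ≢ v′ × x ≢ p′
   Part-piece i x∈ with Part⁻ i x∈
   ... | c , c∈ , q with Pt-free i c q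
   ...   | e , r = subst (_∈ pieces k) (≡.sym e) c∈ , r

   Part-disjoint : ∀ {i j x} → i < j → x ∈ Part i → x ∉ Part j
   Part-disjoint {i} {j} lt x∈ x∈′ with Part⁻ i x∈ | Part⁻ j x∈′
   ... | c , _ , q | c′ , _ , q′ with ≡.trans (≡.sym (proj₁ (Pt-free i c q))) (proj₁ (Pt-free j c′ q′))
   ...   | ≡.refl = part-disjoint (quarter (avail c)) {i} {j} (avail c) (Unique.filter⁺ (free? c) (Unique.allFin⁺ n)) lt q q′

   -- Only proper nonempty sets matter: an unfinished tree contains the root and misses some piece.
   Free : Graph n → ℕ → ℕ → Set
   Free R i j = ∀ {T} → T ∈ subs (pieces k) → 0 < length T → length T < k → ¬ Stuck R col (Part i) (Part j) T

   module _ (R : Graph n) (ind : ∀ zs → GraphWalks.Indep G zs → length zs ≤ a)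
            (U≥ : (4 * a + 4 + suc (suc a)) + costs a (4 * a + 4 + suc (suc a)) + costs a (4 * a + 4 + suc (suc a)) < us)
            (δ≥ : suc (suc a) + (4 * a + 4) + waste G a us ≤ δ₀) where

     open System (Fin._≟_ {n}) (Adj (G ∪ R)) (GraphWalks.E? (G ∪ R)) (GraphWalks.E-sym (G ∪ R)) a (ind∪ G R a us δ₀ S ind) col using (vs; verts; h; l)
     open Route (Fin._≟_ {n}) (Adj (G ∪ R)) (GraphWalks.E? (G ∪ R)) (GraphWalks.E-sym (G ∪ R)) a (ind∪ G R a us δ₀ S ind) col 1 using (Tree)

     Spanning : ℕ → ℕ → Set
     Spanning i j = ∃₂ λ cs es → Tree cs es × Unique cs × (∀ {c} → c ∈ cs → c ∈ pieces k) × (∀ {c} → c ∈ pieces k → c ∈ cs) ×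
       (∀ {P} → P ∈ es → length (vs P) ≡ 2) × Unique (verts es) × (∀ {x} → x ∈ verts es → x ∈ Part i ⊎ x ∈ Part j)

     module _ (i j : ℕ) (i<j : i < j) (fr : Free R i j) where
       open TB G R a us δ₀ S ind (Part i) (Part j) (λ {x} → Part-disjoint {i} {j} i<j) (λ y → first R y (Part j)) using (Crossing; Good; module Good; good-verts; spanning; tree-unique)

       cross : ∀ T → 1 ∈ T → (∀ {c} → c ∈ T → c ∈ pieces k) → (∃ λ c → c ∈ pieces k × c ∉ T) → Crossing T
       cross T 1∈ sub (c , c∈ , c∉) = go (stuck? R col (Part i) (Part j) T′)
         where
         -- The colours of a tree come in order of discovery. Filtering the list of pieces brings
         -- them into the normal form over which the union bound runs.
         T′ : List ℕ
         T′ = filter (_∈ℕ? T) (pieces k)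
         T′⁻ : ∀ {c} → c ∈ T′ → c ∈ T
         T′⁻ c∈ = proj₂ (∈-filter⁻ (_∈ℕ? T) {xs = pieces k} c∈)
         T′⁺ : ∀ {c} → c ∈ T → c ∈ T′
         T′⁺ c∈ = ∈-filter⁺ (_∈ℕ? T) (sub c∈) c∈
         pos : ∀ {xs : List ℕ} {x} → x ∈ xs → 0 < length xs
         pos (here _) = s≤s z≤n
         pos (there _) = s≤s z≤n
         uT′ : Unique (c ∷ T′)
         uT′ = Unique-∷ (λ q → c∉ (T′⁻ q)) (Unique.filter⁺ (_∈ℕ? T) (Unique.applyUpTo⁺₁ suc k (λ i<j _ q → <⇒≢ i<j (suc-injective q))))
         lt : length T′ < k
         lt = ≤-trans (length-⊆ uT′ (λ { (here ≡.refl) → c∈ ; (there q) → proj₁ (∈-filter⁻ (_∈ℕ? T) q) })) (≤-reflexive (length-applyUpTo suc k))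
         go : Dec (Stuck R col (Part i) (Part j) T′) → Crossing T
         go (yes st) = ⊥-elim (fr (filter∈subs (_∈ℕ? T) (pieces k)) (pos (T′⁺ 1∈)) lt st)
         go (no ¬st) with find (All.¬All⇒Any¬ (λ y → T? (inside R col T′ y (Part j))) _ ¬st)
         ... | y , y∈ , ¬in with ∈-filter⁻ (λ y → col y ∈ℕ? T′) {xs = Part i} y∈
         ...   | y∈P , cy with ¬inside R col T′ y (Part j) ¬in
         ...     | x , Fy , cx with first-just R y (Part j) Fy
         ...       | x∈ , e = y , x , y∈P , x∈ , Fy , adj-∪ʳ {G = G} {R} e , T′⁻ cy , proj₁ (Part-piece j x∈) , λ q → cx (T′⁺ q)

       within : ∀ es → (∀ {P} → P ∈ es → Good P) → ∀ {x} → x ∈ verts es → x ∈ Part i ⊎ x ∈ Part j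
       within es g x∈ = side (good-verts es g x∈)
         where
         side : ∀ {x} → (∃ λ P → P ∈ es × (x ≡ h P ⊎ x ≡ l P)) → x ∈ Part i ⊎ x ∈ Part j
         side (P , P∈ , inj₁ ≡.refl) = inj₂ (Good.h∈ (g P∈))
         side (P , P∈ , inj₂ ≡.refl) = inj₁ (Good.l∈ (g P∈))

       spanning-tree : Spanning i j
       spanning-tree = pack (spanning 1≤k cross)
         where
         pack : (∃₂ λ cs es → Tree cs es × Unique cs × (∀ {c} → c ∈ cs → c ∈ pieces k) × (∀ {c} → c ∈ pieces k → c ∈ cs) × (∀ {P} → P ∈ es → Good P)) → Spanning i j
         pack (cs , es , t , u , sub , sup , g) = cs , es , t , u , sub , sup , (λ P∈ → cong length (Good.vs≡ (g P∈))) , tree-unique t g , within es g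

     pancyclic : Free R 0 1 → Free R 2 3 → Pancyclic (G ∪ R)
     pancyclic f₁ f₂ ℓ 3≤ℓ ℓ≤n = main (spanning-tree 0 1 (s≤s z≤n) f₁) (spanning-tree 2 3 (s≤s (s≤s (s≤s z≤n))) f₂)
       where
       dis : ∀ {x} → x ∈ Part 2 ⊎ x ∈ Part 3 → ¬ (x ∈ Part 0 ⊎ x ∈ Part 1)
       dis (inj₁ p) (inj₁ q) = Part-disjoint {0} {2} (s≤s z≤n) q p
       dis (inj₁ p) (inj₂ q) = Part-disjoint {1} {2} (s≤s (s≤s z≤n)) q p
       dis (inj₂ p) (inj₁ q) = Part-disjoint {0} {3} (s≤s z≤n) q p
       dis (inj₂ p) (inj₂ q) = Part-disjoint {1} {3} (s≤s (s≤s z≤n)) q p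
       pc : ∀ {x} i → x ∈ Part i → 1 ≤ col x × x ≢ v′ × x ≢ p′
       pc i x∈ = let q , r = Part-piece i x∈ in proj₁ (∈-pieces⁻ q) , r
       main : Spanning 0 1 → Spanning 2 3 → HasCycle (G ∪ R) ℓ
       main (cs₁ , es₁ , t₁ , u₁ , sub₁ , sup₁ , len₁ , uv₁ , in₁) (cs₂ , es₂ , t₂ , u₂ , sub₂ , sup₂ , len₂ , uv₂ , in₂) =
         let u , xs , w , p , e , uq , len = allCycles G R a us δ₀ S ind U≥ δ≥ t₁ t₂ u₁ u₂ sub₁ sup₁ sub₂ sup₂ len₁ len₂
               (Unique-++ uv₂ uv₁ (λ x∈ y∈ → dis (in₂ x∈) (in₁ y∈)))
               (λ x∈ → case ∈-++⁻ (verts es₂) x∈ of λ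
                 { (inj₁ r) → Data.Sum.Base.[ pc 2 , pc 3 ]′ (in₂ r) ; (inj₂ r) → Data.Sum.Base.[ pc 0 , pc 1 ]′ (in₁ r) })
               ℓ (≤-trans (n≤1+n 2) 3≤ℓ) ℓ≤n
         in hasCycle (G ∪ R) u xs w p e uq len 3≤ℓ

-- Expectation over the random graph with rational edge probability.

module Expectation where

 open import Data.Bool.Base using (Bool; true; false; T; if_then_else_)
 open import Data.Empty using (⊥-elim)
 open import Data.Fin.Base as Fin using (Fin; zero; suc)
 import Data.Fin.Properties as Fin
 open import Data.Fin.Subset using (Subset; inside; outside)
 open import Data.List.Base as List using (List; []; _∷_; _++_; filter; allFin; cartesianProduct; cartesianProductWith; map)
 import Data.List.Properties as List
 open import Data.Nat.Base as ℕ using (zero; suc)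
 open import Data.Product.Base using (_×_; _,_)
 open import Data.Rational.Base
 import Data.Rational.Properties as ℚ
 open import Data.Rational.Solver using (module +-*-Solver)
 open import Data.Vec.Base as Vec using (Vec; []; _∷_; lookup)
 open import Function.Base using (_∘_)
 open import Relation.Binary.PropositionalEquality using (_≡_; _≢_; refl; sym; trans; cong; cong₂)
 open import Relation.Nullary using (Dec; does; no)
 open import Relation.Unary using (Decidable)
 open import Defs using (Graph; adj; addVertex; emptyGraph; graphs; subsets; pairs; module ℚLemmas)
 open ℚLemmas using (*-monoˡ; *-monoʳ; *-mono; *-nonneg; 0≤1)
 open +-*-Solver

 ΣL : ∀ {A : Set} → (A → ℚ) → List A → ℚ
 ΣL f [] = 0ℚ
 ΣL f (x ∷ xs) = f x + ΣL f xs

 ΠL : ∀ {A : Set} → (A → ℚ) → List A → ℚ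
 ΠL f [] = 1ℚ
 ΠL f (x ∷ xs) = f x * ΠL f xs

 bit : Bool → ℚ
 bit true = 1ℚ
 bit false = 0ℚ

 0≤bit : ∀ b → 0ℚ ≤ bit b
 0≤bit true = 0≤1
 0≤bit false = ℚ.≤-refl

 bit≤1 : ∀ b → bit b ≤ 1ℚ
 bit≤1 true = ℚ.≤-refl
 bit≤1 false = 0≤1

 module _ {A : Set} where

   ΣL-cong : ∀ {f g : A → ℚ} → (∀ x → f x ≡ g x) → ∀ xs → ΣL f xs ≡ ΣL g xs
   ΣL-cong h [] = refl
   ΣL-cong h (x ∷ xs) = cong₂ _+_ (h x) (ΣL-cong h xs)

   ΠL-cong : ∀ {f g : A → ℚ} → (∀ x → f x ≡ g x) → ∀ xs → ΠL f xs ≡ ΠL g xs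
   ΠL-cong h [] = refl
   ΠL-cong h (x ∷ xs) = cong₂ _*_ (h x) (ΠL-cong h xs)

   ΣL-++ : ∀ (f : A → ℚ) xs ys → ΣL f (xs ++ ys) ≡ ΣL f xs + ΣL f ys
   ΣL-++ f [] ys = sym (ℚ.+-identityˡ _)
   ΣL-++ f (x ∷ xs) ys = trans (cong (f x +_) (ΣL-++ f xs ys)) (sym (ℚ.+-assoc (f x) _ _))

   ΠL-++ : ∀ (f : A → ℚ) xs ys → ΠL f (xs ++ ys) ≡ ΠL f xs * ΠL f ys
   ΠL-++ f [] ys = sym (ℚ.*-identityˡ _)
   ΠL-++ f (x ∷ xs) ys = trans (cong (f x *_) (ΠL-++ f xs ys)) (sym (ℚ.*-assoc (f x) _ _))

   ΣL-map : ∀ {B : Set} (f : A → ℚ) (g : B → A) xs → ΣL f (map g xs) ≡ ΣL (f ∘ g) xs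
   ΣL-map f g [] = refl
   ΣL-map f g (x ∷ xs) = cong (f (g x) +_) (ΣL-map f g xs)

   ΠL-map : ∀ {B : Set} (f : A → ℚ) (g : B → A) xs → ΠL f (map g xs) ≡ ΠL (f ∘ g) xs
   ΠL-map f g [] = refl
   ΠL-map f g (x ∷ xs) = cong (f (g x) *_) (ΠL-map f g xs)

   ΣL-* : ∀ c (f : A → ℚ) xs → ΣL (λ x → c * f x) xs ≡ c * ΣL f xs
   ΣL-* c f [] = sym (ℚ.*-zeroʳ c)
   ΣL-* c f (x ∷ xs) = trans (cong (c * f x +_) (ΣL-* c f xs)) (sym (ℚ.*-distribˡ-+ c (f x) _))

   ΣL-filter : ∀ {P : A → Set} (P? : Decidable P) f xs → ΣL f (filter P? xs) ≡ ΣL (λ x → f x * bit (does (P? x))) xs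
   ΣL-filter P? f [] = refl
   ΣL-filter P? f (x ∷ xs) with does (P? x)
   ... | true = cong₂ _+_ (sym (ℚ.*-identityʳ (f x))) (ΣL-filter P? f xs)
   ... | false = trans (ΣL-filter P? f xs) (trans (sym (ℚ.+-identityˡ _)) (cong (_+ _) (sym (ℚ.*-zeroʳ (f x)))))

   ΠL-filter : ∀ {P : A → Set} (P? : Decidable P) f xs → ΠL f (filter P? xs) ≡ ΠL (λ x → if does (P? x) then f x else 1ℚ) xs
   ΠL-filter P? f [] = refl
   ΠL-filter P? f (x ∷ xs) with does (P? x)
   ... | true = cong (f x *_) (ΠL-filter P? f xs)
   ... | false = trans (ΠL-filter P? f xs) (sym (ℚ.*-identityˡ _))

 ΠL-cartesian : ∀ {A B : Set} (f : A × B → ℚ) xs ys → ΠL f (cartesianProduct xs ys) ≡ ΠL (λ x → ΠL (λ y → f (x , y)) ys) xs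
 ΠL-cartesian f [] ys = refl
 ΠL-cartesian f (x ∷ xs) ys = trans (ΠL-++ f (map (x ,_) ys) (cartesianProduct xs ys)) (cong₂ _*_ (ΠL-map f (x ,_) ys) (ΠL-cartesian f xs ys))

 ΣL-cartesian : ∀ {A B C : Set} (f : C → ℚ) (g : A → B → C) xs ys → ΣL f (cartesianProductWith g xs ys) ≡ ΣL (λ x → ΣL (λ y → f (g x y)) ys) xs
 ΣL-cartesian f g [] ys = refl
 ΣL-cartesian f g (x ∷ xs) ys = trans (ΣL-++ f (map (g x) ys) _) (cong₂ _+_ (ΣL-map f (g x) ys) (ΣL-cartesian f g xs ys))

 allFin-suc : ∀ n → allFin (suc n) ≡ zero ∷ map suc (allFin n)
 allFin-suc n = cong (zero ∷_) (sym (List.map-tabulate (λ x → x) suc))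

 -- The pairs at vertex zero are separated from the others, in accordance with the construction of
 -- graphs by `addVertex`.
 pairs-suc : ∀ n (F : Fin (suc n) × Fin (suc n) → ℚ) →
   ΠL F (pairs (suc n)) ≡ ΠL (λ v → F (zero , suc v)) (allFin n) * ΠL (λ (u , v) → F (suc u , suc v)) (pairs n)
 pairs-suc n F = trans (grid (suc n) F) (trans (cong (λ l → ΠL (λ u → ΠL (λ v → if does (u Fin.<? v) then F (u , v) else 1ℚ) l) l) (allFin-suc n))
   (cong₂ _*_ (trans (ℚ.*-identityˡ _) (ΠL-map (λ v → if does (zero {n} Fin.<? v) then F (zero , v) else 1ℚ) suc (allFin n)))
     (trans (ΠL-map (λ u → ΠL (λ v → if does (u Fin.<? v) then F (u , v) else 1ℚ) (zero ∷ map suc (allFin n))) suc (allFin n)) (trans (ΠL-cong (λ u → trans (ℚ.*-identityˡ (ΠL (λ v → if does (suc u Fin.<? v) then F (suc u , v) else 1ℚ) (map suc (allFin n)))) (ΠL-map (λ v → if does (suc u Fin.<? v) then F (suc u , v) else 1ℚ) suc (allFin n))) (allFin n))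
       (sym (grid n (λ (u , v) → F (suc u , suc v))))))))
   where
   grid : ∀ n (F : Fin n × Fin n → ℚ) → ΠL F (pairs n) ≡ ΠL (λ u → ΠL (λ v → if does (u Fin.<? v) then F (u , v) else 1ℚ) (allFin n)) (allFin n)
   grid n F = trans (ΠL-filter (λ (u , v) → u Fin.<? v) F (cartesianProduct (allFin n) (allFin n))) (ΠL-cartesian (λ (u , v) → if does (u Fin.<? v) then F (u , v) else 1ℚ) (allFin n) (allFin n))

 module Expect (q : ℚ) where

   wt : Bool → ℚ
   wt b = if b then q else 1ℚ - q

   -- Expectation over one random row, and in `EG` over a graph revealed row by row. In this form
   -- linearity, independence and monotonicity are inductions; `EG-sum` links it to the weighted sum
   -- over all graphs.
   EV : ∀ n → (Vec Bool n → ℚ) → ℚ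
   EV zero g = g []
   EV (suc n) g = (1ℚ - q) * EV n (λ S → g (false ∷ S)) + q * EV n (λ S → g (true ∷ S))

   EG : ∀ n → (Graph n → ℚ) → ℚ
   EG zero f = f emptyGraph
   EG (suc n) f = EV n (λ S → EG n (λ R → f (addVertex S R)))

   weightQ : ∀ {n} → Graph n → ℚ
   weightQ {n} R = ΠL (λ (u , v) → wt (adj R u v)) (pairs n)

   EV-sum : ∀ n g → ΣL (λ S → ΠL (λ v → wt (lookup S v)) (allFin n) * g S) (subsets n) ≡ EV n g
   EV-sum zero g = trans (ℚ.+-identityʳ _) (ℚ.*-identityˡ _)
   EV-sum (suc n) g = trans (ΣL-++ _ (map (outside ∷_) (subsets n)) _) (cong₂ _+_ (half outside) (half inside))
     where
     half : ∀ b → ΣL (λ S → ΠL (λ v → wt (lookup S v)) (allFin (suc n)) * g S) (map (b ∷_) (subsets n)) ≡ wt b * EV n (λ S → g (b ∷ S))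
     half b = trans (ΣL-map _ (b ∷_) (subsets n)) (trans (ΣL-cong (λ S → trans (cong (_* g (b ∷ S)) (trans (cong (ΠL (λ v → wt (lookup (b ∷ S) v))) (allFin-suc n)) (cong (wt b *_) (ΠL-map (λ v → wt (lookup (b ∷ S) v)) suc (allFin n))))) (ℚ.*-assoc (wt b) _ _)) (subsets n))
       (trans (ΣL-* (wt b) _ (subsets n)) (cong (wt b *_) (EV-sum n (λ S → g (b ∷ S))))))

   EV-cong : ∀ n {f g} → (∀ S → f S ≡ g S) → EV n f ≡ EV n g
   EV-cong zero h = h []
   EV-cong (suc n) h = cong₂ (λ x y → (1ℚ - q) * x + q * y) (EV-cong n (h ∘ (false ∷_))) (EV-cong n (h ∘ (true ∷_)))

   EG-cong : ∀ n {f g} → (∀ R → f R ≡ g R) → EG n f ≡ EG n g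
   EG-cong zero h = h emptyGraph
   EG-cong (suc n) h = EV-cong n λ S → EG-cong n λ R → h (addVertex S R)

   EG-sum : ∀ n (f : Graph n → ℚ) → ΣL (λ R → weightQ R * f R) (graphs n) ≡ EG n f
   EG-sum zero f = trans (ℚ.+-identityʳ _) (ℚ.*-identityˡ _)
   EG-sum (suc n) f = trans (ΣL-cartesian (λ R → weightQ R * f R) addVertex (subsets n) (graphs n))
     (trans (ΣL-cong inner (subsets n)) (EV-sum n (λ S → EG n (λ R → f (addVertex S R)))))
     where
     row : Subset n → ℚ
     row S = ΠL (λ v → wt (lookup S v)) (allFin n)
     split : ∀ S R → weightQ (addVertex S R) * f (addVertex S R) ≡ row S * (weightQ R * f (addVertex S R))
     split S R = trans (cong (_* f (addVertex S R)) (pairs-suc n (λ (u , v) → wt (adj (addVertex S R) u v)))) (ℚ.*-assoc (row S) (weightQ R) (f (addVertex S R)))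
     inner : ∀ S → ΣL (λ R → weightQ (addVertex S R) * f (addVertex S R)) (graphs n) ≡ row S * EG n (λ R → f (addVertex S R))
     inner S = trans (ΣL-cong (split S) (graphs n)) (trans (ΣL-* (row S) (λ R → weightQ R * f (addVertex S R)) (graphs n)) (cong (row S *_) (EG-sum n (λ R → f (addVertex S R)))))

   EV-+ : ∀ n f g → EV n (λ S → f S + g S) ≡ EV n f + EV n g
   EV-+ zero f g = refl
   EV-+ (suc n) f g = trans (cong₂ (λ x y → (1ℚ - q) * x + q * y) (EV-+ n _ _) (EV-+ n _ _))
     (solve 6 (λ a b c d x y → x :* (a :+ b) :+ y :* (c :+ d) := (x :* a :+ y :* c) :+ (x :* b :+ y :* d)) refl
       (EV n (f ∘ (false ∷_))) (EV n (g ∘ (false ∷_))) (EV n (f ∘ (true ∷_))) (EV n (g ∘ (true ∷_))) (1ℚ - q) q)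

   EG-+ : ∀ n f g → EG n (λ R → f R + g R) ≡ EG n f + EG n g
   EG-+ zero f g = refl
   EG-+ (suc n) f g = trans (EV-cong n (λ S → EG-+ n _ _)) (EV-+ n _ _)

   EV-* : ∀ n c f → EV n (λ S → c * f S) ≡ c * EV n f
   EV-* zero c f = refl
   EV-* (suc n) c f = trans (cong₂ (λ x y → (1ℚ - q) * x + q * y) (EV-* n c _) (EV-* n c _))
     (solve 5 (λ c a b x y → x :* (c :* a) :+ y :* (c :* b) := c :* (x :* a :+ y :* b)) refl c (EV n (f ∘ (false ∷_))) (EV n (f ∘ (true ∷_))) (1ℚ - q) q)

   EG-* : ∀ n c f → EG n (λ R → c * f R) ≡ c * EG n f
   EG-* zero c f = refl
   EG-* (suc n) c f = trans (EV-cong n (λ S → EG-* n c _)) (EV-* n c _)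

   EV-const : ∀ n c → EV n (λ _ → c) ≡ c
   EV-const zero c = refl
   EV-const (suc n) c = trans (cong₂ (λ x y → (1ℚ - q) * x + q * y) (EV-const n c) (EV-const n c)) (solve 2 (λ c q → (con 1ℚ :- q) :* c :+ q :* c := c) refl c q)

   EG-const : ∀ n c → EG n (λ _ → c) ≡ c
   EG-const zero c = refl
   EG-const (suc n) c = trans (EV-cong n (λ S → EG-const n c)) (EV-const n c)

   Agree : ∀ {n} → (Fin n → Bool) → Bool → Vec Bool n → Vec Bool n → Set
   Agree M b S S′ = ∀ v → M v ≡ b → lookup S v ≡ lookup S′ v

   -- At each coordinate only one of the factors may depend on the bit. The other has the same
   -- expectation in both branches and can be pulled out.
   EV-indep : ∀ n (M : Fin n → Bool) f g → (∀ S S′ → Agree M true S S′ → f S ≡ f S′) → (∀ S S′ → Agree M false S S′ → g S ≡ g S′) →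
     EV n (λ S → f S * g S) ≡ EV n f * EV n g
   EV-indep zero M f g hf hg = refl
   EV-indep (suc n) M f g hf hg = trans (cong₂ (λ x y → (1ℚ - q) * x + q * y) (ih false) (ih true)) (last (M zero) refl)
     where
     ext : ∀ {c b S S′} → Agree (M ∘ suc) b S S′ → Agree M b (c ∷ S) (c ∷ S′)
     ext h zero _ = refl
     ext h (suc v) e = h v e
     ih : ∀ b → _
     ih b = EV-indep n (M ∘ suc) (λ S → f (b ∷ S)) (λ S → g (b ∷ S)) (λ S S′ h → hf _ _ (ext h)) (λ S S′ h → hg _ _ (ext h))
     flip : ∀ {b S} → M zero ≢ b → Agree M b (false ∷ S) (true ∷ S)
     flip ne zero e = ⊥-elim (ne e)
     flip ne (suc v) e = refl
     last : ∀ b → M zero ≡ b → (1ℚ - q) * (EV n (f ∘ (false ∷_)) * EV n (g ∘ (false ∷_))) + q * (EV n (f ∘ (true ∷_)) * EV n (g ∘ (true ∷_)))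
          ≡ EV (suc n) f * EV (suc n) g
     last true e = trans (cong (λ z → (1ℚ - q) * (EV n (f ∘ (false ∷_)) * EV n (g ∘ (false ∷_))) + q * (EV n (f ∘ (true ∷_)) * z)) (sym same))
       (trans (solve 4 (λ q f₀ f₁ g → (con 1ℚ :- q) :* (f₀ :* g) :+ q :* (f₁ :* g) := ((con 1ℚ :- q) :* f₀ :+ q :* f₁) :* ((con 1ℚ :- q) :* g :+ q :* g)) refl
         q (EV n (f ∘ (false ∷_))) (EV n (f ∘ (true ∷_))) (EV n (g ∘ (false ∷_))))
         (cong (λ z → EV (suc n) f * ((1ℚ - q) * EV n (g ∘ (false ∷_)) + q * z)) same))
       where
       same : EV n (g ∘ (false ∷_)) ≡ EV n (g ∘ (true ∷_))
       same = EV-cong n λ S → hg _ _ (flip (λ e′ → case′ (trans (sym e) e′)))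
         where
         case′ : true ≢ false
         case′ ()
     last false e = trans (cong (λ z → (1ℚ - q) * (EV n (f ∘ (false ∷_)) * EV n (g ∘ (false ∷_))) + q * (z * EV n (g ∘ (true ∷_)))) (sym same))
       (trans (solve 4 (λ q f g₀ g₁ → (con 1ℚ :- q) :* (f :* g₀) :+ q :* (f :* g₁) := ((con 1ℚ :- q) :* f :+ q :* f) :* ((con 1ℚ :- q) :* g₀ :+ q :* g₁)) refl
         q (EV n (f ∘ (false ∷_))) (EV n (g ∘ (false ∷_))) (EV n (g ∘ (true ∷_))))
         (cong (λ z → ((1ℚ - q) * EV n (f ∘ (false ∷_)) + q * z) * EV (suc n) g) same))
       where
       same : EV n (f ∘ (false ∷_)) ≡ EV n (f ∘ (true ∷_))
       same = EV-cong n λ S → hf _ _ (flip (λ e′ → case′ (trans (sym e) e′)))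
         where
         case′ : false ≢ true
         case′ ()

   -- Dep M b f: f only depends on the pairs that the mask M marks with b.
   Dep : ∀ {n} → (Fin n → Fin n → Bool) → Bool → (Graph n → ℚ) → Set
   Dep M b f = ∀ R R′ → (∀ u v → M u v ≡ b → adj R u v ≡ adj R′ u v) → f R ≡ f R′

   -- The rows below are independent by induction, the row of the new vertex by `EV-indep`. Symmetry
   -- of the mask is needed because this row represents the pairs in both orders.
   EG-indep : ∀ n (M : Fin n → Fin n → Bool) → (∀ u v → M u v ≡ M v u) → ∀ f g → Dep M true f → Dep M false g →
     EG n (λ R → f R * g R) ≡ EG n f * EG n g
   EG-indep zero M M-sym f g hf hg = refl
   EG-indep (suc n) M M-sym f g hf hg = trans
     (EV-cong n λ S → EG-indep n (λ u v → M (suc u) (suc v)) (λ u v → M-sym _ _) (λ R → f (addVertex S R)) (λ R → g (addVertex S R))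
       (λ R R′ h → hf _ _ (ext S h)) (λ R R′ h → hg _ _ (ext S h)))
     (EV-indep n (λ v → M zero (suc v)) (λ S → EG n (λ R → f (addVertex S R))) (λ S → EG n (λ R → g (addVertex S R)))
       (λ S S′ h → EG-cong n λ R → hf _ _ (row R h)) (λ S S′ h → EG-cong n λ R → hg _ _ (row R h)))
     where
     ext : ∀ S {b R R′} → (∀ u v → M (suc u) (suc v) ≡ b → adj R u v ≡ adj R′ u v) → ∀ u v → M u v ≡ b → adj (addVertex S R) u v ≡ adj (addVertex S R′) u v
     ext S h zero zero e = refl
     ext S h zero (suc v) e = refl
     ext S h (suc u) zero e = refl
     ext S h (suc u) (suc v) e = h u v e
     row : ∀ R {b S S′} → Agree (λ v → M zero (suc v)) b S S′ → ∀ u v → M u v ≡ b → adj (addVertex S R) u v ≡ adj (addVertex S′ R) u v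
     row R h zero zero e = refl
     row R h zero (suc v) e = h v e
     row R h (suc u) zero e = h u (trans (M-sym zero (suc u)) e)
     row R h (suc u) (suc v) e = refl

   EV-bit : ∀ n v → EV n (λ S → bit (lookup S v)) ≡ q
   EV-bit (suc n) zero = trans (cong₂ (λ x y → (1ℚ - q) * x + q * y) (EV-const n 0ℚ) (EV-const n 1ℚ)) (solve 1 (λ q → (con 1ℚ :- q) :* con 0ℚ :+ q :* con 1ℚ := q) refl q)
   EV-bit (suc n) (suc v) = trans (cong₂ (λ x y → (1ℚ - q) * x + q * y) (EV-bit n v) (EV-bit n v)) (solve 1 (λ q → (con 1ℚ :- q) :* q :+ q :* q := q) refl q)

   EG-edge : ∀ n u v → u ≢ v → EG n (λ R → bit (adj R u v)) ≡ q
   EG-edge (suc n) zero zero ne = ⊥-elim (ne refl)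
   EG-edge (suc n) zero (suc v) ne = trans (EV-cong n (λ S → EG-const n _)) (EV-bit n v)
   EG-edge (suc n) (suc u) zero ne = trans (EV-cong n (λ S → EG-const n _)) (EV-bit n u)
   EG-edge (suc n) (suc u) (suc v) ne = trans (EV-cong n (λ S → EG-edge n u v (ne ∘ cong suc))) (EV-const n q)

   module _ (0≤q : 0ℚ ≤ q) (q≤1 : q ≤ 1ℚ) where

     0≤1-q : 0ℚ ≤ 1ℚ - q
     0≤1-q = ℚ.≤-trans (ℚ.≤-reflexive (sym (ℚ.+-inverseʳ q))) (ℚ.+-monoˡ-≤ (- q) q≤1)

     EV-mono : ∀ n {f g} → (∀ S → f S ≤ g S) → EV n f ≤ EV n g
     EV-mono zero h = h []
     EV-mono (suc n) h = ℚ.+-mono-≤ (*-monoˡ (1ℚ - q) 0≤1-q (EV-mono n (h ∘ (false ∷_)))) (*-monoˡ q 0≤q (EV-mono n (h ∘ (true ∷_))))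

     EG-mono : ∀ n {f g} → (∀ R → f R ≤ g R) → EG n f ≤ EG n g
     EG-mono zero h = h emptyGraph
     EG-mono (suc n) h = EV-mono n λ S → EG-mono n λ R → h (addVertex S R)

   EG-Σ : ∀ n {A : Set} (f : A → Graph n → ℚ) xs → EG n (λ R → ΣL (λ x → f x R) xs) ≡ ΣL (λ x → EG n (f x)) xs
   EG-Σ n f [] = EG-const n 0ℚ
   EG-Σ n f (x ∷ xs) = trans (EG-+ n (f x) _) (cong (EG n (f x) +_) (EG-Σ n f xs))

 infix 4 _⊑_ _⊑ᴳ_

 _⊑_ : ∀ {n} → Vec Bool n → Vec Bool n → Set
 S ⊑ S′ = ∀ v → T (lookup S v) → T (lookup S′ v)

 _⊑ᴳ_ : ∀ {n} → Graph n → Graph n → Set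
 R ⊑ᴳ R′ = ∀ u v → T (adj R u v) → T (adj R′ u v)

 module _ {q q′ : ℚ} (0≤q : 0ℚ ≤ q) (q≤q′ : q ≤ q′) (q′≤1 : q′ ≤ 1ℚ) where
   private
     module E = Expect q
     module E′ = Expect q′
     0≤q′ = ℚ.≤-trans 0≤q q≤q′

   -- In terms of the first bit the expectation is x₀ + q (x₁ - x₀), where x₀ ≤ x₁ by monotonicity
   -- of f. This replaces a coupling on a common probability space.
   EV-couple : ∀ n {f} → (∀ S S′ → S ⊑ S′ → f S ≤ f S′) → E.EV n f ≤ E′.EV n f
   EV-couple zero h = ℚ.≤-refl
   EV-couple (suc n) {f} h = begin
     (1ℚ - q) * x₀ + q * x₁
       ≡⟨ solve 3 (λ q x y → (con 1ℚ :- q) :* x :+ q :* y := x :+ q :* (y :- x)) refl q x₀ x₁ ⟩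
     x₀ + q * (x₁ - x₀)
       ≤⟨ ℚ.+-monoʳ-≤ x₀ (*-monoʳ (x₁ - x₀) (ℚ.≤-trans (ℚ.≤-reflexive (sym (ℚ.+-inverseʳ x₀))) (ℚ.+-monoˡ-≤ (- x₀) x₀≤x₁)) q≤q′) ⟩
     x₀ + q′ * (x₁ - x₀)
       ≡⟨ solve 3 (λ q x y → x :+ q :* (y :- x) := (con 1ℚ :- q) :* x :+ q :* y) refl q′ x₀ x₁ ⟩
     (1ℚ - q′) * x₀ + q′ * x₁
       ≤⟨ ℚ.+-mono-≤ (*-monoˡ (1ℚ - q′) (E′.0≤1-q 0≤q′ q′≤1) (EV-couple n (λ S S′ s → h _ _ (ext s)))) (*-monoˡ q′ 0≤q′ (EV-couple n (λ S S′ s → h _ _ (ext s)))) ⟩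
     (1ℚ - q′) * E′.EV n (f ∘ (false ∷_)) + q′ * E′.EV n (f ∘ (true ∷_)) ∎
     where
     open ℚ.≤-Reasoning
     x₀ = E.EV n (f ∘ (false ∷_))
     x₁ = E.EV n (f ∘ (true ∷_))
     ext : ∀ {b} {S S′ : Vec Bool n} → S ⊑ S′ → (b ∷ S) ⊑ (b ∷ S′)
     ext s zero t = t
     ext s (suc v) t = s v t
     x₀≤x₁ : x₀ ≤ x₁
     x₀≤x₁ = E.EV-mono 0≤q (ℚ.≤-trans q≤q′ q′≤1) n (λ S → h _ _ (λ { zero () ; (suc v) t → t }))

   EG-couple : ∀ n {f} → (∀ R R′ → R ⊑ᴳ R′ → f R ≤ f R′) → E.EG n f ≤ E′.EG n f
   EG-couple zero h = ℚ.≤-refl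
   EG-couple (suc n) {f} h = ℚ.≤-trans
     (EV-couple n (λ S S′ s → E.EG-mono 0≤q (ℚ.≤-trans q≤q′ q′≤1) n (λ R → h _ _ (row s))))
     (E′.EV-mono 0≤q′ q′≤1 n (λ S → EG-couple n (λ R R′ r → h _ _ (ext r))))
     where
     row : ∀ {S S′ : Vec Bool n} {R} → S ⊑ S′ → addVertex S R ⊑ᴳ addVertex S′ R
     row s zero (suc v) t = s v t
     row s (suc u) zero t = s u t
     row s (suc u) (suc v) t = t
     ext : ∀ {S} {R R′ : Graph n} → R ⊑ᴳ R′ → addVertex S R ⊑ᴳ addVertex S R′
     ext r zero (suc v) t = t
     ext r (suc u) zero t = t
     ext r (suc u) (suc v) t = r u v t

-- Bernoulli-type inequalities and the probability that a set of pieces is stuck.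

module RationalBounds where

 open import Data.Bool.Base using (Bool; true; false; T; if_then_else_; _∧_; _∨_)
 open import Data.Bool.Properties using (∨-comm)
 open import Data.Empty using (⊥-elim)
 open import Data.Fin.Base as Fin using (Fin; zero; suc)
 import Data.Fin.Properties as Fin
 import Data.Integer.Base as ℤ
 open import Data.List.Base as List using (List; []; _∷_; filter; length)
 open import Data.List.Membership.Propositional using (_∈_; _∉_)
 open import Data.List.Relation.Unary.Any using (here; there)
 open import Data.List.Relation.Unary.All as All using (All; []; _∷_)
 open import Data.List.Relation.Unary.AllPairs using ([]; _∷_)
 open import Data.List.Relation.Unary.Unique.Propositional using (Unique)
 open import Data.Nat.Base as ℕ using (ℕ; zero; suc)
 import Data.Nat.Properties as ℕ
 open import Data.Product.Base using (_×_; _,_; proj₁)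
 open import Data.Rational.Base
 import Data.Rational.Properties as ℚ
 open import Data.Rational.Solver using (module +-*-Solver)
 open import Function.Base using (_∘_)
 open import Relation.Binary.PropositionalEquality using (_≡_; refl; sym; trans; cong; cong₂; subst)
 open import Relation.Nullary using (Dec; does; yes; no; ¬_)
 open import Relation.Nullary.Decidable using (isYes)
 open import Defs using (Graph; adj; module ℚLemmas)
 open ℚLemmas using (*-monoˡ; *-monoʳ; *-mono; *-nonneg; *-pos; 0≤1; 0<1; 0≤½; 0<½; fromℕ-suc; 0≤fromℕ; fromℕ-mono; halves; ½^; ½^-nonneg; ½^≤1)
 open Lists using (Unique-∉)
 open PancyclicCriterion using (inside; Stuck; stuck?; _∈ℕ?_)
 open Expectation
 open +-*-Solver

 ι : ℕ → ℚ
 ι n = ℤ.+ n / 1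

 ι-+ : ∀ m n → ι (m ℕ.+ n) ≡ ι m + ι n
 ι-+ zero n = sym (ℚ.+-identityˡ (ι n))
 ι-+ (suc m) n = trans (fromℕ-suc (m ℕ.+ n)) (trans (cong (1ℚ +_) (ι-+ m n)) (trans (sym (ℚ.+-assoc 1ℚ (ι m) (ι n))) (cong (_+ ι n) (sym (fromℕ-suc m)))))

 ι-* : ∀ m n → ι (m ℕ.* n) ≡ ι m * ι n
 ι-* zero n = sym (ℚ.*-zeroˡ (ι n))
 ι-* (suc m) n = trans (ι-+ n (m ℕ.* n)) (trans (cong (ι n +_) (ι-* m n)) (trans (solve 2 (λ m n → n :+ m :* n := (con 1ℚ :+ m) :* n) refl (ι m) (ι n)) (cong (_* ι n) (sym (fromℕ-suc m)))))

 ι-cancel : ∀ {m n} → ι m ≤ ι n → m ℕ.≤ n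
 ι-cancel {m} {n} le with m ℕ.≤? n
 ... | yes p = p
 ... | no ¬p = ⊥-elim (ℚ.<-irrefl refl (ℚ.<-≤-trans lt (ℚ.≤-trans (fromℕ-mono (ℕ.≰⇒> ¬p)) le)))
   where
   lt : ι n < ι (suc n)
   lt = ℚ.<-respˡ-≡ (ℚ.+-identityˡ (ι n)) (ℚ.<-respʳ-≡ (sym (fromℕ-suc n)) (ℚ.+-monoˡ-< (ι n) 0<1))

 x≤x+ : ∀ x y → 0ℚ ≤ y → x ≤ x + y
 x≤x+ x y 0≤y = ℚ.≤-trans (ℚ.≤-reflexive (sym (ℚ.+-identityʳ x))) (ℚ.+-monoʳ-≤ x 0≤y)

 x-≤x : ∀ x y → 0ℚ ≤ y → x - y ≤ x
 x-≤x x y 0≤y = ℚ.≤-trans (ℚ.+-monoʳ-≤ x (ℚ.neg-antimono-≤ 0≤y)) (ℚ.≤-reflexive (ℚ.+-identityʳ x))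

 ≤-move : ∀ {x y z} → x + y ≤ z → x ≤ z - y
 ≤-move {x} {y} {z} le = ℚ.≤-trans (ℚ.≤-reflexive (solve 2 (λ x y → x := x :+ y :- y) refl x y)) (ℚ.+-monoˡ-≤ (- y) le)

 0≤1- : ∀ {x} → x ≤ 1ℚ → 0ℚ ≤ 1ℚ - x
 0≤1- {x} le = ≤-move {0ℚ} {x} (ℚ.≤-trans (ℚ.≤-reflexive (ℚ.+-identityˡ x)) le)

 1-≤1 : ∀ {x} → 0ℚ ≤ x → 1ℚ - x ≤ 1ℚ
 1-≤1 {x} le = ℚ.≤-trans (ℚ.+-monoʳ-≤ 1ℚ (ℚ.neg-antimono-≤ le)) (ℚ.≤-reflexive (ℚ.+-identityʳ 1ℚ))

 1-anti : ∀ {x y} → x ≤ y → 1ℚ - y ≤ 1ℚ - x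
 1-anti le = ℚ.+-monoʳ-≤ 1ℚ (ℚ.neg-antimono-≤ le)

 pow : ℚ → ℕ → ℚ
 pow x zero = 1ℚ
 pow x (suc n) = x * pow x n

 pow-+ : ∀ x m n → pow x (m ℕ.+ n) ≡ pow x m * pow x n
 pow-+ x zero n = sym (ℚ.*-identityˡ _)
 pow-+ x (suc m) n = trans (cong (x *_) (pow-+ x m n)) (sym (ℚ.*-assoc x (pow x m) (pow x n)))

 pow-* : ∀ x m n → pow x (m ℕ.* n) ≡ pow (pow x n) m
 pow-* x zero n = refl
 pow-* x (suc m) n = trans (pow-+ x n (m ℕ.* n)) (cong (pow x n *_) (pow-* x m n))

 pow-nonneg : ∀ {x} → 0ℚ ≤ x → ∀ n → 0ℚ ≤ pow x n
 pow-nonneg 0≤x zero = 0≤1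
 pow-nonneg 0≤x (suc n) = *-nonneg 0≤x (pow-nonneg 0≤x n)

 pow-mono : ∀ {x y} → 0ℚ ≤ x → x ≤ y → ∀ n → pow x n ≤ pow y n
 pow-mono 0≤x x≤y zero = ℚ.≤-refl
 pow-mono 0≤x x≤y (suc n) = *-mono (pow-nonneg 0≤x n) x≤y (ℚ.≤-trans 0≤x x≤y) (pow-mono 0≤x x≤y n)

 pow≤1 : ∀ {x} → 0ℚ ≤ x → x ≤ 1ℚ → ∀ n → pow x n ≤ 1ℚ
 pow≤1 0≤x x≤1 zero = ℚ.≤-refl
 pow≤1 {x} 0≤x x≤1 (suc n) = ℚ.≤-trans (*-mono (pow-nonneg 0≤x n) x≤1 0≤1 (pow≤1 0≤x x≤1 n)) (ℚ.≤-reflexive (ℚ.*-identityˡ 1ℚ))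

 pow-anti : ∀ {x} → 0ℚ ≤ x → x ≤ 1ℚ → ∀ {m n} → m ℕ.≤ n → pow x n ≤ pow x m
 pow-anti {x} 0≤x x≤1 {m} {n} m≤n = subst (λ k → pow x k ≤ pow x m) (ℕ.m+[n∸m]≡n m≤n)
   (ℚ.≤-trans (ℚ.≤-reflexive (pow-+ x m (n ℕ.∸ m))) (ℚ.≤-trans (*-monoˡ (pow x m) (pow-nonneg 0≤x m) (pow≤1 0≤x x≤1 (n ℕ.∸ m))) (ℚ.≤-reflexive (ℚ.*-identityʳ _))))

 pow-½ : ∀ n → pow ½ n ≡ ½^ n
 pow-½ zero = refl
 pow-½ (suc n) = cong (½ *_) (pow-½ n)

 bernoulli : ∀ {x} → x ≤ 1ℚ → 0ℚ ≤ x → ∀ m → 1ℚ - ι m * x ≤ pow (1ℚ - x) m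
 bernoulli {x} x≤1 0≤x zero = ℚ.≤-reflexive (solve 1 (λ x → con 1ℚ :- con 0ℚ :* x := con 1ℚ) refl x)
 bernoulli {x} x≤1 0≤x (suc m) = begin
   1ℚ - ι (suc m) * x                ≡⟨ cong (λ z → 1ℚ - z * x) (fromℕ-suc m) ⟩
   1ℚ - (1ℚ + ι m) * x               ≤⟨ x≤x+ (1ℚ - (1ℚ + ι m) * x) (ι m * (x * x)) (*-nonneg (0≤fromℕ m) (*-nonneg 0≤x 0≤x)) ⟩
   (1ℚ - (1ℚ + ι m) * x) + ι m * (x * x) ≡⟨ solve 2 (λ m x → (con 1ℚ :- (con 1ℚ :+ m) :* x) :+ m :* (x :* x) := (con 1ℚ :- x) :* (con 1ℚ :- m :* x)) refl (ι m) x ⟩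
   (1ℚ - x) * (1ℚ - ι m * x)         ≤⟨ *-monoˡ (1ℚ - x) (0≤1- x≤1) (bernoulli x≤1 0≤x m) ⟩
   (1ℚ - x) * pow (1ℚ - x) m         ∎
   where open ℚ.≤-Reasoning

 -- The bound of (1 - x)^m by 1 / (1 + m x), written without division.
 bernoulli⁻ : ∀ {x} → x ≤ 1ℚ → 0ℚ ≤ x → ∀ m → pow (1ℚ - x) m * (1ℚ + ι m * x) ≤ 1ℚ
 bernoulli⁻ {x} x≤1 0≤x zero = ℚ.≤-reflexive (solve 1 (λ x → con 1ℚ :* (con 1ℚ :+ con 0ℚ :* x) := con 1ℚ) refl x)
 bernoulli⁻ {x} x≤1 0≤x (suc m) = begin
   (1ℚ - x) * P * (1ℚ + ι (suc m) * x) ≡⟨ cong (λ z → (1ℚ - x) * P * (1ℚ + z * x)) (fromℕ-suc m) ⟩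
   (1ℚ - x) * P * (1ℚ + (1ℚ + ι m) * x) ≡⟨ solve 3 (λ P m x → (con 1ℚ :- x) :* P :* (con 1ℚ :+ (con 1ℚ :+ m) :* x) := P :* (con 1ℚ :+ m :* x) :- P :* ((con 1ℚ :+ m) :* (x :* x))) refl P (ι m) x ⟩
   P * (1ℚ + ι m * x) - P * ((1ℚ + ι m) * (x * x)) ≤⟨ x-≤x (P * (1ℚ + ι m * x)) (P * ((1ℚ + ι m) * (x * x))) (*-nonneg (pow-nonneg (0≤1- x≤1) m) (*-nonneg (ℚ.+-mono-≤ 0≤1 (0≤fromℕ m)) (*-nonneg 0≤x 0≤x))) ⟩
   P * (1ℚ + ι m * x) ≤⟨ bernoulli⁻ x≤1 0≤x m ⟩
   1ℚ ∎
   where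
   open ℚ.≤-Reasoning
   P = pow (1ℚ - x) m

 half-power : ∀ {x} → x ≤ 1ℚ → 0ℚ ≤ x → ∀ m → 1ℚ ≤ ι m * x → pow (1ℚ - x) m ≤ ½
 half-power {x} x≤1 0≤x m le = begin
   P                        ≡⟨ solve 1 (λ P → P := con ½ :* (P :* (con 1ℚ :+ con 1ℚ))) refl P ⟩
   ½ * (P * (1ℚ + 1ℚ))      ≤⟨ *-monoˡ ½ 0≤½ (*-monoˡ P (pow-nonneg (0≤1- x≤1) m) (ℚ.+-monoʳ-≤ 1ℚ le)) ⟩
   ½ * (P * (1ℚ + ι m * x)) ≤⟨ *-monoˡ ½ 0≤½ (bernoulli⁻ x≤1 0≤x m) ⟩
   ½ * 1ℚ                   ≡⟨ ℚ.*-identityʳ ½ ⟩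
   ½                        ∎
   where
   open ℚ.≤-Reasoning
   P = pow (1ℚ - x) m

 -- Among the N factors there are j groups of m, and each group contributes at most ½.
 decay : ∀ {x} → x ≤ 1ℚ → 0ℚ ≤ x → ∀ m j N → 1ℚ ≤ ι m * x → j ℕ.* m ℕ.≤ N → pow (1ℚ - x) N ≤ ½^ j
 decay {x} x≤1 0≤x m j N le jm = begin
   pow (1ℚ - x) N           ≤⟨ pow-anti (0≤1- x≤1) (1-≤1 0≤x) jm ⟩
   pow (1ℚ - x) (j ℕ.* m)   ≡⟨ pow-* (1ℚ - x) j m ⟩
   pow (pow (1ℚ - x) m) j   ≤⟨ pow-mono (pow-nonneg (0≤1- x≤1) m) (half-power x≤1 0≤x m le) j ⟩
   pow ½ j                  ≡⟨ pow-½ j ⟩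
   ½^ j                     ∎
   where open ℚ.≤-Reasoning

 ΠL-nonneg : ∀ {A : Set} {f : A → ℚ} → (∀ x → 0ℚ ≤ f x) → ∀ xs → 0ℚ ≤ ΠL f xs
 ΠL-nonneg h [] = 0≤1
 ΠL-nonneg h (x ∷ xs) = *-nonneg (h x) (ΠL-nonneg h xs)

 ΠL-All : ∀ {A : Set} (f : A → Bool) {xs} → All (T ∘ f) xs → ΠL (bit ∘ f) xs ≡ 1ℚ
 ΠL-All f [] = refl
 ΠL-All f {x ∷ xs} (p ∷ ps) with f x
 ... | true = trans (ℚ.*-identityˡ _) (ΠL-All f ps)

 bit-dec : ∀ {A : Set} (d : Dec A) {r} → 0ℚ ≤ r → (A → r ≡ 1ℚ) → bit (does d) ≤ r
 bit-dec (yes a) _ h = ℚ.≤-reflexive (sym (h a))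
 bit-dec (no _) 0≤r _ = 0≤r

 select-true : ∀ s g → s ≡ s * 1ℚ + (1ℚ - 1ℚ) * g
 select-true = solve 2 (λ s g → s := s :* con 1ℚ :+ (con 1ℚ :- con 1ℚ) :* g) refl

 select-false : ∀ s g → g ≡ s * 0ℚ + (1ℚ - 0ℚ) * g
 select-false = solve 2 (λ s g → g := s :* con 0ℚ :+ (con 1ℚ :- con 0ℚ) :* g) refl

 neg-* : ∀ r → - r ≡ - 1ℚ * r
 neg-* = solve 1 (λ r → :- r := con (- 1ℚ) :* r) refl

 step-inside : ∀ q o P → q * 1ℚ + (1ℚ - q) * (1ℚ - q * o * P) ≡ 1ℚ - q * o * ((1ℚ - q) * P)
 step-inside = solve 3 (λ q o P → q :* con 1ℚ :+ (con 1ℚ :- q) :* (con 1ℚ :- q :* o :* P) := con 1ℚ :- q :* o :* ((con 1ℚ :- q) :* P)) refl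

 step-outside : ∀ q o P → q * 0ℚ + (1ℚ - q) * (1ℚ - q * o * P) ≡ 1ℚ - (q + q * o * ((1ℚ - q) * P))
 step-outside = solve 3 (λ q o P → q :* con 0ℚ :+ (con 1ℚ :- q) :* (con 1ℚ :- q :* o :* P) := con 1ℚ :- (q :+ q :* o :* ((con 1ℚ :- q) :* P))) refl

 expand-suc : ∀ q o P → q * (1ℚ + o) * P ≡ q * P + q * o * P
 expand-suc = solve 3 (λ q o P → q :* (con 1ℚ :+ o) :* P := q :* P :+ q :* o :* P) refl

 nothing-out : ∀ q → 1ℚ - q * 0ℚ * 1ℚ ≡ 1ℚ
 nothing-out = solve 1 (λ q → con 1ℚ :- q :* con 0ℚ :* con 1ℚ := con 1ℚ) refl

 module StuckBound {n : ℕ} (q : ℚ) (0≤q : 0ℚ ≤ q) (q≤1 : q ≤ 1ℚ) (col : Fin n → ℕ) (S : List ℕ) where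
   open Expect q
   open import Data.List.Membership.DecPropositional (Fin._≟_ {n}) using (_∈?_)

   f : Fin n → List (Fin n) → Graph n → ℚ
   f y xs R = bit (inside R col S y xs)

   module _ (y : Fin n) where

     mask : List (Fin n) → Fin n → Fin n → Bool
     mask xs u v = (isYes (u Fin.≟ y) ∧ isYes (v ∈? xs)) ∨ (isYes (v Fin.≟ y) ∧ isYes (u ∈? xs))

     mask-sym : ∀ xs u v → mask xs u v ≡ mask xs v u
     mask-sym xs u v = ∨-comm (isYes (u Fin.≟ y) ∧ isYes (v ∈? xs)) _

     mask-in : ∀ xs {x} → x ∈ xs → mask xs y x ≡ true
     mask-in xs {x} x∈ with y Fin.≟ y | x ∈? xs
     ... | yes _ | yes _ = refl
     ... | no ne | _ = ⊥-elim (ne refl)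
     ... | _ | no ne = ⊥-elim (ne x∈)

     mask-out : ∀ xs {u x} → ¬ (u ≡ y × x ∈ xs) → u ∉ xs → mask xs u x ≡ false
     mask-out xs {u} {x} h u∉ with u Fin.≟ y | x ∈? xs | x Fin.≟ y | u ∈? xs
     ... | yes e | yes m | _ | _ = ⊥-elim (h (e , m))
     ... | _ | _ | _ | yes m = ⊥-elim (u∉ m)
     ... | yes _ | no _ | yes _ | no _ = refl
     ... | yes _ | no _ | no _ | no _ = refl
     ... | no _ | yes _ | yes _ | no _ = refl
     ... | no _ | yes _ | no _ | no _ = refl
     ... | no _ | no _ | yes _ | no _ = refl
     ... | no _ | no _ | no _ | no _ = refl

   f-dep : ∀ {y} xs R R′ → (∀ {x} → x ∈ xs → adj R y x ≡ adj R′ y x) → f y xs R ≡ f y xs R′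
   f-dep [] R R′ h = refl
   f-dep {y} (x ∷ xs) R R′ h = trans (cong (λ b → bit (if b then isYes (col x ∈ℕ? S) else inside R col S y xs)) (h (here refl))) (branch (adj R′ y x))
     where
     branch : ∀ b → bit (if b then isYes (col x ∈ℕ? S) else inside R col S y xs) ≡ bit (if b then isYes (col x ∈ℕ? S) else inside R′ col S y xs)
     branch true = refl
     branch false = f-dep xs R R′ (h ∘ there)

   -- The probability of `inside` for a vertex off the list: with probability q the head is a
   -- neighbour and decides, otherwise the tail does.
   Fp : List (Fin n) → ℚ
   Fp [] = 1ℚ
   Fp (x ∷ xs) = q * bit (isYes (col x ∈ℕ? S)) + (1ℚ - q) * Fp xs

   E-inside : ∀ y xs → Unique xs → y ∉ xs → EG n (f y xs) ≡ Fp xs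
   E-inside y [] _ _ = EG-const n 1ℚ
   E-inside y (x ∷ xs) u@(_ ∷ u′) y∉ = trans (EG-cong n split) (trans (EG-+ n _ _) (cong₂ _+_
       (trans (EG-* n s r) (trans (cong (s *_) (EG-edge n y x (λ e → y∉ (here e)))) (ℚ.*-comm s q)))
       (trans (EG-indep n (mask y (x ∷ [])) (mask-sym y (x ∷ [])) (λ R → 1ℚ - r R) (f y xs)
           (λ R R′ h → cong (λ b → 1ℚ - bit b) (h y x (mask-in y (x ∷ []) (here refl))))
           (λ R R′ h → f-dep xs R R′ λ {x′} x′∈ → h y x′ (mask-out y (x ∷ []) (λ { (_ , here refl) → Unique-∉ u x′∈ }) (λ { (here e) → y∉ (here e) }))))
         (cong₂ _*_ E1-r (E-inside y xs u′ (y∉ ∘ there))))))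
     where
     s = bit (isYes (col x ∈ℕ? S))
     r : Graph n → ℚ
     r R = bit (adj R y x)
     split : ∀ R → f y (x ∷ xs) R ≡ s * r R + (1ℚ - r R) * f y xs R
     split R with adj R y x
     ... | true = select-true s (f y xs R)
     ... | false = select-false s (f y xs R)
     E1-r : EG n (λ R → 1ℚ - r R) ≡ 1ℚ - q
     E1-r = trans (EG-cong n (λ R → cong (1ℚ +_) (neg-* (r R)))) (trans (EG-+ n _ _) (cong₂ _+_ (EG-const n 1ℚ)
       (trans (EG-* n (- 1ℚ) r) (trans (cong (- 1ℚ *_) (EG-edge n y x (λ e → y∉ (here e)))) (sym (neg-* q))))))

   out : List (Fin n) → ℕ
   out [] = 0
   out (x ∷ xs) = (if isYes (col x ∈ℕ? S) then 0 else 1) ℕ.+ out xs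

   -- Each of the `out xs` vertices outside S is the first neighbour with probability at least q (1
   -- - q)^|xs|, and these events are disjoint.
   Fp-bound : ∀ xs → Fp xs ≤ 1ℚ - q * ι (out xs) * pow (1ℚ - q) (length xs)
   Fp-bound [] = ℚ.≤-reflexive (sym (nothing-out q))
   Fp-bound (x ∷ xs) with isYes (col x ∈ℕ? S)
   ... | true = begin
       q * 1ℚ + (1ℚ - q) * Fp xs ≤⟨ ℚ.+-monoʳ-≤ (q * 1ℚ) (*-monoˡ (1ℚ - q) (0≤1- q≤1) (Fp-bound xs)) ⟩
       q * 1ℚ + (1ℚ - q) * (1ℚ - q * o * P) ≡⟨ step-inside q o P ⟩
       1ℚ - q * o * ((1ℚ - q) * P) ∎
     where
     open ℚ.≤-Reasoning
     o = ι (out xs)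
     P = pow (1ℚ - q) (length xs)
   ... | false = begin
       q * 0ℚ + (1ℚ - q) * Fp xs ≤⟨ ℚ.+-monoʳ-≤ (q * 0ℚ) (*-monoˡ (1ℚ - q) (0≤1- q≤1) (Fp-bound xs)) ⟩
       q * 0ℚ + (1ℚ - q) * (1ℚ - q * o * P) ≡⟨ step-outside q o P ⟩
       1ℚ - (q + q * o * ((1ℚ - q) * P)) ≤⟨ 1-anti {q * (1ℚ + o) * ((1ℚ - q) * P)} (begin
           q * (1ℚ + o) * P′ ≡⟨ expand-suc q o P′ ⟩
           q * P′ + q * o * P′ ≤⟨ ℚ.+-monoˡ-≤ (q * o * P′) (ℚ.≤-trans (*-monoˡ q 0≤q (pow≤1 (0≤1- q≤1) (1-≤1 0≤q) (suc (length xs)))) (ℚ.≤-reflexive (ℚ.*-identityʳ q))) ⟩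
           q + q * o * P′ ∎) ⟩
       1ℚ - q * (1ℚ + o) * ((1ℚ - q) * P) ≡⟨ cong (λ z → 1ℚ - q * z * ((1ℚ - q) * P)) (sym (fromℕ-suc (out xs))) ⟩
       1ℚ - q * ι (suc (out xs)) * ((1ℚ - q) * P) ∎
     where
     open ℚ.≤-Reasoning
     o = ι (out xs)
     P = pow (1ℚ - q) (length xs)
     P′ = (1ℚ - q) * P

   -- Different vertices of `ys` look at different pairs, because `ys` and `Cs` are disjoint; hence
   -- the expectations multiply.
   E-stuck : ∀ Cs → Unique Cs → ∀ ys → Unique ys → (∀ {y} → y ∈ ys → y ∉ Cs) → EG n (λ R → ΠL (λ y → f y Cs R) ys) ≡ pow (Fp Cs) (length ys)
   E-stuck Cs uC [] _ _ = EG-const n 1ℚ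
   E-stuck Cs uC (y ∷ ys) u@(_ ∷ u′) d = trans
     (EG-indep n (mask y Cs) (mask-sym y Cs) (f y Cs) (λ R → ΠL (λ y → f y Cs R) ys)
       (λ R R′ h → f-dep Cs R R′ λ {x} x∈ → h y x (mask-in y Cs x∈))
       (λ R R′ h → rest ys (λ y′∈ → y′∈) R R′ h))
     (cong₂ _*_ (E-inside y Cs uC (d (here refl))) (E-stuck Cs uC ys u′ (d ∘ there)))
     where
     rest : ∀ zs → (∀ {z} → z ∈ zs → z ∈ ys) → ∀ R R′ → (∀ u v → mask y Cs u v ≡ false → adj R u v ≡ adj R′ u v) → ΠL (λ y → f y Cs R) zs ≡ ΠL (λ y → f y Cs R′) zs
     rest [] sub R R′ h = refl
     rest (z ∷ zs) sub R R′ h = cong₂ _*_ (f-dep Cs R R′ λ {x} x∈ → h z x (mask-out y Cs (λ { (refl , _) → Unique-∉ u (sub (here refl)) }) (d (there (sub (here refl))))))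
       (rest zs (sub ∘ there) R R′ h)

   -- If q |Cs| ≤ ½, then (1 - q)^|Cs| ≥ ½ by Bernoulli, so every vertex of `Ps` in S leads out of S
   -- with probability at least ½ q · out Cs.
   stuck-bound : ∀ Ps Cs → Unique Ps → Unique Cs → (∀ {y} → y ∈ Ps → y ∉ Cs) → q * ι (length Cs) ≤ ½ →
     EG n (λ R → bit (does (stuck? R col Ps Cs S))) ≤ pow (1ℚ - ½ * (q * ι (out Cs))) (length (filter (λ y → col y ∈ℕ? S) Ps))
   stuck-bound Ps Cs uP uC d small = begin
     EG n (λ R → bit (does (stuck? R col Ps Cs S)))
       ≤⟨ EG-mono 0≤q q≤1 n (λ R → bit-dec (stuck? R col Ps Cs S) (ΠL-nonneg (λ y → 0≤bit (inside R col S y Cs)) ys) (ΠL-All (λ y → inside R col S y Cs))) ⟩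
     EG n (λ R → ΠL (λ y → f y Cs R) ys)
       ≡⟨ E-stuck Cs uC ys (Unique.filter⁺ _ uP) (λ y∈ → d (proj₁ (∈-filter⁻ (λ y → col y ∈ℕ? S) y∈))) ⟩
     pow (Fp Cs) (length ys)
       ≤⟨ pow-mono (Fp≥0 Cs) (ℚ.≤-trans (Fp-bound Cs) (1-anti (begin
             ½ * (q * o) ≡⟨ ℚ.*-comm ½ (q * o) ⟩
             q * o * ½ ≤⟨ *-monoˡ (q * o) (*-nonneg 0≤q (0≤fromℕ (out Cs))) (begin
                ½ ≡⟨ refl ⟩
                1ℚ - ½ ≤⟨ 1-anti (ℚ.≤-trans (ℚ.≤-reflexive (ℚ.*-comm (ι (length Cs)) q)) small) ⟩
                1ℚ - ι (length Cs) * q ≤⟨ bernoulli q≤1 0≤q (length Cs) ⟩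
                pow (1ℚ - q) (length Cs) ∎) ⟩
             q * o * pow (1ℚ - q) (length Cs) ∎))) (length ys) ⟩
     pow (1ℚ - ½ * (q * o)) (length ys) ∎
     where
     open ℚ.≤-Reasoning
     import Data.List.Relation.Unary.Unique.Propositional.Properties as Unique
     open import Data.List.Membership.Propositional.Properties using (∈-filter⁻)
     ys = filter (λ y → col y ∈ℕ? S) Ps
     o = ι (out Cs)
     Fp≥0 : ∀ xs → 0ℚ ≤ Fp xs
     Fp≥0 [] = 0≤1
     Fp≥0 (x ∷ xs) = ℚ.+-mono-≤ (*-nonneg 0≤q (0≤bit (isYes (col x ∈ℕ? S)))) (*-nonneg (0≤1- q≤1) (Fp≥0 xs))

-- Union bound over all sets of pieces.

module TreeProbability where

 open import Data.Bool.Base using (Bool; true; false; T; if_then_else_)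
 open import Data.Fin.Base as Fin using (Fin; zero; suc)
 import Data.Fin.Properties as Fin
 open import Data.List.Base as List using (List; []; _∷_; _++_; filter; length; map; concatMap)
 import Data.List.Properties as List
 open import Data.List.Membership.Propositional using (_∈_; _∉_; find)
 open import Data.List.Membership.Propositional.Properties
 open import Data.List.Relation.Unary.Any as Any using (Any; here; there)
 open import Data.List.Relation.Unary.All as All using (All; []; _∷_)
 import Data.List.Relation.Unary.All.Properties as All
 open import Data.List.Relation.Unary.AllPairs using ([]; _∷_)
 open import Data.List.Relation.Unary.Unique.Propositional using (Unique)
 import Data.List.Relation.Unary.Unique.Propositional.Properties as Unique
 open import Data.Nat.Base as ℕ using (ℕ; zero; suc)
 import Data.Nat.Properties as ℕ
 open import Data.Nat.DivMod using (m/n*n≤m; m/n≤m)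
 open import Data.Product.Base using (∃; _×_; _,_; proj₁; proj₂)
 open import Data.Rational.Base
 import Data.Rational.Properties as ℚ
 open import Data.Rational.Solver using (module +-*-Solver)
 open import Data.Sum.Base using (inj₁; inj₂; _⊎_; [_,_]′)
 open import Function.Base using (_∘_; id)
 open import Relation.Binary.PropositionalEquality using (_≡_; _≢_; refl; sym; trans; cong; cong₂; subst)
 open import Relation.Nullary using (Dec; does; yes; no; ¬_)
 open import Relation.Nullary.Decidable using (isYes; _×-dec_; dec-true)
 open import Defs using (Graph; pancyclic?; _∪_; module ℚLemmas)
 open ℚLemmas using (*-monoˡ; *-monoʳ; *-mono; *-nonneg; *-pos; 0≤1; 0<1; 0≤½; 0<½; fromℕ-suc; 0≤fromℕ; fromℕ-mono; halves; ½^; ½^-nonneg; ½^≤1)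
 open Lists
 open PathSystems using (costs)
 open Pieces using (pieces; ∈-pieces)
 open GraphSetup using (Setup; waste; module GraphWalks)
 open PancyclicCriterion
 open Expectation
 open RationalBounds
 open +-*-Solver

 subs-⊆ : ∀ cs {T} → T ∈ subs cs → T ⊆ cs
 subs-⊆ [] (here refl) ()
 subs-⊆ (c ∷ cs) T∈ x∈ with ∈-++⁻ (map (c ∷_) (subs cs)) T∈
 ... | inj₂ q = there (subs-⊆ cs q x∈)
 ... | inj₁ q with ∈-map⁻ (c ∷_) q
 ...   | T′ , T′∈ , refl with x∈
 ...     | here e = here e
 ...     | there r = there (subs-⊆ cs T′∈ r)

 subs-unique : ∀ {cs} → Unique cs → ∀ {T} → T ∈ subs cs → Unique T
 subs-unique [] (here refl) = []
 subs-unique {c ∷ cs} u@(_ ∷ u′) T∈ with ∈-++⁻ (map (c ∷_) (subs cs)) T∈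
 ... | inj₂ q = subs-unique u′ q
 ... | inj₁ q with ∈-map⁻ (c ∷_) q
 ...   | T′ , T′∈ , refl = Unique-∷ (λ c∈ → Unique-∉ u (subs-⊆ cs T′∈ c∈)) (subs-unique u′ T′∈)

 subs-length : ∀ cs {T} → T ∈ subs cs → length T ℕ.≤ length cs
 subs-length [] (here refl) = ℕ.z≤n
 subs-length (c ∷ cs) T∈ with ∈-++⁻ (map (c ∷_) (subs cs)) T∈
 ... | inj₂ q = ℕ.m≤n⇒m≤1+n (subs-length cs q)
 ... | inj₁ q with ∈-map⁻ (c ∷_) q
 ...   | T′ , T′∈ , refl = ℕ.s≤s (subs-length cs T′∈)

 ΣL-cong∈ : ∀ {A : Set} {f g : A → ℚ} xs → (∀ {x} → x ∈ xs → f x ≡ g x) → ΣL f xs ≡ ΣL g xs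
 ΣL-cong∈ [] h = refl
 ΣL-cong∈ (x ∷ xs) h = cong₂ _+_ (h (here refl)) (ΣL-cong∈ xs (h ∘ there))

 ΣL-mono∈ : ∀ {A : Set} {f g : A → ℚ} xs → (∀ {x} → x ∈ xs → f x ≤ g x) → ΣL f xs ≤ ΣL g xs
 ΣL-mono∈ [] h = ℚ.≤-refl
 ΣL-mono∈ (x ∷ xs) h = ℚ.+-mono-≤ (h (here refl)) (ΣL-mono∈ xs (h ∘ there))

 ΣL-+ : ∀ {A : Set} (f g : A → ℚ) xs → ΣL (λ x → f x + g x) xs ≡ ΣL f xs + ΣL g xs
 ΣL-+ f g [] = refl
 ΣL-+ f g (x ∷ xs) = trans (cong (f x + g x +_) (ΣL-+ f g xs)) (solve 4 (λ a b c d → a :+ b :+ (c :+ d) := (a :+ c) :+ (b :+ d)) refl (f x) (g x) (ΣL f xs) (ΣL g xs))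

 -- pow₀ β m is β^m for m > 0, but 0 for m = 0.
 pow₀ : ℚ → ℕ → ℚ
 pow₀ β zero = 0ℚ
 pow₀ β (suc m) = pow β (suc m)

 pow₀-nonneg : ∀ {β} → 0ℚ ≤ β → ∀ m → 0ℚ ≤ pow₀ β m
 pow₀-nonneg 0≤β zero = ℚ.≤-refl
 pow₀-nonneg 0≤β (suc m) = pow-nonneg 0≤β (suc m)

 module _ (β : ℚ) where
   -- The binomial theorem. The primed versions sum over complements; with `pow₀` the exponent 0
   -- drops out, which reduces the sum to (1 + β)^k - 1.
   Σ-subs : ∀ cs → ΣL (λ T → pow β (length T)) (subs cs) ≡ pow (1ℚ + β) (length cs)
   Σ-subs [] = refl
   Σ-subs (c ∷ cs) = trans (ΣL-++ _ (map (c ∷_) (subs cs)) (subs cs)) (trans (cong₂ _+_ (trans (ΣL-map _ (c ∷_) (subs cs)) (trans (ΣL-* β _ (subs cs)) (cong (β *_) (Σ-subs cs)))) (Σ-subs cs))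
     (solve 2 (λ b p → b :* p :+ p := (con 1ℚ :+ b) :* p) refl β (pow (1ℚ + β) (length cs))))

   Σ-subs′ : ∀ cs → ΣL (λ T → pow β (length cs ℕ.∸ length T)) (subs cs) ≡ pow (1ℚ + β) (length cs)
   Σ-subs′ [] = refl
   Σ-subs′ (c ∷ cs) = trans (ΣL-++ _ (map (c ∷_) (subs cs)) (subs cs)) (trans (cong₂ _+_ (trans (ΣL-map _ (c ∷_) (subs cs)) (Σ-subs′ cs))
       (trans (ΣL-cong∈ (subs cs) (λ T∈ → cong (pow β) (ℕ.+-∸-assoc 1 (subs-length cs T∈)))) (trans (ΣL-* β _ (subs cs)) (cong (β *_) (Σ-subs′ cs)))))
     (solve 2 (λ b p → p :+ b :* p := (con 1ℚ :+ b) :* p) refl β (pow (1ℚ + β) (length cs))))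

   Σ₀-subs : ∀ cs → ΣL (λ T → pow₀ β (length T)) (subs cs) ≡ pow (1ℚ + β) (length cs) - 1ℚ
   Σ₀-subs [] = refl
   Σ₀-subs (c ∷ cs) = trans (ΣL-++ _ (map (c ∷_) (subs cs)) (subs cs)) (trans (cong₂ _+_ (trans (ΣL-map _ (c ∷_) (subs cs)) (trans (ΣL-* β _ (subs cs)) (cong (β *_) (Σ-subs cs)))) (Σ₀-subs cs))
     (solve 2 (λ b p → b :* p :+ (p :- con 1ℚ) := (con 1ℚ :+ b) :* p :- con 1ℚ) refl β (pow (1ℚ + β) (length cs))))

   Σ₀-subs′ : ∀ cs → ΣL (λ T → pow₀ β (length cs ℕ.∸ length T)) (subs cs) ≡ pow (1ℚ + β) (length cs) - 1ℚ
   Σ₀-subs′ [] = refl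
   Σ₀-subs′ (c ∷ cs) = trans (ΣL-++ _ (map (c ∷_) (subs cs)) (subs cs)) (trans (cong₂ _+_ (trans (ΣL-map _ (c ∷_) (subs cs)) (Σ₀-subs′ cs))
       (trans (ΣL-cong∈ (subs cs) (λ T∈ → cong (pow₀ β) (ℕ.+-∸-assoc 1 (subs-length cs T∈)))) (trans (ΣL-* β _ (subs cs)) (cong (β *_) (Σ-subs′ cs)))))
     (solve 2 (λ b p → (p :- con 1ℚ) :+ b :* p := (con 1ℚ :+ b) :* p :- con 1ℚ) refl β (pow (1ℚ + β) (length cs))))

   -- Let X = (1 + β)^k. Since X (1 - β)^k ≤ 1, Bernoulli gives X (1 - kβ) ≤ 1. This yields X ≤ 2
   -- and then X - 1 ≤ X kβ.
   pow-1+ : 0ℚ ≤ β → β ≤ 1ℚ → ∀ k → ι k * β ≤ ½ → pow (1ℚ + β) k - 1ℚ ≤ (1ℚ + 1ℚ) * (ι k * β)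
   pow-1+ 0≤β β≤1 k small = begin
     X - 1ℚ ≤⟨ ℚ.+-monoʳ-≤ X (ℚ.neg-antimono-≤ X1) ⟩
     X - X * (1ℚ - y) ≡⟨ solve 2 (λ X y → X :- X :* (con 1ℚ :- y) := X :* y) refl X y ⟩
     X * y ≤⟨ *-monoʳ y (*-nonneg (0≤fromℕ k) 0≤β) X≤2 ⟩
     (1ℚ + 1ℚ) * y ∎
     where
     open ℚ.≤-Reasoning
     X = pow (1ℚ + β) k
     y = ι k * β
     0≤1+β : 0ℚ ≤ 1ℚ + β
     0≤1+β = ℚ.+-mono-≤ 0≤1 0≤β
     prod : ∀ k → pow (1ℚ + β) k * pow (1ℚ - β) k ≤ 1ℚ
     prod zero = ℚ.≤-refl
     prod (suc k) = begin
       (1ℚ + β) * A * ((1ℚ - β) * B) ≡⟨ solve 3 (λ b A B → (con 1ℚ :+ b) :* A :* ((con 1ℚ :- b) :* B) := (con 1ℚ :- b :* b) :* (A :* B)) refl β A B ⟩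
       (1ℚ - β * β) * (A * B) ≤⟨ *-mono (*-nonneg (pow-nonneg 0≤1+β k) (pow-nonneg (0≤1- β≤1) k)) (1-≤1 (*-nonneg 0≤β 0≤β)) 0≤1 (prod k) ⟩
       1ℚ * 1ℚ ≡⟨ refl ⟩
       1ℚ ∎
       where
       A = pow (1ℚ + β) k
       B = pow (1ℚ - β) k
     X1 : X * (1ℚ - y) ≤ 1ℚ
     X1 = ℚ.≤-trans (*-monoˡ X (pow-nonneg 0≤1+β k) (bernoulli β≤1 0≤β k)) (prod k)
     X≤2 : X ≤ 1ℚ + 1ℚ
     X≤2 = begin
       X ≡⟨ solve 1 (λ X → X := (con 1ℚ :+ con 1ℚ) :* (X :* con ½)) refl X ⟩
       (1ℚ + 1ℚ) * (X * ½) ≤⟨ *-monoˡ (1ℚ + 1ℚ) (ℚ.+-mono-≤ 0≤1 0≤1) (ℚ.≤-trans (*-monoˡ X (pow-nonneg 0≤1+β k) (1-anti {y} {½} small)) X1) ⟩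
       (1ℚ + 1ℚ) * 1ℚ ≡⟨ ℚ.*-identityʳ (1ℚ + 1ℚ) ⟩
       1ℚ + 1ℚ ∎

 -- `ω` is a lower bound for the share of one piece and 2 `W₂` for all shares together. `m₀` and
 -- `m₁` factors suffice to halve a power of 1 - ½ q W₂ and of 1 - ½ q ω.
 module _ (q : ℚ) (0≤q : 0ℚ ≤ q) (n : ℕ) (small : q * ι n ≤ ½) (ω W₂ e m₀ m₁ : ℕ) (ω≤n : ω ℕ.≤ n)
     (m₀≤ : e ℕ.* m₀ ℕ.≤ ω) (m₁≤ : e ℕ.* m₁ ℕ.≤ W₂)
     (h₀ : 1ℚ ≤ ι m₀ * (½ * (q * ι W₂))) (h₁ : 1ℚ ≤ ι m₁ * (½ * (q * ι ω))) where

   private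
     ½* : ∀ x y → x ≤ y → ½ * (q * x) ≤ ½ * (q * y)
     ½* x y le = *-monoˡ ½ 0≤½ (*-monoˡ q 0≤q le)

     ≤1 : ∀ m → m ℕ.≤ n → ½ * (q * ι m) ≤ 1ℚ
     ≤1 m m≤ = ℚ.≤-trans (½* (ι m) (ι n) (fromℕ-mono m≤)) (ℚ.≤-trans (*-monoˡ ½ 0≤½ small) (½^≤1 2))

     0≤x : ∀ m → 0ℚ ≤ ½ * (q * ι m)
     0≤x m = *-nonneg 0≤½ (*-nonneg 0≤q (0≤fromℕ m))

     ½^-pow : ∀ m → ½^ (m ℕ.* e) ≡ pow (½^ e) m
     ½^-pow m = trans (sym (pow-½ (m ℕ.* e))) (trans (pow-* ½ m e) (cong (λ z → pow z m) (pow-½ e)))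

   -- N vertices of s pieces try to reach o vertices of s′ other pieces, and o or N is at least W₂.
   -- If it is o, each of the sω or more attempts fails with probability at most 1 - ½ q W₂. If it
   -- is N, each attempt fails with probability at most (1 - ½ q ω)^s′, since o ≥ s′ω.
   escape-bound : ∀ o N s s′ → o ℕ.≤ n → s ℕ.* ω ℕ.≤ N → s′ ℕ.* ω ℕ.≤ o → W₂ ℕ.+ W₂ ℕ.≤ N ℕ.+ o →
     pow (1ℚ - ½ * (q * ι o)) N ≤ pow (½^ e) s ⊔ pow (½^ e) s′
   escape-bound o N s s′ o≤n N≥ o≥ sum = [ many , few ]′ (ℕ.≤-total W₂ o)
     where
     open ℚ.≤-Reasoning
     β = ½^ e
     many : W₂ ℕ.≤ o → pow (1ℚ - ½ * (q * ι o)) N ≤ pow β s ⊔ pow β s′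
     many le = begin
       pow (1ℚ - ½ * (q * ι o)) N ≤⟨ pow-mono (0≤1- (≤1 o o≤n)) (1-anti (½* (ι W₂) (ι o) (fromℕ-mono le))) N ⟩
       pow (1ℚ - ½ * (q * ι W₂)) N ≤⟨ decay (≤1 W₂ (ℕ.≤-trans le o≤n)) (0≤x W₂) m₀ (s ℕ.* e) N h₀
          (ℕ.≤-trans (ℕ.≤-reflexive (ℕ.*-assoc s e m₀)) (ℕ.≤-trans (ℕ.*-monoʳ-≤ s m₀≤) N≥)) ⟩
       ½^ (s ℕ.* e) ≡⟨ ½^-pow s ⟩
       pow β s ≤⟨ ℚ.p≤p⊔q (pow β s) (pow β s′) ⟩
       pow β s ⊔ pow β s′ ∎
     few : o ℕ.≤ W₂ → pow (1ℚ - ½ * (q * ι o)) N ≤ pow β s ⊔ pow β s′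
     few gt = begin
       pow (1ℚ - ½ * (q * ι o)) N ≤⟨ pow-mono (0≤1- (≤1 o o≤n)) (ℚ.≤-trans (1-anti x≤) (bernoulli (≤1 ω ω≤n) (0≤x ω) s′)) N ⟩
       pow (pow (1ℚ - ½ * (q * ι ω)) s′) N ≡⟨ sym (pow-* (1ℚ - ½ * (q * ι ω)) N s′) ⟩
       pow (1ℚ - ½ * (q * ι ω)) (N ℕ.* s′) ≤⟨ decay (≤1 ω ω≤n) (0≤x ω) m₁ (s′ ℕ.* e) (N ℕ.* s′) h₁
          (ℕ.≤-trans (ℕ.≤-reflexive (ℕ.*-assoc s′ e m₁)) (ℕ.≤-trans (ℕ.*-monoʳ-≤ s′ (ℕ.≤-trans m₁≤ W₂≤N)) (ℕ.≤-reflexive (ℕ.*-comm s′ N)))) ⟩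
       ½^ (s′ ℕ.* e) ≡⟨ ½^-pow s′ ⟩
       pow β s′ ≤⟨ ℚ.p≤q⊔p (pow β s) (pow β s′) ⟩
       pow β s ⊔ pow β s′ ∎
       where
       x≤ : ι s′ * (½ * (q * ι ω)) ≤ ½ * (q * ι o)
       x≤ = ℚ.≤-trans (ℚ.≤-reflexive (trans (solve 3 (λ s q w → s :* (con ½ :* (q :* w)) := con ½ :* (q :* (s :* w))) refl (ι s′) q (ι ω)) (cong (λ z → ½ * (q * z)) (sym (ι-* s′ ω))))) (½* (ι (s′ ℕ.* ω)) (ι o) (fromℕ-mono o≥))
       W₂≤N : W₂ ℕ.≤ N
       W₂≤N = ℕ.+-cancelʳ-≤ W₂ W₂ N (ℕ.≤-trans sum (ℕ.+-monoʳ-≤ N gt))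

 one-of-three : ∀ p b₁ b₂ {A B : Set} → 0ℚ ≤ p → 0ℚ ≤ b₁ → 0ℚ ≤ b₂ → (1ℚ ≤ b₁) ⊎ A → (1ℚ ≤ b₂) ⊎ B → (A → B → p ≡ 1ℚ) → 1ℚ ≤ p + (b₁ + b₂)
 one-of-three p b₁ b₂ 0≤p 0≤b₁ 0≤b₂ (inj₁ h) _ _ = ℚ.≤-trans h (ℚ.≤-trans (x≤x+ b₁ b₂ 0≤b₂) (ℚ.≤-trans (x≤x+ (b₁ + b₂) p 0≤p) (ℚ.≤-reflexive (ℚ.+-comm (b₁ + b₂) p))))
 one-of-three p b₁ b₂ 0≤p 0≤b₁ 0≤b₂ (inj₂ _) (inj₁ h) _ = ℚ.≤-trans h (ℚ.≤-trans (x≤x+ b₂ b₁ 0≤b₁) (ℚ.≤-trans (ℚ.≤-reflexive (ℚ.+-comm b₂ b₁)) (ℚ.≤-trans (x≤x+ (b₁ + b₂) p 0≤p) (ℚ.≤-reflexive (ℚ.+-comm (b₁ + b₂) p)))))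
 one-of-three p b₁ b₂ 0≤p 0≤b₁ 0≤b₂ (inj₂ a) (inj₂ b) f = ℚ.≤-trans (ℚ.≤-reflexive (sym (f a b))) (x≤x+ p (b₁ + b₂) (ℚ.+-mono-≤ 0≤b₁ 0≤b₂))

 four-terms : ∀ P E₁ E₂ x z → 1ℚ ≤ P + (E₁ + E₂) → E₁ ≤ x + x → E₂ ≤ x + x → x ≤ (1ℚ + 1ℚ) * z → 1ℚ ≤ P + ι 8 * z
 four-terms P E₁ E₂ x z le h₁ h₂ hx = ℚ.≤-trans le (ℚ.+-monoʳ-≤ P (ℚ.≤-trans (ℚ.+-mono-≤ (ℚ.≤-trans h₁ xx) (ℚ.≤-trans h₂ xx))
     (ℚ.≤-reflexive (solve 1 (λ z → ((con 1ℚ :+ con 1ℚ) :* z :+ (con 1ℚ :+ con 1ℚ) :* z) :+ ((con 1ℚ :+ con 1ℚ) :* z :+ (con 1ℚ :+ con 1ℚ) :* z) := con (ι 8) :* z) refl z))))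
   where
   xx : x + x ≤ (1ℚ + 1ℚ) * z + (1ℚ + 1ℚ) * z
   xx = ℚ.+-mono-≤ hx hx

 member≤Σ : ∀ {A : Set} {f : A → ℚ} → (∀ x → 0ℚ ≤ f x) → ∀ {xs x} → x ∈ xs → f x ≤ ΣL f xs
 member≤Σ {f = f} h {y ∷ ys} (here refl) = x≤x+ (f y) _ (Σ≥0 ys)
   where
   Σ≥0 : ∀ ys → 0ℚ ≤ ΣL f ys
   Σ≥0 [] = ℚ.≤-refl
   Σ≥0 (y ∷ ys) = ℚ.+-mono-≤ (h y) (Σ≥0 ys)
 member≤Σ {f = f} h {y ∷ ys} (there x∈) = ℚ.≤-trans (member≤Σ h x∈) (ℚ.≤-trans (x≤x+ (ΣL f ys) (f y) (h y)) (ℚ.≤-reflexive (ℚ.+-comm (ΣL f ys) (f y))))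

 module Union {n : ℕ} (k : ℕ) (st : List ℕ → Graph n → Bool) where

   -- The empty set and the set of all pieces are stuck in any case and must not be counted. The
   -- case distinction matches that of `pow₀`.
   cond : List ℕ → ℚ
   cond T with length T | k ℕ.∸ length T
   ... | suc _ | suc _ = 1ℚ
   ... | _ | _ = 0ℚ

   0≤cond : ∀ T → 0ℚ ≤ cond T
   0≤cond T with length T | k ℕ.∸ length T
   ... | suc _ | suc _ = 0≤1
   ... | suc _ | zero = ℚ.≤-refl
   ... | zero | _ = ℚ.≤-refl

   cond-proper : ∀ T → 0 ℕ.< length T → length T ℕ.< k → cond T ≡ 1ℚ
   cond-proper T p q with length T | k ℕ.∸ length T | ℕ.m<n⇒0<n∸m q
   ... | suc _ | suc _ | _ = refl
   ... | suc _ | zero | ()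

   bad : Graph n → ℚ
   bad R = ΣL (λ T → cond T * bit (st T R)) (subs (pieces k))

   0≤term : ∀ R T → 0ℚ ≤ cond T * bit (st T R)
   0≤term R T = *-nonneg (0≤cond T) (0≤bit (st T R))

   0≤bad : ∀ R → 0ℚ ≤ bad R
   0≤bad R = go (subs (pieces k))
     where
     go : ∀ Ts → 0ℚ ≤ ΣL (λ T → cond T * bit (st T R)) Ts
     go [] = ℚ.≤-refl
     go (T ∷ Ts) = ℚ.+-mono-≤ (0≤term R T) (go Ts)

   hit : ∀ R {T} → T ∈ subs (pieces k) → 0 ℕ.< length T → length T ℕ.< k → st T R ≡ true → 1ℚ ≤ bad R
   hit R {T} T∈ p q st≡ = ℚ.≤-trans (ℚ.≤-reflexive (sym (cong₂ (λ c b → c * bit b) (cond-proper T p q) st≡))) (member≤Σ (0≤term R) T∈)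

   module _ (q : ℚ) (0≤q : 0ℚ ≤ q) (q≤1 : q ≤ 1ℚ) (β : ℚ) (0≤β : 0ℚ ≤ β)
       (bound : ∀ {T} → T ∈ subs (pieces k) → Expect.EG q n (λ R → bit (st T R)) ≤ pow β (length T) ⊔ pow β (k ℕ.∸ length T)) where
     open Expect q using (EG; EG-Σ; EG-*; EG-const; EG-mono)

     cond-bound : ∀ T {x} → 0ℚ ≤ x → x ≤ pow β (length T) ⊔ pow β (k ℕ.∸ length T) → cond T * x ≤ pow₀ β (length T) + pow₀ β (k ℕ.∸ length T)
     cond-bound T {x} 0≤x le with length T | k ℕ.∸ length T
     ... | suc i | suc j = ℚ.≤-trans (ℚ.≤-reflexive (ℚ.*-identityˡ x)) (ℚ.≤-trans le (ℚ.⊔-lub {pow β (suc i) + pow β (suc j)} {pow β (suc i)} {pow β (suc j)} (x≤x+ (pow β (suc i)) (pow β (suc j)) (pow-nonneg 0≤β (suc j))) (ℚ.≤-trans (x≤x+ (pow β (suc j)) (pow β (suc i)) (pow-nonneg 0≤β (suc i))) (ℚ.≤-reflexive (ℚ.+-comm (pow β (suc j)) (pow β (suc i)))))))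
     ... | suc i | zero = ℚ.≤-trans (ℚ.≤-reflexive (ℚ.*-zeroˡ x)) (ℚ.+-mono-≤ (pow-nonneg 0≤β (suc i)) ℚ.≤-refl)
     ... | zero | j = ℚ.≤-trans (ℚ.≤-reflexive (ℚ.*-zeroˡ x)) (ℚ.+-mono-≤ ℚ.≤-refl (pow₀-nonneg 0≤β j))

     -- The maximum of the two powers is at most their sum, so the union bound splits into a sum
     -- over sets and a sum over complements.
     E-bad : EG n bad ≤ (pow (1ℚ + β) k - 1ℚ) + (pow (1ℚ + β) k - 1ℚ)
     E-bad = begin
       EG n bad ≡⟨ EG-Σ n (λ T R → cond T * bit (st T R)) (subs (pieces k)) ⟩
       ΣL (λ T → EG n (λ R → cond T * bit (st T R))) (subs (pieces k)) ≡⟨ ΣL-cong (λ T → EG-* n (cond T) _) (subs (pieces k)) ⟩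
       ΣL (λ T → cond T * EG n (λ R → bit (st T R))) (subs (pieces k))
         ≤⟨ ΣL-mono∈ (subs (pieces k)) (λ {T} T∈ → cond-bound T (ℚ.≤-trans (ℚ.≤-reflexive (sym (EG-const n 0ℚ))) (EG-mono 0≤q q≤1 n (λ R → 0≤bit (st T R)))) (bound T∈)) ⟩
       ΣL (λ T → pow₀ β (length T) + pow₀ β (k ℕ.∸ length T)) (subs (pieces k)) ≡⟨ ΣL-+ (λ T → pow₀ β (length T)) _ (subs (pieces k)) ⟩
       ΣL (λ T → pow₀ β (length T)) (subs (pieces k)) + ΣL (λ T → pow₀ β (k ℕ.∸ length T)) (subs (pieces k)) ≡⟨ cong₂ _+_ (trans (Σ₀-subs β (pieces k)) lk) (trans (cong (λ m → ΣL (λ T → pow₀ β (m ℕ.∸ length T)) (subs (pieces k))) (sym (List.length-applyUpTo suc k))) (trans (Σ₀-subs′ β (pieces k)) lk)) ⟩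
       (pow (1ℚ + β) k - 1ℚ) + (pow (1ℚ + β) k - 1ℚ) ∎
       where
       open ℚ.≤-Reasoning
       lk : pow (1ℚ + β) (length (pieces k)) - 1ℚ ≡ pow (1ℚ + β) k - 1ℚ
       lk = cong (λ m → pow (1ℚ + β) m - 1ℚ) (List.length-applyUpTo suc k)

 module TreeProb {n : ℕ} (G : Graph n) (a us δ₀ : ℕ) (S : Setup G a us δ₀) where
   open Setup S
   open Parts G a us δ₀ S

   w : ℕ → ℕ
   w c = quarter (avail c)

   wIn wOut : List ℕ → List ℕ → ℕ
   wIn T [] = 0
   wIn T (c ∷ cs) = (if isYes (c ∈ℕ? T) then w c else 0) ℕ.+ wIn T cs
   wOut T [] = 0
   wOut T (c ∷ cs) = (if isYes (c ∈ℕ? T) then 0 else w c) ℕ.+ wOut T cs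

   Pt-length : ∀ i → i ℕ.≤ 3 → ∀ c → length (Pt i c) ≡ w c
   Pt-length i i≤3 c = part-length (w c) i (avail c) (ℕ.≤-trans (ℕ.*-monoˡ-≤ (w c) (ℕ.s≤s i≤3)) (ℕ.≤-trans (ℕ.≤-reflexive (ℕ.*-comm 4 (w c))) (m/n*n≤m (length (avail c)) 4)))

   count-in : ∀ T xs {c} → (∀ {x} → x ∈ xs → col x ≡ c) → length (filter (λ y → col y ∈ℕ? T) xs) ≡ (if isYes (c ∈ℕ? T) then length xs else 0)
   count-in T xs {c} h with c ∈ℕ? T
   ... | yes p = cong length (List.filter-all (λ y → col y ∈ℕ? T) {xs = xs} (All.tabulate λ x∈ → subst (_∈ T) (sym (h x∈)) p))
   ... | no p = cong length (List.filter-none (λ y → col y ∈ℕ? T) {xs = xs} (All.tabulate λ x∈ q → p (subst (_∈ T) (h x∈) q)))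

   wIn-length : ∀ i → i ℕ.≤ 3 → ∀ T cs → length (filter (λ y → col y ∈ℕ? T) (concatMap (Pt i) cs)) ≡ wIn T cs
   wIn-length i i≤3 T [] = refl
   wIn-length i i≤3 T (c ∷ cs) = trans (cong length (List.filter-++ (λ y → col y ∈ℕ? T) (Pt i c) (concatMap (Pt i) cs)))
     (trans (List.length-++ (filter (λ y → col y ∈ℕ? T) (Pt i c))) (cong₂ ℕ._+_ (trans (count-in T (Pt i c) (λ x∈ → proj₁ (Pt-free i c x∈)))
       (cong (λ m → if isYes (c ∈ℕ? T) then m else 0) (Pt-length i i≤3 c))) (wIn-length i i≤3 T cs)))

   module _ (q : ℚ) (0≤q : 0ℚ ≤ q) (q≤1 : q ≤ 1ℚ) where
     module SB T = StuckBound q 0≤q q≤1 col T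

     out-++ : ∀ T xs ys → SB.out T (xs ++ ys) ≡ SB.out T xs ℕ.+ SB.out T ys
     out-++ T [] ys = refl
     out-++ T (x ∷ xs) ys = trans (cong ((if isYes (col x ∈ℕ? T) then 0 else 1) ℕ.+_) (out-++ T xs ys)) (sym (ℕ.+-assoc (if isYes (col x ∈ℕ? T) then 0 else 1) _ _))

     out-Pt : ∀ T {c} xs → (∀ {x} → x ∈ xs → col x ≡ c) → SB.out T xs ≡ (if isYes (c ∈ℕ? T) then 0 else length xs)
     out-Pt T {c} [] h with c ∈ℕ? T
     ... | yes _ = refl
     ... | no _ = refl
     out-Pt T {c} (x ∷ xs) h rewrite h (here refl) with c ∈ℕ? T | out-Pt T {c} xs (h ∘ there)
     ... | yes _ | e = e
     ... | no _ | e = cong suc e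

     out-≤ : ∀ T xs → SB.out T xs ℕ.≤ length xs
     out-≤ T [] = ℕ.z≤n
     out-≤ T (x ∷ xs) with isYes (col x ∈ℕ? T)
     ... | true = ℕ.m≤n⇒m≤1+n (out-≤ T xs)
     ... | false = ℕ.s≤s (out-≤ T xs)

     wOut-out : ∀ i → i ℕ.≤ 3 → ∀ T cs → SB.out T (concatMap (Pt i) cs) ≡ wOut T cs
     wOut-out i i≤3 T [] = refl
     wOut-out i i≤3 T (c ∷ cs) = trans (out-++ T (Pt i c) (concatMap (Pt i) cs)) (cong₂ ℕ._+_ (trans (out-Pt T (Pt i c) (λ x∈ → proj₁ (Pt-free i c x∈)))
       (cong (λ m → if isYes (c ∈ℕ? T) then 0 else m) (Pt-length i i≤3 c))) (wOut-out i i≤3 T cs))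

   wSum : List ℕ → ℕ
   wSum [] = 0
   wSum (c ∷ cs) = w c ℕ.+ wSum cs

   wIn+wOut : ∀ T cs → wIn T cs ℕ.+ wOut T cs ≡ wSum cs
   wIn+wOut T [] = refl
   wIn+wOut T (c ∷ cs) with isYes (c ∈ℕ? T)
   ... | true = trans (ℕ.+-assoc (w c) _ _) (cong (w c ℕ.+_) (wIn+wOut T cs))
   ... | false = trans (ℕ.+-comm (wIn T cs) _) (trans (ℕ.+-assoc (w c) _ _) (cong (w c ℕ.+_) (trans (ℕ.+-comm (wOut T cs) _) (wIn+wOut T cs))))

   module _ (ω : ℕ) (ω≤ : ∀ {c} → c ∈ pieces k → ω ℕ.≤ w c) where

     nIn : List ℕ → List ℕ → ℕ
     nIn T cs = length (filter (_∈ℕ? T) cs)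

     wIn-≥ : ∀ T cs → (∀ {c} → c ∈ cs → c ∈ pieces k) → nIn T cs ℕ.* ω ℕ.≤ wIn T cs
     wIn-≥ T [] h = ℕ.z≤n
     wIn-≥ T (c ∷ cs) h with c ∈ℕ? T
     ... | yes _ = ℕ.+-mono-≤ (ω≤ (h (here refl))) (wIn-≥ T cs (h ∘ there))
     ... | no _ = wIn-≥ T cs (h ∘ there)

     wOut-≥ : ∀ T cs → (∀ {c} → c ∈ cs → c ∈ pieces k) → (length cs ℕ.∸ nIn T cs) ℕ.* ω ℕ.≤ wOut T cs
     wOut-≥ T [] h = ℕ.z≤n
     wOut-≥ T (c ∷ cs) h with c ∈ℕ? T
     ... | yes _ = wOut-≥ T cs (h ∘ there)
     ... | no _ = ℕ.≤-trans (ℕ.*-monoˡ-≤ ω (ℕ.≤-reflexive (ℕ.+-∸-assoc 1 (List.length-filter (_∈ℕ? T) cs)))) (ℕ.+-mono-≤ (ω≤ (h (here refl))) (wOut-≥ T cs (h ∘ there)))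

     pieces-unique : Unique (pieces k)
     pieces-unique = Unique.applyUpTo⁺₁ suc k (λ i<j _ e → ℕ.<⇒≢ i<j (ℕ.suc-injective e))

     nIn-subs : ∀ {T} → T ∈ subs (pieces k) → nIn T (pieces k) ≡ length T
     nIn-subs {T} T∈ = ℕ.≤-antisym
       (length-⊆ (Unique.filter⁺ (_∈ℕ? T) pieces-unique) (λ x∈ → proj₂ (∈-filter⁻ (_∈ℕ? T) {xs = pieces k} x∈)))
       (length-⊆ (subs-unique pieces-unique T∈) (λ x∈ → ∈-filter⁺ (_∈ℕ? T) (subs-⊆ (pieces k) T∈ x∈) x∈))

     module _ (q : ℚ) (0≤q : 0ℚ ≤ q) (q≤1 : q ≤ 1ℚ) (W₂ e m₀ m₁ : ℕ)
         (W₂≤ : W₂ ℕ.+ W₂ ℕ.≤ wSum (pieces k))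
         (m₀≤ : e ℕ.* m₀ ℕ.≤ ω) (m₁≤ : e ℕ.* m₁ ℕ.≤ W₂)
         (h₀ : 1ℚ ≤ ι m₀ * (½ * (q * ι W₂))) (h₁ : 1ℚ ≤ ι m₁ * (½ * (q * ι ω)))
         (small : q * ι n ≤ ½) where
       open Expect q

       β : ℚ
       β = ½^ e

       Part-unique : ∀ i → Unique (Part i)
       Part-unique i = go (pieces k) pieces-unique
         where
         go : ∀ cs → Unique cs → Unique (concatMap (Pt i) cs)
         go [] _ = []
         go (c ∷ cs) u@(_ ∷ u′) = Unique-++ (uPt c) (go cs u′) (λ x∈ x∈′ → dis x∈ (find (∈-concatMap⁻ (Pt i) {xs = cs} x∈′)))
           where
           uPt : ∀ c → Unique (Pt i c)
           uPt c = uPart′ i (avail c) (Unique.filter⁺ (free? c) (Unique.allFin⁺ n))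
             where
             uPart′ : ∀ j (xs : List (Fin n)) → Unique xs → Unique (part (w c) j xs)
             uPart′ zero xs u = Unique.take⁺ (w c) u
             uPart′ (suc j) xs u = uPart′ j (List.drop (w c) xs) (Unique.drop⁺ (w c) u)
           dis : ∀ {x} → x ∈ Pt i c → ¬ (∃ λ c′ → c′ ∈ cs × x ∈ Pt i c′)
           dis x∈ (c′ , c′∈ , x∈′) = Unique-∉ u (subst (_∈ cs) (trans (sym (proj₁ (Pt-free i c′ x∈′))) (proj₁ (Pt-free i c x∈))) c′∈)

       Part-small : ∀ i → length (Part i) ℕ.≤ n
       Part-small i = ℕ.≤-trans (length-⊆ (Part-unique i) (λ _ → ∈-allFin _)) (ℕ.≤-reflexive (List.length-tabulate {n = n} id))

       bound-T : ∀ i j → i ℕ.≤ 3 → j ℕ.≤ 3 → i ℕ.< j → ∀ {T} → T ∈ subs (pieces k) →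
         EG n (λ R → bit (does (stuck? R col (Part i) (Part j) T))) ≤ pow β (length T) ⊔ pow β (k ℕ.∸ length T)
       bound-T i j i≤3 j≤3 i<j {T} T∈ = ℚ.≤-trans (SB.stuck-bound q 0≤q q≤1 T (Part i) (Part j) (Part-unique i) (Part-unique j) (λ x∈ → Part-disjoint {i} {j} i<j x∈) smallC)
           (ℚ.≤-trans (ℚ.≤-reflexive (cong₂ (λ o N → pow (1ℚ - ½ * (q * ι o)) N) (wOut-out q 0≤q q≤1 j j≤3 T (pieces k)) (wIn-length i i≤3 T (pieces k)))) cases)
         where
         smallC : q * ι (length (Part j)) ≤ ½
         smallC = ℚ.≤-trans (*-monoˡ q 0≤q (fromℕ-mono (Part-small j))) small
         o N : ℕ
         o = wOut T (pieces k)
         N = wIn T (pieces k)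
         N≥ : length T ℕ.* ω ℕ.≤ N
         N≥ = subst (λ m → m ℕ.* ω ℕ.≤ N) (nIn-subs T∈) (wIn-≥ T (pieces k) id)
         o≥ : (k ℕ.∸ length T) ℕ.* ω ℕ.≤ o
         o≥ = subst (λ m → m ℕ.* ω ℕ.≤ o) (cong₂ ℕ._∸_ (List.length-applyUpTo suc k) (nIn-subs T∈)) (wOut-≥ T (pieces k) id)
         o≤n : o ℕ.≤ n
         o≤n = ℕ.≤-trans (ℕ.≤-reflexive (sym (wOut-out q 0≤q q≤1 j j≤3 T (pieces k)))) (ℕ.≤-trans (out-≤ q 0≤q q≤1 T (Part j)) (Part-small j))
         ω≤n : ω ℕ.≤ n
         ω≤n = ℕ.≤-trans (ω≤ (∈-pieces ℕ.≤-refl 1≤k)) (ℕ.≤-trans (m/n≤m (length (avail 1)) 4) (ℕ.≤-trans (List.length-filter (free? 1) (List.allFin n)) (ℕ.≤-reflexive (List.length-tabulate {n = n} id))))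
         cases : pow (1ℚ - ½ * (q * ι o)) N ≤ pow β (length T) ⊔ pow β (k ℕ.∸ length T)
         cases = escape-bound q 0≤q n small ω W₂ e m₀ m₁ ω≤n m₀≤ m₁≤ h₀ h₁ o N (length T) (k ℕ.∸ length T) o≤n N≥ o≥
           (ℕ.≤-trans W₂≤ (ℕ.≤-reflexive (sym (wIn+wOut T (pieces k)))))

       0≤β : 0ℚ ≤ β
       0≤β = ½^-nonneg e

       st : ℕ → ℕ → List ℕ → Graph n → Bool
       st i j T R = does (stuck? R col (Part i) (Part j) T)

       bad : ℕ → ℕ → Graph n → ℚ
       bad i j = Union.bad k (st i j)

       0≤bad : ∀ i j R → 0ℚ ≤ bad i j R
       0≤bad i j = Union.0≤bad k (st i j)

       E-bad : ∀ i j → i ℕ.≤ 3 → j ℕ.≤ 3 → i ℕ.< j → EG n (bad i j) ≤ (pow (1ℚ + β) k - 1ℚ) + (pow (1ℚ + β) k - 1ℚ)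
       E-bad i j i≤3 j≤3 i<j = Union.E-bad k (st i j) q 0≤q q≤1 β 0≤β (bound-T i j i≤3 j≤3 i<j)

       Stuck-T : Graph n → ℕ → ℕ → List ℕ → Set
       Stuck-T R i j T = (0 ℕ.< length T × length T ℕ.< k) × Stuck R col (Part i) (Part j) T

       bad-or-free : ∀ R i j → (1ℚ ≤ bad i j R) ⊎ Free R i j
       bad-or-free R i j = split (Any.any? (λ T → ((0 ℕ.<? length T) ×-dec (length T ℕ.<? k)) ×-dec stuck? R col (Part i) (Part j) T) (subs (pieces k)))
         where
         hit : (∃ λ T → T ∈ subs (pieces k) × Stuck-T R i j T) → 1ℚ ≤ bad i j R
         hit (T , T∈ , (p , q) , st≡) = Union.hit k (st i j) R T∈ p q (dec-true (stuck? R col (Part i) (Part j) T) st≡)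
         split : Dec (Any (Stuck-T R i j) (subs (pieces k))) → (1ℚ ≤ bad i j R) ⊎ Free R i j
         split (no none) = inj₂ λ {T} T∈ p q st → All.lookup (All.¬Any⇒All¬ _ none) T∈ ((p , q) , st)
         split (yes some) = inj₁ (hit (find some))

       module _ (ind : ∀ zs → GraphWalks.Indep G zs → length zs ℕ.≤ a)
            (U≥ : (4 ℕ.* a ℕ.+ 4 ℕ.+ suc (suc a)) ℕ.+ costs a (4 ℕ.* a ℕ.+ 4 ℕ.+ suc (suc a)) ℕ.+ costs a (4 ℕ.* a ℕ.+ 4 ℕ.+ suc (suc a)) ℕ.< us)
            (δ≥ : suc (suc a) ℕ.+ (4 ℕ.* a ℕ.+ 4) ℕ.+ waste G a us ℕ.≤ δ₀) (kβ : ι k * β ≤ ½) where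

         good-or-bad : ∀ R → 1ℚ ≤ bit (does (pancyclic? (G ∪ R))) + (bad 0 1 R + bad 2 3 R)
         good-or-bad R = one-of-three (bit (does (pancyclic? (G ∪ R)))) (bad 0 1 R) (bad 2 3 R) (0≤bit (does (pancyclic? (G ∪ R)))) (0≤bad 0 1 R) (0≤bad 2 3 R)
           (bad-or-free R 0 1) (bad-or-free R 2 3) (λ f₁ f₂ → cong bit (dec-true (pancyclic? (G ∪ R)) (pancyclic R ind U≥ δ≥ f₁ f₂)))

         total-bound : 1ℚ ≤ EG n (λ R → bit (does (pancyclic? (G ∪ R)))) + (EG n (bad 0 1) + EG n (bad 2 3))
         total-bound = ℚ.≤-trans (ℚ.≤-reflexive (sym (EG-const n 1ℚ))) (ℚ.≤-trans (EG-mono 0≤q q≤1 n good-or-bad)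
           (ℚ.≤-reflexive (trans (EG-+ n (λ R → bit (does (pancyclic? (G ∪ R)))) (λ R → bad 0 1 R + bad 2 3 R)) (cong (EG n (λ R → bit (does (pancyclic? (G ∪ R)))) +_) (EG-+ n (bad 0 1) (bad 2 3))))))

         -- Two trees, each with a sum over sets and a sum over complements, and each of these four
         -- sums is at most 2kβ.
         pancyclic-likely : 1ℚ ≤ EG n (λ R → bit (does (pancyclic? (G ∪ R)))) + ι 8 * (ι k * β)
         pancyclic-likely = four-terms (EG n (λ R → bit (does (pancyclic? (G ∪ R))))) (EG n (bad 0 1)) (EG n (bad 2 3)) (pow (1ℚ + β) k - 1ℚ) (ι k * β) total-bound
           (E-bad 0 1 ℕ.z≤n (ℕ.s≤s ℕ.z≤n) (ℕ.s≤s ℕ.z≤n)) (E-bad 2 3 (ℕ.s≤s (ℕ.s≤s ℕ.z≤n)) ℕ.≤-refl ℕ.≤-refl) (pow-1+ β 0≤β (½^≤1 e) k kβ)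

-- Dyadic bounds for the approximations of the logarithm.

module LogBounds where

 open import Data.Empty using (⊥-elim)
 open import Data.Nat.Base as ℕ using (ℕ; zero; suc)
 import Data.Nat.Properties as ℕ
 open import Data.Product.Base using (∃; _×_; _,_)
 open import Data.Rational.Base
 import Data.Rational.Properties as ℚ
 open import Data.Rational.Solver using (module +-*-Solver)
 open import Data.Sum.Base using ([_,_]′)
 open import Relation.Binary.PropositionalEquality using (_≡_; refl; sym; trans; cong; cong₂)
 open import Relation.Nullary using (¬_; yes; no)
 open import Defs using (riemann; logIntegrand; recip₁; module ℚLemmas; module LogCauchy; module Cauchy)
 open ℚLemmas using (*-monoˡ; *-monoʳ; *-mono; *-nonneg; *-pos; 0≤1; 0<1; 0≤½; 0<½; fromℕ-suc; 0≤fromℕ; fromℕ-mono; halves; ½^; ½^-nonneg; ½^≤1)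
 open LogCauchy using (L; integrand-nonneg; recip₁-inv′; 1≤1+ta)
 open RationalBounds
 open TreeProbability using (pow-1+)
 open +-*-Solver

 pow-distrib : ∀ x y n → pow (x * y) n ≡ pow x n * pow y n
 pow-distrib x y zero = refl
 pow-distrib x y (suc n) = trans (cong (x * y *_) (pow-distrib x y n)) (solve 4 (λ x y p q → x :* y :* (p :* q) := (x :* p) :* (y :* q)) refl x y (pow x n) (pow y n))

 2^*½^ : ∀ M → ι (2 ℕ.^ M) * ½^ M ≡ 1ℚ
 2^*½^ zero = refl
 2^*½^ (suc M) = trans (cong (_* (½ * ½^ M)) (ι-* 2 (2 ℕ.^ M))) (trans (solve 2 (λ p h → con (ι 2) :* p :* (con ½ :* h) := p :* h) refl (ι (2 ℕ.^ M)) (½^ M)) (2^*½^ M))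

 ½^-pos : ∀ M → 0ℚ < ½^ M
 ½^-pos zero = 0<1
 ½^-pos (suc M) = *-pos 0<½ (½^-pos M)

 module _ (a : ℚ) (0≤a : 0ℚ ≤ a) where
   private
     g = logIntegrand a
     U : ℚ → ℚ
     U t = 1ℚ + t * a

   cell : ∀ t w → 0ℚ ≤ t → U (t + w) ≡ U t * (1ℚ + w * g t)
   cell t w 0≤t = sym (trans (solve 4 (λ t a w r → (con 1ℚ :+ t :* a) :* (con 1ℚ :+ w :* (a :* r)) := (con 1ℚ :+ t :* a) :+ w :* a :* (r :* (con 1ℚ :+ t :* a))) refl t a w (recip₁ (1ℚ + t * a)))
     (trans (cong (λ z → (1ℚ + t * a) + w * a * z) (recip₁-inv′ (1ℚ + t * a) (1≤1+ta 0≤t 0≤a))) (solve 3 (λ t a w → (con 1ℚ :+ t :* a) :+ w :* a :* con 1ℚ := con 1ℚ :+ (t :+ w) :* a) refl t a w)))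

   0≤U : ∀ {t} → 0ℚ ≤ t → 0ℚ ≤ U t
   0≤U 0≤t = ℚ.≤-trans 0≤1 (1≤1+ta 0≤t 0≤a)

   riemann-nonneg : ∀ n t w → 0ℚ ≤ w → 0ℚ ≤ riemann g n t w
   riemann-nonneg zero t w 0≤w = *-nonneg 0≤w (integrand-nonneg a 0≤a t)
   riemann-nonneg (suc n) t w 0≤w = ℚ.+-mono-≤ (riemann-nonneg n t (½ * w) (*-nonneg 0≤½ 0≤w)) (riemann-nonneg n (t + ½ * w) (½ * w) (*-nonneg 0≤½ 0≤w))

   end≡ : ∀ t w → (t + ½ * w) + ½ * w ≡ t + w
   end≡ = solve 2 (λ t w → (t :+ con ½ :* w) :+ con ½ :* w := t :+ w) refl

   -- The cells of the Riemann sum multiply: U (t + w) = U t · ∏ (1 + yᵢ), where Y = ∑ yᵢ.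
   -- Comparing 1 + y with (1 - y/M)^{-M}, respectively (1 + y/2M)^M, bounds Y by powers of 2.
   module _ (M : ℕ) (μ : ℚ) (0≤μ : 0ℚ ≤ μ) where

     -- The base `b` is carried along so that the two halves of the interval can be treated in turn:
     -- the second one starts from what the first leaves of it.
     lowerStep : ι M * μ ≡ 1ℚ → ∀ n t w b → 0ℚ ≤ t → 0ℚ ≤ w → riemann g n t w * μ ≤ b → b ≤ 1ℚ →
       U (t + w) * pow (b - riemann g n t w * μ) M ≤ U t * pow b M
     lowerStep Mμ zero t w b 0≤t 0≤w le b≤1 = begin
       U (t + w) * pow (b - z) M ≤⟨ *-monoˡ (U (t + w)) (0≤U (ℚ.+-mono-≤ 0≤t 0≤w)) (pow-mono 0≤b-z b-z≤ M) ⟩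
       U (t + w) * pow (b * (1ℚ - z)) M ≡⟨ cong₂ _*_ (cell t w 0≤t) (pow-distrib b (1ℚ - z) M) ⟩
       U t * (1ℚ + y) * (pow b M * pow (1ℚ - z) M) ≡⟨ solve 4 (λ u y p q → u :* (con 1ℚ :+ y) :* (p :* q) := u :* p :* (q :* (con 1ℚ :+ y))) refl (U t) y (pow b M) (pow (1ℚ - z) M) ⟩
       U t * pow b M * (pow (1ℚ - z) M * (1ℚ + y)) ≡⟨ cong (λ x → U t * pow b M * (pow (1ℚ - z) M * (1ℚ + x))) (sym yM) ⟩
       U t * pow b M * (pow (1ℚ - z) M * (1ℚ + ι M * z)) ≤⟨ *-monoˡ (U t * pow b M) (*-nonneg (0≤U 0≤t) (pow-nonneg 0≤b M)) (bernoulli⁻ (ℚ.≤-trans le b≤1) 0≤z M) ⟩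
       U t * pow b M * 1ℚ ≡⟨ ℚ.*-identityʳ _ ⟩
       U t * pow b M ∎
       where
       open ℚ.≤-Reasoning
       y = w * g t
       z = y * μ
       0≤z : 0ℚ ≤ z
       0≤z = *-nonneg (riemann-nonneg zero t w 0≤w) 0≤μ
       0≤b : 0ℚ ≤ b
       0≤b = ℚ.≤-trans 0≤z le
       0≤b-z : 0ℚ ≤ b - z
       0≤b-z = ≤-move {0ℚ} {z} (ℚ.≤-trans (ℚ.≤-reflexive (ℚ.+-identityˡ z)) le)
       b-z≤ : b - z ≤ b * (1ℚ - z)
       b-z≤ = ℚ.≤-trans (ℚ.+-monoʳ-≤ b (ℚ.neg-antimono-≤ (ℚ.≤-trans (*-monoʳ z 0≤z b≤1) (ℚ.≤-reflexive (ℚ.*-identityˡ z))))) (ℚ.≤-reflexive (solve 2 (λ b z → b :- b :* z := b :* (con 1ℚ :- z)) refl b z))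
       yM : ι M * z ≡ y
       yM = trans (solve 3 (λ m y u → m :* (y :* u) := y :* (m :* u)) refl (ι M) y μ) (trans (cong (y *_) Mμ) (ℚ.*-identityʳ y))
     lowerStep Mμ (suc n) t w b 0≤t 0≤w le b≤1 = begin
       U (t + w) * pow (b - (Y₁ + Y₂) * μ) M ≡⟨ cong₂ (λ x z → U x * pow z M) (sym (end≡ t w)) (solve 4 (λ b y z u → b :- (y :+ z) :* u := (b :- y :* u) :- z :* u) refl b Y₁ Y₂ μ) ⟩
       U ((t + w/2) + w/2) * pow ((b - Y₁ * μ) - Y₂ * μ) M ≤⟨ lowerStep Mμ n (t + w/2) w/2 (b - Y₁ * μ) (ℚ.+-mono-≤ 0≤t 0≤w/2) 0≤w/2 le₂ (ℚ.≤-trans (x-≤x b (Y₁ * μ) (*-nonneg 0≤Y₁ 0≤μ)) b≤1) ⟩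
       U (t + w/2) * pow (b - Y₁ * μ) M ≤⟨ lowerStep Mμ n t w/2 b 0≤t 0≤w/2 le₁ b≤1 ⟩
       U t * pow b M ∎
       where
       open ℚ.≤-Reasoning
       w/2 = ½ * w
       0≤w/2 = *-nonneg 0≤½ 0≤w
       Y₁ = riemann g n t w/2
       Y₂ = riemann g n (t + w/2) w/2
       0≤Y₁ = riemann-nonneg n t w/2 0≤w/2
       sum : Y₂ * μ + Y₁ * μ ≤ b
       sum = ℚ.≤-trans (ℚ.≤-reflexive (solve 3 (λ y z u → z :* u :+ y :* u := (y :+ z) :* u) refl Y₁ Y₂ μ)) le
       le₂ : Y₂ * μ ≤ b - Y₁ * μ
       le₂ = ≤-move {Y₂ * μ} {Y₁ * μ} sum
       le₁ : Y₁ * μ ≤ b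
       le₁ = ℚ.≤-trans (x≤x+ (Y₁ * μ) (Y₂ * μ) (*-nonneg (riemann-nonneg n (t + w/2) w/2 0≤w/2) 0≤μ)) (ℚ.≤-trans (ℚ.≤-reflexive (ℚ.+-comm (Y₁ * μ) (Y₂ * μ))) sum)

     -- A left sum overestimates the integral of a decreasing function, so the mesh must be fine. It
     -- gives y ≤ 1 for each cell, hence M z = y / 2 ≤ ½, and `pow-1+` yields (1 + z)^M ≤ 1 + y.
     upperStep : ι M * μ ≡ ½ → ∀ n t w b → 0ℚ ≤ t → 0ℚ ≤ w → w * a * ½^ n ≤ 1ℚ → 1ℚ ≤ b →
       U t * pow (b + riemann g n t w * μ) M ≤ U (t + w) * pow b M
     upperStep Mμ zero t w b 0≤t 0≤w fine 1≤b = begin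
       U t * pow (b + z) M ≤⟨ *-monoˡ (U t) (0≤U 0≤t) (pow-mono (ℚ.+-mono-≤ 0≤b 0≤z) b+z≤ M) ⟩
       U t * pow (b * (1ℚ + z)) M ≡⟨ cong (U t *_) (pow-distrib b (1ℚ + z) M) ⟩
       U t * (pow b M * pow (1ℚ + z) M) ≤⟨ *-monoˡ (U t) (0≤U 0≤t) (*-monoˡ (pow b M) (pow-nonneg 0≤b M) small) ⟩
       U t * (pow b M * (1ℚ + y)) ≡⟨ solve 3 (λ u p y → u :* (p :* (con 1ℚ :+ y)) := u :* (con 1ℚ :+ y) :* p) refl (U t) (pow b M) y ⟩
       U t * (1ℚ + y) * pow b M ≡⟨ cong (_* pow b M) (sym (cell t w 0≤t)) ⟩
       U (t + w) * pow b M ∎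
       where
       open ℚ.≤-Reasoning
       y = w * g t
       z = y * μ
       0≤b = ℚ.≤-trans 0≤1 1≤b
       0≤y = riemann-nonneg zero t w 0≤w
       0≤z : 0ℚ ≤ z
       0≤z = *-nonneg 0≤y 0≤μ
       b+z≤ : b + z ≤ b * (1ℚ + z)
       b+z≤ = ℚ.≤-trans (ℚ.+-monoʳ-≤ b (ℚ.≤-trans (ℚ.≤-reflexive (sym (ℚ.*-identityˡ z))) (*-monoʳ z 0≤z 1≤b))) (ℚ.≤-reflexive (solve 2 (λ b z → b :+ b :* z := b :* (con 1ℚ :+ z)) refl b z))
       y≤1 : y ≤ 1ℚ
       y≤1 = ℚ.≤-trans (*-monoˡ w 0≤w (ℚ.≤-trans (*-monoˡ a 0≤a (LogCauchy.recip₁≤1 (1ℚ + t * a))) (ℚ.≤-reflexive (ℚ.*-identityʳ a)))) (ℚ.≤-trans (ℚ.≤-reflexive (sym (ℚ.*-identityʳ (w * a)))) fine)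
       yM : ι M * z ≡ ½ * y
       yM = trans (solve 3 (λ m y u → m :* (y :* u) := (m :* u) :* y) refl (ι M) y μ) (cong (_* y) Mμ)
       Mz≤ : ι M * z ≤ ½
       Mz≤ = ℚ.≤-trans (ℚ.≤-reflexive yM) (ℚ.≤-trans (*-monoˡ ½ 0≤½ y≤1) (ℚ.≤-reflexive (ℚ.*-identityʳ ½)))
       z≤1 : 1 ℕ.≤ M → z ≤ 1ℚ
       z≤1 1≤M = ℚ.≤-trans (ℚ.≤-trans (ℚ.≤-reflexive (sym (ℚ.*-identityˡ z))) (*-monoʳ z 0≤z (fromℕ-mono 1≤M))) (ℚ.≤-trans Mz≤ (½^≤1 1))
       small : pow (1ℚ + z) M ≤ 1ℚ + y
       small with M ℕ.≤? 0
       ... | yes ℕ.z≤n = x≤x+ 1ℚ y 0≤y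
       ... | no 0<M = begin
         pow (1ℚ + z) M ≡⟨ solve 1 (λ p → p := con 1ℚ :+ (p :- con 1ℚ)) refl (pow (1ℚ + z) M) ⟩
         1ℚ + (pow (1ℚ + z) M - 1ℚ) ≤⟨ ℚ.+-monoʳ-≤ 1ℚ (pow-1+ z 0≤z (z≤1 (ℕ.≰⇒> 0<M)) M Mz≤) ⟩
         1ℚ + (1ℚ + 1ℚ) * (ι M * z) ≡⟨ cong (λ x → 1ℚ + (1ℚ + 1ℚ) * x) yM ⟩
         1ℚ + (1ℚ + 1ℚ) * (½ * y) ≡⟨ solve 1 (λ y → con 1ℚ :+ (con 1ℚ :+ con 1ℚ) :* (con ½ :* y) := con 1ℚ :+ y) refl y ⟩
         1ℚ + y ∎
     upperStep Mμ (suc n) t w b 0≤t 0≤w fine 1≤b = begin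
       U t * pow (b + (Y₁ + Y₂) * μ) M ≡⟨ cong (λ z → U t * pow z M) (solve 4 (λ b y z u → b :+ (y :+ z) :* u := (b :+ z :* u) :+ y :* u) refl b Y₁ Y₂ μ) ⟩
       U t * pow ((b + Y₂ * μ) + Y₁ * μ) M ≤⟨ upperStep Mμ n t w/2 (b + Y₂ * μ) 0≤t 0≤w/2 fine′ (ℚ.≤-trans 1≤b (x≤x+ b (Y₂ * μ) (*-nonneg (riemann-nonneg n (t + w/2) w/2 0≤w/2) 0≤μ))) ⟩
       U (t + w/2) * pow (b + Y₂ * μ) M ≤⟨ upperStep Mμ n (t + w/2) w/2 b (ℚ.+-mono-≤ 0≤t 0≤w/2) 0≤w/2 fine′ 1≤b ⟩
       U ((t + w/2) + w/2) * pow b M ≡⟨ cong (λ x → U x * pow b M) (end≡ t w) ⟩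
       U (t + w) * pow b M ∎
       where
       open ℚ.≤-Reasoning
       w/2 = ½ * w
       0≤w/2 = *-nonneg 0≤½ 0≤w
       Y₁ = riemann g n t w/2
       Y₂ = riemann g n (t + w/2) w/2
       fine′ : w/2 * a * ½^ n ≤ 1ℚ
       fine′ = ℚ.≤-trans (ℚ.≤-reflexive (solve 3 (λ w a h → con ½ :* w :* a :* h := w :* a :* (con ½ :* h)) refl w a (½^ n))) fine

 1≰½ : ¬ (1ℚ ≤ ½)
 1≰½ le = ℚ.<-irrefl refl (ℚ.<-≤-trans (ℚ.<-respˡ-≡ (ℚ.+-identityˡ ½) (ℚ.+-monoˡ-< ½ 0<½)) le)

 recipℕ : ∀ M → ∃ λ μ → 0ℚ ≤ μ × ι (suc M) * μ ≡ 1ℚ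
 recipℕ M = let η , 0<η , e = Cauchy.quotient 1ℚ (ι (suc M)) 0<1 (ℚ.<-≤-trans 0<1 (fromℕ-mono {1} {suc M} (ℕ.s≤s ℕ.z≤n)))
            in η , ℚ.<⇒≤ 0<η , trans (ℚ.*-comm (ι (suc M)) η) e

 pow-1 : ∀ m → pow 1ℚ m ≡ 1ℚ
 pow-1 zero = refl
 pow-1 (suc m) = trans (ℚ.*-identityˡ _) (pow-1 m)

 -- If the sum Y were at most M/2, then 1 - Y/M ≥ ½ and `lowerStep` would give (1 + a) 2^-M ≤ 1,
 -- against 1 + a ≥ 2^(M+1).
 log-lower : ∀ a → 0ℚ ≤ a → ∀ M → ι (2 ℕ.^ suc M) ≤ 1ℚ + a → ∀ n → ½ * ι M ≤ L a n
 log-lower a 0≤a zero big n = ℚ.≤-trans (ℚ.≤-reflexive (ℚ.*-zeroʳ ½)) (riemann-nonneg a 0≤a n 0ℚ 1ℚ 0≤1)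
 log-lower a 0≤a (suc M) big n = [ (λ le → le) , (λ le → ⊥-elim (1≰½ (contra (recipℕ M) le))) ]′ (ℚ.≤-total (½ * ι (suc M)) (L a n))
   where
   open ℚ.≤-Reasoning
   Y = L a n
   H = ½^ (suc M)
   contra : (∃ λ μ → 0ℚ ≤ μ × ι (suc M) * μ ≡ 1ℚ) → L a n ≤ ½ * ι (suc M) → 1ℚ ≤ ½
   contra (μ , 0≤μ , Mμ) le = begin
     1ℚ ≡⟨ sym (2^*½^ (suc (suc M))) ⟩
     ι (2 ℕ.^ suc (suc M)) * (½ * H) ≤⟨ *-monoʳ (½ * H) (*-nonneg 0≤½ (½^-nonneg (suc M))) big ⟩
     (1ℚ + a) * (½ * H) ≡⟨ solve 2 (λ u h → u :* (con ½ :* h) := con ½ :* (u :* h)) refl (1ℚ + a) H ⟩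
     ½ * ((1ℚ + a) * H) ≤⟨ *-monoˡ ½ 0≤½ bound ⟩
     ½ * 1ℚ ≡⟨ ℚ.*-identityʳ ½ ⟩
     ½ ∎
    where
     Yμ : Y * μ ≤ ½
     Yμ = ℚ.≤-trans (*-monoʳ μ 0≤μ le) (ℚ.≤-reflexive (trans (ℚ.*-assoc ½ (ι (suc M)) μ) (trans (cong (½ *_) Mμ) (ℚ.*-identityʳ ½))))
     bound : (1ℚ + a) * H ≤ 1ℚ
     bound = begin
       (1ℚ + a) * H ≡⟨ cong₂ _*_ (solve 1 (λ a → con 1ℚ :+ a := con 1ℚ :+ (con 0ℚ :+ con 1ℚ) :* a) refl a) (sym (pow-½ (suc M))) ⟩
       (1ℚ + (0ℚ + 1ℚ) * a) * pow ½ (suc M) ≤⟨ *-monoˡ (1ℚ + (0ℚ + 1ℚ) * a) (0≤U a 0≤a {0ℚ + 1ℚ} 0≤1) (pow-mono 0≤½ (1-anti {Y * μ} {½} Yμ) (suc M)) ⟩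
       (1ℚ + (0ℚ + 1ℚ) * a) * pow (1ℚ - Y * μ) (suc M) ≤⟨ lowerStep a 0≤a (suc M) μ 0≤μ Mμ n 0ℚ 1ℚ 1ℚ ℚ.≤-refl 0≤1 (ℚ.≤-trans Yμ (½^≤1 1)) ℚ.≤-refl ⟩
       (1ℚ + 0ℚ * a) * pow 1ℚ (suc M) ≡⟨ cong₂ _*_ (solve 1 (λ a → con 1ℚ :+ con 0ℚ :* a := con 1ℚ) refl a) (pow-1 (suc M)) ⟩
       1ℚ * 1ℚ ≡⟨ refl ⟩
       1ℚ ∎

 2^≡pow : ∀ m → ι (2 ℕ.^ m) ≡ pow (ι 2) m
 2^≡pow zero = refl
 2^≡pow (suc m) = trans (ι-* 2 (2 ℕ.^ m)) (cong (ι 2 *_) (2^≡pow m))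

 doubling : ∀ m Y ν → 0ℚ ≤ ν → m * ν ≡ ½ → ι 2 * m ≤ Y → ι 2 ≤ 1ℚ + Y * ν
 doubling m Y ν 0≤ν mν le = ℚ.+-monoʳ-≤ 1ℚ {1ℚ} {Y * ν} (ℚ.≤-trans (ℚ.≤-reflexive (sym (trans (ℚ.*-assoc (ι 2) m ν) (cong (ι 2 *_) mν)))) (*-monoʳ ν 0≤ν le))

 strip : ∀ a P Q → Q ≡ 1ℚ → (1ℚ + 0ℚ * a) * P ≤ (1ℚ + (0ℚ + 1ℚ) * a) * Q → P ≤ 1ℚ + a
 strip a P Q Q≡1 le = ℚ.≤-trans (ℚ.≤-reflexive (solve 2 (λ a p → p := (con 1ℚ :+ con 0ℚ :* a) :* p) refl a P))
   (ℚ.≤-trans le (ℚ.≤-reflexive (trans (cong ((1ℚ + (0ℚ + 1ℚ) * a) *_) Q≡1) (solve 1 (λ a → (con 1ℚ :+ (con 0ℚ :+ con 1ℚ) :* a) :* con 1ℚ := con 1ℚ :+ a) refl a))))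

 grows-too-fast : ∀ a M z → 1ℚ + a ≤ ι (2 ℕ.^ M) → ι 2 ≤ z → pow z (suc M) ≤ 1ℚ + a → 1ℚ ≤ ½
 grows-too-fast a M z small 2≤z le = begin
   1ℚ ≡⟨ trans (sym (2^*½^ (suc M))) (cong (_* H) (2^≡pow (suc M))) ⟩
   pow (ι 2) (suc M) * H ≤⟨ *-monoʳ H (½^-nonneg (suc M)) (ℚ.≤-trans (pow-mono (0≤fromℕ 2) 2≤z (suc M)) (ℚ.≤-trans le small)) ⟩
   ι (2 ℕ.^ M) * (½ * ½^ M) ≡⟨ solve 2 (λ u h → u :* (con ½ :* h) := con ½ :* (u :* h)) refl (ι (2 ℕ.^ M)) (½^ M) ⟩
   ½ * (ι (2 ℕ.^ M) * ½^ M) ≡⟨ trans (cong (½ *_) (2^*½^ M)) (ℚ.*-identityʳ ½) ⟩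
   ½ ∎
   where
   open ℚ.≤-Reasoning
   H = ½^ (suc M)

 -- If the sum were at least 2 (M + 1), then `upperStep` with μ = 1 / (2 (M + 1)) would give 2^(M+1)
 -- ≤ 1 + a, against 1 + a ≤ 2^M.
 log-upper : ∀ a → 0ℚ ≤ a → ∀ M → 1ℚ + a ≤ ι (2 ℕ.^ M) → ∀ n → a * ½^ n ≤ 1ℚ → L a n ≤ ι 2 * ι (suc M)
 log-upper a 0≤a M small n fine = [ (λ le → le) , (λ le → ⊥-elim (1≰½ (contra (recipℕ M) le))) ]′ (ℚ.≤-total (L a n) (ι 2 * ι (suc M)))
   where
   contra : (∃ λ μ → 0ℚ ≤ μ × ι (suc M) * μ ≡ 1ℚ) → ι 2 * ι (suc M) ≤ L a n → 1ℚ ≤ ½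
   contra (μ , 0≤μ , Mμ) le = grows-too-fast a M (1ℚ + L a n * ν) small (doubling (ι (suc M)) (L a n) ν 0≤ν Mν le)
       (strip a (pow (1ℚ + L a n * ν) (suc M)) (pow 1ℚ (suc M)) (pow-1 (suc M))
         (upperStep a 0≤a (suc M) ν 0≤ν Mν n 0ℚ 1ℚ 1ℚ ℚ.≤-refl 0≤1 (ℚ.≤-trans (ℚ.≤-reflexive (cong (_* ½^ n) (ℚ.*-identityˡ a))) fine) ℚ.≤-refl))
    where
     ν = ½ * μ
     0≤ν : 0ℚ ≤ ν
     0≤ν = *-nonneg 0≤½ 0≤μ
     Mν : ι (suc M) * ν ≡ ½
     Mν = trans (solve 2 (λ m u → m :* (con ½ :* u) := con ½ :* (m :* u)) refl (ι (suc M)) μ) (trans (cong (½ *_) Mμ) (ℚ.*-identityʳ ½))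

-- From rational to real edge probabilities.

module AasCriterion where

 open import Data.Bool.Base using (Bool; true; false; if_then_else_)
 open import Data.Fin.Base using (Fin)
 open import Data.List.Base as List using (List; []; _∷_; filter; map)
 open import Data.Nat.Base as ℕ using (ℕ; zero; suc)
 import Data.Nat.Properties as ℕ
 import Data.Sum.Base
 open import Data.Product.Base using (∃; _×_; _,_; proj₁; proj₂)
 open import Data.Rational.Base
 import Data.Rational.Properties as ℚ
 open import Data.Rational.Solver using (module +-*-Solver)
 open import Data.Vec.Base as Vec using (Vec; []; _∷_)
 open import Function.Base using (_∘_)
 open import Relation.Binary.PropositionalEquality using (_≡_; refl; sym; trans; cong; cong₂; subst; subst₂)
 open import Relation.Nullary using (Dec; does; no)
 open import Relation.Unary using (Decidable)
 import Defs
 open import Defs using (Eventually; Graph; adj; addVertex; emptyGraph; graphs; pairs; module ℚLemmas; module Cauchy; ℝ; seq; ∑; ∏; weight; ℙ; IsProbability; Aas; 1ℝ)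
 open ℚLemmas
 open Expectation
 open RationalBounds using (ι; x≤x+)
 open +-*-Solver

 seq-∑ : ∀ {A : Set} (f : A → ℝ) xs m → seq (∑ (map f xs)) m ≡ ΣL (λ x → seq (f x) m) xs
 seq-∑ f [] m = refl
 seq-∑ f (x ∷ xs) m = cong (seq (f x) m +_) (seq-∑ f xs m)

 module _ {n : ℕ} {A : Graph n → Set} (A? : Decidable A) where

   PQ : ℚ → ℚ
   PQ q = Expect.EG q n (λ R → bit (does (A? R)))

   seq-ℙ : ∀ p m → seq (ℙ p A?) m ≡ PQ (seq p m)
   seq-ℙ p m = trans (seq-∑ (weight p) (filter A? (graphs n)) m) (trans (ΣL-cong wt≡ (filter A? (graphs n)))
     (trans (ΣL-filter A? weightQ (graphs n)) (EG-sum n (λ R → bit (does (A? R))))))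
     where
     open Expect (seq p m)
     case : ∀ b → seq (if b then p else (1ℝ Defs.- p)) m ≡ wt b
     case true = refl
     case false = refl
     wtList : ∀ (R : Graph n) (ps : List (Fin n × Fin n)) → seq (∏ (map (λ (u , v) → if adj R u v then p else (1ℝ Defs.- p)) ps)) m ≡ ΠL (λ (u , v) → wt (adj R u v)) ps
     wtList R [] = refl
     wtList R ((u , v) ∷ ps) = cong₂ _*_ (case (adj R u v)) (wtList R ps)
     wt≡ : ∀ R → seq (weight p R) m ≡ weightQ R
     wt≡ R = wtList R (pairs n)

 -- Boundedness is included so that products stay in the class, which then contains the polynomial
 -- `EG` in q. The interval [-2,2] contains all late approximations of a number in [0,1].
 record Lip (F : ℚ → ℚ) : Set where
   field
     C : ℚ
     0≤C : 0ℚ ≤ C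
     bnd : ∀ {x} → ∣ x ∣ ≤ ι 2 → ∣ F x ∣ ≤ C
     lip : ∀ {x y} → ∣ x ∣ ≤ ι 2 → ∣ y ∣ ≤ ι 2 → ∣ F x - F y ∣ ≤ C * ∣ x - y ∣
 open Lip

 Lip-const : ∀ c → Lip (λ _ → c)
 Lip-const c = record { C = ∣ c ∣ ; 0≤C = ℚ.0≤∣p∣ c ; bnd = λ _ → ℚ.≤-refl
   ; lip = λ {x} {y} _ _ → ℚ.≤-trans (ℚ.≤-reflexive (cong ∣_∣ (ℚ.+-inverseʳ c))) (*-nonneg (ℚ.0≤∣p∣ c) (ℚ.0≤∣p∣ (x - y))) }

 Lip-id : Lip (λ x → x)
 Lip-id = record { C = ι 2 ; 0≤C = 0≤fromℕ 2 ; bnd = λ h → h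
   ; lip = λ {x} {y} _ _ → ℚ.≤-trans (ℚ.≤-reflexive (sym (ℚ.*-identityˡ ∣ x - y ∣))) (*-monoʳ ∣ x - y ∣ (ℚ.0≤∣p∣ (x - y)) (fromℕ-mono {1} {2} (ℕ.s≤s ℕ.z≤n))) }

 Lip-+ : ∀ {F G} → Lip F → Lip G → Lip (λ x → F x + G x)
 Lip-+ {F} {G} f g = record { C = C f + C g ; 0≤C = ℚ.+-mono-≤ (0≤C f) (0≤C g)
   ; bnd = λ {x} h → ℚ.≤-trans (ℚ.∣p+q∣≤∣p∣+∣q∣ (F x) (G x)) (ℚ.+-mono-≤ (bnd f h) (bnd g h))
   ; lip = λ {x} {y} hx hy → ℚ.≤-trans (ℚ.≤-reflexive (cong ∣_∣ (solve 4 (λ a b c d → (a :+ b) :- (c :+ d) := (a :- c) :+ (b :- d)) refl (F x) (G x) (F y) (G y))))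
       (ℚ.≤-trans (ℚ.∣p+q∣≤∣p∣+∣q∣ (F x - F y) (G x - G y)) (ℚ.≤-trans (ℚ.+-mono-≤ (lip f hx hy) (lip g hx hy)) (ℚ.≤-reflexive (sym (ℚ.*-distribʳ-+ ∣ x - y ∣ (C f) (C g)))))) }

 Lip-* : ∀ {F G} → Lip F → Lip G → Lip (λ x → F x * G x)
 Lip-* {F} {G} f g = record { C = c + c ; 0≤C = ℚ.+-mono-≤ 0≤c 0≤c
   ; bnd = λ {x} h → ℚ.≤-trans (ℚ.≤-reflexive (ℚ.∣p*q∣≡∣p∣*∣q∣ (F x) (G x))) (ℚ.≤-trans (*-mono (ℚ.0≤∣p∣ (G x)) (bnd f h) (0≤C f) (bnd g h)) (x≤x+ c c 0≤c))
   ; lip = λ {x} {y} hx hy → ℚ.≤-trans (ℚ.≤-reflexive (cong ∣_∣ (Cauchy.*-diff (F x) (G x) (F y) (G y))))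
       (ℚ.≤-trans (ℚ.∣p+q∣≤∣p∣+∣q∣ (F x * (G x - G y)) ((F x - F y) * G y))
       (ℚ.≤-trans (ℚ.≤-reflexive (cong₂ _+_ (ℚ.∣p*q∣≡∣p∣*∣q∣ (F x) (G x - G y)) (ℚ.∣p*q∣≡∣p∣*∣q∣ (F x - F y) (G y))))
       (ℚ.≤-trans (ℚ.+-mono-≤ (*-mono (ℚ.0≤∣p∣ (G x - G y)) (bnd f hx) (0≤C f) (lip g hx hy)) (*-mono (ℚ.0≤∣p∣ (G y)) (lip f hx hy) (*-nonneg (0≤C f) (ℚ.0≤∣p∣ (x - y))) (bnd g hy)))
         (ℚ.≤-reflexive (solve 3 (λ a b d → a :* (b :* d) :+ a :* d :* b := (a :* b :+ a :* b) :* d) refl (C f) (C g) ∣ x - y ∣))))) }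
   where
   c = C f * C g
   0≤c = *-nonneg (0≤C f) (0≤C g)

 Lip-1- : Lip (λ x → 1ℚ - x)
 Lip-1- = record { C = C h ; 0≤C = 0≤C h
   ; bnd = λ {x} p → subst (λ z → ∣ z ∣ ≤ C h) (eq x) (bnd h p)
   ; lip = λ {x} {y} p q → subst₂ (λ z w → ∣ z - w ∣ ≤ C h * ∣ x - y ∣) (eq x) (eq y) (lip h p q) }
   where
   h : Lip (λ x → 1ℚ + - 1ℚ * x)
   h = Lip-+ (Lip-const 1ℚ) (Lip-* (Lip-const (- 1ℚ)) Lip-id)
   eq : ∀ x → 1ℚ + - 1ℚ * x ≡ 1ℚ - x
   eq = solve 1 (λ x → con 1ℚ :+ con (- 1ℚ) :* x := con 1ℚ :- x) refl

 Lip-EV : ∀ n (f : Vec Bool n → ℚ → ℚ) → (∀ S → Lip (f S)) → Lip (λ q → Expect.EV q n (λ S → f S q))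
 Lip-EV zero f h = h []
 Lip-EV (suc n) f h = Lip-+ (Lip-* Lip-1- (Lip-EV n _ (h ∘ (false ∷_)))) (Lip-* Lip-id (Lip-EV n _ (h ∘ (true ∷_))))

 Lip-EG : ∀ n (f : Graph n → ℚ) → Lip (λ q → Expect.EG q n f)
 Lip-EG zero f = Lip-const (f emptyGraph)
 Lip-EG (suc n) f = Lip-EV n (λ S q → Expect.EG q n (λ R → f (addVertex S R))) (λ S → Lip-EG n (λ R → f (addVertex S R)))

 -- The real p lies in [0,1], but its rational approximations need not, and the bounds on
 -- expectations require 0 ≤ q ≤ 1.
 clamp : ℚ → ℚ
 clamp q = (q ⊔ 0ℚ) ⊓ 1ℚ

 0≤clamp : ∀ q → 0ℚ ≤ clamp q
 0≤clamp q = ℚ.⊓-glb (ℚ.p≤q⊔p q 0ℚ) 0≤1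

 clamp≤1 : ∀ q → clamp q ≤ 1ℚ
 clamp≤1 q = ℚ.p⊓q≤q (q ⊔ 0ℚ) 1ℚ

 clamp-close : ∀ {q η} → 0ℚ ≤ η → 0ℚ ≤ q + η → q ≤ 1ℚ + η → ∣ q - clamp q ∣ ≤ η
 clamp-close {q} {η} 0≤η h₀ h₁ = ≤+⇒∣∣≤ {q} {clamp q}
   (ℚ.≤-trans (ℚ.⊓-glb {q} {q ⊔ 0ℚ + η} {1ℚ + η} (ℚ.≤-trans (ℚ.p≤p⊔q q 0ℚ) (x≤x+ (q ⊔ 0ℚ) η 0≤η)) h₁) (ℚ.≤-reflexive (sym (ℚ.mono-≤-distrib-⊓ {λ x → x + η} (ℚ.+-monoˡ-≤ η) (q ⊔ 0ℚ) 1ℚ))))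
   (ℚ.≤-trans (ℚ.p⊓q≤p (q ⊔ 0ℚ) 1ℚ) (ℚ.⊔-lub {q + η} {q} {0ℚ} (x≤x+ q η 0≤η) h₀))

 module _ (p : ℝ) (isP : IsProbability p) where

   close : ∀ {F} → Lip F → ∀ ε → 0ℚ < ε → Eventually λ m → ∣ F (seq p m) - F (clamp (seq p m)) ∣ ≤ ε
   close {F} l ε 0<ε = N₀ ℕ.⊔ N₁ , λ m N≤m → bound m (proj₂ E₀ m (ℕ.m⊔n≤o⇒m≤o N₀ N₁ N≤m)) (proj₂ E₁ m (ℕ.m⊔n≤o⇒n≤o N₀ N₁ N≤m))
     where
     D = C l + 1ℚ
     0<D : 0ℚ < D
     0<D = ℚ.+-mono-≤-< (0≤C l) 0<1
     Q = Cauchy.quotient ε D 0<ε 0<D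
     η₀ = proj₁ Q
     η = η₀ ⊓ 1ℚ
     0<η : 0ℚ < η
     0<η with ℚ.≤-total η₀ 1ℚ
     ... | Data.Sum.Base.inj₁ le = ℚ.<-respʳ-≡ (sym (ℚ.p≤q⇒p⊓q≡p le)) (proj₁ (proj₂ Q))
     ... | Data.Sum.Base.inj₂ le = ℚ.<-respʳ-≡ (sym (ℚ.p≥q⇒p⊓q≡q le)) 0<1
     E₀ = proj₁ isP η 0<η
     E₁ = proj₂ isP η 0<η
     N₀ = proj₁ E₀
     N₁ = proj₁ E₁
     bound : ∀ m → 0ℚ ≤ seq p m + η → seq p m ≤ 1ℚ + η → ∣ F (seq p m) - F (clamp (seq p m)) ∣ ≤ ε
     bound m h₀ h₁ = ℚ.≤-trans (lip l big₁ big₂) (ℚ.≤-trans (*-mono (ℚ.0≤∣p∣ (q - clamp q)) (x≤x+ (C l) 1ℚ 0≤1) (ℚ.<⇒≤ 0<D) (ℚ.≤-trans cl (ℚ.p⊓q≤p η₀ 1ℚ))) (ℚ.≤-reflexive (trans (ℚ.*-comm D η₀) (proj₂ (proj₂ Q)))))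
       where
       q = seq p m
       cl : ∣ q - clamp q ∣ ≤ η
       cl = clamp-close (ℚ.<⇒≤ 0<η) h₀ h₁
       η≤1 : η ≤ 1ℚ
       η≤1 = ℚ.p⊓q≤q η₀ 1ℚ
       clampAbs : ∣ clamp q ∣ ≤ 1ℚ
       clampAbs = ℚ.≤-trans (ℚ.≤-reflexive (ℚ.0≤p⇒∣p∣≡p (0≤clamp q))) (clamp≤1 q)
       big₂ : ∣ clamp q ∣ ≤ ι 2
       big₂ = ℚ.≤-trans clampAbs (fromℕ-mono {1} {2} (ℕ.s≤s ℕ.z≤n))
       big₁ : ∣ q ∣ ≤ ι 2
       big₁ = ℚ.≤-trans (ℚ.≤-reflexive (cong ∣_∣ (solve 2 (λ q c → q := (q :- c) :+ c) refl q (clamp q)))) (ℚ.≤-trans (ℚ.∣p+q∣≤∣p∣+∣q∣ (q - clamp q) (clamp q)) (ℚ.+-mono-≤ (ℚ.≤-trans cl η≤1) clampAbs))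

   module _ {n : ℕ} {A : Graph n → Set} (A? : Decidable A) where

     ℙ-lower : ∀ {B} (Q : ℚ → Set) → Eventually (Q ∘ clamp ∘ seq p) → (∀ q → 0ℚ ≤ q → q ≤ 1ℚ → Q q → B ≤ PQ A? q) →
       ∀ ε → 0ℚ < ε → Eventually λ m → B ≤ seq (ℙ p A?) m + ε
     ℙ-lower {B} Q (N , hQ) h ε 0<ε = N ℕ.⊔ proj₁ cl , λ m N≤m →
       let q = seq p m in
       ℚ.≤-trans (h (clamp q) (0≤clamp q) (clamp≤1 q) (hQ m (ℕ.m⊔n≤o⇒m≤o N (proj₁ cl) N≤m)))
         (ℚ.≤-trans (∣∣≤⇒≤+ {PQ A? (clamp q)} {PQ A? q} (ℚ.≤-trans (ℚ.≤-reflexive (∣∣-comm (PQ A? (clamp q)) (PQ A? q))) (proj₂ cl m (ℕ.m⊔n≤o⇒n≤o N (proj₁ cl) N≤m))))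
           (ℚ.≤-reflexive (cong (_+ ε) (sym (seq-ℙ A? p m)))))
       where
       cl = close (Lip-EG n (λ R → bit (does (A? R)))) ε 0<ε

     PQ≤1 : ∀ q → 0ℚ ≤ q → q ≤ 1ℚ → PQ A? q ≤ 1ℚ
     PQ≤1 q 0≤q q≤1 = ℚ.≤-trans (Expect.EG-mono q 0≤q q≤1 n (λ R → bit≤1 (does (A? R)))) (ℚ.≤-reflexive (Expect.EG-const q n 1ℚ))

     ℙ-upper : ∀ ε → 0ℚ < ε → Eventually λ m → seq (ℙ p A?) m ≤ 1ℚ + ε
     ℙ-upper ε 0<ε = proj₁ cl , λ m N≤m → let q = seq p m in
       ℚ.≤-trans (ℚ.≤-reflexive (seq-ℙ A? p m)) (ℚ.≤-trans (∣∣≤⇒≤+ {PQ A? q} {PQ A? (clamp q)} (proj₂ cl m N≤m)) (ℚ.+-monoˡ-≤ ε (PQ≤1 (clamp q) (0≤clamp q) (clamp≤1 q))))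
       where
       cl = close (Lip-EG n (λ R → bit (does (A? R)))) ε 0<ε

 module _ (x ε : ℝ) {ε₀ : ℚ} (0<ε₀ : 0ℚ < ε₀) (ev : Eventually λ m → 0ℚ + ε₀ ≤ seq ε m) where
   private
     M = proj₁ ev
     ε₀≤ : ∀ m → M ℕ.≤ m → ε₀ ≤ seq ε m
     ε₀≤ m M≤m = ℚ.≤-trans (ℚ.≤-reflexive (sym (ℚ.+-identityˡ ε₀))) (proj₂ ev m M≤m)

   toLower : (∀ η → 0ℚ < η → Eventually λ m → 1ℚ - ε₀ ≤ seq x m + η) → (1ℝ Defs.- ε) Defs.≤ x
   toLower h η 0<η = M ℕ.⊔ proj₁ (h η 0<η) , λ m M≤m →
     ℚ.≤-trans (ℚ.+-monoʳ-≤ 1ℚ (ℚ.neg-antimono-≤ (ε₀≤ m (ℕ.m⊔n≤o⇒m≤o M (proj₁ (h η 0<η)) M≤m)))) (proj₂ (h η 0<η) m (ℕ.m⊔n≤o⇒n≤o M (proj₁ (h η 0<η)) M≤m))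

   toUpper : (∀ η → 0ℚ < η → Eventually λ m → seq x m ≤ 1ℚ + η) → x Defs.≤ (1ℝ Defs.+ ε)
   toUpper h η 0<η = M ℕ.⊔ proj₁ (h η 0<η) , λ m M≤m →
     ℚ.≤-trans (proj₂ (h η 0<η) m (ℕ.m⊔n≤o⇒n≤o M (proj₁ (h η 0<η)) M≤m))
       (ℚ.+-monoˡ-≤ η (x≤x+ 1ℚ (seq ε m) (ℚ.≤-trans (ℚ.<⇒≤ 0<ε₀) (ε₀≤ m (ℕ.m⊔n≤o⇒m≤o M (proj₁ (h η 0<η)) M≤m)))))

 -- The probability is at least 1 - ε, provided that p lies in a suitable interval.
 Likely : ℝ → ∀ {n} {A : Graph n → Set} → Decidable A → ℚ → Set
 Likely p A? ε = ∃ λ lo → ∃ λ hi → Eventually (λ m → lo ≤ clamp (seq p m) × clamp (seq p m) ≤ hi) ×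
   (∀ q → 0ℚ ≤ q → q ≤ 1ℚ → lo ≤ q × q ≤ hi → 1ℚ ≤ PQ A? q + ε)

 drop-ε : ∀ x e → 1ℚ ≤ x + e → 1ℚ - e ≤ x
 drop-ε x e le = ℚ.≤-trans (ℚ.+-monoˡ-≤ (- e) le) (ℚ.≤-reflexive (solve 2 (λ x e → x :+ e :- e := x) refl x e))

 likely-lower : ∀ p → IsProbability p → ∀ {n} {A : Graph n → Set} (A? : Decidable A) {ε₀} → Likely p A? ε₀ →
   ∀ η → 0ℚ < η → Eventually λ m → 1ℚ - ε₀ ≤ seq (ℙ p A?) m + η
 likely-lower p isP A? {ε₀} (lo , hi , ev , b) = ℙ-lower p isP A? {1ℚ - ε₀} (λ q → lo ≤ q × q ≤ hi) ev
   (λ q 0≤q q≤1 Qq → drop-ε (PQ A? q) ε₀ (b q 0≤q q≤1 Qq))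

 aas : ∀ (p : ℕ → ℝ) → (∀ n → IsProbability (p n)) → ∀ {A : ∀ n → Graph n → Set} (A? : ∀ n → Decidable (A n)) →
   (∀ ε → 0ℚ < ε → Eventually λ n → Likely (p n) (A? n) ε) → Aas p A?
 aas p isP A? h ε (ε₀ , 0<ε₀ , ev) = proj₁ (h ε₀ 0<ε₀) , λ n N≤n →
   toLower (ℙ (p n) (A? n)) ε 0<ε₀ ev (likely-lower (p n) (isP n) (A? n) (proj₂ (h ε₀ 0<ε₀) n N≤n)) ,
   toUpper (ℙ (p n) (A? n)) ε 0<ε₀ ev (ℙ-upper (p n) (isP n) (A? n))

-- Harmonic sums and the sizes of connectivity, waste and parts.

module Counting where

 open import Data.Empty using (⊥-elim)
 open import Data.Fin.Base using (Fin)
 import Data.Fin.Properties as Fin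
 open import Data.List.Base as List using (List; []; _∷_; length; filter; allFin; concatMap)
 import Data.List.Properties as List
 open import Data.List.Membership.Propositional using (_∈_)
 open import Data.List.Membership.Propositional.Properties
 open import Data.List.Relation.Unary.Any as Any using (here; there)
 open import Data.List.Relation.Unary.Unique.Propositional using (Unique)
 import Data.List.Relation.Unary.Unique.Propositional.Properties as Unique
 open import Data.Nat.Base
 open import Data.Nat.Properties
 open import Data.Nat.DivMod
 open import Data.Nat.Solver using (module +-*-Solver)
 open import Data.Product.Base using (∃; _×_; _,_; proj₁; proj₂)
 open import Function.Base using (id)
 open import Relation.Binary.PropositionalEquality using (_≡_; _≢_; refl; sym; trans; cong; subst)
 open import Relation.Nullary using (yes; no)
 open Lists using (_⊆_; length-⊆; _≟ℕ_)
 open WalkJoining using (cost)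
 open PathSystems using (costs)
 open Pieces using (pieces; ∈-pieces; ∈-pieces⁻)
 open GraphSetup using (Setup; waste)
 open PancyclicCriterion
 open TreeProbability using (module TreeProb)
 open import Defs using (Graph; δ)
 open +-*-Solver

 harmonic : ℕ → ℕ → ℕ
 harmonic a zero = 0
 harmonic a (suc m) = a / suc m + harmonic a m

 harmonic-+ : ∀ a b r → harmonic a (r + b) ≤ r * (a / suc b) + harmonic a b
 harmonic-+ a b zero = ≤-refl
 harmonic-+ a b (suc r) = ≤-trans (+-mono-≤ (/-monoʳ-≤ a (s≤s (m≤n+m b r))) (harmonic-+ a b r)) (≤-reflexive (sym (+-assoc (a / suc b) _ _)))

 harmonic-mono : ∀ a {m n} → m ≤ n → harmonic a m ≤ harmonic a n
 harmonic-mono a {n = zero} z≤n = z≤n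
 harmonic-mono a {m} {suc n} le with m ≟ℕ suc n
 ... | yes refl = ≤-refl
 ... | no ne = ≤-trans (harmonic-mono a (≤-pred (≤∧≢⇒< le ne))) (m≤n+m _ (a / suc n))

 -- Dyadic grouping: the 2^i terms with index from 2^i to 2^(i+1) - 1 are at most a / 2^i each, so
 -- every group adds at most a.
 harmonic-2^ : ∀ a i b → suc b ≡ 2 ^ i → harmonic a b ≤ a * i
 harmonic-2^ a zero zero refl = z≤n
 harmonic-2^ a (suc i) b e with 2 ^ i in eq
 ... | zero = ⊥-elim (1+n≢0 e)
 ... | suc b′ = subst (λ m → harmonic a m ≤ a * suc i) (sym b≡) (≤-trans (harmonic-+ a b′ (suc b′))
       (≤-trans (+-mono-≤ (≤-trans (≤-reflexive (*-comm (suc b′) (a / suc b′))) (m/n*n≤m a (suc b′))) (harmonic-2^ a i b′ (sym eq))) (≤-reflexive (sym (*-suc a i)))))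
   where
   b≡ : b ≡ suc b′ + b′
   b≡ = suc-injective (trans e (trans (cong (suc b′ +_) (+-identityʳ (suc b′))) (solve 1 (λ x → con 1 :+ x :+ (con 1 :+ x) := con 1 :+ (con 1 :+ x :+ x)) refl b′)))

 costs-harmonic : ∀ a m → costs a m ≡ 4 * m + 4 * harmonic a m
 costs-harmonic a zero = refl
 costs-harmonic a (suc m) = trans (cong (4 * suc (a / suc m) +_) (costs-harmonic a m)) (solve 3 (λ q m h → con 4 :* (con 1 :+ q) :+ (con 4 :* m :+ con 4 :* h) := con 4 :* (con 1 :+ m) :+ con 4 :* (q :+ h)) refl (a / suc m) m (harmonic a m))

 costs-≤ : ∀ a m i → m < 2 ^ i → costs a m ≤ 4 * m + 4 * (a * i)
 costs-≤ a m i lt with 2 ^ i in eq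
 costs-≤ a m i (s≤s m≤) | suc b = ≤-trans (≤-reflexive (costs-harmonic a m)) (+-monoʳ-≤ (4 * m) (*-monoʳ-≤ 4 (≤-trans (harmonic-mono a m≤) (harmonic-2^ a i b (sym eq)))))

 log₂ : ∀ n → 1 ≤ n → ∃ λ ℓ → 2 ^ ℓ ≤ n × n < 2 ^ suc ℓ
 log₂ (suc zero) _ = 0 , ≤-refl , ≤-refl
 log₂ (suc (suc n)) _ with log₂ (suc n) (s≤s z≤n)
 ... | ℓ , le , lt with suc (suc n) <? 2 ^ suc ℓ
 ...   | yes p = ℓ , m≤n⇒m≤1+n le , p
 ...   | no ¬p = suc ℓ , ≮⇒≥ ¬p , ≤-<-trans lt (^-monoʳ-< 2 (s≤s (s≤s z≤n)) {suc ℓ} {suc (suc ℓ)} ≤-refl)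

 -- A bound for the vertices of one piece in use after the a + 2 loops have been added, hence also
 -- for the number of paths to be merged there.
 tokens : ℕ → ℕ
 tokens a = 4 * a + 4 + suc (suc a)

 -- The connectivity that `run` demands of a piece: more than the vertices in use and those spent in
 -- both merging phases.
 usage : ℕ → ℕ
 usage a = suc (tokens a + costs a (tokens a) + costs a (tokens a))

 module Numbers (a ℓ n : ℕ) (1≤a : 1 ≤ a) (20≤ℓ : 20 ≤ ℓ) (a≤n : a ≤ n) (n< : n < 2 ^ suc ℓ) where
   open ≤-Reasoning

   tokens≤ : tokens a ≤ 11 * a
   tokens≤ = begin
     4 * a + 4 + suc (suc a) ≡⟨ solve 1 (λ a → con 4 :* a :+ con 4 :+ (con 2 :+ a) := con 5 :* a :+ con 6 :* con 1) refl a ⟩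
     5 * a + 6 * 1 ≤⟨ +-monoʳ-≤ (5 * a) (*-monoʳ-≤ 6 1≤a) ⟩
     5 * a + 6 * a ≡⟨ solve 1 (λ a → con 5 :* a :+ con 6 :* a := con 11 :* a) refl a ⟩
     11 * a ∎

   tokens< : tokens a < 2 ^ (5 + ℓ)
   tokens< = begin-strict
     tokens a ≤⟨ tokens≤ ⟩
     11 * a ≤⟨ *-monoʳ-≤ 11 a≤n ⟩
     11 * n <⟨ *-monoʳ-< 11 n< ⟩
     11 * 2 ^ suc ℓ ≤⟨ *-monoˡ-≤ (2 ^ suc ℓ) (m≤m+n 11 5) ⟩
     16 * 2 ^ suc ℓ ≡⟨ solve 1 (λ x → con 16 :* (con 2 :* x) := con 2 :* (con 2 :* (con 2 :* (con 2 :* (con 2 :* x))))) refl (2 ^ ℓ) ⟩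
     2 ^ (5 + ℓ) ∎

   costs≤ : costs a (tokens a) ≤ 8 * (a * ℓ)
   costs≤ = begin
     costs a (tokens a) ≤⟨ costs-≤ a (tokens a) (5 + ℓ) tokens< ⟩
     4 * tokens a + 4 * (a * (5 + ℓ)) ≤⟨ +-monoˡ-≤ (4 * (a * (5 + ℓ))) (*-monoʳ-≤ 4 tokens≤) ⟩
     4 * (11 * a) + 4 * (a * (5 + ℓ)) ≡⟨ solve 2 (λ a l → con 4 :* (con 11 :* a) :+ con 4 :* (a :* (con 5 :+ l)) := a :* con 64 :+ con 4 :* (a :* l)) refl a ℓ ⟩
     a * 64 + 4 * (a * ℓ) ≤⟨ +-monoˡ-≤ (4 * (a * ℓ)) (*-monoʳ-≤ a (≤-trans (m≤m+n 64 16) (*-monoʳ-≤ 4 20≤ℓ))) ⟩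
     a * (4 * ℓ) + 4 * (a * ℓ) ≡⟨ solve 2 (λ a l → a :* (con 4 :* l) :+ con 4 :* (a :* l) := con 8 :* (a :* l)) refl a ℓ ⟩
     8 * (a * ℓ) ∎

   usage≤ : usage a ≤ 17 * (a * ℓ)
   usage≤ = begin
     1 + (tokens a + costs a (tokens a) + costs a (tokens a)) ≤⟨ +-mono-≤ 1≤a (+-mono-≤ (+-mono-≤ tokens≤ costs≤) costs≤) ⟩
     a + (11 * a + 8 * (a * ℓ) + 8 * (a * ℓ)) ≡⟨ solve 2 (λ a l → a :+ (con 11 :* a :+ con 8 :* (a :* l) :+ con 8 :* (a :* l)) := a :* con 12 :+ con 16 :* (a :* l)) refl a ℓ ⟩
     a * 12 + 16 * (a * ℓ) ≤⟨ +-monoˡ-≤ (16 * (a * ℓ)) (*-monoʳ-≤ a (≤-trans (m≤m+n 12 8) 20≤ℓ)) ⟩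
     a * ℓ + 16 * (a * ℓ) ≡⟨ refl ⟩
     17 * (a * ℓ) ∎

   -- The unit for all losses: a separator has O(a ℓ) vertices and at most a pieces are charged. The
   -- condition ℓ ≥ 20 lets constant multiples of a² disappear in it.
   Q : ℕ
   Q = a * a * ℓ

   20a²≤Q : a * a * 20 ≤ Q
   20a²≤Q = *-monoʳ-≤ (a * a) 20≤ℓ

   a≤a² : a ≤ a * a
   a≤a² = ≤-trans (≤-reflexive (sym (*-identityˡ a))) (*-monoˡ-≤ a 1≤a)

   waste≤ : (usage a + suc (suc (a + a))) * a + suc (suc (a + a)) ≤ 18 * Q
   waste≤ = begin
     (usage a + suc (suc (a + a))) * a + suc (suc (a + a)) ≤⟨ +-mono-≤ (*-monoˡ-≤ a (+-mono-≤ usage≤ two)) (≤-trans two (*-monoʳ-≤ 4 a≤a²)) ⟩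
     (17 * (a * ℓ) + 4 * a) * a + 4 * (a * a) ≡⟨ solve 2 (λ a l → (con 17 :* (a :* l) :+ con 4 :* a) :* a :+ con 4 :* (a :* a) := con 17 :* (a :* a :* l) :+ a :* a :* con 8) refl a ℓ ⟩
     17 * Q + a * a * 8 ≤⟨ +-monoʳ-≤ (17 * Q) (≤-trans (*-monoʳ-≤ (a * a) (m≤m+n 8 12)) 20a²≤Q) ⟩
     17 * Q + Q ≡⟨ +-comm (17 * Q) Q ⟩
     18 * Q ∎
     where
     two : suc (suc (a + a)) ≤ 4 * a
     two = ≤-trans (+-monoˡ-≤ (a + a) (+-mono-≤ 1≤a 1≤a)) (≤-reflexive (solve 1 (λ a → a :+ a :+ (a :+ a) := con 4 :* a) refl a))

   Q-pos : 20 ≤ Q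
   Q-pos = ≤-trans (*-monoˡ-≤ 20 (≤-trans 1≤a a≤a²)) 20a²≤Q

   ℓ≤Q : ℓ ≤ Q
   ℓ≤Q = ≤-trans (≤-reflexive (sym (*-identityˡ ℓ))) (*-monoˡ-≤ ℓ (≤-trans 1≤a a≤a²))

   rest≤ : a * (a + a) + a + 4 ≤ Q
   rest≤ = ≤-trans (+-mono-≤ (+-monoʳ-≤ (a * (a + a)) a≤a²) (*-monoʳ-≤ 4 (≤-trans 1≤a a≤a²))) (≤-trans (≤-reflexive (solve 1 (λ a → a :* (a :+ a) :+ a :* a :+ con 4 :* (a :* a) := a :* a :* con 7) refl a)) (≤-trans (*-monoʳ-≤ (a * a) (m≤m+n 7 13)) 20a²≤Q))

   rest′≤ : suc (suc a) + (4 * a + 4) ≤ Q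
   rest′≤ = ≤-trans (≤-reflexive (+-comm (suc (suc a)) (4 * a + 4))) (≤-trans tokens≤ (≤-trans (*-monoʳ-≤ 11 a≤a²) (≤-trans (≤-reflexive (*-comm 11 (a * a))) (≤-trans (*-monoʳ-≤ (a * a) (m≤m+n 11 9)) 20a²≤Q))))

 /-lower : ∀ x y .{{_ : NonZero y}} → x < y + x / y * y
 /-lower x y = ≤-trans (s≤s (≤-reflexive (m≡m%n+[m/n]*n x y))) (+-monoˡ-≤ (x / y * y) (m%n<n x y))

 module _ {n : ℕ} (G : Graph n) (a us δ₀ : ℕ) (S : Setup G a us δ₀) where
   open Setup S
   open Parts G a us δ₀ S
   open TreeProb G a us δ₀ S

   private
     bp : List (Fin n)
     bp = v′ ∷ p′ ∷ []

   avail-≥ : ∀ {c} → c ∈ pieces k → δ₀ ≤ length (avail c) + (2 + waste G a us)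
   avail-≥ {c} c∈ with big c (proj₁ (∈-pieces⁻ c∈)) (proj₂ (∈-pieces⁻ c∈))
   ... | bs , ub , cb , le = ≤-trans le (≤-trans (+-monoˡ-≤ (waste G a us) (≤-trans (length-⊆ ub sub) (≤-reflexive (List.length-++ (avail c))))) (≤-reflexive (+-assoc (length (avail c)) 2 _)))
     where
     sub : bs ⊆ avail c List.++ bp
     sub {x} x∈ with x Fin.≟ v′ | x Fin.≟ p′
     ... | yes e | _ = ∈-++⁺ʳ (avail c) (here e)
     ... | no _ | yes e = ∈-++⁺ʳ (avail c) (there (here e))
     ... | no ne | no ne′ = ∈-++⁺ˡ (∈-filter⁺ (free? c) (∈-allFin x) (cb x∈ , ne , ne′))

   quarter-≥ : ∀ {A : Set} (xs : List A) → length xs ≤ 4 * quarter xs + 3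
   quarter-≥ xs = ≤-pred (≤-trans (/-lower (length xs) 4) (≤-reflexive (trans (+-comm 4 _) (trans (cong (_+ 4) (*-comm (length xs / 4) 4)) (+-suc (4 * quarter xs) 3)))))

   total : ∀ cs → length (concatMap avail cs) ≤ 4 * wSum cs + 3 * length cs
   total [] = z≤n
   total (c ∷ cs) = ≤-trans (≤-reflexive (List.length-++ (avail c))) (≤-trans (+-mono-≤ (quarter-≥ (avail c)) (total cs))
     (≤-reflexive (solve 3 (λ w s l → (con 4 :* w :+ con 3) :+ (con 4 :* s :+ con 3 :* l) := con 4 :* (w :+ s) :+ con 3 :* (con 1 :+ l)) refl (w c) (wSum cs) (length cs))))

   -- Every vertex is available in its piece, or is v′ or p′, or has colour 0; rounding to quarters
   -- loses at most 3 per piece.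
   wSum-≥ : n ≤ 4 * wSum (pieces k) + (3 * a + (2 + waste G a us))
   wSum-≥ = begin
     n ≡⟨ sym (List.length-tabulate {n = n} id) ⟩
     length (allFin n) ≤⟨ length-⊆ (Unique.allFin⁺ n) cov ⟩
     length (concatMap avail (pieces k) List.++ bp List.++ Z) ≡⟨ trans (List.length-++ (concatMap avail (pieces k))) (cong (length (concatMap avail (pieces k)) +_) (List.length-++ bp {Z})) ⟩
     length (concatMap avail (pieces k)) + (2 + length Z) ≤⟨ +-mono-≤ (total (pieces k)) (+-monoʳ-≤ 2 zeros) ⟩
     4 * wSum (pieces k) + 3 * length (pieces k) + (2 + waste G a us) ≤⟨ +-monoˡ-≤ (2 + waste G a us) (+-monoʳ-≤ (4 * wSum (pieces k)) (*-monoʳ-≤ 3 (≤-trans (≤-reflexive (List.length-applyUpTo suc k)) k≤a))) ⟩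
     4 * wSum (pieces k) + 3 * a + (2 + waste G a us) ≡⟨ +-assoc (4 * wSum (pieces k)) (3 * a) _ ⟩
     4 * wSum (pieces k) + (3 * a + (2 + waste G a us)) ∎
     where
     open ≤-Reasoning
     Z : List (Fin n)
     Z = filter (λ x → col x ≟ℕ 0) (allFin n)
     cov : allFin n ⊆ concatMap avail (pieces k) List.++ bp List.++ Z
     cov {x} _ with col x ≟ℕ 0 | x Fin.≟ v′ | x Fin.≟ p′
     ... | yes e | _ | _ = ∈-++⁺ʳ (concatMap avail (pieces k)) (∈-++⁺ʳ bp (∈-filter⁺ (λ x → col x ≟ℕ 0) (∈-allFin x) e))
     ... | no _ | yes e | _ = ∈-++⁺ʳ (concatMap avail (pieces k)) (here e)
     ... | no _ | no _ | yes e = ∈-++⁺ʳ (concatMap avail (pieces k)) (there (here e))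
     ... | no nz | no ne | no ne′ = ∈-++⁺ˡ (∈-concatMap⁺ avail (Any.map (λ { refl → ∈-filter⁺ (free? (col x)) (∈-allFin x) (refl , ne , ne′) }) (∈-pieces (n≢0⇒n>0 nz) (colMax x))))

-- Choice of the parameters for (a).

module PancyclicLikely where

 open import Data.Empty using (⊥-elim)
 open import Data.Bool.Base using (T; true; false)
 open import Data.Fin.Base as Fin using (Fin)
 import Data.Integer.Base as ℤ
 open import Data.List.Base as List using (List; length)
 open import Data.List.Extrema.Nat using (min≤⊤)
 open import Data.List.Membership.Propositional using (_∈_)
 open import Data.Nat.Base as ℕ using (ℕ; zero; suc; s≤s; z≤n)
 import Data.Nat.Properties as ℕ
 open import Data.Nat.DivMod using (m/n*n≤m; m*n/n≡m; n/n≡1; /-monoˡ-≤)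
 import Data.Nat.Solver as ℕS
 open import Data.Product.Base using (∃; _×_; _,_)
 open import Data.Rational.Base
 import Data.Rational.Properties as ℚ
 open import Data.Rational.Solver using (module +-*-Solver)
 import Data.Vec.Base as Vec
 import Data.Vec.Relation.Unary.Linked as VLinked
 open import Relation.Binary.PropositionalEquality using (_≡_; refl; sym; trans; cong)
 open import Relation.Nullary using (does; Dec; yes; no)
 open import Defs using (Graph; adj; Adj; α; δ; _∪_; pancyclic?; HasCycle; degree; module ℚLemmas)
 open ℚLemmas
 open import Data.List.Relation.Unary.All as All using ()
 open import Data.List.Relation.Unary.AllPairs as AllPairs using ()
 open import Data.List.Relation.Unary.Unique.Propositional using (Unique)
 open import Data.List.Membership.Propositional.Properties using (∈-allFin)
 open Lists using (length-⊆)
 open PathSystems using (costs)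
 open Pieces using (pieces)
 open GraphSetup using (module GraphWalks; Setup; setup; waste)
 open GraphParameters
 open PancyclicCriterion
 open Expectation
 open RationalBounds
 open TreeProbability using (module TreeProb)
 open LogBounds using (2^*½^)
 open AasCriterion using (PQ)
 open Counting
 open +-*-Solver

 open ℕS.+-*-Solver using () renaming (solve to solveℕ; _:+_ to _⊕_; _:*_ to _⊗_; con to conℕ; _:=_ to _⊜_)

 -- A quotient that is at least 1 loses at most half by rounding.
 double : ∀ x y .{{_ : ℕ.NonZero y}} → y ℕ.≤ x → x ℕ.≤ 2 ℕ.* (x ℕ./ y ℕ.* y)
 double x y y≤x = begin
   x ≤⟨ ℕ.<⇒≤ (/-lower x y) ⟩
   y ℕ.+ x ℕ./ y ℕ.* y ≤⟨ ℕ.+-monoˡ-≤ (x ℕ./ y ℕ.* y) (ℕ.≤-trans (ℕ.≤-reflexive (sym (ℕ.*-identityˡ y))) (ℕ.*-monoˡ-≤ y (ℕ.≤-trans (ℕ.≤-reflexive (sym (n/n≡1 y))) (/-monoˡ-≤ y y≤x)))) ⟩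
   x ℕ./ y ℕ.* y ℕ.+ x ℕ./ y ℕ.* y ≡⟨ solveℕ 1 (λ z → z ⊕ z ⊜ conℕ 2 ⊗ z) refl (x ℕ./ y ℕ.* y) ⟩
   2 ℕ.* (x ℕ./ y ℕ.* y) ∎
   where open ℕ.≤-Reasoning

 product₀ : ∀ w m e s → 2 ℕ.* (2 ℕ.* (w ℕ.* s) ℕ.* (2 ℕ.* (2 ℕ.* (m ℕ.* e) ℕ.* s))) ≡ m ℕ.* (16 ℕ.* (s ℕ.* s) ℕ.* e) ℕ.* w
 product₀ = solveℕ 4 (λ w m e s → conℕ 2 ⊗ (conℕ 2 ⊗ (w ⊗ s) ⊗ (conℕ 2 ⊗ (conℕ 2 ⊗ (m ⊗ e) ⊗ s))) ⊜ m ⊗ (conℕ 16 ⊗ (s ⊗ s) ⊗ e) ⊗ w) refl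

 product₁ : ∀ w m e s → 2 ℕ.* (2 ℕ.* (2 ℕ.* (m ℕ.* e) ℕ.* s) ℕ.* (2 ℕ.* (w ℕ.* s))) ≡ m ℕ.* (16 ℕ.* (s ℕ.* s) ℕ.* e) ℕ.* w
 product₁ = solveℕ 4 (λ w m e s → conℕ 2 ⊗ (conℕ 2 ⊗ (conℕ 2 ⊗ (m ⊗ e) ⊗ s) ⊗ (conℕ 2 ⊗ (w ⊗ s))) ⊜ m ⊗ (conℕ 16 ⊗ (s ⊗ s) ⊗ e) ⊗ w) refl

 double½ : ∀ x u → x * u ≡ ½ * (ι 2 * x * u)
 double½ = solve 2 (λ x u → x :* u := con ½ :* (con (ι 2) :* x :* u)) refl

 bit-mono : ∀ {A B : Set} (x : Dec A) (y : Dec B) → (A → B) → bit (does x) ≤ bit (does y)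
 bit-mono (no _) y f = 0≤bit (does y)
 bit-mono (yes p) (yes _) f = ℚ.≤-refl
 bit-mono (yes p) (no n) f = ⊥-elim (n (f p))

 pancyclic-mono : ∀ {n} (G : Graph n) R R′ → R ⊑ᴳ R′ → bit (does (pancyclic? (G ∪ R))) ≤ bit (does (pancyclic? (G ∪ R′)))
 pancyclic-mono {n} G R R′ s = bit-mono (pancyclic? (G ∪ R)) (pancyclic? (G ∪ R′)) λ pc ℓ 3≤ ℓ≤ → cyc (pc ℓ 3≤ ℓ≤)
   where
   sub : ∀ {x y} → Adj (G ∪ R) x y → Adj (G ∪ R′) x y
   sub {x} {y} t with adj G x y
   ... | true = t
   ... | false = s x y t
   cyc : ∀ {ℓ} → HasCycle (G ∪ R) ℓ → HasCycle (G ∪ R′) ℓ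
   cyc (3≤ , Vec.[] , ())
   cyc (3≤ , v Vec.∷ vs , u , l) = 3≤ , v Vec.∷ vs , u , linked l
     where
     linked : ∀ {m} {xs : Vec.Vec (Fin n) m} → VLinked.Linked (Adj (G ∪ R)) xs → VLinked.Linked (Adj (G ∪ R′)) xs
     linked VLinked.[] = VLinked.[]
     linked VLinked.[-] = VLinked.[-]
     linked (p VLinked.∷ ps) = sub p VLinked.∷ linked ps

 module Fixed {n : ℕ} (G : Graph n) (a d us ℓ C κ Q : ℕ) (S : Setup G a us d) (ind : ∀ zs → GraphWalks.Indep G zs → length zs ℕ.≤ a)
     (1≤n : 1 ℕ.≤ n) (d≤n : d ℕ.≤ n) (a≤n : a ℕ.≤ n) (20≤ℓ : 20 ℕ.≤ ℓ) (n< : n ℕ.< 2 ℕ.^ suc ℓ)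
     (W≤ : waste G a us ℕ.≤ 18 ℕ.* Q) (Q-pos : 20 ℕ.≤ Q) (ℓ≤Q : ℓ ℕ.≤ Q) (a≤Q : a ℕ.≤ Q) (rest≤ : suc (suc a) ℕ.+ (4 ℕ.* a ℕ.+ 4) ℕ.≤ Q)
     (us≥ : tokens a ℕ.+ costs a (tokens a) ℕ.+ costs a (tokens a) ℕ.< us)
     (large : C ℕ.* Q ℕ.≤ d) (80≤C : 80 ℕ.≤ C) (8κ≤C : 8 ℕ.* κ ℕ.≤ C) (κ≡ : 16 ℕ.* (16 ℕ.* 16) ≡ κ) where

   small : ∀ m {x} → x ℕ.≤ m ℕ.* Q → m ℕ.≤ 80 → x ℕ.≤ d
   small m le m≤ = ℕ.≤-trans le (ℕ.≤-trans (ℕ.*-monoˡ-≤ Q (ℕ.≤-trans m≤ 80≤C)) large)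

   19Q : ℕ
   19Q = 19 ℕ.* Q

   module Se = Setup S
   module Pa = Parts G a us d S
   module TP = TreeProb G a us d S

   -- The divisor 16 leaves room for the quartering and for the wasted vertices. The choice of `e`
   -- makes β = 2^-e smaller than n^-2, and `m₀` and `m₁` are the largest group sizes of which `e`
   -- fit into `ω` and `W₂`. The edge probability will be `K` / (n d).
   ω W₂ e m₀ m₁ K : ℕ
   ω = d ℕ./ 16
   W₂ = n ℕ./ 16
   e = 2 ℕ.* suc ℓ
   m₀ = ω ℕ./ e
   m₁ = W₂ ℕ./ e
   K = κ ℕ.* e

   2+W≤ : 2 ℕ.+ waste G a us ℕ.≤ 19Q
   2+W≤ = ℕ.+-mono-≤ (ℕ.≤-trans (s≤s (s≤s z≤n)) Q-pos) W≤

   ω≤ : ∀ {c} → c ∈ pieces Se.k → ω ℕ.≤ TP.w c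
   ω≤ {c} c∈ = ℕ.*-cancelˡ-≤ 4 (ℕ.+-cancelʳ-≤ 3 _ _ (ℕ.≤-trans lo (quarter-≥ G a us d S (Pa.avail c))))
     where
     lo : 4 ℕ.* ω ℕ.+ 3 ℕ.≤ length (Pa.avail c)
     lo = ℕ.+-cancelʳ-≤ 19Q _ _ (ℕ.≤-trans up (ℕ.≤-trans (avail-≥ G a us d S c∈) (ℕ.+-monoʳ-≤ (length (Pa.avail c)) 2+W≤)))
       where
       up : 4 ℕ.* ω ℕ.+ 3 ℕ.+ 19Q ℕ.≤ d
       up = ℕ.*-cancelˡ-≤ 4 (begin
         4 ℕ.* (4 ℕ.* ω ℕ.+ 3 ℕ.+ 19Q) ≡⟨ solveℕ 2 (λ w q → conℕ 4 ⊗ (conℕ 4 ⊗ w ⊕ conℕ 3 ⊕ q) ⊜ w ⊗ conℕ 16 ⊕ conℕ 4 ⊗ (conℕ 3 ⊕ q)) refl ω 19Q ⟩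
         ω ℕ.* 16 ℕ.+ 4 ℕ.* (3 ℕ.+ 19Q) ≤⟨ ℕ.+-mono-≤ (m/n*n≤m d 16) (ℕ.*-monoʳ-≤ 4 (ℕ.+-monoˡ-≤ 19Q (ℕ.≤-trans (s≤s (s≤s (s≤s z≤n))) Q-pos))) ⟩
         d ℕ.+ 4 ℕ.* (20 ℕ.* Q) ≤⟨ ℕ.+-monoʳ-≤ d (ℕ.≤-trans (ℕ.≤-reflexive (sym (ℕ.*-assoc 4 20 Q))) (small 80 ℕ.≤-refl ℕ.≤-refl)) ⟩
         d ℕ.+ d ≤⟨ ℕ.m≤m+n (d ℕ.+ d) (d ℕ.+ d) ⟩
         (d ℕ.+ d) ℕ.+ (d ℕ.+ d) ≡⟨ solveℕ 1 (λ d → (d ⊕ d) ⊕ (d ⊕ d) ⊜ conℕ 4 ⊗ d) refl d ⟩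
         4 ℕ.* d ∎)
         where open ℕ.≤-Reasoning

   W₂≤ : W₂ ℕ.+ W₂ ℕ.≤ TP.wSum (pieces Se.k)
   W₂≤ = ℕ.*-cancelˡ-≤ 4 (ℕ.+-cancelʳ-≤ R _ _ (ℕ.≤-trans up (wSum-≥ G a us d S)))
     where
     R : ℕ
     R = 3 ℕ.* a ℕ.+ (2 ℕ.+ waste G a us)
     R≤ : 2 ℕ.* R ℕ.≤ d
     R≤ = small 44 (ℕ.≤-trans (ℕ.*-monoʳ-≤ 2 (ℕ.+-mono-≤ (ℕ.*-monoʳ-≤ 3 a≤Q) 2+W≤))
       (ℕ.≤-reflexive (solveℕ 1 (λ q → conℕ 2 ⊗ (conℕ 3 ⊗ q ⊕ conℕ 19 ⊗ q) ⊜ conℕ 44 ⊗ q) refl Q))) (ℕ.m≤m+n 44 36)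
     up : 4 ℕ.* (W₂ ℕ.+ W₂) ℕ.+ R ℕ.≤ n
     up = ℕ.*-cancelˡ-≤ 2 (begin
       2 ℕ.* (4 ℕ.* (W₂ ℕ.+ W₂) ℕ.+ R) ≡⟨ solveℕ 2 (λ w r → conℕ 2 ⊗ (conℕ 4 ⊗ (w ⊕ w) ⊕ r) ⊜ w ⊗ conℕ 16 ⊕ conℕ 2 ⊗ r) refl W₂ R ⟩
       W₂ ℕ.* 16 ℕ.+ 2 ℕ.* R ≤⟨ ℕ.+-mono-≤ (m/n*n≤m n 16) (ℕ.≤-trans R≤ d≤n) ⟩
       n ℕ.+ n ≡⟨ solveℕ 1 (λ n → n ⊕ n ⊜ conℕ 2 ⊗ n) refl n ⟩
       2 ℕ.* n ∎)
       where open ℕ.≤-Reasoning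

   e≤4ℓ : e ℕ.≤ 4 ℕ.* ℓ
   e≤4ℓ = ℕ.≤-trans (ℕ.*-monoʳ-≤ 2 (ℕ.+-monoˡ-≤ ℓ (ℕ.≤-trans (s≤s z≤n) 20≤ℓ))) (ℕ.≤-reflexive (solveℕ 1 (λ l → conℕ 2 ⊗ (l ⊕ l) ⊜ conℕ 4 ⊗ l) refl ℓ))

   e≤4Q : e ℕ.≤ 4 ℕ.* Q
   e≤4Q = ℕ.≤-trans e≤4ℓ (ℕ.*-monoʳ-≤ 4 ℓ≤Q)

   16≤d : 16 ℕ.≤ d
   16≤d = small 1 (ℕ.≤-trans (ℕ.≤-trans (ℕ.m≤m+n 16 4) Q-pos) (ℕ.≤-reflexive (sym (ℕ.*-identityˡ Q)))) (ℕ.m≤m+n 1 79)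

   e≤/16 : ∀ {x} → d ℕ.≤ x → e ℕ.≤ x ℕ./ 16
   e≤/16 {x} d≤x = ℕ.≤-trans (ℕ.≤-reflexive (sym (m*n/n≡m e 16))) (/-monoˡ-≤ 16 (ℕ.≤-trans (small 64 (ℕ.≤-trans (ℕ.*-monoˡ-≤ 16 e≤4Q) (ℕ.≤-reflexive (solveℕ 1 (λ q → conℕ 4 ⊗ q ⊗ conℕ 16 ⊜ conℕ 64 ⊗ q) refl Q))) (ℕ.m≤m+n 64 16)) d≤x))

   -- The origin of κ: each rounded quotient loses at most a factor 2, so n ≤ 32 W₂ and d ≤ 64 e m₀,
   -- and 2 · 32 · 64 = 16³.
   prod₀ : 2 ℕ.* (n ℕ.* d) ℕ.≤ m₀ ℕ.* K ℕ.* W₂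
   prod₀ = begin
     2 ℕ.* (n ℕ.* d) ≤⟨ ℕ.*-monoʳ-≤ 2 (ℕ.*-mono-≤ (double n 16 (ℕ.≤-trans 16≤d d≤n)) (ℕ.≤-trans (double d 16 16≤d) (ℕ.*-monoʳ-≤ 2 (ℕ.*-monoˡ-≤ 16 (double ω e (e≤/16 ℕ.≤-refl)))))) ⟩
     2 ℕ.* (2 ℕ.* (W₂ ℕ.* 16) ℕ.* (2 ℕ.* (2 ℕ.* (m₀ ℕ.* e) ℕ.* 16))) ≡⟨ trans (product₀ W₂ m₀ e 16) (cong (λ k → m₀ ℕ.* (k ℕ.* e) ℕ.* W₂) κ≡) ⟩
     m₀ ℕ.* K ℕ.* W₂ ∎
     where open ℕ.≤-Reasoning

   prod₁ : 2 ℕ.* (n ℕ.* d) ℕ.≤ m₁ ℕ.* K ℕ.* ω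
   prod₁ = begin
     2 ℕ.* (n ℕ.* d) ≤⟨ ℕ.*-monoʳ-≤ 2 (ℕ.*-mono-≤ (ℕ.≤-trans (double n 16 (ℕ.≤-trans 16≤d d≤n)) (ℕ.*-monoʳ-≤ 2 (ℕ.*-monoˡ-≤ 16 (double W₂ e (e≤/16 d≤n))))) (double d 16 16≤d)) ⟩
     2 ℕ.* (2 ℕ.* (2 ℕ.* (m₁ ℕ.* e) ℕ.* 16) ℕ.* (2 ℕ.* (ω ℕ.* 16))) ≡⟨ trans (product₁ ω m₁ e 16) (cong (λ k → m₁ ℕ.* (k ℕ.* e) ℕ.* ω) κ≡) ⟩
     m₁ ℕ.* K ℕ.* ω ∎
     where open ℕ.≤-Reasoning

   -- Here C must be large compared with κ. The result is q₀ n ≤ ½, the smallness required by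
   -- `stuck-bound`.
   2K≤d : 2 ℕ.* K ℕ.≤ d
   2K≤d = begin
     2 ℕ.* (κ ℕ.* e) ≤⟨ ℕ.*-monoʳ-≤ 2 (ℕ.*-monoʳ-≤ κ e≤4Q) ⟩
     2 ℕ.* (κ ℕ.* (4 ℕ.* Q)) ≡⟨ solveℕ 2 (λ k q → conℕ 2 ⊗ (k ⊗ (conℕ 4 ⊗ q)) ⊜ conℕ 8 ⊗ k ⊗ q) refl κ Q ⟩
     8 ℕ.* κ ℕ.* Q ≤⟨ ℕ.*-monoˡ-≤ Q 8κ≤C ⟩
     C ℕ.* Q ≤⟨ large ⟩
     d ∎
     where open ℕ.≤-Reasoning

   module _ (μ : ℚ) (0≤μ : 0ℚ ≤ μ) (nd : ι (n ℕ.* d) * μ ≡ 1ℚ) where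

     q₀ : ℚ
     q₀ = ι K * μ

     0≤q₀ : 0ℚ ≤ q₀
     0≤q₀ = *-nonneg (0≤fromℕ K) 0≤μ

     scale : ∀ x → x ℕ.≤ n ℕ.* d → ι x * μ ≤ 1ℚ
     scale x le = ℚ.≤-trans (*-monoʳ μ 0≤μ (fromℕ-mono le)) (ℚ.≤-reflexive nd)

     scale½ : ∀ x → 2 ℕ.* x ℕ.≤ n ℕ.* d → ι x * μ ≤ ½
     scale½ x le = ℚ.≤-trans (ℚ.≤-reflexive (trans (double½ (ι x) μ) (cong (λ z → ½ * (z * μ)) (sym (ι-* 2 x)))))
       (ℚ.≤-trans (*-monoˡ ½ 0≤½ (scale (2 ℕ.* x) le)) (ℚ.≤-reflexive (ℚ.*-identityʳ ½)))

     q₀≤1 : q₀ ≤ 1ℚ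
     q₀≤1 = scale K (ℕ.≤-trans (ℕ.≤-trans (ℕ.m≤m+n K (K ℕ.+ 0)) 2K≤d) (ℕ.≤-trans (ℕ.≤-reflexive (sym (ℕ.*-identityˡ d))) (ℕ.*-monoˡ-≤ d 1≤n)))

     hits : ∀ m w → 2 ℕ.* (n ℕ.* d) ℕ.≤ m ℕ.* K ℕ.* w → 1ℚ ≤ ι m * (½ * (q₀ * ι w))
     hits m w le = begin
       1ℚ ≡⟨ sym nd ⟩
       ι (n ℕ.* d) * μ ≡⟨ trans (double½ (ι (n ℕ.* d)) μ) (cong (λ z → ½ * (z * μ)) (sym (ι-* 2 (n ℕ.* d)))) ⟩
       ½ * (ι (2 ℕ.* (n ℕ.* d)) * μ) ≤⟨ *-monoˡ ½ 0≤½ (*-monoʳ μ 0≤μ (fromℕ-mono le)) ⟩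
       ½ * (ι (m ℕ.* K ℕ.* w) * μ) ≡⟨ cong (λ z → ½ * (z * μ)) (trans (ι-* (m ℕ.* K) w) (cong (_* ι w) (ι-* m K))) ⟩
       ½ * (ι m * ι K * ι w * μ) ≡⟨ solve 4 (λ m k w u → con ½ :* (m :* k :* w :* u) := m :* (con ½ :* (k :* u :* w))) refl (ι m) (ι K) (ι w) μ ⟩
       ι m * (½ * (q₀ * ι w)) ∎
       where open ℚ.≤-Reasoning

     qn : q₀ * ι n ≤ ½
     qn = ℚ.≤-trans (ℚ.≤-reflexive (trans (solve 3 (λ k u n → k :* u :* n := k :* n :* u) refl (ι K) μ (ι n)) (cong (_* μ) (sym (ι-* K n)))))
       (scale½ (K ℕ.* n) (ℕ.≤-trans (ℕ.≤-reflexive (sym (ℕ.*-assoc 2 K n))) (ℕ.≤-trans (ℕ.*-monoˡ-≤ n 2K≤d) (ℕ.≤-reflexive (ℕ.*-comm d n)))))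

     β≡ : ½^ e ≡ ½^ (suc ℓ) * ½^ (suc ℓ)
     β≡ = trans (sym (pow-½ e)) (trans (pow-* ½ 2 (suc ℓ)) (trans (cong (λ z → z * (z * 1ℚ)) (pow-½ (suc ℓ))) (cong (½^ (suc ℓ) *_) (ℚ.*-identityʳ (½^ (suc ℓ))))))

     -- Since k ≤ n < 2^(ℓ+1), one of the two factors 2^-(ℓ+1) of β cancels k and the other remains
     -- as the error.
     kβ≤ : ι Se.k * ½^ e ≤ ½^ (suc ℓ)
     kβ≤ = begin
       ι Se.k * ½^ e ≡⟨ trans (cong (ι Se.k *_) β≡) (sym (ℚ.*-assoc (ι Se.k) (½^ (suc ℓ)) (½^ (suc ℓ)))) ⟩
       ι Se.k * ½^ (suc ℓ) * ½^ (suc ℓ) ≤⟨ *-monoʳ (½^ (suc ℓ)) (½^-nonneg (suc ℓ)) (*-monoʳ (½^ (suc ℓ)) (½^-nonneg (suc ℓ)) (fromℕ-mono (ℕ.≤-trans Se.k≤a (ℕ.≤-trans a≤n (ℕ.<⇒≤ n<))))) ⟩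
       ι (2 ℕ.^ suc ℓ) * ½^ (suc ℓ) * ½^ (suc ℓ) ≡⟨ trans (cong (_* ½^ (suc ℓ)) (2^*½^ (suc ℓ))) (ℚ.*-identityˡ (½^ (suc ℓ))) ⟩
       ½^ (suc ℓ) ∎
       where open ℚ.≤-Reasoning

     ½^suc≤½ : ∀ m → ½^ (suc m) ≤ ½
     ½^suc≤½ m = ℚ.≤-trans (*-monoˡ ½ 0≤½ (½^≤1 m)) (ℚ.≤-reflexive (ℚ.*-identityʳ ½))

     likely₀ : 1ℚ ≤ PQ (λ R → pancyclic? (G ∪ R)) q₀ + ι 8 * ½^ (suc ℓ)
     likely₀ = ℚ.≤-trans (TP.pancyclic-likely ω ω≤ q₀ 0≤q₀ q₀≤1 W₂ e m₀ m₁ W₂≤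
         (ℕ.≤-trans (ℕ.≤-reflexive (ℕ.*-comm e m₀)) (m/n*n≤m ω e)) (ℕ.≤-trans (ℕ.≤-reflexive (ℕ.*-comm e m₁)) (m/n*n≤m W₂ e))
         (hits m₀ W₂ prod₀) (hits m₁ ω prod₁) qn ind us≥ (small 19 (ℕ.+-mono-≤ rest≤ W≤) (ℕ.m≤m+n 19 61)) (ℚ.≤-trans kβ≤ (½^suc≤½ ℓ)))
       (ℚ.+-monoʳ-≤ (PQ (λ R → pancyclic? (G ∪ R)) q₀) (*-monoˡ (ι 8) (0≤fromℕ 8) kβ≤))

     -- The direct estimate relies on q n ≤ ½ and is made at q₀. Larger q follow because added edges
     -- preserve pancyclicity.
     likelyQ : ∀ q → q ≤ 1ℚ → q₀ ≤ q → 1ℚ ≤ PQ (λ R → pancyclic? (G ∪ R)) q + ι 8 * ½^ (suc ℓ)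
     likelyQ q q≤1 q₀≤q = ℚ.≤-trans likely₀ (ℚ.+-monoˡ-≤ (ι 8 * ½^ (suc ℓ)) (EG-couple 0≤q₀ q₀≤q q≤1 n (pancyclic-mono G)))

 α≤n : ∀ {n} (G : Graph n) → α G ℕ.≤ n
 α≤n {n} G = α-≤ G n λ zs i → ℕ.≤-trans (length-⊆ (AllPairs.map (λ nc e → nc (inj₁ e)) i) (λ _ → ∈-allFin _)) (ℕ.≤-reflexive (List.length-tabulate {n = n} (λ x → x)))
   where
   open import Data.Sum.Base using (inj₁)
   import Data.List.Properties as List

 δ≤n : ∀ {n} (G : Graph n) → δ G ℕ.≤ n
 δ≤n {n} G = min≤⊤ n (List.map (degree G) (List.allFin n))

 nonempty : ∀ {n} → 1 ℕ.≤ n → Fin n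
 nonempty (s≤s z≤n) = Fin.zero

 1≤α : ∀ {n} (G : Graph n) → 1 ℕ.≤ n → 1 ℕ.≤ α G
 1≤α G 1≤n = indep-≤α G (nonempty 1≤n List.∷ List.[]) (All.[] AllPairs.∷ AllPairs.[])

 likely : ∀ {n} (G : Graph n) ℓ C κ → 1 ℕ.≤ n → 20 ℕ.≤ ℓ → n ℕ.< 2 ℕ.^ suc ℓ →
   C ℕ.* (α G ℕ.* α G ℕ.* ℓ) ℕ.≤ δ G → 80 ℕ.≤ C → 8 ℕ.* κ ℕ.≤ C → 16 ℕ.* (16 ℕ.* 16) ≡ κ →
   ∀ μ → 0ℚ ≤ μ → ι (n ℕ.* δ G) * μ ≡ 1ℚ →
   ι (κ ℕ.* (2 ℕ.* suc ℓ)) * μ ≤ 1ℚ × (∀ q → q ≤ 1ℚ → ι (κ ℕ.* (2 ℕ.* suc ℓ)) * μ ≤ q → 1ℚ ≤ PQ (λ R → pancyclic? (G ∪ R)) q + ι 8 * ½^ (suc ℓ))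
 likely {n} G ℓ C κ 1≤n 20≤ℓ n< large 80≤C 8κ≤C κ≡ = go (α G) (δ G) (α≤n G) (δ≤n G) (1≤α G 1≤n) (indep-≤α G) (neighbours G) large
   where
   go : ∀ a d → a ℕ.≤ n → d ℕ.≤ n → 1 ℕ.≤ a → (∀ zs → GraphWalks.Indep G zs → length zs ℕ.≤ a) →
     (∀ v → ∃ λ N → Unique N × (∀ {u} → u ∈ N → Adj G v u) × d ℕ.≤ length N) → C ℕ.* (a ℕ.* a ℕ.* ℓ) ℕ.≤ d →
     ∀ μ → 0ℚ ≤ μ → ι (n ℕ.* d) * μ ≡ 1ℚ →
     ι (κ ℕ.* (2 ℕ.* suc ℓ)) * μ ≤ 1ℚ × (∀ q → q ≤ 1ℚ → ι (κ ℕ.* (2 ℕ.* suc ℓ)) * μ ≤ q → 1ℚ ≤ PQ (λ R → pancyclic? (G ∪ R)) q + ι 8 * ½^ (suc ℓ))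
   go a d a≤n d≤n 1≤a ind deg large μ 0≤μ nd = run (usage a) N.Q S₀ N.waste≤ N.Q-pos N.ℓ≤Q a≤Q N.rest′≤ ℕ.≤-refl large
     where
     module N = Numbers a ℓ n 1≤a 20≤ℓ a≤n n<
     a≤Q : a ℕ.≤ N.Q
     a≤Q = ℕ.≤-trans N.a≤a² (ℕ.≤-trans (ℕ.≤-trans (ℕ.≤-reflexive (sym (ℕ.*-identityʳ (a ℕ.* a)))) (ℕ.*-monoʳ-≤ (a ℕ.* a) (s≤s z≤n))) N.20a²≤Q)
     S₀ : Setup G a (usage a) d
     S₀ = setup G a (usage a) ind d deg (ℕ.≤-trans (ℕ.+-mono-≤ N.rest≤ N.waste≤) (ℕ.≤-trans (ℕ.*-monoˡ-≤ N.Q (ℕ.≤-trans (ℕ.m≤m+n 19 61) 80≤C)) large)) (nonempty 1≤n)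
     run : ∀ us Q → Setup G a us d → waste G a us ℕ.≤ 18 ℕ.* Q → 20 ℕ.≤ Q → ℓ ℕ.≤ Q → a ℕ.≤ Q → suc (suc a) ℕ.+ (4 ℕ.* a ℕ.+ 4) ℕ.≤ Q →
       tokens a ℕ.+ costs a (tokens a) ℕ.+ costs a (tokens a) ℕ.< us → C ℕ.* Q ℕ.≤ d →
       ι (κ ℕ.* (2 ℕ.* suc ℓ)) * μ ≤ 1ℚ × (∀ q → q ≤ 1ℚ → ι (κ ℕ.* (2 ℕ.* suc ℓ)) * μ ≤ q → 1ℚ ≤ PQ (λ R → pancyclic? (G ∪ R)) q + ι 8 * ½^ (suc ℓ))
     run us Q S W≤ Q-pos ℓ≤Q a≤Q rest≤ us≥ large =
       Fixed.q₀≤1 G a d us ℓ C κ Q S ind 1≤n d≤n a≤n 20≤ℓ n< W≤ Q-pos ℓ≤Q a≤Q rest≤ us≥ large 80≤C 8κ≤C κ≡ μ 0≤μ nd ,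
       Fixed.likelyQ G a d us ℓ C κ Q S ind 1≤n d≤n a≤n 20≤ℓ n< W≤ Q-pos ℓ≤Q a≤Q rest≤ us≥ large 80≤C 8κ≤C κ≡ μ 0≤μ nd

-- Asymptotics of (a).

module PancyclicAas where

 import Data.Integer.Base as ℤ
 import Data.Integer.Properties as ℤ
 open import Data.Nat.Base as ℕ using (ℕ; suc; s≤s; z≤n)
 import Data.Nat.Properties as ℕ
 import Data.Nat.Solver as ℕS
 open import Data.Product.Base using (∃; _×_; _,_; proj₁; proj₂)
 open import Data.Rational.Base
 import Data.Rational.Properties as ℚ
 open import Data.Rational.Solver using (module +-*-Solver)
 import Data.Rational.Unnormalised.Base as ℚᵘ
 import Data.Rational.Unnormalised.Properties as ℚᵘ
 open import Function.Base using (id)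
 open import Relation.Binary.PropositionalEquality using (_≡_; refl; sym; trans; cong)
 open import Relation.Nullary using (yes; no; contradiction)
 import Defs
 open import Defs using (Eventually; Graph; α; δ; _∪_; pancyclic?; ℝ; seq; fromℕ; log; IsProbability; Aas; module ℚLemmas; module LogCauchy)
 open ℚLemmas
 open LogCauchy using (L; trunc)
 open RationalBounds
 open LogBounds
 open AasCriterion
 open Counting using (log₂)
 open PancyclicLikely using (likely; 1≤α)
 open +-*-Solver

 log-≥ : ∀ (x : ℝ) m M → ι (2 ℕ.^ suc M) ≤ seq x m → ½ * ι M ≤ seq (log x) m
 log-≥ x m M le = log-lower (trunc (seq x m)) (ℚ.p≤q⊔p (seq x m - 1ℚ) 0ℚ) M (ℚ.≤-trans le (over (seq x m))) m
   where
   over : ∀ y → y ≤ 1ℚ + trunc y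
   over y = ℚ.≤-trans (ℚ.≤-reflexive (solve 1 (λ y → y := con 1ℚ :+ (y :- con 1ℚ)) refl y)) (ℚ.+-monoʳ-≤ 1ℚ (ℚ.p≤p⊔q (y - 1ℚ) 0ℚ))

 reciprocal : ∀ N → ι (suc N) * (ℤ.+ 1 / suc N) ≡ 1ℚ
 reciprocal N = ℚ.toℚᵘ-injective (ℚᵘ.≃-trans (ℚ.toℚᵘ-homo-* (ι (suc N)) (ℤ.+ 1 / suc N))
   (ℚᵘ.≃-trans (ℚᵘ.*-cong (ℚ.toℚᵘ-fromℚᵘ (ℚᵘ.mkℚᵘ (ℤ.+ suc N) 0)) (ℚ.toℚᵘ-fromℚᵘ (ℚᵘ.mkℚᵘ (ℤ.+ 1) N))) (ℚᵘ.*≡* eq)))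
   where
   eq : (ℤ.+ suc N ℤ.* ℤ.+ 1) ℤ.* ℤ.+ 1 ≡ ℤ.+ 1 ℤ.* ℤ.+ (1 ℕ.* suc N)
   eq = trans (ℤ.*-identityʳ (ℤ.+ suc N ℤ.* ℤ.+ 1)) (trans (ℤ.*-comm (ℤ.+ suc N) (ℤ.+ 1)) (cong (λ z → ℤ.+ 1 ℤ.* ℤ.+ z) (sym (ℕ.*-identityˡ (suc N)))))

 exponent-≥ : ∀ {L n ℓ} → 2 ℕ.^ L ℕ.≤ n → n ℕ.< 2 ℕ.^ suc ℓ → L ℕ.≤ ℓ
 exponent-≥ {L} {n} {ℓ} lo hi with L ℕ.≤? ℓ
 ... | yes le = le
 ... | no nle = contradiction (ℕ.<-≤-trans hi (ℕ.≤-trans (ℕ.^-monoʳ-≤ 2 (ℕ.≰⇒> nle)) lo)) (ℕ.<-irrefl refl)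

 -- The hypothesis on δ(G), with the logarithm replaced by its lower bound M/2.
 density : ∀ C a d M y → ½ * ι M ≤ y → ι (4 ℕ.* C) * ((ι a * y) * ((ι a * y) * 1ℚ)) ≤ ι d → C ℕ.* (a ℕ.* M ℕ.* (a ℕ.* M)) ℕ.≤ d
 density C a d M y le h = ι-cancel (begin
   ι (C ℕ.* (a ℕ.* M ℕ.* (a ℕ.* M))) ≡⟨ trans (ι-* C (a ℕ.* M ℕ.* (a ℕ.* M))) (cong (ι C *_) (trans (ι-* (a ℕ.* M) (a ℕ.* M)) (cong (λ z → z * z) (ι-* a M)))) ⟩
   ι C * (ι a * ι M * (ι a * ι M)) ≡⟨ solve 3 (λ c a m → c :* (a :* m :* (a :* m)) := con (ι 4) :* c :* ((a :* (con ½ :* m)) :* ((a :* (con ½ :* m)) :* con 1ℚ))) refl (ι C) (ι a) (ι M) ⟩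
   ι 4 * ι C * (z * (z * 1ℚ)) ≡⟨ cong (_* (z * (z * 1ℚ))) (sym (ι-* 4 C)) ⟩
   ι (4 ℕ.* C) * (z * (z * 1ℚ)) ≤⟨ *-monoˡ (ι (4 ℕ.* C)) (0≤fromℕ (4 ℕ.* C)) (*-mono {z} {ι a * y} {z * 1ℚ} {(ι a * y) * 1ℚ} (*-nonneg 0≤z 0≤1) z≤ (ℚ.≤-trans 0≤z z≤) (*-monoʳ 1ℚ 0≤1 z≤)) ⟩
   ι (4 ℕ.* C) * ((ι a * y) * ((ι a * y) * 1ℚ)) ≤⟨ h ⟩
   ι d ∎)
   where
   open ℚ.≤-Reasoning
   z = ι a * (½ * ι M)
   0≤z : 0ℚ ≤ z
   0≤z = *-nonneg (0≤fromℕ a) (*-nonneg 0≤½ (0≤fromℕ M))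
   z≤ : z ≤ ι a * y
   z≤ = *-monoˡ (ι a) (0≤fromℕ a) le

 square-≥ : ∀ C a M → 2 ℕ.≤ M → C ℕ.* (a ℕ.* a ℕ.* suc M) ℕ.≤ C ℕ.* (a ℕ.* M ℕ.* (a ℕ.* M))
 square-≥ C a M 2≤M = ℕ.*-monoʳ-≤ C (begin
   a ℕ.* a ℕ.* suc M ≤⟨ ℕ.*-monoʳ-≤ (a ℕ.* a) (ℕ.≤-trans (ℕ.+-monoˡ-≤ M (ℕ.≤-trans (s≤s z≤n) 2≤M)) (ℕ.≤-trans (ℕ.≤-reflexive (cong (M ℕ.+_) (sym (ℕ.+-identityʳ M)))) (ℕ.*-monoˡ-≤ M 2≤M))) ⟩
   a ℕ.* a ℕ.* (M ℕ.* M) ≡⟨ ℕS.+-*-Solver.solve 2 (λ a m → a ⊗ a ⊗ (m ⊗ m) ⊜ a ⊗ m ⊗ (a ⊗ m)) refl a M ⟩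
   a ℕ.* M ℕ.* (a ℕ.* M) ∎)
   where
   open ℕ.≤-Reasoning
   open ℕS.+-*-Solver using () renaming (_:*_ to _⊗_; _:=_ to _⊜_)

 -- Twice the edge probability needed by the pancyclicity argument is a lower bound of the one that is assumed.
 rate : ∀ κ M → 2 ℕ.≤ M → ∀ y z → ½ * ι M ≤ y → 1ℚ ≤ z → ι 2 * ι (κ ℕ.* (2 ℕ.* suc (suc M))) ≤ ι (16 ℕ.* κ) * y * z
 rate κ M 2≤M y z hy hz = begin
   ι 2 * ι (κ ℕ.* (2 ℕ.* suc (suc M))) ≤⟨ *-monoˡ (ι 2) (0≤fromℕ 2) (fromℕ-mono (ℕ.*-monoʳ-≤ κ (ℕ.*-monoʳ-≤ 2 (ℕ.+-monoˡ-≤ M 2≤M)))) ⟩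
   ι 2 * ι (κ ℕ.* (2 ℕ.* (M ℕ.+ M))) ≡⟨ trans (sym (ι-* 2 (κ ℕ.* (2 ℕ.* (M ℕ.+ M))))) (trans (cong ι (ℕS.+-*-Solver.solve 2 (λ k m → conℕ 2 ⊗ (k ⊗ (conℕ 2 ⊗ (m ⊕ m))) ⊜ conℕ 8 ⊗ k ⊗ m) refl κ M)) (trans (ι-* (8 ℕ.* κ) M) (cong (_* ι M) (ι-* 8 κ)))) ⟩
   ι 8 * ι κ * ι M ≡⟨ solve 2 (λ k m → con (ι 8) :* k :* m := con (ι 16) :* k :* (con ½ :* m) :* con 1ℚ) refl (ι κ) (ι M) ⟩
   ι 16 * ι κ * (½ * ι M) * 1ℚ ≡⟨ cong (λ w → w * (½ * ι M) * 1ℚ) (sym (ι-* 16 κ)) ⟩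
   ι (16 ℕ.* κ) * (½ * ι M) * 1ℚ ≤⟨ *-mono {ι (16 ℕ.* κ) * (½ * ι M)} {ι (16 ℕ.* κ) * y} {1ℚ} {z} 0≤1 le (ℚ.≤-trans (*-nonneg (0≤fromℕ (16 ℕ.* κ)) (*-nonneg 0≤½ (0≤fromℕ M))) le) hz ⟩
   ι (16 ℕ.* κ) * y * z ∎
   where
   open ℚ.≤-Reasoning
   open ℕS.+-*-Solver using () renaming (_:+_ to _⊕_; _:*_ to _⊗_; con to conℕ; _:=_ to _⊜_)
   le : ι (16 ℕ.* κ) * (½ * ι M) ≤ ι (16 ℕ.* κ) * y
   le = *-monoˡ (ι (16 ℕ.* κ)) (0≤fromℕ (16 ℕ.* κ)) hy

 -- From 8 = 2³ on, `log-≥` gives at least ½ · 2 = 1 for the iterated logarithm, which is the bound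
 -- on z in `rate`.
 iterated : ∀ a M y → 1 ℕ.≤ a → 16 ℕ.≤ M → ½ * ι M ≤ y → ι (2 ℕ.^ 3) ≤ ι a * y
 iterated a M y 1≤a 16≤M hy = ℚ.≤-trans (*-mono {1ℚ} {ι a} {½ * ι 16} {y} (0≤fromℕ 8) (fromℕ-mono 1≤a) (0≤fromℕ a) (ℚ.≤-trans (*-monoˡ ½ 0≤½ (fromℕ-mono 16≤M)) hy)) ℚ.≤-refl

 clamp-≥ : ∀ {x q} → x ≤ 1ℚ → x ≤ q → x ≤ clamp q
 clamp-≥ {x} {q} x≤1 x≤q = ℚ.⊓-glb (ℚ.≤-trans x≤q (ℚ.p≤p⊔q q 0ℚ)) x≤1

 -- The hypothesis on p is an inequality of reals, which holds for approximations up to an arbitrary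
 -- positive error. With the error K μ and twice the required probability on the left, an exact
 -- bound is left.
 halve-bound : ∀ K μ X p → 0ℚ ≤ μ → ι 2 * K ≤ X → X * μ ≤ p + K * μ → K * μ ≤ p
 halve-bound K μ X p 0≤μ h le = ℚ.≤-trans (≤-move {K * μ} {K * μ} {p + K * μ} (ℚ.≤-trans (ℚ.≤-reflexive (solve 2 (λ k u → k :* u :+ k :* u := con (ι 2) :* k :* u) refl K μ)) (ℚ.≤-trans (*-monoʳ μ 0≤μ h) le)))
   (ℚ.≤-reflexive (solve 2 (λ p x → p :+ x :- x := p) refl p (K * μ)))

 module PartA (C κ : ℕ) (80≤C : 80 ℕ.≤ C) (8κ≤C : 8 ℕ.* κ ℕ.≤ C) (κ≡ : 16 ℕ.* (16 ℕ.* 16) ≡ κ) (1≤κ : 1 ℕ.≤ κ) where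

   -- The factor 4 makes up for the square of log n ≥ M/2. The factor 16 comes from 2 (M + 2) ≤ 4M,
   -- from log n ≥ M/2 again, and from the doubling in `halve-bound`.
   c₁ c₂ : ℝ
   c₁ = fromℕ (4 ℕ.* C)
   c₂ = fromℕ (16 ℕ.* κ)

   module _ {n : ℕ} (G : Graph n) (p : ℝ) where

     Dense Frequent : Set
     Dense = c₁ Defs.* (fromℕ (α G) Defs.* log (fromℕ n)) Defs.^ 2 Defs.< fromℕ (δ G)
     Frequent = (c₂ Defs.* log (fromℕ n) Defs.* log (fromℕ (α G) Defs.* log (fromℕ n))) Defs./ (n ℕ.* δ G) Defs.≤ p

     -- The integer part of the binary logarithm of n is written M + 1, since `log-≥` then bounds
     -- log n from below by M/2.
     module _ (M : ℕ) (19≤M : 19 ℕ.≤ M) (lo : 2 ℕ.^ suc M ℕ.≤ n) (hi : n ℕ.< 2 ℕ.^ suc (suc M)) (dense : Dense) where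

       2≤M : 2 ℕ.≤ M
       2≤M = ℕ.≤-trans (s≤s (s≤s z≤n)) 19≤M

       log-n : ∀ m → ½ * ι M ≤ seq (log (fromℕ n)) m
       log-n m = log-≥ (fromℕ n) m M (fromℕ-mono lo)

       large : C ℕ.* (α G ℕ.* α G ℕ.* suc M) ℕ.≤ δ G
       large = large′ dense
         where
         large′ : Dense → C ℕ.* (α G ℕ.* α G ℕ.* suc M) ℕ.≤ δ G
         large′ (ε , 0<ε , N , h) = ℕ.≤-trans (square-≥ C (α G) M 2≤M)
           (density C (α G) (δ G) M (seq (log (fromℕ n)) N) (log-n N) (ℚ.≤-trans (x≤x+ _ ε (ℚ.<⇒≤ 0<ε)) (h N ℕ.≤-refl)))

       1≤n : 1 ℕ.≤ n
       1≤n = ℕ.≤-trans (ℕ.m^n>0 2 (suc M)) lo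

       1≤δ : 1 ℕ.≤ δ G
       1≤δ = ℕ.≤-trans (ℕ.*-mono-≤ {1} {C} (ℕ.≤-trans (s≤s z≤n) 80≤C) (ℕ.*-mono-≤ {1} (ℕ.*-mono-≤ {1} (1≤α G 1≤n) (1≤α G 1≤n)) (s≤s z≤n))) large

       module _ (N : ℕ) (nδ : n ℕ.* δ G ≡ suc N)
         (frequent : (c₂ Defs.* log (fromℕ n) Defs.* log (fromℕ (α G) Defs.* log (fromℕ n))) Defs./ suc N Defs.≤ p) where

         μ K : ℚ
         μ = ℤ.+ 1 / suc N
         K = ι (κ ℕ.* (2 ℕ.* suc (suc M)))

         0<K : 0ℚ < K
         0<K = ℚ.<-≤-trans 0<1 (fromℕ-mono {1} (ℕ.*-mono-≤ {1} 1≤κ (s≤s z≤n)))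

         0≤μ : 0ℚ ≤ μ
         0≤μ = ℚ.nonNegative⁻¹ μ {{ℚ.normalize-nonNeg 1 (suc N)}}

         0<μ : 0ℚ < μ
         0<μ = ℚ.positive⁻¹ μ {{ℚ.normalize-pos 1 (suc N)}}

         bounds : K * μ ≤ 1ℚ × (∀ q → q ≤ 1ℚ → K * μ ≤ q → 1ℚ ≤ PQ (λ R → pancyclic? (G ∪ R)) q + ι 8 * ½^ (suc (suc M)))
         bounds = likely G (suc M) C κ 1≤n (s≤s 19≤M) hi large 80≤C 8κ≤C κ≡ μ 0≤μ (trans (cong (λ z → ι z * μ) nδ) (reciprocal N))

         often : Eventually λ m → K * μ ≤ seq p m
         often = often′ (frequent (K * μ) (*-pos 0<K 0<μ))
           where
           y : ℕ → ℚ
           y = seq (log (fromℕ n))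
           often′ : (Eventually λ m → ι (16 ℕ.* κ) * y m * seq (log (fromℕ (α G) Defs.* log (fromℕ n))) m * μ ≤ seq p m + K * μ) → Eventually λ m → K * μ ≤ seq p m
           often′ (N , h) = N , λ m N≤m → halve-bound K μ _ (seq p m) 0≤μ
             (rate κ M 2≤M (y m) _ (log-n m) (log-≥ (fromℕ (α G) Defs.* log (fromℕ n)) m 2 (iterated (α G) M (y m) (1≤α G 1≤n) (ℕ.≤-trans (ℕ.m≤m+n 16 3) 19≤M) (log-n m))))
             (h m N≤m)

         result : ∀ ε → ι 8 * ½^ (suc (suc M)) ≤ ε → Likely p (λ R → pancyclic? (G ∪ R)) ε
         result ε le = K * μ , 1ℚ , (proj₁ often , λ m N≤m → clamp-≥ (proj₁ bounds) (proj₂ often m N≤m) , clamp≤1 (seq p m)) ,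
           λ q 0≤q q≤1 (lo , _) → ℚ.≤-trans (proj₂ bounds q q≤1 lo) (ℚ.+-monoʳ-≤ (PQ (λ R → pancyclic? (G ∪ R)) q) le)

     likely-n : ∀ L₀ → 20 ℕ.≤ L₀ → 2 ℕ.^ L₀ ℕ.≤ n → Dense → Frequent → ∀ ε → (∀ j → L₀ ℕ.≤ j → ½^ j * ι 8 ≤ ε) → Likely p (λ R → pancyclic? (G ∪ R)) ε
     likely-n L₀ 20≤L₀ big dense frequent ε small = from-log (log₂ n (ℕ.≤-trans (ℕ.m^n>0 2 L₀) big))
       where
       from-log : (∃ λ ℓ → 2 ℕ.^ ℓ ℕ.≤ n × n ℕ.< 2 ℕ.^ suc ℓ) → Likely p (λ R → pancyclic? (G ∪ R)) ε
       from-log (ℓ , lo , hi) = from-suc ℓ (ℕ.≤-trans 20≤L₀ (exponent-≥ big hi)) lo hi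
         where
         from-suc : ∀ ℓ → 20 ℕ.≤ ℓ → 2 ℕ.^ ℓ ℕ.≤ n → n ℕ.< 2 ℕ.^ suc ℓ → Likely p (λ R → pancyclic? (G ∪ R)) ε
         from-suc (suc M) (s≤s 19≤M) lo hi = from-pos (n ℕ.* δ G) refl frequent (ℕ.*-mono-≤ (1≤n M 19≤M lo hi dense) (1≤δ M 19≤M lo hi dense))
           where
           from-pos : ∀ N → n ℕ.* δ G ≡ N → (c₂ Defs.* log (fromℕ n) Defs.* log (fromℕ (α G) Defs.* log (fromℕ n))) Defs./ N Defs.≤ p →
             1 ℕ.≤ N → Likely p (λ R → pancyclic? (G ∪ R)) ε
           from-pos (suc N) eq fr _ = result M 19≤M lo hi dense N eq fr ε
             (ℚ.≤-trans (ℚ.≤-reflexive (ℚ.*-comm (ι 8) (½^ (suc (suc M))))) (small (suc (suc M)) (ℕ.m≤n⇒m≤1+n (exponent-≥ big hi))))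

   partA : (G : ∀ n → Graph n) (p : ℕ → ℝ) → (∀ n → IsProbability (p n)) →
     Eventually (λ n → Dense (G n) (p n)) → Eventually (λ n → Frequent (G n) (p n)) →
     Aas p (λ n R → pancyclic? (G n ∪ R))
   partA G p isP (N₁ , dense) (N₂ , frequent) = aas p isP (λ n R → pancyclic? (G n ∪ R)) λ ε 0<ε → eventually ε (½^-decay (ι 8) ε 0<ε)
     where
     eventually : ∀ ε → (∃ λ K → ∀ j → K ℕ.≤ j → ½^ j * ι 8 ≤ ε) → Eventually λ n → Likely (p n) (λ R → pancyclic? (G n ∪ R)) ε
     eventually ε (K , small) = 2 ℕ.^ (20 ℕ.+ K) ℕ.+ (N₁ ℕ.+ N₂) , λ n le →
       likely-n (G n) (p n) (20 ℕ.+ K) (ℕ.m≤m+n 20 K) (ℕ.≤-trans (ℕ.m≤m+n (2 ℕ.^ (20 ℕ.+ K)) (N₁ ℕ.+ N₂)) le)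
         (dense n (ℕ.≤-trans (ℕ.≤-trans (ℕ.m≤m+n N₁ N₂) (ℕ.m≤n+m (N₁ ℕ.+ N₂) (2 ℕ.^ (20 ℕ.+ K)))) le))
         (frequent n (ℕ.≤-trans (ℕ.≤-trans (ℕ.m≤n+m N₂ N₁) (ℕ.m≤n+m (N₁ ℕ.+ N₂) (2 ℕ.^ (20 ℕ.+ K)))) le))
         ε (λ j L≤j → small j (ℕ.≤-trans (ℕ.m≤n+m K 20) L≤j))

-- Independence of the absence of edges from disjoint sets of pairs.

module AbsentEdges where

 open import Data.Bool.Base using (Bool; true; false)
 open import Data.Fin.Base as Fin using (Fin)
 import Data.Fin.Properties as Fin
 open import Data.List.Base using (List; []; _∷_; length)
 open import Data.List.Membership.Propositional using (_∈_; lose)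
 open import Data.List.Relation.Unary.All as All using (All; []; _∷_)
 open import Data.List.Relation.Unary.AllPairs using (AllPairs; []; _∷_)
 open import Data.List.Relation.Unary.Any as Any using (Any; here; there; any?)
 open import Data.Nat.Base as ℕ using (ℕ)
 open import Data.Product.Base using (_×_; _,_)
 open import Data.Rational.Base
 import Data.Rational.Properties as ℚ
 open import Data.Rational.Solver using (module +-*-Solver)
 open import Data.Sum.Base using (_⊎_; inj₁; inj₂)
 open import Function.Base using (_∘_)
 open import Function.Bundles using (mk⇔)
 open import Relation.Binary.PropositionalEquality using (_≡_; _≢_; refl; sym; trans; cong; cong₂)
 open import Relation.Nullary using (Dec; does; ¬_; no)
 open import Relation.Nullary.Decidable using (dec-true; dec-false; _×-dec_; _⊎-dec_; does-⇔)
 open import Defs using (Graph; adj)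
 open Expectation
 open RationalBounds using (pow)
 open +-*-Solver

 module Absent (q : ℚ) (n : ℕ) where
   open Expect q

   Pair : Set
   Pair = Fin n × Fin n

   -- Equality of unordered pairs.
   Match : Pair → Pair → Set
   Match (u , v) (x , y) = (u ≡ x × v ≡ y) ⊎ (u ≡ y × v ≡ x)

   match? : ∀ p r → Dec (Match p r)
   match? (u , v) (x , y) = ((u Fin.≟ x) ×-dec (v Fin.≟ y)) ⊎-dec ((u Fin.≟ y) ×-dec (v Fin.≟ x))

   flip-match : ∀ {u v p} → Match (u , v) p → Match (v , u) p
   flip-match (inj₁ (e , e′)) = inj₂ (e′ , e)
   flip-match (inj₂ (e , e′)) = inj₁ (e′ , e)

   mask : List Pair → Fin n → Fin n → Bool
   mask ps u v = does (any? (match? (u , v)) ps)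

   mask-sym : ∀ ps u v → mask ps u v ≡ mask ps v u
   mask-sym ps u v = does-⇔ (mk⇔ (Any.map (λ {p} → flip-match {p = p})) (Any.map (λ {p} → flip-match {p = p}))) (any? (match? (u , v)) ps) (any? (match? (v , u)) ps)

   absent : Graph n → Pair → ℚ
   absent R (x , y) = 1ℚ - bit (adj R x y)

   none : List Pair → Graph n → ℚ
   none ps R = ΠL (absent R) ps

   Apart : List Pair → List Pair → Set
   Apart ps rs = ∀ {p r} → p ∈ ps → r ∈ rs → ¬ Match p r

   none-dep : ∀ ps R R′ → (∀ {x y} → (x , y) ∈ ps → adj R x y ≡ adj R′ x y) → none ps R ≡ none ps R′
   none-dep [] R R′ h = refl
   none-dep (p ∷ ps) R R′ h = cong₂ _*_ (cong (λ b → 1ℚ - bit b) (h (here refl))) (none-dep ps R R′ (h ∘ there))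

   none-true : ∀ ps → Dep (mask ps) true (none ps)
   none-true ps R R′ h = none-dep ps R R′ λ {x} {y} m → h x y (dec-true (any? (match? (x , y)) ps) (lose m (inj₁ (refl , refl))))

   none-false : ∀ ps rs → Apart rs ps → Dep (mask ps) false (none rs)
   none-false ps rs ap R R′ h = none-dep rs R R′ λ {x} {y} m → h x y (dec-false (any? (match? (x , y)) ps) λ a →
     let (p , p∈ , mt) = Data.List.Membership.Propositional.find a in ap m p∈ mt)
     where import Data.List.Membership.Propositional

   E-complement : ∀ f → EG n (λ R → 1ℚ - f R) ≡ 1ℚ - EG n f
   E-complement f = trans (EG-cong n (λ R → cong (1ℚ +_) (negate (f R)))) (trans (EG-+ n _ _) (cong₂ _+_ (EG-const n 1ℚ) (trans (EG-* n (- 1ℚ) f) (sym (negate (EG n f))))))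
     where
     negate : ∀ x → - x ≡ - 1ℚ * x
     negate = solve 1 (λ x → :- x := con (- 1ℚ) :* x) refl

   E-none : ∀ ps → All (λ (x , y) → x ≢ y) ps → AllPairs (λ p r → ¬ Match r p) ps → EG n (none ps) ≡ pow (1ℚ - q) (length ps)
   E-none [] _ _ = EG-const n 1ℚ
   E-none (p@(x , y) ∷ ps) (ne ∷ nes) (m ∷ ms) = trans
     (EG-indep n (mask (p ∷ [])) (mask-sym (p ∷ [])) (λ R → absent R p) (none ps)
       (λ R R′ h → cong (λ b → 1ℚ - bit b) (h x y (dec-true (any? (match? p) (p ∷ [])) (here (inj₁ (refl , refl))))))
       (none-false (p ∷ []) ps (λ { r∈ (here refl) → All.lookup m r∈ })))
     (cong₂ _*_ (trans (E-complement (λ R → bit (adj R x y))) (cong (λ z → 1ℚ - z) (EG-edge n x y ne))) (E-none ps nes ms))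

   module _ {I : Set} (P : I → List Pair) where

     -- The families share no unordered pair, so they are split off one by one, with the pairs of
     -- the first family as the mask.
     E-all-hit : ∀ is → AllPairs (λ i j → Apart (P j) (P i)) is →
       EG n (λ R → ΠL (λ i → 1ℚ - none (P i) R) is) ≡ ΠL (λ i → 1ℚ - EG n (none (P i))) is
     E-all-hit [] _ = EG-const n 1ℚ
     E-all-hit (i ∷ is) (a ∷ as) = trans
       (EG-indep n (mask (P i)) (mask-sym (P i)) (λ R → 1ℚ - none (P i) R) (λ R → ΠL (λ i → 1ℚ - none (P i) R) is)
         (λ R R′ h → cong (λ z → 1ℚ - z) (none-true (P i) R R′ h)) (rest a))
       (cong₂ _*_ (E-complement (none (P i))) (E-all-hit is as))
       where
       rest : ∀ {js} → All (λ j → Apart (P j) (P i)) js → Dep (mask (P i)) false (λ R → ΠL (λ i → 1ℚ - none (P i) R) js)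
       rest [] R R′ h = refl
       rest (_∷_ {j} b bs) R R′ h = cong₂ _*_ (cong (λ z → 1ℚ - z) (none-false (P i) (P j) b R R′ h)) (rest bs R R′ h)

-- The disjoint union of cliques and its parameters.

module ClusterGraph where

 open import Data.Bool.Base using (Bool; true; false; T; _∧_; _∨_; not)
 open import Data.Bool.Properties using (T-∨)
 open import Data.Empty using (⊥; ⊥-elim)
 open import Data.Fin.Base as Fin using (Fin; toℕ; fromℕ<)
 import Data.Fin.Properties as Fin
 open import Data.List.Base as List using (List; []; _∷_; length; map; upTo; tabulate; allFin)
 import Data.List.Properties as List
 open import Data.List.Membership.Propositional using (_∈_)
 open import Data.List.Membership.Propositional.Properties using (∈-map⁺; ∈-map⁻; ∈-upTo⁺; ∈-tabulate⁻; ∈-allFin)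
 open import Data.List.Relation.Unary.All as All using (All; []; _∷_)
 open import Data.List.Relation.Unary.Any using (here; there)
 open import Data.List.Relation.Unary.AllPairs as AllPairs using (AllPairs; []; _∷_)
 import Data.List.Relation.Unary.AllPairs.Properties as AllPairs
 open import Data.List.Relation.Unary.Unique.Propositional using (Unique)
 import Data.List.Relation.Unary.Unique.Propositional.Properties as Unique
 open import Data.Nat.Base hiding (_⊔_)
 open import Data.Nat.Divisibility using (n∣m*n)
 open import Data.Nat.DivMod using (m*n/n≡m; +-distrib-/-∣ˡ; m<n⇒m/n≡0; m≡m%n+[m/n]*n; m%n<n)
 open import Data.Nat.Properties
 open import Data.Product.Base using (∃; _×_; _,_; proj₁; proj₂)
 open import Data.Sum.Base using (_⊎_; inj₁; inj₂; [_,_]′)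
 open import Data.Vec.Base as Vec using (Vec; []; _∷_)
 import Data.Vec.Properties as Vec
 import Data.Vec.Relation.Unary.All as VAll
 import Data.Vec.Relation.Unary.All.Properties as VAll
 import Data.Vec.Relation.Unary.AllPairs as VPairs
 import Data.Vec.Relation.Unary.Linked as VLinked
 open import Function.Base using (_∘_)
 open import Function.Bundles using (Equivalence)
 open import Relation.Binary.PropositionalEquality using (_≡_; _≢_; refl; sym; trans; cong; cong₂; subst)
 open import Relation.Nullary using (¬_; Dec; does; yes; no)
 open import Relation.Nullary.Decidable using (dec-true; dec-false)
 open import Defs using (Graph; adj; adj-sym; Adj; α; δ; degree; _∪_; Hamiltonian)
 open Lists using (length-⊆; Unique-∷)
 open GraphSetup using (module GraphWalks)
 open GraphParameters

 ∈-unique-full : ∀ {n} {xs : List (Fin n)} → Unique xs → length xs ≡ n → ∀ x → x ∈ xs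
 ∈-unique-full {n} {xs} u len x with x ∈? xs
   where open import Data.List.Membership.DecPropositional (Fin._≟_ {n}) using (_∈?_)
 ... | yes x∈ = x∈
 ... | no x∉ = ⊥-elim (<-irrefl refl (≤-trans (s≤s (≤-reflexive (sym len)))
   (≤-trans (length-⊆ (Unique-∷ x∉ u) (λ _ → ∈-allFin _)) (≤-reflexive (List.length-tabulate {n = n} (λ i → i))))))

 toList-Unique : ∀ {A : Set} {m} {xs : Vec A m} → VPairs.AllPairs _≢_ xs → Unique (Vec.toList xs)
 toList-Unique VPairs.[] = []
 toList-Unique (p VPairs.∷ ps) = VAll.toList⁺ p ∷ toList-Unique ps

 -- A cycle cannot cross between a set and its complement if no edge does.
 module _ {n : ℕ} (G : Graph n) {P : Fin n → Set} (P? : ∀ x → Dec (P x)) (closed : ∀ {x y} → Adj G x y → P x → P y) where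

   linked-All : ∀ {m v} {vs : Vec (Fin n) m} {Q : Fin n → Set} → (∀ {x y} → Adj G x y → Q x → Q y) → VLinked.Linked (Adj G) (v ∷ vs) → Q v → VAll.All Q (v ∷ vs)
   linked-All cl VLinked.[-] q = q VAll.∷ VAll.[]
   linked-All {vs = _ ∷ _} cl (e VLinked.∷ l) q = q VAll.∷ linked-All cl l (cl e q)

   ∷ʳ-All : ∀ {m x} (vs : Vec (Fin n) m) {Q : Fin n → Set} → VAll.All Q (vs Vec.∷ʳ x) → VAll.All Q vs
   ∷ʳ-All [] _ = VAll.[]
   ∷ʳ-All (v ∷ vs) (q VAll.∷ qs) = q VAll.∷ ∷ʳ-All vs qs

   not-hamiltonian : ∀ {x y} → P x → ¬ P y → ¬ Hamiltonian G
   not-hamiltonian {x} {y} px ¬py (_ , [] , ())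
   not-hamiltonian {x} {y} px ¬py (_ , v ∷ vs , u , l) with P? v
   ... | yes pv = ¬py (All.lookup (VAll.toList⁺ (∷ʳ-All (v ∷ vs) (linked-All closed l pv))) (∈-unique-full (toList-Unique u) (Vec.length-toList (v ∷ vs)) y))
   ... | no ¬pv = All.lookup (VAll.toList⁺ (∷ʳ-All (v ∷ vs) (linked-All (λ {a} {b} e ¬pa pb → ¬pa (closed (subst T (adj-sym G a b) e) pb)) l ¬pv))) (∈-unique-full (toList-Unique u) (Vec.length-toList (v ∷ vs)) x) px

 block : ∀ i j D .{{_ : NonZero D}} → j < D → (i * D + j) / D ≡ i
 block i j D j<D = trans (+-distrib-/-∣ˡ j (n∣m*n i)) (trans (cong₂ _+_ (m*n/n≡m i D) (m<n⇒m/n≡0 j<D)) (+-identityʳ i))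

 quotient-< : ∀ m D s .{{_ : NonZero D}} → m / D < s → m < s * D
 quotient-< m D s lt = ≤-trans (s≤s (≤-reflexive (m≡m%n+[m/n]*n m D))) (≤-trans (+-monoˡ-≤ (m / D * D) (m%n<n m D)) (*-monoˡ-≤ D lt))

 module Clusters (n d k : ℕ) where

   D : ℕ
   D = suc d

   -- Consecutive blocks of d + 1 vertices, where the minimum sends all surplus vertices to the last
   -- cluster.
   cl : Fin n → ℕ
   cl v = toℕ v / D ⊓ (k ∸ 1)

   H : Graph n
   adj H u v = does (cl u ≟ cl v) ∧ not (does (u Fin.≟ v))
   Graph.adj-sym H u v = cong₂ _∧_ (swap≟ _≟_ (cl u) (cl v)) (cong not (swap≟ Fin._≟_ u v))
     where
     swap≟ : ∀ {A : Set} (_≟′_ : ∀ (x y : A) → Dec (x ≡ y)) x y → does (x ≟′ y) ≡ does (y ≟′ x)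
     swap≟ _≟′_ x y with x ≟′ y
     ... | yes e = sym (dec-true (y ≟′ x) (sym e))
     ... | no ne = sym (dec-false (y ≟′ x) (ne ∘ sym))
   Graph.adj-irr H v = trans (cong (λ b → does (cl v ≟ cl v) ∧ not b) (dec-true (v Fin.≟ v) refl)) (∧-zero (does (cl v ≟ cl v)))
     where
     ∧-zero : ∀ b → b ∧ false ≡ false
     ∧-zero true = refl
     ∧-zero false = refl

   H⁺ : ∀ {u v} → cl u ≡ cl v → u ≢ v → Adj H u v
   H⁺ {u} {v} e ne = subst T (sym (cong₂ (λ a b → a ∧ not b) (dec-true (cl u ≟ cl v) e) (dec-false (u Fin.≟ v) ne))) _

   H⁻ : ∀ {u v} → Adj H u v → cl u ≡ cl v × u ≢ v
   H⁻ {u} {v} t = split (cl u ≟ cl v) (u Fin.≟ v) t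
     where
     split : ∀ {A B : Set} (a : Dec A) (b : Dec B) → T (does a ∧ not (does b)) → A × ¬ B
     split (yes a) (no b) _ = a , b

   module _ (2≤k : 2 ≤ k) (fit : k * D ≤ n) where

     ≤k-1 : ∀ {i} → i < k → i ≤ k ∸ 1
     ≤k-1 i<k = ∸-monoˡ-≤ 1 i<k

     cl< : ∀ x → cl x < k
     cl< x = ≤-trans (s≤s (m⊓n≤n (toℕ x / D) (k ∸ 1))) (≤-reflexive (m+[n∸m]≡n (≤-trans (s≤s z≤n) 2≤k)))

     place< : ∀ {i j} → i < k → j < D → i * D + j < n
     place< {i} {j} i<k j<D = ≤-trans (≤-trans (≤-reflexive (sym (+-suc (i * D) j))) (≤-trans (+-monoʳ-≤ (i * D) j<D) (≤-reflexive (+-comm (i * D) D)))) (≤-trans (*-monoˡ-≤ D i<k) fit)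

     vertex : ∀ {i j} → i < k → j < D → Fin n
     vertex i<k j<D = fromℕ< (place< i<k j<D)

     cl-vertex : ∀ {i j} (i<k : i < k) (j<D : j < D) → cl (vertex i<k j<D) ≡ i
     cl-vertex {i} {j} i<k j<D = trans (cong (λ z → z / D ⊓ (k ∸ 1)) (Fin.toℕ-fromℕ< (place< i<k j<D)))
       (trans (cong (_⊓ (k ∸ 1)) (block i j D j<D)) (m≤n⇒m⊓n≡m (≤k-1 i<k)))

     cl-low : ∀ {x s} → cl x < s → s ≤ k ∸ 1 → cl x ≡ toℕ x / D
     cl-low {x} {s} lt s≤ with ⊓-sel (toℕ x / D) (k ∸ 1)
     ... | inj₁ e = e
     ... | inj₂ e = ⊥-elim (<-irrefl refl (≤-trans lt (≤-trans s≤ (≤-reflexive (sym e)))))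

     low-length : ∀ {s xs} → s ≤ k ∸ 1 → Unique xs → (∀ {x} → x ∈ xs → cl x < s) → length xs ≤ s * D
     low-length {s} {xs} s≤ u h = ≤-trans (≤-reflexive (sym (List.length-map toℕ xs)))
       (≤-trans (length-⊆ (Unique.map⁺ Fin.toℕ-injective u) sub) (≤-reflexive (List.length-upTo (s * D))))
       where
       sub : ∀ {m} → m ∈ map toℕ xs → m ∈ upTo (s * D)
       sub m∈ with ∈-map⁻ toℕ m∈
       ... | x , x∈ , refl = ∈-upTo⁺ (quotient-< (toℕ x) D s (≤-trans (≤-reflexive (cong suc (sym (cl-low {x} (h x∈) s≤)))) (h x∈)))

     cluster-length : ∀ {i xs} → i < k ∸ 1 → Unique xs → (∀ {x} → x ∈ xs → cl x ≡ i) → length xs ≤ D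
     cluster-length {i} {xs} i< u h = ≤-trans (≤-reflexive (sym (List.length-map toℕ xs)))
       (≤-trans (length-⊆ (Unique.map⁺ Fin.toℕ-injective u) sub) (≤-reflexive (trans (List.length-map (_+ i * D) (upTo D)) (List.length-upTo D))))
       where
       sub : ∀ {m} → m ∈ map toℕ xs → m ∈ map (_+ i * D) (upTo D)
       sub m∈ with ∈-map⁻ toℕ m∈
       ... | x , x∈ , refl = subst (_∈ map (_+ i * D) (upTo D))
         (sym (trans (m≡m%n+[m/n]*n (toℕ x) D) (cong (λ z → toℕ x % D + z * D) (trans (sym (cl-low {x} (s≤s (≤-reflexive (h x∈))) i<)) (h x∈)))))
         (∈-map⁺ (_+ i * D) (∈-upTo⁺ (m%n<n (toℕ x) D)))

     α-H : α H ≡ k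
     α-H = ≤-antisym (α-≤ H k upper) (≤-trans (≤-reflexive (sym (List.length-tabulate rep))) (indep-≤α H (tabulate rep) (AllPairs.tabulate⁺ reps-apart)))
       where
       upper : ∀ zs → GraphWalks.Indep H zs → length zs ≤ k
       upper zs i = ≤-trans (≤-reflexive (sym (List.length-map cl zs))) (≤-trans (length-⊆ (AllPairs.map⁺ (AllPairs.map apart i)) sub) (≤-reflexive (List.length-upTo k)))
         where
         apart : ∀ {x y} → ¬ (x ≡ y ⊎ Adj H x y) → cl x ≢ cl y
         apart {x} {y} nc e = split (x Fin.≟ y)
           where
           split : Dec (x ≡ y) → ⊥
           split (yes p) = nc (inj₁ p)
           split (no ¬p) = nc (inj₂ (H⁺ e ¬p))
         sub : ∀ {m} → m ∈ map cl zs → m ∈ upTo k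
         sub m∈ with ∈-map⁻ cl m∈
         ... | x , _ , refl = ∈-upTo⁺ (cl< x)
       rep : Fin k → Fin n
       rep i = vertex (Fin.toℕ<n i) (s≤s z≤n)
       cl-rep : ∀ i → cl (rep i) ≡ toℕ i
       cl-rep i = cl-vertex (Fin.toℕ<n i) (s≤s z≤n)
       reps-apart : ∀ {i j} → i ≢ j → ¬ (rep i ≡ rep j ⊎ Adj H (rep i) (rep j))
       reps-apart {i} {j} ne c = ne (Fin.toℕ-injective (trans (sym (cl-rep i)) (trans ([ cong cl , (λ e → proj₁ (H⁻ {rep i} {rep j} e)) ]′ c) (cl-rep j))))

     -- Every cluster has at least d + 1 vertices, and cluster 0 has no more because k ≥ 2 makes it
     -- different from the last one.
     δ-H : δ H ≡ d
     δ-H = ≤-antisym upper (δ-≥ H d (≤-trans (n≤1+n d) (≤-trans (≤-trans (≤-reflexive (sym (*-identityˡ D))) (*-monoˡ-≤ D (≤-trans (s≤s z≤n) 2≤k))) fit)) lower)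
       where
       lower : ∀ v → d ≤ degree H v
       lower v = ≤-trans (≤-pred (≤-trans (≤-reflexive (sym (List.length-tabulate mate))) (length-⊆ (Unique.tabulate⁺ mate-inj) sub))) (≤-reflexive (sym (degree≡ H v)))
         where
         mate : Fin D → Fin n
         mate j = vertex (cl< v) (Fin.toℕ<n j)
         mate-inj : ∀ {i j} → mate i ≡ mate j → i ≡ j
         mate-inj {i} {j} e = Fin.toℕ-injective (+-cancelˡ-≡ (cl v * D) (toℕ i) (toℕ j)
           (trans (sym (Fin.toℕ-fromℕ< (place< (cl< v) (Fin.toℕ<n i)))) (trans (cong toℕ e) (Fin.toℕ-fromℕ< (place< (cl< v) (Fin.toℕ<n j))))))
         sub : ∀ {x} → x ∈ tabulate mate → x ∈ v ∷ nbrList H v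
         sub {x} x∈ = split (x Fin.≟ v) (∈-tabulate⁻ x∈)
           where
           split : Dec (x ≡ v) → (∃ λ j → x ≡ mate j) → x ∈ v ∷ nbrList H v
           split (yes e) _ = here e
           split (no ne) (j , refl) = there (∈-nbrList⁺ H {v} {mate j} (H⁺ {v} {mate j} (sym (cl-vertex (cl< v) (Fin.toℕ<n j))) (ne ∘ sym)))
       0<k-1 : 0 < k ∸ 1
       0<k-1 = ∸-monoˡ-≤ 1 2≤k
       v₀ : Fin n
       v₀ = vertex (≤-trans (s≤s z≤n) 2≤k) (s≤s z≤n)
       cl-v₀ : cl v₀ ≡ 0
       cl-v₀ = cl-vertex (≤-trans (s≤s z≤n) 2≤k) (s≤s z≤n)
       upper : δ H ≤ d
       upper = ≤-trans (δ-≤ H v₀) (≤-trans (≤-reflexive (degree≡ H v₀)) (≤-pred (cluster-length {0} {v₀ ∷ nbrList H v₀} 0<k-1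
         (Unique-∷ (λ v∈ → proj₂ (H⁻ {v₀} {v₀} (∈-nbrList⁻ H {v₀} {v₀} v∈)) refl) (unique-nbrList H v₀)) same)))
         where
         same : ∀ {x} → x ∈ v₀ ∷ nbrList H v₀ → cl x ≡ 0
         same (here refl) = cl-v₀
         same {x} (there x∈) = trans (sym (proj₁ (H⁻ {v₀} {x} (∈-nbrList⁻ H {v₀} {x} x∈)))) cl-v₀

     isolated-cluster : ∀ R {i} → i < k → (∀ {x y} → cl x ≡ i → cl y ≢ i → ¬ Adj R x y) → ¬ Hamiltonian (H ∪ R)
     isolated-cluster R {i} i<k iso = not-hamiltonian (H ∪ R) {λ x → cl x ≡ i} (λ x → cl x ≟ i) closed {vertex i<k (s≤s z≤n)} {vertex other< (s≤s z≤n)}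
         (cl-vertex i<k (s≤s z≤n)) (λ e → other≢ (trans (sym (cl-vertex other< (s≤s z≤n))) e))
       where
       closed : ∀ {x y} → Adj (H ∪ R) x y → cl x ≡ i → cl y ≡ i
       closed {x} {y} e cx with cl y ≟ i
       ... | yes p = p
       ... | no ¬p = [ (λ h → trans (sym (proj₁ (H⁻ {x} {y} h))) cx) , (λ r → ⊥-elim (iso cx ¬p r)) ]′ (Equivalence.to T-∨ e)
       other : ∃ λ j → j < k × j ≢ i
       other with i ≟ 0
       ... | yes refl = 1 , 2≤k , λ ()
       ... | no ne = 0 , ≤-trans (s≤s z≤n) 2≤k , ne ∘ sym
       other< : proj₁ other < k
       other< = proj₁ (proj₂ other)
       other≢ : proj₁ other ≢ i
       other≢ = proj₂ (proj₂ other)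

-- A cluster without random edges to the other clusters.

module IsolatedCluster where

 open import Data.Bool.Base using (Bool; true; T)
 open import Data.Bool.Properties using (T?)
 open import Data.Empty using (⊥-elim)
 open import Data.Fin.Base as Fin using (Fin; toℕ)
 import Data.Fin.Properties as Fin
 open import Data.List.Base as List using (List; []; _∷_; length; filter; allFin; cartesianProduct)
 import Data.List.Properties as List
 open import Data.List.Membership.Propositional using (_∈_; lose)
 open import Data.List.Membership.Propositional.Properties using (∈-filter⁺; ∈-filter⁻; ∈-allFin; ∈-cartesianProduct⁺; ∈-cartesianProduct⁻)
 open import Data.List.Relation.Unary.All as All using (All; []; _∷_)
 open import Data.List.Relation.Unary.AllPairs as AllPairs using (AllPairs; []; _∷_)
 import Data.List.Relation.Unary.AllPairs.Properties as AllPairs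
 open import Data.List.Relation.Unary.Any using (Any; here; there; any?)
 open import Data.List.Relation.Unary.Unique.Propositional using (Unique)
 import Data.List.Relation.Unary.Unique.Propositional.Properties as Unique
 open import Data.Nat.Base as ℕ using (ℕ; zero; suc; s≤s)
 import Data.Nat.Properties as ℕ
 import Data.Nat.Solver as ℕS
 open import Data.Product.Base using (_×_; _,_; proj₁; proj₂)
 open import Data.Rational.Base
 import Data.Rational.Properties as ℚ
 open import Data.Rational.Solver using (module +-*-Solver)
 open import Data.Sum.Base using (inj₁; inj₂)
 open import Function.Base using (_∘_)
 open import Relation.Binary.PropositionalEquality using (_≡_; _≢_; refl; sym; trans; cong; cong₂)
 open import Relation.Nullary using (¬_; Dec; does; yes; no)
 open import Relation.Nullary.Decidable using (¬?)
 open import Defs using (Graph; adj; Adj; _∪_; Hamiltonian; hamiltonian?; module ℚLemmas)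
 open ℚLemmas
 open Expectation
 open RationalBounds
 open AasCriterion using (PQ)
 open AbsentEdges
 open ClusterGraph
 open +-*-Solver

 length-cartesianProduct : ∀ {A B : Set} (xs : List A) (ys : List B) → length (cartesianProduct xs ys) ≡ length xs ℕ.* length ys
 length-cartesianProduct [] ys = refl
 length-cartesianProduct (x ∷ xs) ys = trans (List.length-++ (List.map (x ,_) ys)) (cong₂ ℕ._+_ (List.length-map (x ,_) ys) (length-cartesianProduct xs ys))

 ΠL-one : ∀ {A : Set} (f : A → ℚ) xs → (∀ x → f x ≡ 1ℚ) → ΠL f xs ≡ 1ℚ
 ΠL-one f [] h = refl
 ΠL-one f (x ∷ xs) h = cong₂ _*_ (h x) (ΠL-one f xs h)

 ΠL-≤pow : ∀ {A : Set} (f : A → ℚ) {y} xs → (∀ x → 0ℚ ≤ f x) → (∀ x → f x ≤ y) → ΠL f xs ≤ pow y (length xs)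
 ΠL-≤pow f [] h₀ h = ℚ.≤-refl
 ΠL-≤pow f {y} (x ∷ xs) h₀ h = *-mono {f x} {y} {ΠL f xs} {pow y (length xs)} (ΠL-nonneg h₀ xs) (h x) (ℚ.≤-trans (h₀ x) (h x)) (ΠL-≤pow f xs h₀ h)

 ΣL-nonneg : ∀ {A : Set} (f : A → ℚ) xs → (∀ x → 0ℚ ≤ f x) → 0ℚ ≤ ΣL f xs
 ΣL-nonneg f [] h = ℚ.≤-refl
 ΣL-nonneg f (x ∷ xs) h = ℚ.+-mono-≤ (h x) (ΣL-nonneg f xs h)

 ΣL-≤ : ∀ {A : Set} (f : A → ℚ) y xs → (∀ {x} → x ∈ xs → f x ≤ y) → ΣL f xs ≤ ι (length xs) * y
 ΣL-≤ f y [] h = ℚ.≤-reflexive (sym (ℚ.*-zeroˡ y))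
 ΣL-≤ f y (x ∷ xs) h = ℚ.≤-trans (ℚ.+-mono-≤ (h (here refl)) (ΣL-≤ f y xs (h ∘ there)))
   (ℚ.≤-reflexive (trans (solve 2 (λ l y → y :+ l :* y := (con 1ℚ :+ l) :* y) refl (ι (length xs)) y) (cong (_* y) (sym (fromℕ-suc (length xs))))))

 module Escape (n d k s : ℕ) (2≤k : 2 ℕ.≤ k) (fit : k ℕ.* suc d ℕ.≤ n) (s≤ : s ℕ.≤ k ℕ.∸ 1) where
   open Clusters n d k

   -- The first s clusters are the candidates for isolation. Pairs from a candidate to the other
   -- clusters of `outs` belong to this candidate alone, which makes these events independent. Pairs
   -- between candidates are shared, and are excluded by a first moment bound.
   outs low : List (Fin n)
   outs = filter (λ y → s ℕ.≤? cl y) (allFin n)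
   low = filter (λ x → cl x ℕ.<? s) (allFin n)

   cluster : ℕ → List (Fin n)
   cluster i = filter (λ x → cl x ℕ.≟ i) (allFin n)

   boundary : Fin s → List (Fin n × Fin n)
   boundary i = cartesianProduct (cluster (toℕ i)) outs

   inner : List (Fin n × Fin n)
   inner = filter (λ (x , y) → ¬? (cl x ℕ.≟ cl y)) (cartesianProduct low low)

   <k : ∀ (i : Fin s) → toℕ i ℕ.< k ℕ.∸ 1
   <k i = ℕ.<-≤-trans (Fin.toℕ<n i) s≤

   ∈-boundary⁺ : ∀ {i x y} → cl x ≡ toℕ i → s ℕ.≤ cl y → (x , y) ∈ boundary i
   ∈-boundary⁺ e le = ∈-cartesianProduct⁺ (∈-filter⁺ _ (∈-allFin _) e) (∈-filter⁺ _ (∈-allFin _) le)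

   ∈-boundary⁻ : ∀ i {x y} → (x , y) ∈ boundary i → cl x ≡ toℕ i × s ℕ.≤ cl y
   ∈-boundary⁻ i m with ∈-cartesianProduct⁻ (cluster (toℕ i)) outs m
   ... | x∈ , y∈ = proj₂ (∈-filter⁻ (λ x → cl x ℕ.≟ toℕ i) {xs = allFin n} x∈) , proj₂ (∈-filter⁻ (λ y → s ℕ.≤? cl y) {xs = allFin n} y∈)

   boundary-length : ∀ i → length (boundary i) ℕ.≤ D ℕ.* n
   boundary-length i = ℕ.≤-trans (ℕ.≤-reflexive (length-cartesianProduct (cluster (toℕ i)) outs)) (ℕ.*-mono-≤
     (cluster-length 2≤k fit (<k i) (Unique.filter⁺ _ (Unique.allFin⁺ n)) (λ x∈ → proj₂ (∈-filter⁻ (λ x → cl x ℕ.≟ toℕ i) {xs = allFin n} x∈)))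
     (ℕ.≤-trans (List.length-filter _ (allFin n)) (ℕ.≤-reflexive (List.length-tabulate {n = n} (λ x → x)))))

   inner-length : length inner ℕ.≤ (s ℕ.* D) ℕ.* (s ℕ.* D)
   inner-length = ℕ.≤-trans (List.length-filter _ (cartesianProduct low low)) (ℕ.≤-trans (ℕ.≤-reflexive (length-cartesianProduct low low)) (ℕ.*-mono-≤ low≤ low≤))
     where
     low≤ : length low ℕ.≤ s ℕ.* D
     low≤ = low-length 2≤k fit s≤ (Unique.filter⁺ _ (Unique.allFin⁺ n)) (λ x∈ → proj₂ (∈-filter⁻ (λ x → cl x ℕ.<? s) {xs = allFin n} x∈))

   isolated : ∀ (R : Graph n) i → ¬ Any (λ (x , y) → Adj R x y) inner → ¬ Any (λ (x , y) → Adj R x y) (boundary i) → ¬ Hamiltonian (H ∪ R)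
   isolated R i ¬in ¬out = isolated-cluster 2≤k fit R (ℕ.<-≤-trans (<k i) (ℕ.m∸n≤m k 1)) iso
     where
     iso : ∀ {x y} → cl x ≡ toℕ i → cl y ≢ toℕ i → ¬ Adj R x y
     iso {x} {y} ex ey e = split (s ℕ.≤? cl y)
       where
       split : Dec (s ℕ.≤ cl y) → _
       split (yes le) = ¬out (lose (∈-boundary⁺ ex le) e)
       split (no nle) = ¬in (lose (∈-filter⁺ _ (∈-cartesianProduct⁺ (∈-filter⁺ _ (∈-allFin x) (ℕ.≤-trans (s≤s (ℕ.≤-reflexive ex)) (Fin.toℕ<n i))) (∈-filter⁺ _ (∈-allFin y) (ℕ.≰⇒> nle)))
         (λ c → ey (trans (sym c) ex))) e)

   module _ (q : ℚ) (0≤q : 0ℚ ≤ q) (q≤1 : q ≤ 1ℚ) where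
     open Expect q
     open Absent q n

     present : Graph n → Pair → ℚ
     present R (x , y) = bit (adj R x y)

     bit-T : ∀ {b} → T b → bit b ≡ 1ℚ
     bit-T {true} _ = refl

     ΣL-hit : ∀ R {ps} → Any (λ (x , y) → Adj R x y) ps → 1ℚ ≤ ΣL (present R) ps
     ΣL-hit R {(x , y) ∷ ps} (here e) = ℚ.≤-trans (ℚ.≤-reflexive (sym (bit-T e))) (x≤x+ (bit (adj R x y)) _ (ΣL-nonneg (present R) ps (λ (x , y) → 0≤bit (adj R x y))))
     ΣL-hit R {(x , y) ∷ ps} (there a) = ℚ.≤-trans (ℚ.≤-reflexive (sym (ℚ.+-identityˡ 1ℚ))) (ℚ.+-mono-≤ {0ℚ} {bit (adj R x y)} (0≤bit (adj R x y)) (ΣL-hit R a))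

     none-hit : ∀ R {ps} → Any (λ (x , y) → Adj R x y) ps → none ps R ≡ 0ℚ
     none-hit R {(x , y) ∷ ps} (here e) = trans (cong (λ z → (1ℚ - z) * none ps R) (bit-T e)) (ℚ.*-zeroˡ (none ps R))
     none-hit R {p ∷ ps} (there a) = trans (cong (absent R p *_) (none-hit R a)) (ℚ.*-zeroʳ (absent R p))

     0≤absent : ∀ R p → 0ℚ ≤ absent R p
     0≤absent R (x , y) = 0≤1- (bit≤1 (adj R x y))

     none≤1 : ∀ R ps → none ps R ≤ 1ℚ
     none≤1 R ps = ℚ.≤-trans (ΠL-≤pow (absent R) {1ℚ} ps (0≤absent R) (λ (x , y) → 1-≤1 (0≤bit (adj R x y)))) (pow≤1 0≤1 ℚ.≤-refl (length ps))

     hits : Graph n → ℚ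
     hits R = ΠL (λ i → 1ℚ - none (boundary i) R) (allFin s)

     0≤hits : ∀ R → 0ℚ ≤ hits R
     0≤hits R = ΠL-nonneg (λ i → 0≤1- (none≤1 R (boundary i))) (allFin s)

     -- If H ∪ R is Hamiltonian, then two candidates are joined, which makes the sum at least 1, or
     -- every candidate has an edge to `outs`, which makes `hits` equal to 1.
     cover : ∀ R → 1ℚ ≤ bit (does (¬? (hamiltonian? (H ∪ R)))) + (ΣL (present R) inner + hits R)
     cover R = go (hamiltonian? (H ∪ R))
       where
       0≤Σ : 0ℚ ≤ ΣL (present R) inner
       0≤Σ = ΣL-nonneg (present R) inner (λ (x , y) → 0≤bit (adj R x y))
       go : (h : Dec (Hamiltonian (H ∪ R))) → 1ℚ ≤ bit (does (¬? h)) + (ΣL (present R) inner + hits R)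
       go (no _) = x≤x+ 1ℚ (ΣL (present R) inner + hits R) (ℚ.+-mono-≤ 0≤Σ (0≤hits R))
       go (yes ham) = ℚ.≤-trans (in? (any? (λ (x , y) → T? (adj R x y)) inner)) (ℚ.≤-reflexive (sym (ℚ.+-identityˡ _)))
         where
         in? : Dec (Any (λ (x , y) → Adj R x y) inner) → 1ℚ ≤ ΣL (present R) inner + hits R
         in? (yes a) = ℚ.≤-trans (ΣL-hit R a) (x≤x+ (ΣL (present R) inner) (hits R) (0≤hits R))
         in? (no ¬in) = ℚ.≤-trans (ℚ.≤-reflexive (sym (ΠL-one _ (allFin s) λ i → cong (λ z → 1ℚ - z) (out? i (any? (λ (x , y) → T? (adj R x y)) (boundary i))))))
           (ℚ.≤-trans (ℚ.≤-reflexive (sym (ℚ.+-identityˡ (hits R)))) (ℚ.+-monoˡ-≤ (hits R) 0≤Σ))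
           where
           out? : ∀ i → Dec (Any (λ (x , y) → Adj R x y) (boundary i)) → none (boundary i) R ≡ 0ℚ
           out? i (yes a) = none-hit R a
           out? i (no ¬out) = ⊥-elim (isolated R i ¬in ¬out ham)

     apart : ∀ {i j} → i ≢ j → Apart (boundary j) (boundary i)
     apart {i} {j} ne {x , y} {x′ , y′} p∈ r∈ (inj₁ (refl , _)) = ne (Fin.toℕ-injective (trans (sym (proj₁ (∈-boundary⁻ i r∈))) (proj₁ (∈-boundary⁻ j p∈))))
     apart {i} {j} ne {x , y} {x′ , y′} p∈ r∈ (inj₂ (refl , _)) = ℕ.<-irrefl refl (ℕ.≤-trans (Fin.toℕ<n j) (ℕ.≤-trans (proj₂ (∈-boundary⁻ i r∈)) (ℕ.≤-reflexive (proj₁ (∈-boundary⁻ j p∈)))))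

     E-boundary : ∀ i → EG n (none (boundary i)) ≡ pow (1ℚ - q) (length (boundary i))
     E-boundary i = E-none (boundary i) (All.tabulate λ p∈ → cross p∈ p∈) (distinct (λ p∈ → p∈) (Unique.cartesianProduct⁺ (Unique.filter⁺ _ (Unique.allFin⁺ n)) (Unique.filter⁺ _ (Unique.allFin⁺ n))))
       where
       cross : ∀ {x y x′ y′} → (x , y) ∈ boundary i → (x′ , y′) ∈ boundary i → x ≢ y′
       cross p∈ r∈ refl = ℕ.<-irrefl refl (ℕ.≤-trans (Fin.toℕ<n i) (ℕ.≤-trans (proj₂ (∈-boundary⁻ i r∈)) (ℕ.≤-reflexive (proj₁ (∈-boundary⁻ i p∈)))))
       distinct : ∀ {ps} → (∀ {p} → p ∈ ps → p ∈ boundary i) → Unique ps → AllPairs (λ p r → ¬ Match r p) ps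
       distinct sub [] = []
       distinct sub (p ∷ ps) = All.tabulate (λ r∈ → λ { (inj₁ (refl , refl)) → All.lookup p r∈ refl ; (inj₂ (e , _)) → cross (sub (there r∈)) (sub (here refl)) e }) ∷ distinct (sub ∘ there) ps

     -- A candidate has at most D n pairs to `outs`, so `ρ` bounds from below the probability that
     -- none of them is an edge.
     escape : ∀ ρ → ρ ≤ pow (1ℚ - q) (D ℕ.* n) →
       1ℚ ≤ PQ (λ R → ¬? (hamiltonian? (H ∪ R))) q + (ι ((s ℕ.* D) ℕ.* (s ℕ.* D)) * q + pow (1ℚ - ρ) s)
     escape ρ ρ≤ = begin
       1ℚ ≡⟨ sym (EG-const n 1ℚ) ⟩
       EG n (λ _ → 1ℚ) ≤⟨ EG-mono 0≤q q≤1 n cover ⟩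
       EG n (λ R → bit (does (¬? (hamiltonian? (H ∪ R)))) + (ΣL (present R) inner + hits R)) ≡⟨ trans (EG-+ n _ _) (cong (P +_) (EG-+ n _ _)) ⟩
       P + (EG n (λ R → ΣL (present R) inner) + EG n hits) ≤⟨ ℚ.+-monoʳ-≤ P (ℚ.+-mono-≤ {EG n (λ R → ΣL (present R) inner)} E-inner E-hits) ⟩
       P + (ι ((s ℕ.* D) ℕ.* (s ℕ.* D)) * q + pow (1ℚ - ρ) s) ∎
       where
       open ℚ.≤-Reasoning
       P = PQ (λ R → ¬? (hamiltonian? (H ∪ R))) q
       E-inner : EG n (λ R → ΣL (present R) inner) ≤ ι ((s ℕ.* D) ℕ.* (s ℕ.* D)) * q
       E-inner = ℚ.≤-trans (ℚ.≤-reflexive (EG-Σ n (λ p R → present R p) inner)) (ℚ.≤-trans (ΣL-≤ _ q inner edge) (*-monoʳ q 0≤q (fromℕ-mono inner-length)))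
         where
         edge : ∀ {p} → p ∈ inner → EG n (λ R → present R p) ≤ q
         edge {x , y} p∈ = ℚ.≤-reflexive (EG-edge n x y (λ e → proj₂ (∈-filter⁻ (λ (x , y) → ¬? (cl x ℕ.≟ cl y)) {xs = cartesianProduct low low} p∈) (cong cl e)))
       E-hits : EG n hits ≤ pow (1ℚ - ρ) s
       E-hits = begin
         EG n hits ≡⟨ E-all-hit boundary (allFin s) (AllPairs.tabulate⁺ apart) ⟩
         ΠL (λ i → 1ℚ - EG n (none (boundary i))) (allFin s) ≤⟨ ΠL-≤pow _ {1ℚ - ρ} (allFin s) (λ i → 0≤1- (ℚ.≤-trans (EG-mono 0≤q q≤1 n (λ R → none≤1 R (boundary i))) (ℚ.≤-reflexive (EG-const n 1ℚ))))
              (λ i → 1-anti (ℚ.≤-trans ρ≤ (ℚ.≤-trans (pow-anti (0≤1- q≤1) (1-≤1 0≤q) (boundary-length i)) (ℚ.≤-reflexive (sym (E-boundary i)))))) ⟩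
         pow (1ℚ - ρ) (length (allFin s)) ≡⟨ cong (pow (1ℚ - ρ)) (List.length-tabulate {n = s} (λ x → x)) ⟩
         pow (1ℚ - ρ) s ∎

-- Asymptotics of (b).

module NonHamiltonianAas where

 import Data.Integer.Base as ℤ
 open import Data.Nat.Base as ℕ using (ℕ; zero; suc; s≤s; z≤n)
 import Data.Nat.Properties as ℕ
 import Data.Nat.Solver as ℕS
 open import Data.Nat.DivMod using (/-monoˡ-≤; m*n/n≡m; m/n*n≤m)
 open import Data.Product.Base using (∃; Σ; _×_; _,_; proj₁; proj₂)
 open import Data.Rational.Base
 import Data.Rational.Properties as ℚ
 open import Data.Rational.Solver using (module +-*-Solver)
 open import Relation.Binary.PropositionalEquality using (_≡_; refl; sym; trans; cong; subst)
 open import Relation.Nullary.Decidable using (¬?)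
 import Defs
 open import Defs using (Eventually; _→∞; Graph; α; δ; _∪_; hamiltonian?; ℝ; seq; fromℕ; fromℚ; log; IsProbability; Aas; module ℚLemmas; module LogCauchy)
 open ℚLemmas
 open LogCauchy using (L; trunc)
 open RationalBounds
 open LogBounds
 open AasCriterion
 open Counting using (log₂; /-lower)
 open PancyclicAas using (reciprocal; exponent-≥)
 open ClusterGraph using (module Clusters)
 open IsolatedCluster using (module Escape)
 open +-*-Solver
 open ℕS.+-*-Solver using () renaming (solve to solveℕ; _:+_ to _⊕_; _:*_ to _⊗_; con to conℕ; _:=_ to _⊜_)

 ¼ : ℚ
 ¼ = ½ * ½

 n≤2^n : ∀ n → n ℕ.≤ 2 ℕ.^ n
 n≤2^n zero = z≤n
 n≤2^n (suc n) = ℕ.≤-trans (ℕ.+-mono-≤ (ℕ.m^n>0 2 n) (n≤2^n n)) (ℕ.≤-reflexive (cong (2 ℕ.^ n ℕ.+_) (sym (ℕ.+-identityʳ (2 ℕ.^ n)))))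

 -- (1-q)^N is split into t blocks, each of which is at least 1/2.
 pow-lower : ∀ {q} → 0ℚ ≤ q → q ≤ 1ℚ → ∀ N t → 1 ℕ.≤ t → t ℕ.≤ N → q * ι N ≤ ¼ * ι t → ½^ t ≤ pow (1ℚ - q) N
 pow-lower {q} 0≤q q≤1 N (suc t′) _ t≤N le = begin
   ½^ t ≡⟨ sym (pow-½ t) ⟩
   pow ½ t ≤⟨ pow-mono 0≤½ (ℚ.≤-trans (1-anti {ι b * q} {½} qb) (bernoulli q≤1 0≤q b)) t ⟩
   pow (pow (1ℚ - q) b) t ≡⟨ sym (pow-* (1ℚ - q) t b) ⟩
   pow (1ℚ - q) (t ℕ.* b) ≤⟨ pow-anti (0≤1- q≤1) (1-≤1 0≤q) (ℕ.≤-trans (ℕ.<⇒≤ (/-lower N t)) (ℕ.≤-reflexive (ℕ.*-comm b t))) ⟩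
   pow (1ℚ - q) N ∎
   where
   open ℚ.≤-Reasoning
   t b : ℕ
   t = suc t′
   -- Rounding up gives t b ≥ N, while t ≤ N keeps t b ≤ 2N and hence b q ≤ ½.
   b = suc (N ℕ./ t)
   cancel : ∀ x → ι t * x ≤ ι t * ½ → x ≤ ½
   cancel x h = ℚ.*-cancelˡ-≤-pos (ι t) {{ℚ.normalize-pos t 1}} h
   b≤ : t ℕ.* b ℕ.≤ N ℕ.+ N
   b≤ = ℕ.≤-trans (ℕ.≤-reflexive (trans (ℕ.*-suc t (N ℕ./ t)) (ℕ.+-comm t _))) (ℕ.+-mono-≤ (ℕ.≤-trans (ℕ.≤-reflexive (ℕ.*-comm t (N ℕ./ t))) (m/n*n≤m N t)) t≤N)
   qb : ι b * q ≤ ½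
   qb = cancel (ι b * q) (begin
     ι t * (ι b * q) ≡⟨ trans (sym (ℚ.*-assoc (ι t) (ι b) q)) (cong (_* q) (sym (ι-* t b))) ⟩
     ι (t ℕ.* b) * q ≤⟨ *-monoʳ q 0≤q (fromℕ-mono b≤) ⟩
     ι (N ℕ.+ N) * q ≡⟨ trans (cong (_* q) (ι-+ N N)) (solve 2 (λ n q → (n :+ n) :* q := con (ι 2) :* (q :* n)) refl (ι N) q) ⟩
     ι 2 * (q * ι N) ≤⟨ *-monoˡ (ι 2) (0≤fromℕ 2) le ⟩
     ι 2 * (¼ * ι t) ≡⟨ solve 1 (λ t → con (ι 2) :* (con ¼ :* t) := t :* con ½) refl (ι t) ⟩
     ι t * ½ ∎)

 ¼x≤x : ∀ x → 0ℚ ≤ x → ¼ * x ≤ x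
 ¼x≤x x 0≤x = ℚ.≤-trans (*-monoʳ x 0≤x (ℚ.≤-trans (*-monoˡ ½ 0≤½ (½^≤1 1)) (ℚ.≤-reflexive refl))) (ℚ.≤-trans (*-monoʳ x 0≤x (½^≤1 1)) (ℚ.≤-reflexive (ℚ.*-identityˡ x)))

 -- In the application u = 2^t and h = 1/u, with u² candidates. The expected number of edges between
 -- them is at most u⁴ D² q; since u⁶ D ≤ n and D n q ≤ u, this is at most u / u² = h. The
 -- probability that no candidate is free of edges to `outs` is at most (1 - h)^(u²) ≤ 1 / (1 + u) <
 -- h.
 module Bound (n d k u t : ℕ) (h : ℚ) (0≤h : 0ℚ ≤ h) (h≤1 : h ≤ 1ℚ) (uh : ι u * h ≡ 1ℚ) (t≤u : t ℕ.≤ u) (2≤u : 2 ℕ.≤ u)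
     (u⁶ : u ℕ.* u ℕ.* (u ℕ.* u) ℕ.* (u ℕ.* u) ℕ.≤ k) (fit : k ℕ.* suc d ℕ.≤ n) where
   open Clusters n d k using (H)

   1≤u : 1 ℕ.≤ u
   1≤u = ℕ.≤-trans (s≤s z≤n) 2≤u

   u² : ℕ
   u² = u ℕ.* u

   2≤u² : 2 ℕ.≤ u²
   2≤u² = ℕ.≤-trans (ℕ.≤-trans 2≤u (ℕ.≤-reflexive (sym (ℕ.*-identityʳ u)))) (ℕ.*-monoʳ-≤ u 1≤u)

   u²+u²≤k : u² ℕ.+ u² ℕ.≤ k
   u²+u²≤k = ℕ.≤-trans (ℕ.≤-trans (ℕ.≤-reflexive (cong (u² ℕ.+_) (sym (ℕ.+-identityʳ u²)))) (ℕ.*-mono-≤ 2≤u² (ℕ.≤-trans (ℕ.≤-reflexive (sym (ℕ.*-identityʳ u²))) (ℕ.*-monoʳ-≤ u² (ℕ.≤-trans (s≤s z≤n) 2≤u²)))))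
     (ℕ.≤-trans (ℕ.≤-reflexive (sym (ℕ.*-assoc u² u² u²))) u⁶)

   2≤k : 2 ℕ.≤ k
   2≤k = ℕ.≤-trans (ℕ.≤-trans 2≤u² (ℕ.m≤m+n u² u²)) u²+u²≤k

   u²≤k-1 : u² ℕ.≤ k ℕ.∸ 1
   u²≤k-1 = ℕ.≤-trans (ℕ.≤-reflexive (sym (ℕ.m+n∸n≡m u² 1))) (ℕ.∸-monoˡ-≤ 1 (ℕ.≤-trans (ℕ.+-monoʳ-≤ u² (ℕ.≤-trans (s≤s z≤n) 2≤u²)) u²+u²≤k))

   module _ (q : ℚ) (0≤q : 0ℚ ≤ q) (q≤1 : q ≤ 1ℚ) (sparse : q * ι (suc d ℕ.* n) ≤ ¼ * ι t) (hρ : h ≤ pow (1ℚ - q) (suc d ℕ.* n)) where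
     open ℚ.≤-Reasoning

     inner≤ : ι ((u² ℕ.* suc d) ℕ.* (u² ℕ.* suc d)) * q ≤ h
     inner≤ = begin
       x * q ≡⟨ sym (trans (cong (λ z → x * q * (z * z)) uh) (ℚ.*-identityʳ (x * q))) ⟩
       x * q * (ι u * h * (ι u * h)) ≡⟨ solve 4 (λ x q u h → x :* q :* (u :* h :* (u :* h)) := x :* (u :* u) :* q :* (h :* h)) refl x q (ι u) h ⟩
       x * (ι u * ι u) * q * (h * h) ≡⟨ cong (λ z → z * q * (h * h)) (trans (cong (x *_) (sym (ι-* u u))) (trans (sym (ι-* ((u² ℕ.* suc d) ℕ.* (u² ℕ.* suc d)) u²)) (cong ι (solveℕ 2 (λ v D → (v ⊗ D) ⊗ (v ⊗ D) ⊗ v ⊜ D ⊗ (v ⊗ v ⊗ v ⊗ D)) refl u² (suc d))))) ⟩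
       ι (suc d ℕ.* (u² ℕ.* u² ℕ.* u² ℕ.* suc d)) * q * (h * h) ≤⟨ *-monoʳ (h * h) (*-nonneg 0≤h 0≤h) (*-monoʳ q 0≤q (fromℕ-mono (ℕ.*-monoʳ-≤ (suc d) (ℕ.≤-trans (ℕ.*-monoˡ-≤ (suc d) u⁶) fit)))) ⟩
       ι (suc d ℕ.* n) * q * (h * h) ≤⟨ *-monoʳ (h * h) (*-nonneg 0≤h 0≤h) (ℚ.≤-trans (ℚ.≤-reflexive (ℚ.*-comm (ι (suc d ℕ.* n)) q)) (ℚ.≤-trans sparse (ℚ.≤-trans (¼x≤x (ι t) (0≤fromℕ t)) (fromℕ-mono t≤u)))) ⟩
       ι u * (h * h) ≡⟨ trans (sym (ℚ.*-assoc (ι u) h h)) (trans (cong (_* h) uh) (ℚ.*-identityˡ h)) ⟩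
       h ∎
       where
       x = ι ((u² ℕ.* suc d) ℕ.* (u² ℕ.* suc d))

     hit≤ : pow (1ℚ - h) u² ≤ h
     hit≤ = begin
       P ≡⟨ sym (trans (cong (P *_) uh) (ℚ.*-identityʳ P)) ⟩
       P * (ι u * h) ≡⟨ sym (ℚ.*-assoc P (ι u) h) ⟩
       P * ι u * h ≤⟨ *-monoʳ h 0≤h (ℚ.≤-trans (*-monoˡ P (pow-nonneg (0≤1- h≤1) u²) u≤) (bernoulli⁻ h≤1 0≤h u²)) ⟩
       1ℚ * h ≡⟨ ℚ.*-identityˡ h ⟩
       h ∎
       where
       P = pow (1ℚ - h) u²
       u≤ : ι u ≤ 1ℚ + ι u² * h
       u≤ = begin
         ι u ≡⟨ sym (trans (cong (_* h) (ι-* u u)) (trans (ℚ.*-assoc (ι u) (ι u) h) (trans (cong (ι u *_) uh) (ℚ.*-identityʳ (ι u))))) ⟩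
         ι u² * h ≡⟨ sym (ℚ.+-identityˡ (ι u² * h)) ⟩
         0ℚ + ι u² * h ≤⟨ ℚ.+-monoˡ-≤ (ι u² * h) 0≤1 ⟩
         1ℚ + ι u² * h ∎

     bound : 1ℚ ≤ PQ (λ R → ¬? (hamiltonian? (H ∪ R))) q + (h + h)
     bound = ℚ.≤-trans (Escape.escape n d k u² 2≤k fit u²≤k-1 q 0≤q q≤1 h hρ)
       (ℚ.+-monoʳ-≤ (PQ (λ R → ¬? (hamiltonian? (H ∪ R))) q) (ℚ.+-mono-≤ {ι ((u² ℕ.* suc d) ℕ.* (u² ℕ.* suc d)) * q} inner≤ hit≤))

 -- The bound sets in only when the mesh is fine enough for `log-upper`, hence `Eventually`.
 log-≤ : ∀ k M → k ℕ.≤ 2 ℕ.^ M → Eventually λ m → seq (log (fromℕ k)) m ≤ ι 2 * ι (suc M)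
 log-≤ k M k≤ = proj₁ fine , λ m le → log-upper a 0≤a M 1+a≤ m (ℚ.≤-trans (ℚ.≤-reflexive (ℚ.*-comm a (½^ m))) (proj₂ fine m le))
   where
   a = trunc (ι k)
   0≤a : 0ℚ ≤ a
   0≤a = ℚ.p≤q⊔p (ι k - 1ℚ) 0ℚ
   fine : ∃ λ K → ∀ m → K ℕ.≤ m → ½^ m * a ≤ 1ℚ
   fine = ½^-decay a 1ℚ 0<1
   1+a≤ : 1ℚ + a ≤ ι (2 ℕ.^ M)
   1+a≤ = ℚ.≤-trans (ℚ.+-monoʳ-≤ 1ℚ {a} {ι (2 ℕ.^ M) - 1ℚ} (ℚ.⊔-lub {ι (2 ℕ.^ M) - 1ℚ} {ι k - 1ℚ} {0ℚ} (ℚ.+-monoˡ-≤ (- 1ℚ) (fromℕ-mono k≤)) (0≤diff (fromℕ-mono {1} (ℕ.m^n>0 2 M)))))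
     (ℚ.≤-reflexive (solve 1 (λ x → con 1ℚ :+ (x :- con 1ℚ) := x) refl (ι (2 ℕ.^ M))))
     where
     0≤diff : ∀ {x} → 1ℚ ≤ x → 0ℚ ≤ x - 1ℚ
     0≤diff {x} le = ≤-move {0ℚ} {1ℚ} (ℚ.≤-trans (ℚ.≤-reflexive (ℚ.+-identityˡ 1ℚ)) le)

 clamp-≤ : ∀ {x y} → 0ℚ ≤ y → x ≤ y → clamp x ≤ y
 clamp-≤ {x} {y} 0≤y x≤y = ℚ.≤-trans (ℚ.p⊓q≤p (x ⊔ 0ℚ) 1ℚ) (ℚ.⊔-lub {y} {x} {0ℚ} x≤y 0≤y)

 module PartB (c : ℚ) (0<c : 0ℚ < c) (c-small : ι 8 * c * ι 16 ≤ ¼) where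

   c₃ : ℝ
   c₃ = fromℚ c

   module _ (n d k r : ℕ) (p : ℝ) (1≤d : 1 ℕ.≤ d) (fit : k ℕ.* suc d ℕ.≤ n) (lo : 2 ℕ.^ r ℕ.≤ k) (hi : k ℕ.< 2 ℕ.^ suc r) (6≤r : 6 ℕ.≤ r) where
     open Clusters n d k using (H)

     -- The divisor 6 comes from the condition u⁶ ≤ k in `Bound`.
     t u : ℕ
     t = r ℕ./ 6
     u = 2 ℕ.^ t

     1≤t : 1 ℕ.≤ t
     1≤t = /-monoˡ-≤ 6 6≤r

     r≤16t : suc (suc r) ℕ.≤ 16 ℕ.* t
     r≤16t = begin
       suc (suc r) ≤⟨ s≤s (/-lower r 6) ⟩
       7 ℕ.+ t ℕ.* 6 ≤⟨ ℕ.+-monoˡ-≤ (t ℕ.* 6) (ℕ.≤-trans (ℕ.m≤m+n 7 3) (ℕ.*-monoʳ-≤ 10 1≤t)) ⟩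
       10 ℕ.* t ℕ.+ t ℕ.* 6 ≡⟨ solveℕ 1 (λ t → conℕ 10 ⊗ t ⊕ t ⊗ conℕ 6 ⊜ conℕ 16 ⊗ t) refl t ⟩
       16 ℕ.* t ∎
       where open ℕ.≤-Reasoning

     t≤r : t ℕ.≤ r
     t≤r = ℕ.≤-trans (ℕ.≤-trans (ℕ.≤-reflexive (sym (ℕ.*-identityʳ t))) (ℕ.*-monoʳ-≤ t (s≤s z≤n))) (m/n*n≤m r 6)

     u⁶≤k : u ℕ.* u ℕ.* (u ℕ.* u) ℕ.* (u ℕ.* u) ℕ.≤ k
     u⁶≤k = begin
       u ℕ.* u ℕ.* (u ℕ.* u) ℕ.* (u ℕ.* u) ≡⟨ solveℕ 1 (λ u → u ⊗ u ⊗ (u ⊗ u) ⊗ (u ⊗ u) ⊜ u ⊗ (u ⊗ (u ⊗ (u ⊗ (u ⊗ (u ⊗ conℕ 1)))))) refl u ⟩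
       u ℕ.^ 6 ≡⟨ ℕ.^-*-assoc 2 t 6 ⟩
       2 ℕ.^ (t ℕ.* 6) ≤⟨ ℕ.^-monoʳ-≤ 2 (m/n*n≤m r 6) ⟩
       2 ℕ.^ r ≤⟨ lo ⟩
       k ∎
       where open ℕ.≤-Reasoning

     k≤n : k ℕ.≤ n
     k≤n = ℕ.≤-trans (ℕ.≤-trans (ℕ.≤-reflexive (sym (ℕ.*-identityʳ k))) (ℕ.*-monoʳ-≤ k (s≤s z≤n))) fit

     t≤Dn : t ℕ.≤ suc d ℕ.* n
     t≤Dn = ℕ.≤-trans (ℕ.≤-trans t≤r (ℕ.≤-trans (n≤2^n r) lo)) (ℕ.≤-trans k≤n (ℕ.m≤m+n n (d ℕ.* n)))

     1≤n : 1 ℕ.≤ n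
     1≤n = ℕ.≤-trans (ℕ.≤-trans (ℕ.m^n>0 2 r) lo) k≤n

     module _ (N : ℕ) (dn : d ℕ.* n ≡ suc N) (sparse : p Defs.≤ (c₃ Defs.* log (fromℕ k)) Defs./ suc N) where

       μ X : ℚ
       μ = ℤ.+ 1 / suc N
       X = c * (ι 2 * ι (suc (suc r))) * μ

       0≤μ : 0ℚ ≤ μ
       0≤μ = ℚ.nonNegative⁻¹ μ {{ℚ.normalize-nonNeg 1 (suc N)}}

       0<X : 0ℚ < X
       0<X = *-pos (*-pos 0<c (*-pos (ℚ.<-≤-trans 0<1 (fromℕ-mono {1} {2} (s≤s z≤n))) (ℚ.<-≤-trans 0<1 (fromℕ-mono {1} {suc (suc r)} (s≤s z≤n))))) (ℚ.positive⁻¹ μ {{ℚ.normalize-pos 1 (suc N)}})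

       0≤X+X : 0ℚ ≤ X + X
       0≤X+X = ℚ.+-mono-≤ {0ℚ} {X} {0ℚ} {X} (ℚ.<⇒≤ 0<X) (ℚ.<⇒≤ 0<X)

       seldom : Eventually λ m → seq p m ≤ X + X
       seldom = combine (sparse X 0<X) (log-≤ k (suc r) (ℕ.<⇒≤ hi))
         where
         y : ℕ → ℚ
         y = seq (log (fromℕ k))
         combine : (Eventually λ m → seq p m ≤ c * y m * μ + X) → (Eventually λ m → y m ≤ ι 2 * ι (suc (suc r))) → Eventually λ m → seq p m ≤ X + X
         combine (N₁ , h₁) (N₂ , h₂) = N₁ ℕ.⊔ N₂ , λ m le → ℚ.≤-trans (h₁ m (ℕ.m⊔n≤o⇒m≤o N₁ N₂ le))
           (ℚ.+-monoˡ-≤ X (*-monoʳ μ 0≤μ (*-monoˡ c (ℚ.<⇒≤ 0<c) (h₂ m (ℕ.m⊔n≤o⇒n≤o N₁ N₂ le)))))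

       -- The factor 8 collects q ≤ 2X, the 2 from the bound on log k, and D n ≤ 2 d n; with r + 2 ≤
       -- 16 t the total is at most 8 · 16 · c t, and `c-small` makes this at most t / 4.
       few-edges : ∀ q → 0ℚ ≤ q → q ≤ X + X → q * ι (suc d ℕ.* n) ≤ ¼ * ι t
       few-edges q 0≤q q≤ = begin
         q * ι (suc d ℕ.* n) ≤⟨ *-mono {q} {X + X} {ι (suc d ℕ.* n)} {ι (2 ℕ.* suc N)} (0≤fromℕ (suc d ℕ.* n)) q≤ 0≤X+X (fromℕ-mono Dn≤) ⟩
         (X + X) * ι (2 ℕ.* suc N) ≡⟨ cong ((X + X) *_) (ι-* 2 (suc N)) ⟩
         (X + X) * (ι 2 * ι (suc N)) ≡⟨ regroup c (ι (suc (suc r))) μ (ι (suc N)) ⟩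
         ι 8 * c * ι (suc (suc r)) * (ι (suc N) * μ) ≡⟨ trans (cong (ι 8 * c * ι (suc (suc r)) *_) (reciprocal N)) (ℚ.*-identityʳ _) ⟩
         ι 8 * c * ι (suc (suc r)) ≤⟨ *-monoˡ (ι 8 * c) (*-nonneg (0≤fromℕ 8) (ℚ.<⇒≤ 0<c)) (fromℕ-mono r≤16t) ⟩
         ι 8 * c * ι (16 ℕ.* t) ≡⟨ trans (cong (ι 8 * c *_) (ι-* 16 t)) (sym (ℚ.*-assoc (ι 8 * c) (ι 16) (ι t))) ⟩
         ι 8 * c * ι 16 * ι t ≤⟨ *-monoʳ (ι t) (0≤fromℕ t) c-small ⟩
         ¼ * ι t ∎
         where
         open ℚ.≤-Reasoning
         regroup : ∀ c r u s → (c * (ι 2 * r) * u + c * (ι 2 * r) * u) * (ι 2 * s) ≡ ι 8 * c * r * (s * u)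
         regroup = solve 4 (λ c r u s → (c :* (con (ι 2) :* r) :* u :+ c :* (con (ι 2) :* r) :* u) :* (con (ι 2) :* s) := con (ι 8) :* c :* r :* (s :* u)) refl
         Dn≤ : suc d ℕ.* n ℕ.≤ 2 ℕ.* suc N
         Dn≤ = ℕ.≤-trans (ℕ.*-monoˡ-≤ n (ℕ.≤-trans (ℕ.+-monoˡ-≤ d 1≤d) (ℕ.≤-reflexive (cong (d ℕ.+_) (sym (ℕ.+-identityʳ d)))))) (ℕ.≤-reflexive (trans (ℕ.*-assoc 2 d n) (cong (2 ℕ.*_) dn)))

       result : ∀ ε → ½^ t * ι 2 ≤ ε → Likely p (λ R → ¬? (hamiltonian? (H ∪ R))) ε
       result ε le = 0ℚ , X + X , (proj₁ seldom , λ m N≤m → 0≤clamp (seq p m) , clamp-≤ 0≤X+X (proj₂ seldom m N≤m)) ,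
         λ q 0≤q q≤1 (_ , q≤) → ℚ.≤-trans (Bound.bound n d k u t (½^ t) (½^-nonneg t) (½^≤1 t) (2^*½^ t) (n≤2^n t) (ℕ.^-monoʳ-≤ 2 1≤t) u⁶≤k fit q 0≤q q≤1
             (few-edges q 0≤q q≤) (pow-lower 0≤q q≤1 (suc d ℕ.* n) t 1≤t t≤Dn (few-edges q 0≤q q≤)))
           (ℚ.+-monoʳ-≤ (PQ (λ R → ¬? (hamiltonian? (H ∪ R))) q) (ℚ.≤-trans (ℚ.≤-reflexive (solve 1 (λ h → h :+ h := h :* con (ι 2)) refl (½^ t))) le))

   likely-n : ∀ n d k (p : ℝ) j → 1 ℕ.≤ d → k ℕ.* suc d ℕ.≤ n → 2 ℕ.^ (suc j ℕ.* 6) ℕ.≤ k → p Defs.≤ (c₃ Defs.* log (fromℕ k)) Defs./ (d ℕ.* n) →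
     ∀ ε → (∀ i → j ℕ.≤ i → ½^ i * ι 2 ≤ ε) → Likely p (λ R → ¬? (hamiltonian? (Clusters.H n d k ∪ R))) ε
   likely-n n d k p j 1≤d fit big sparse ε small = from-log (log₂ k (ℕ.≤-trans (ℕ.m^n>0 2 (suc j ℕ.* 6)) big))
     where
     from-log : (∃ λ r → 2 ℕ.^ r ℕ.≤ k × k ℕ.< 2 ℕ.^ suc r) → Likely p (λ R → ¬? (hamiltonian? (Clusters.H n d k ∪ R))) ε
     from-log (r , lo , hi) = from-pos (d ℕ.* n) refl sparse (ℕ.*-mono-≤ 1≤d (1≤n n d k r p 1≤d fit lo hi 6≤r))
       where
       j≤r : suc j ℕ.* 6 ℕ.≤ r
       j≤r = exponent-≥ big hi
       6≤r : 6 ℕ.≤ r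
       6≤r = ℕ.≤-trans (ℕ.m≤m+n 6 (j ℕ.* 6)) j≤r
       from-pos : ∀ N → d ℕ.* n ≡ N → p Defs.≤ (c₃ Defs.* log (fromℕ k)) Defs./ N → 1 ℕ.≤ N → Likely p (λ R → ¬? (hamiltonian? (Clusters.H n d k ∪ R))) ε
       from-pos (suc N) eq sp _ = result n d k r p 1≤d fit lo hi 6≤r N eq sp ε
         (small (r ℕ./ 6) (ℕ.≤-trans (ℕ.n≤1+n j) (ℕ.≤-trans (ℕ.≤-reflexive (sym (m*n/n≡m (suc j) 6))) (/-monoˡ-≤ 6 j≤r))))

   partB : (d k : ℕ → ℕ) → Eventually (λ n → 1 ℕ.≤ d n) → k →∞ → Eventually (λ n → k n ℕ.* (d n ℕ.+ 1) ℕ.≤ n) →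
     Σ (∀ n → Graph n) λ H → Eventually (λ n → (α (H n) ≡ k n) × (δ (H n) ≡ d n)) ×
       ((p : ℕ → ℝ) → (∀ n → IsProbability (p n)) → Eventually (λ n → p n Defs.≤ (c₃ Defs.* log (fromℕ (k n))) Defs./ (d n ℕ.* n)) →
         Aas p (λ n R → ¬? (hamiltonian? (H n ∪ R))))
   partB d k (N₁ , d≥1) k→∞ (N₂ , fits) = H , parameters (k→∞ 2) ,
       λ p isP sparse → aas p isP (λ n R → ¬? (hamiltonian? (H n ∪ R))) λ ε 0<ε → eventually p sparse ε (½^-decay (ι 2) ε 0<ε)
     where
     H : ∀ n → Graph n
     H n = Clusters.H n (d n) (k n)
     fit : ∀ n → N₂ ℕ.≤ n → k n ℕ.* suc (d n) ℕ.≤ n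
     fit n le = subst (λ z → k n ℕ.* z ℕ.≤ n) (ℕ.+-comm (d n) 1) (fits n le)
     parameters : Eventually (λ n → 2 ℕ.≤ k n) → Eventually (λ n → (α (H n) ≡ k n) × (δ (H n) ≡ d n))
     parameters (N₀ , 2≤k) = N₀ ℕ.⊔ N₂ , λ n le → Clusters.α-H n (d n) (k n) (2≤k n (ℕ.m⊔n≤o⇒m≤o N₀ N₂ le)) (fit n (ℕ.m⊔n≤o⇒n≤o N₀ N₂ le)) ,
       Clusters.δ-H n (d n) (k n) (2≤k n (ℕ.m⊔n≤o⇒m≤o N₀ N₂ le)) (fit n (ℕ.m⊔n≤o⇒n≤o N₀ N₂ le))
     eventually : ∀ p → Eventually (λ n → p n Defs.≤ (c₃ Defs.* log (fromℕ (k n))) Defs./ (d n ℕ.* n)) → ∀ ε → (∃ λ j → ∀ i → j ℕ.≤ i → ½^ i * ι 2 ≤ ε) →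
       Eventually λ n → Likely (p n) (λ R → ¬? (hamiltonian? (H n ∪ R))) ε
     eventually p (N₃ , sparse) ε (j , small) = combine (k→∞ (2 ℕ.^ (suc j ℕ.* 6)))
       where
       combine : Eventually (λ n → 2 ℕ.^ (suc j ℕ.* 6) ℕ.≤ k n) → Eventually λ n → Likely (p n) (λ R → ¬? (hamiltonian? (H n ∪ R))) ε
       combine (N₄ , big) = (N₁ ℕ.⊔ N₂) ℕ.⊔ (N₃ ℕ.⊔ N₄) , λ n le →
         let le₁₂ = ℕ.m⊔n≤o⇒m≤o (N₁ ℕ.⊔ N₂) (N₃ ℕ.⊔ N₄) le
             le₃₄ = ℕ.m⊔n≤o⇒n≤o (N₁ ℕ.⊔ N₂) (N₃ ℕ.⊔ N₄) le
         in likely-n n (d n) (k n) (p n) j (d≥1 n (ℕ.m⊔n≤o⇒m≤o N₁ N₂ le₁₂)) (fit n (ℕ.m⊔n≤o⇒n≤o N₁ N₂ le₁₂))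
           (big n (ℕ.m⊔n≤o⇒n≤o N₃ N₄ le₃₄)) (sparse n (ℕ.m⊔n≤o⇒m≤o N₃ N₄ le₃₄)) ε small

-- The constants and the theorem.

open import Defs
open import Data.Nat.Base as ℕ using (ℕ)
open import Data.Product.Base using (Σ-syntax; _×_; _,_)
open import Function.Base using (id)
open import Relation.Binary.PropositionalEquality using (_≡_; refl)
open import Relation.Nullary.Decidable using (¬?)
import Data.Nat.Properties as ℕ
import Data.Rational.Base as ℚ
import Data.Rational.Properties as ℚ
open RationalBounds using (ι)
open LogBounds using (½^-pos)
open PancyclicAas using (module PartA)
open NonHamiltonianAas using (module PartB; ¼)

positive-constant : ∀ c → ℚ.0ℚ ℚ.< c → 0ℝ < fromℚ c
positive-constant c 0<c = c , 0<c , 0 , λ _ _ → ℚ.≤-reflexive (ℚ.+-identityˡ c)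

-- The first constant has to be at least 80 and at least 8 · 4096 = 32768.
module A = PartA 40000 4096 (ℕ.≤ᵇ⇒≤ 80 40000 _) (ℕ.≤ᵇ⇒≤ 32768 40000 _) refl (ℕ.≤ᵇ⇒≤ 1 4096 _)
-- The value 2^-9 satisfies 8 · 2^-9 · 16 = ¼ exactly.
module B = PartB (ℚLemmas.½^ 9) (½^-pos 9) ℚ.≤-refl

theorem1p3 :
    Σ[ c₁ ∈ ℝ ] Σ[ c₂ ∈ ℝ ] Σ[ c₃ ∈ ℝ ]
      (0ℝ < c₁) × (0ℝ < c₂) × (0ℝ < c₃) ×
      -- (a)
      ((G : ∀ n → Graph n) (p : ℕ → ℝ) →
        (∀ n → IsProbability (p n)) →
        (λ n → α (G n) ℕ.* δ (G n)) =O id →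
        Eventually (λ n → c₁ * (fromℕ (α (G n)) * log (fromℕ n)) ^ 2 < fromℕ (δ (G n))) →
        Eventually (λ n → (c₂ * log (fromℕ n) * log (fromℕ (α (G n)) * log (fromℕ n))) / (n ℕ.* δ (G n)) ≤ p n) →
        Aas p (λ n R → pancyclic? (G n ∪ R))) ×
      -- (b)
      ((d k : ℕ → ℕ) →
        Eventually (λ n → 1 ℕ.≤ d n) →
        k →∞ →
        Eventually (λ n → k n ℕ.* (d n ℕ.+ 1) ℕ.≤ n) →
        Σ[ H ∈ (∀ n → Graph n) ]
          Eventually (λ n → (α (H n) ≡ k n) × (δ (H n) ≡ d n)) ×
          ((p : ℕ → ℝ) →
            (∀ n → IsProbability (p n)) →
            Eventually (λ n → p n ≤ (c₃ * log (fromℕ (k n))) / (d n ℕ.* n)) →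
            Aas p (λ n R → ¬? (hamiltonian? (H n ∪ R)))))
theorem1p3 = A.c₁ , A.c₂ , B.c₃ ,
  positive-constant (ι 160000) (ℚ.positive⁻¹ (ι 160000)) , positive-constant (ι 65536) (ℚ.positive⁻¹ (ι 65536)) , positive-constant (ℚLemmas.½^ 9) (½^-pos 9) ,
  (λ G p isP _ → A.partA G p isP) , B.partB
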